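{- Let $p$ be a prime with $p\equiv 3 \pmod 4$, and let $\mathcal{E}\subset\mathbb{F}_p^2$ with $|\mathcal{E}|\ll p^{8/5}$. Then $$T(\mathcal{E})\ll |\mathcal{E}|^2\log|\mathcal{E}|+|\Delta(\mathcal{E})|^{\frac{4}{15}}|\mathcal{E}|^{\frac{33}{15}}+|\mathcal{E}|^{\frac{5}{3}}|\Delta(\mathcal{E})|^{\frac{4}{15}}\square(\mathcal{E})^{\frac{4}{15}}.$$ Consequently, $$|\Delta(\mathcal{E})|\gg \min\left\{|\mathcal{E}|^{\frac{12}{19}},\ \frac{|\mathcal{E}|^{\frac{20}{19}}}{\square(\mathcal{E})^{\frac{4}{19}}}\right\}.$$
   Context: For $x=(x_1,x_2),y=(y_1,y_2)\in\mathbb{F}_p^2$ the distance is $\|x-y\|:=(x_1-y_1)^2+(x_2-y_2)^2$, and $\Delta(\mathcal{E}):=\{\|x-y\|: x,y\in\mathcal{E}\}$. $T(\mathcal{E})$ is the number of isosceles triangles determined by $\mathcal{E}$, i.e. $T(\mathcal{E})=|\{(a,b,c)\in\mathcal{E}^3:\|a-c\|=\|b-c\|\neq 0\}|$. A triple $(a,b,c)$ of points of $\mathbb{F}_p^2$ is a corner if $(b-a)\cdot(c-a)=0$ (standard dot product). A quadruple $(a,b,c,d)$ forms a rectangle if the triples $(a,b,d),(b,a,c),(c,b,d),(d,a,c)$ are all corners; it is non-degenerate if not all of its vertices lie on a line. $\square(\mathcal{E})$ is the number of non-degenerate rectangles $(a,b,c,d)$ with all vertices in $\mathcal{E}$. Notation: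 $X\ll Y$ (equivalently $Y\gg X$) means $X\le CY$ for an absolute constant $C>0$ independent of $p$; the hypothesis $|\mathcal{E}|\ll p^{8/5}$ means $|\mathcal{E}|\le Cp^{8/5}$ for a suitable absolute constant $C$. -}

module Defs where

open import Data.Nat using (ℕ; zero; suc; _+_; _*_; _∸_; _≡ᵇ_; NonZero)
open import Data.Nat.DivMod using (_%_)
open import Data.Bool using (Bool; true; false; _∧_; _∨_; not)
open import Data.Product using (_×_; _,_; proj₁; proj₂)
open import Data.List using (List; length; filterᵇ; cartesianProduct; upTo; _∷_; [])
open import Data.Bool.ListAction using (any; all)
open import Data.List.Relation.Unary.All using (All)
open import Data.List.Relation.Unary.Unique.Propositional using (Unique)
open import Data.Nat using (_<_)

-- A point of F_p^2 is represented by a pair of naturals (x₁ , x₂) with x₁ , x₂ < p.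
Point : Set
Point = ℕ × ℕ

IsSubsetFp2 : (p : ℕ) → List Point → Set
IsSubsetFp2 p E = Unique E × All (λ x → proj₁ x < p × proj₂ x < p) E

module _ (p : ℕ) .{{_ : NonZero p}} where

  subₚ : ℕ → ℕ → ℕ
  subₚ a b = (a + (p ∸ (b % p))) % p

  dist : Point → Point → ℕ
  dist (x₁ , x₂) (y₁ , y₂) =
    (subₚ x₁ y₁ * subₚ x₁ y₁ + subₚ x₂ y₂ * subₚ x₂ y₂) % p

  corner : Point → Point → Point → Bool
  corner (a₁ , a₂) (b₁ , b₂) (c₁ , c₂) =
    ((subₚ b₁ a₁ * subₚ c₁ a₁ + subₚ b₂ a₂ * subₚ c₂ a₂) % p) ≡ᵇ 0

  isoTriangles : List Point → ℕ
  isoTriangles E = length (filterᵇ isIso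
                     (cartesianProduct E (cartesianProduct E E)))
    where
    isIso : Point × (Point × Point) → Bool
    isIso (a , (b , c)) = (dist a c ≡ᵇ dist b c) ∧ not (dist b c ≡ᵇ 0)

  distanceCount : List Point → ℕ
  distanceCount E = length (filterᵇ
    (λ d → any (λ xy → dist (proj₁ xy) (proj₂ xy) ≡ᵇ d) (cartesianProduct E E))
    (upTo p))

  onLine : ℕ → ℕ → ℕ → Point → Bool
  onLine α β γ (x₁ , x₂) = ((α * x₁ + β * x₂) % p) ≡ᵇ γ

  allOnALine : List Point → Bool
  allOnALine xs =
    any (λ α → any (λ β → any (λ γ →
          not ((α ≡ᵇ 0) ∧ (β ≡ᵇ 0)) ∧ all (onLine α β γ) xs)
        (upTo p)) (upTo p)) (upTo p)

  isRectangle : Point → Point → Point → Point → Bool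
  isRectangle a b c d =
    corner a b d ∧ corner b a c ∧ corner c b d ∧ corner d a c

  rectangles : List Point → ℕ
  rectangles E = length (filterᵇ ok
    (cartesianProduct E (cartesianProduct E (cartesianProduct E E))))
    where
    ok : Point × (Point × (Point × Point)) → Bool
    ok (a , (b , (c , d))) =
      isRectangle a b c d ∧ not (allOnALine (a ∷ b ∷ c ∷ d ∷ []))

{-# OPTIONS --safe #-}
-- Write N = |E|, T, D and □ for the numbers of points, isosceles triangles, distances and rectangles. Let B count the
-- quadruples (a , b , a′ , b′) for which a b and a′ b′ have the same perpendicular bisector. Two pairs with the same
-- bisector and the same length are opposite sides of a rectangle, so Cauchy–Schwarz over the distances gives
-- B ≤ 2 D (□ + N²). In turn T is the number of incidences, weighted by multiplicity, between E and the bisectors of E,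
-- so Cauchy–Schwarz over the lines of the plane gives T ≲ N² + N √B and p T ≲ N³ + √(p³ N B). For N¹⁴ ≥ p¹⁵ the second
-- bound suffices, together with B ≤ N³, p² B ≳ N⁴ and N⁵ ≲ p⁸. For N¹⁴ < p¹⁵ the first bound suffices once
-- T⁷ ≲ N¹⁷ is known.
--
-- To prove T⁷ ≲ N¹⁷, remove the circles and lines that contain many points of E, which costs few triangles, and bound B
-- for the remaining points. Pairs a b and a′ b′ have the same bisector exactly when the segments a a′ and b b′ are
-- mirror images. In coordinates depending on a generic origin, a segment of given length becomes one red and one blue
-- line of F³, a mirror pair becomes an incidence of a red and a blue line, and the segments with lines in a common
-- regulus start on a common circle or line. If there were many incidences, some nonzero polynomial f of low degree
-- would vanish on the red lines. Passing to y-derivatives of f, one may assume that at most incidences the surface f = 0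
-- contains both lines and ∂f/∂y ≠ 0. The red lines lie in the slices v = const of the surface, which therefore have
-- inflections at many points of each blue line, hence along the whole of it. Differentiating this along the blue lines
-- that meet a given red line shows that their slopes depend linearly on the position of the meeting point, so that these
-- blue lines belong to one regulus, a contradiction.
module Submission where

open import Defs
open import Data.Nat using (ℕ; _+_; _*_; _^_; _≤_; NonZero)
open import Data.Nat.DivMod using (_%_)
open import Data.Nat.Logarithm using (⌊log₂_⌋)
open import Data.Nat.Primality using (Prime)
open import Data.List using (List; length)
open import Data.Product using (_×_; ∃)
open import Data.Sum using (_⊎_)
open import Relation.Binary.PropositionalEquality using (_≡_)
open import Data.Nat as ℕ using (zero; suc; _<_; z≤n; s≤s; _∸_; _⊔_; _≡ᵇ_)
open import Data.Nat.DivMod using (_/_; m≡m%n+[m/n]*n; m<n⇒m%n≡m; m%n≤m; n%n≡0; m%n%n≡m%n; m%n<n)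
open import Data.Nat.Logarithm using (⌊log₂⌋-mono-≤; ⌊log₂[2^n]⌋≡n)
open import Data.Nat.Coprimality using (coprime-Bézout; prime⇒coprime)
open import Data.Nat.GCD using (module Bézout)
import Data.Nat.Properties as ℕₚ
open import Data.Nat.Solver using (module +-*-Solver)
open import Data.Integer as ℤ using (ℤ)
open import Data.Integer.DivMod using (_%ℕ_; _/ℕ_; n%ℕd<d; a≡a%ℕn+[a/ℕn]*n)
import Data.Integer.Properties as ℤₚ
open import Data.Integer.Solver using () renaming (module +-*-Solver to ℤ-Solver)
open import Data.Bool using (Bool; true; false; not; _∧_)
open import Data.Bool.ListAction using (any; all)
open import Data.Bool.Properties using (T-∧; T?)
open import Data.Product using (_,_; proj₁; proj₂; ∃-syntax; Σ-syntax; uncurry)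
import Data.Product.Properties as ×ₚ
open import Data.Unit using (tt)
open import Data.Sum using (inj₁; inj₂; [_,_]′)
open import Data.Empty using (⊥; ⊥-elim)
open import Data.Maybe using (Maybe; just; nothing)
open import Data.Fin as Fin using (Fin)
import Data.Fin.Properties as Finₚ
open import Data.List as List using ([]; _∷_; map; _++_; filter; filterᵇ; cartesianProduct; upTo)
import Data.List.Properties as Listₚ
open import Data.List.Relation.Unary.All as All using (All; []; _∷_)
import Data.List.Relation.Unary.All.Properties as Allₚ
open import Data.List.Relation.Unary.Any as Any using (Any; here; there)
import Data.List.Relation.Unary.Any.Properties as Anyₚ
open import Data.List.Relation.Unary.AllPairs as AllPairs using (AllPairs; []; _∷_)
import Data.List.Relation.Unary.AllPairs.Properties as AllPairsₚ
open import Data.List.Relation.Unary.Unique.Propositional using (Unique)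
import Data.List.Relation.Unary.Unique.Propositional.Properties as Uniqueₚ
open import Data.List.Membership.Propositional using (_∈_; find; lose)
import Data.List.Membership.Propositional.Properties as ∈ₚ
open import Data.List.Membership.Propositional.Properties.WithK using (unique∧set⇒bag)
open import Data.List.Relation.Binary.BagAndSetEquality using (∼bag⇒↭)
open import Data.List.Relation.Binary.Permutation.Propositional as ↭ using (_↭_)
open import Relation.Nullary using (Dec; yes; no; ¬_; contradiction)
open import Relation.Nullary.Decidable using (_×-dec_; _⊎-dec_; ¬?; map′; decidable-stable)
open import Relation.Unary using (Decidable)
open import Relation.Binary.Definitions using (DecidableEquality; tri<; tri≈; tri>)
open import Relation.Binary.PropositionalEquality
open import Function using (_∘_; id; _$_)
open import Function.Bundles using (Equivalence; mk⇔)
open import Algebra.Structures using (IsCommutativeRing)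
open import Algebra.Bundles using (CommutativeRing)
import Algebra.Solver.Ring
import Algebra.Solver.Ring.NaturalCoefficients.Default
open import Algebra.Solver.Ring.AlmostCommutativeRing using (fromCommutativeRing; _-Raw-AlmostCommutative⟶_)

-- The exponents come from T³⁰ = (T⁷)² (T²)⁸ ≲ N³⁴ (B N²)⁸ = B⁸ N⁵⁰. The threshold N¹⁴ = p¹⁵ is
-- where the deviation term of the second bound, T² ≲ p N B, combined with B ≤ N³ reaches the same
-- B⁸ N⁵⁰. Positive characteristic shapes the proof of T⁷ ≲ N¹⁷. A function determines the
-- coefficients of a polynomial only below degree p, and a vanishing derivative means a constant
-- only in low degree. The degrees used are of order N^(5/7), while p > N^(14/15); the constants are
-- the reason for treating bounded N apart. Polynomials occur as functions with degree bounds, and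
-- the order of vanishing in the direction y takes the place of a squarefree part. Since -1 is no
-- square, F² is the field F(i), and a vector of given norm is a fixed vector e times g / conj g.
-- The half-angle g linearises the mirror relation into a symplectic form on F⁴, whose isotropic
-- pairs become incidences of red and blue lines. A generic origin makes the denominators nonzero
-- and lets few lines of one colour pass through a point.

-- Finite prime fields in which a sum of two squares is anisotropic

module FieldDef where
  -- The interface keeps the arithmetic of residues opaque and feeds the ring solver, whose
  -- coefficients are integers through `fromℤ`. For residues modulo p, primality gives `inverse`,
  -- and p ≡ 3 mod 4 gives `anisotropic` and `2<p`.
  record Field : Set₁ where
    infixl 6 _⊕_ _⊖_
    infixl 7 _⊗_
    infix  8 ⊝_
    infix  4 _≟_
    field
      F : Set
      _⊕_ _⊗_ : F → F → F
      ⊝_ : F → F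
      𝟘 𝟙 : F
      isCommutativeRing : IsCommutativeRing _≡_ _⊕_ _⊗_ ⊝_ 𝟘 𝟙
      fromℤ : ℤ → F
      fromℤ-+ : ∀ x y → fromℤ (x ℤ.+ y) ≡ fromℤ x ⊕ fromℤ y
      fromℤ-* : ∀ x y → fromℤ (x ℤ.* y) ≡ fromℤ x ⊗ fromℤ y
      fromℤ-neg : ∀ x → fromℤ (ℤ.- x) ≡ ⊝ fromℤ x
      fromℤ-0 : fromℤ ℤ.0ℤ ≡ 𝟘
      fromℤ-1 : fromℤ ℤ.1ℤ ≡ 𝟙
      _≟_ : DecidableEquality F
      inv : F → F
      inverse : ∀ x → x ≢ 𝟘 → x ⊗ inv x ≡ 𝟙
      p : ℕ
      elems : List F
      elems-unique : Unique elems
      elems-complete : ∀ x → x ∈ elems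
      elems-length : length elems ≡ p
      char : ∀ k → 0 < k → k < p → fromℤ (ℤ.+ k) ≢ 𝟘
      2<p : 2 < p
      anisotropic : ∀ x y → x ⊗ x ⊕ y ⊗ y ≡ 𝟘 → x ≡ 𝟘

    _⊖_ : F → F → F
    x ⊖ y = x ⊕ ⊝ y

  module FieldTheory (𝔽 : Field) where
    open Field 𝔽 public

    ringF : CommutativeRing _ _
    ringF = record { isCommutativeRing = isCommutativeRing }

    open IsCommutativeRing isCommutativeRing public using ()
      renaming (+-comm to ⊕-comm; +-assoc to ⊕-assoc; *-comm to ⊗-comm; *-assoc to ⊗-assoc;
                +-identityˡ to ⊕-identityˡ; +-identityʳ to ⊕-identityʳ;
                *-identityˡ to ⊗-identityˡ; *-identityʳ to ⊗-identityʳ;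
                zeroˡ to ⊗-zeroˡ; zeroʳ to ⊗-zeroʳ; -‿inverseʳ to ⊝-inverseʳ)

    private
      morphism : CommutativeRing.rawRing ℤₚ.+-*-commutativeRing -Raw-AlmostCommutative⟶ fromCommutativeRing ringF
      morphism = record
        { ⟦_⟧ = fromℤ
        ; +-homo = fromℤ-+
        ; *-homo = fromℤ-*
        ; -‿homo = fromℤ-neg
        ; 0-homo = fromℤ-0
        ; 1-homo = fromℤ-1
        }

      coeff≟ : ∀ x y → Maybe (fromℤ x ≡ fromℤ y)
      coeff≟ x y with x ℤ.≟ y
      ... | yes q = just (cong fromℤ q)
      ... | no  _ = nothing

    open Algebra.Solver.Ring (CommutativeRing.rawRing ℤₚ.+-*-commutativeRing)
           (fromCommutativeRing ringF) morphism coeff≟ public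
      using (solve; con; _:+_; _:*_; _:-_; :-_; _:=_; Polynomial)

    two : F
    two = fromℤ (ℤ.+ 2)

    two≢𝟘 : two ≢ 𝟘
    two≢𝟘 = char 2 (s≤s z≤n) 2<p

    𝟙≢𝟘 : 𝟙 ≢ 𝟘
    𝟙≢𝟘 q = char 1 (s≤s z≤n) (ℕₚ.<-trans (s≤s (s≤s z≤n)) 2<p) (trans fromℤ-1 q)

    ⊖-self : ∀ x → x ⊖ x ≡ 𝟘
    ⊖-self = ⊝-inverseʳ

    ⊖≡𝟘⇒≡ : ∀ {x y} → x ⊖ y ≡ 𝟘 → x ≡ y
    ⊖≡𝟘⇒≡ {x} {y} q = trans (solve 2 (λ x y → x := (x :- y) :+ y) refl x y)
      (trans (cong (_⊕ y) q) (⊕-identityˡ y))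

    ≡⇒⊖≡𝟘 : ∀ {x y} → x ≡ y → x ⊖ y ≡ 𝟘
    ≡⇒⊖≡𝟘 {x} refl = ⊖-self x

    ⊗-inverseˡ : ∀ x → x ≢ 𝟘 → inv x ⊗ x ≡ 𝟙
    ⊗-inverseˡ x x≢ = trans (⊗-comm _ _) (inverse x x≢)

    ⊗≡𝟘 : ∀ x y → x ⊗ y ≡ 𝟘 → x ≢ 𝟘 → y ≡ 𝟘
    ⊗≡𝟘 x y q x≢ = begin
      y                 ≡⟨ ⊗-identityˡ y ⟨
      𝟙 ⊗ y             ≡⟨ cong (_⊗ y) (⊗-inverseˡ x x≢) ⟨
      inv x ⊗ x ⊗ y     ≡⟨ ⊗-assoc _ _ _ ⟩
      inv x ⊗ (x ⊗ y)   ≡⟨ cong (inv x ⊗_) q ⟩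
      inv x ⊗ 𝟘         ≡⟨ ⊗-zeroʳ _ ⟩
      𝟘                 ∎
      where open ≡-Reasoning

    ⊗≢𝟘 : ∀ {x y} → x ≢ 𝟘 → y ≢ 𝟘 → x ⊗ y ≢ 𝟘
    ⊗≢𝟘 {x} {y} x≢ y≢ q = y≢ (⊗≡𝟘 x y q x≢)

    ⊗-cancelˡ : ∀ {x y z} → x ≢ 𝟘 → x ⊗ y ≡ x ⊗ z → y ≡ z
    ⊗-cancelˡ {x} {y} {z} x≢ q = ⊖≡𝟘⇒≡ (⊗≡𝟘 x (y ⊖ z)
      (trans (solve 3 (λ x y z → x :* (y :- z) := x :* y :- x :* z) refl x y z) (≡⇒⊖≡𝟘 q)) x≢)

    inv≢𝟘 : ∀ {x} → x ≢ 𝟘 → inv x ≢ 𝟘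
    inv≢𝟘 {x} x≢ q = 𝟙≢𝟘 (trans (sym (inverse x x≢)) (trans (cong (x ⊗_) q) (⊗-zeroʳ x)))

    anisotropicʳ : ∀ x y → x ⊗ x ⊕ y ⊗ y ≡ 𝟘 → y ≡ 𝟘
    anisotropicʳ x y q = anisotropic y x (trans (⊕-comm _ _) q)

open FieldDef

-- Finite sums, counting, and pruning of bipartite graphs

module Counting where
  private variable
    A B : Set
    P Q R : Set

  ∑ : List A → (A → ℕ) → ℕ
  ∑ []       f = 0
  ∑ (x ∷ xs) f = f x + ∑ xs f

  infix 0 ∑
  syntax ∑ xs (λ x → e) = ∑[ x ∈ xs ] e

  ⟦_⟧ : Dec P → ℕ
  ⟦ yes _ ⟧ = 1
  ⟦ no  _ ⟧ = 0

  ⟦⟧≤1 : (d : Dec P) → ⟦ d ⟧ ≤ 1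
  ⟦⟧≤1 (yes _) = s≤s z≤n
  ⟦⟧≤1 (no _)  = z≤n

  ⟦⟧-yes : (d : Dec P) → P → ⟦ d ⟧ ≡ 1
  ⟦⟧-yes (yes _) _ = refl
  ⟦⟧-yes (no ¬x) x = contradiction x ¬x

  ⟦⟧-no : (d : Dec P) → ¬ P → ⟦ d ⟧ ≡ 0
  ⟦⟧-no (yes x) ¬x = contradiction x ¬x
  ⟦⟧-no (no _)  _  = refl

  ⟦⟧-mono : (d : Dec P) (e : Dec Q) → (P → Q) → ⟦ d ⟧ ≤ ⟦ e ⟧
  ⟦⟧-mono (no _)  e f = z≤n
  ⟦⟧-mono (yes x) e f = ℕₚ.≤-reflexive (sym (⟦⟧-yes e (f x)))

  ⟦⟧-cong : (d : Dec P) (e : Dec Q) → (P → Q) → (Q → P) → ⟦ d ⟧ ≡ ⟦ e ⟧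
  ⟦⟧-cong d e f g = ℕₚ.≤-antisym (⟦⟧-mono d e f) (⟦⟧-mono e d g)

  ⟦⟧-× : (d : Dec P) (e : Dec Q) → ⟦ d ×-dec e ⟧ ≡ ⟦ d ⟧ * ⟦ e ⟧
  ⟦⟧-× (yes _) (yes _) = refl
  ⟦⟧-× (yes _) (no _)  = refl
  ⟦⟧-× (no _)  e       = refl

  ⟦⟧-≤+ : (d : Dec P) (e : Dec Q) (f : Dec R) → (P → Q ⊎ R) → ⟦ d ⟧ ≤ ⟦ e ⟧ + ⟦ f ⟧
  ⟦⟧-≤+ (no _)  e f g = z≤n
  ⟦⟧-≤+ (yes x) e f g with g x
  ... | inj₁ y = ℕₚ.≤-trans (ℕₚ.≤-reflexive (sym (⟦⟧-yes e y))) (ℕₚ.m≤m+n _ _)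
  ... | inj₂ z = ℕₚ.≤-trans (ℕₚ.≤-reflexive (sym (⟦⟧-yes f z))) (ℕₚ.m≤n+m _ _)

  ⟦⟧*≤ : (d : Dec P) (m n : ℕ) → (P → m ≤ n) → ⟦ d ⟧ * m ≤ n
  ⟦⟧*≤ (no _)  m n f = z≤n
  ⟦⟧*≤ (yes x) m n f = ℕₚ.≤-trans (ℕₚ.≤-reflexive (ℕₚ.*-identityˡ m)) (f x)

  ⟦⟧*-mono : (d : Dec P) {m n : ℕ} → (P → m ≤ n) → ⟦ d ⟧ * m ≤ ⟦ d ⟧ * n
  ⟦⟧*-mono (no _)  f = z≤n
  ⟦⟧*-mono (yes x) f = ℕₚ.*-monoʳ-≤ 1 (f x)

  ⟦⟧>0 : (d : Dec P) → 0 < ⟦ d ⟧ → P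
  ⟦⟧>0 (yes x) _ = x

  ∑-mono : (xs : List A) {f g : A → ℕ} → (∀ {x} → x ∈ xs → f x ≤ g x) → ∑ xs f ≤ ∑ xs g
  ∑-mono []       h = z≤n
  ∑-mono (x ∷ xs) h = ℕₚ.+-mono-≤ (h (here refl)) (∑-mono xs (h ∘ there))

  ∑-cong : (xs : List A) {f g : A → ℕ} → (∀ {x} → x ∈ xs → f x ≡ g x) → ∑ xs f ≡ ∑ xs g
  ∑-cong []       h = refl
  ∑-cong (x ∷ xs) h = cong₂ _+_ (h (here refl)) (∑-cong xs (h ∘ there))

  ∑-+ : (xs : List A) (f g : A → ℕ) → ∑ xs (λ x → f x + g x) ≡ ∑ xs f + ∑ xs g
  ∑-+ []       f g = refl
  ∑-+ (x ∷ xs) f g = trans (cong (f x + g x +_) (∑-+ xs f g))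
    (solve 4 (λ a b c d → a :+ b :+ (c :+ d) := a :+ c :+ (b :+ d)) refl (f x) (g x) (∑ xs f) (∑ xs g))
    where open +-*-Solver using (solve; _:=_; _:+_; _:*_; con)

  ∑-*ˡ : (xs : List A) (c : ℕ) (f : A → ℕ) → ∑ xs (λ x → c * f x) ≡ c * ∑ xs f
  ∑-*ˡ []       c f = sym (ℕₚ.*-zeroʳ c)
  ∑-*ˡ (x ∷ xs) c f = trans (cong (c * f x +_) (∑-*ˡ xs c f)) (sym (ℕₚ.*-distribˡ-+ c (f x) _))

  ∑-*ʳ : (xs : List A) (c : ℕ) (f : A → ℕ) → ∑ xs (λ x → f x * c) ≡ ∑ xs f * c
  ∑-*ʳ xs c f = trans (∑-cong xs (λ {x} _ → ℕₚ.*-comm (f x) c)) (trans (∑-*ˡ xs c f) (ℕₚ.*-comm c _))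

  ∑-const : (xs : List A) (c : ℕ) → ∑ xs (λ _ → c) ≡ length xs * c
  ∑-const []       c = refl
  ∑-const (x ∷ xs) c = cong (c +_) (∑-const xs c)

  ∑-bound : (xs : List A) (c : ℕ) {f : A → ℕ} → (∀ {x} → x ∈ xs → f x ≤ c) → ∑ xs f ≤ length xs * c
  ∑-bound xs c h = ℕₚ.≤-trans (∑-mono xs h) (ℕₚ.≤-reflexive (∑-const xs c))

  ∑-zero : (xs : List A) → ∑ xs (λ _ → 0) ≡ 0
  ∑-zero xs = trans (∑-const xs 0) (ℕₚ.*-zeroʳ (length xs))

  ∑-swap : (xs : List A) (ys : List B) (f : A → B → ℕ) →
           (∑[ x ∈ xs ] ∑[ y ∈ ys ] f x y) ≡ (∑[ y ∈ ys ] ∑[ x ∈ xs ] f x y)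
  ∑-swap []       ys f = sym (∑-zero ys)
  ∑-swap (x ∷ xs) ys f = trans (cong (∑ ys (f x) +_) (∑-swap xs ys f)) (sym (∑-+ ys (f x) _))

  ∑-++ : (xs ys : List A) (f : A → ℕ) → ∑ (xs ++ ys) f ≡ ∑ xs f + ∑ ys f
  ∑-++ []       ys f = refl
  ∑-++ (x ∷ xs) ys f = trans (cong (f x +_) (∑-++ xs ys f)) (sym (ℕₚ.+-assoc (f x) _ _))

  ∑-map : (h : A → B) (xs : List A) (f : B → ℕ) → ∑ (map h xs) f ≡ ∑ xs (f ∘ h)
  ∑-map h []       f = refl
  ∑-map h (x ∷ xs) f = cong (f (h x) +_) (∑-map h xs f)

  ∑-cartesianProduct : (xs : List A) (ys : List B) (f : A × B → ℕ) →
                       ∑ (cartesianProduct xs ys) f ≡ (∑[ x ∈ xs ] ∑[ y ∈ ys ] f (x , y))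
  ∑-cartesianProduct []       ys f = refl
  ∑-cartesianProduct (x ∷ xs) ys f = trans (∑-++ (map (x ,_) ys) _ f)
    (cong₂ _+_ (∑-map (x ,_) ys f) (∑-cartesianProduct xs ys f))

  ∑-filter : {P : A → Set} (P? : Decidable P) (xs : List A) (f : A → ℕ) →
             ∑ (filter P? xs) f ≡ (∑[ x ∈ xs ] ⟦ P? x ⟧ * f x)
  ∑-filter P? []       f = refl
  ∑-filter P? (x ∷ xs) f with P? x
  ... | yes _ = cong₂ _+_ (sym (ℕₚ.*-identityˡ (f x))) (∑-filter P? xs f)
  ... | no  _ = ∑-filter P? xs f

  ∑-filter≤ : {P : A → Set} (P? : Decidable P) (xs : List A) (f : A → ℕ) → ∑ (filter P? xs) f ≤ ∑ xs f
  ∑-filter≤ P? xs f = ℕₚ.≤-trans (ℕₚ.≤-reflexive (∑-filter P? xs f))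
    (∑-mono xs (λ {x} _ → ⟦⟧*≤ (P? x) (f x) (f x) (λ _ → ℕₚ.≤-refl)))

  length-∑ : (xs : List A) → length xs ≡ ∑ xs (λ _ → 1)
  length-∑ xs = sym (trans (∑-const xs 1) (ℕₚ.*-identityʳ _))

  length-filter-∑ : {P : A → Set} (P? : Decidable P) (xs : List A) →
                    length (filter P? xs) ≡ (∑[ x ∈ xs ] ⟦ P? x ⟧)
  length-filter-∑ P? xs = trans (length-∑ (filter P? xs)) (trans (∑-filter P? xs _)
    (∑-cong xs (λ {x} _ → ℕₚ.*-identityʳ ⟦ P? x ⟧)))

  ∑-split : {P : A → Set} (P? : Decidable P) (xs : List A) (f : A → ℕ) →
            ∑ xs f ≡ ∑ (filter P? xs) f + ∑ (filter (¬? ∘ P?) xs) f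
  ∑-split P? []       f = refl
  ∑-split P? (x ∷ xs) f with P? x
  ... | yes _ = trans (cong (f x +_) (∑-split P? xs f)) (sym (ℕₚ.+-assoc (f x) _ _))
  ... | no  _ = trans (cong (f x +_) (∑-split P? xs f))
    (solve 3 (λ a b c → a :+ (b :+ c) := b :+ (a :+ c)) refl (f x) (∑ (filter P? xs) f) (∑ (filter (¬? ∘ P?) xs) f))
    where open +-*-Solver using (solve; _:=_; _:+_; _:*_; con)

  ∑-∃ : (xs : List A) (f g : A → ℕ) → ∑ xs f < ∑ xs g → ∃[ x ] x ∈ xs × f x < g x
  ∑-∃ (x ∷ xs) f g h with f x ℕ.<? g x
  ... | yes q = x , here refl , q
  ... | no ¬q with ∑-∃ xs f g (ℕₚ.≰⇒> λ q → ℕₚ.<⇒≱ h (ℕₚ.+-mono-≤ (ℕₚ.≮⇒≥ ¬q) q))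
  ...   | y , y∈ , r = y , there y∈ , r

  ∑>0 : (xs : List A) (f : A → ℕ) → 0 < ∑ xs f → ∃[ x ] x ∈ xs × 0 < f x
  ∑>0 xs f h = ∑-∃ xs (λ _ → 0) f (ℕₚ.≤-<-trans (ℕₚ.≤-reflexive (∑-zero xs)) h)

  term≤∑ : (xs : List A) (f : A → ℕ) {x : A} → x ∈ xs → f x ≤ ∑ xs f
  term≤∑ (x ∷ xs) f (here refl) = ℕₚ.m≤m+n _ _
  term≤∑ (x ∷ xs) f (there x∈)  = ℕₚ.≤-trans (term≤∑ xs f x∈) (ℕₚ.m≤n+m _ _)

  ∑-* : (xs : List A) (ys : List B) (f : A → ℕ) (g : B → ℕ) →
        ∑ xs f * ∑ ys g ≡ (∑[ x ∈ xs ] ∑[ y ∈ ys ] f x * g y)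
  ∑-* xs ys f g = trans (sym (∑-*ʳ xs (∑ ys g) f)) (∑-cong xs (λ {x} _ → sym (∑-*ˡ ys (f x) g)))

  2xy≤x²+y² : ∀ x y → 2 * (x * y) ≤ x * x + y * y
  2xy≤x²+y² x y with ℕₚ.≤-total x y
  ... | inj₁ x≤y = lemma x≤y
    where
    lemma : ∀ {x y} → x ≤ y → 2 * (x * y) ≤ x * x + y * y
    lemma {x} {y} x≤y with ℕₚ.m≤n⇒∃[o]m+o≡n x≤y
    ... | o , refl = ℕₚ.≤-trans (ℕₚ.m≤m+n _ (o * o)) (ℕₚ.≤-reflexive
      (solve 2 (λ x o → con 2 :* (x :* (x :+ o)) :+ o :* o := x :* x :+ (x :+ o) :* (x :+ o)) refl x o))
      where open +-*-Solver using (solve; _:=_; _:+_; _:*_; con)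
  ... | inj₂ y≤x with ℕₚ.m≤n⇒∃[o]m+o≡n y≤x
  ...   | o , refl = ℕₚ.≤-trans (ℕₚ.m≤m+n _ (o * o)) (ℕₚ.≤-reflexive
      (solve 2 (λ y o → con 2 :* ((y :+ o) :* y) :+ o :* o := (y :+ o) :* (y :+ o) :+ y :* y) refl y o))
      where open +-*-Solver using (solve; _:=_; _:+_; _:*_; con)

  length-cartesianProduct : (xs : List A) (ys : List B) → length (cartesianProduct xs ys) ≡ length xs * length ys
  length-cartesianProduct xs ys = trans (length-∑ (cartesianProduct xs ys)) (trans (∑-cartesianProduct xs ys (λ _ → 1))
    (trans (∑-cong xs (λ _ → sym (length-∑ ys))) (∑-const xs (length ys))))

  -- Both products are expanded over pairs (x , y), and `2xy≤x²+y²` is applied to f x g y and f y g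
  -- x. Doubling both sides avoids halves and subtraction.
  cauchy-schwarz : (xs : List A) (f g : A → ℕ) →
    (∑[ x ∈ xs ] f x * g x) * (∑[ x ∈ xs ] f x * g x) ≤ (∑[ x ∈ xs ] f x * f x) * (∑[ x ∈ xs ] g x * g x)
  cauchy-schwarz xs f g = ℕₚ.*-cancelˡ-≤ 2 (begin
    2 * (S * S)
      ≡⟨ cong (2 *_) (∑-* xs xs _ _) ⟩
    2 * (∑[ x ∈ xs ] ∑[ y ∈ xs ] (f x * g x) * (f y * g y))
      ≡⟨ trans (sym (∑-*ˡ xs 2 _)) (∑-cong xs λ _ → sym (∑-*ˡ xs 2 _)) ⟩
    (∑[ x ∈ xs ] ∑[ y ∈ xs ] 2 * ((f x * g x) * (f y * g y)))
      ≤⟨ ∑-mono xs (λ {x} _ → ∑-mono xs (λ {y} _ → pointwise (f x) (g x) (f y) (g y))) ⟩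
    (∑[ x ∈ xs ] ∑[ y ∈ xs ] ((f x * f x) * (g y * g y) + (f y * f y) * (g x * g x)))
      ≡⟨ trans (∑-cong xs (λ _ → ∑-+ xs _ _)) (∑-+ xs _ _) ⟩
    (∑[ x ∈ xs ] ∑[ y ∈ xs ] (f x * f x) * (g y * g y)) + (∑[ x ∈ xs ] ∑[ y ∈ xs ] (f y * f y) * (g x * g x))
      ≡⟨ cong₂ _+_ (sym (∑-* xs xs _ _)) (trans (∑-swap xs xs _) (sym (∑-* xs xs _ _))) ⟩
    X * Y + X * Y
      ≡⟨ cong (X * Y +_) (sym (ℕₚ.+-identityʳ _)) ⟩
    2 * (X * Y) ∎)
    where
    open ℕₚ.≤-Reasoning
    S X Y : ℕ
    S = ∑[ x ∈ xs ] f x * g x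
    X = ∑[ x ∈ xs ] f x * f x
    Y = ∑[ x ∈ xs ] g x * g x
    pointwise : ∀ a b c d → 2 * ((a * b) * (c * d)) ≤ (a * a) * (d * d) + (c * c) * (b * b)
    pointwise a b c d = subst₂ _≤_
      (solve 4 (λ a b c d → con 2 :* ((a :* d) :* (c :* b)) := con 2 :* ((a :* b) :* (c :* d))) refl a b c d)
      (solve 4 (λ a b c d → (a :* d) :* (a :* d) :+ (c :* b) :* (c :* b) := (a :* a) :* (d :* d) :+ (c :* c) :* (b :* b)) refl a b c d)
      (2xy≤x²+y² (a * d) (c * b))
      where open +-*-Solver using (solve; _:=_; _:+_; _:*_; con)

  -- Quantifying over all duplicate-free lists of solutions makes bounds on roots or on points in
  -- special position directly applicable.
  count≤ : {P : A → Set} (P? : Decidable P) {xs : List A} (k : ℕ) → Unique xs →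
           (∀ ys → Unique ys → (∀ {y} → y ∈ ys → y ∈ xs × P y) → length ys ≤ k) → (∑[ x ∈ xs ] ⟦ P? x ⟧) ≤ k
  count≤ P? {xs} k uniq h = ℕₚ.≤-trans (ℕₚ.≤-reflexive (sym (length-filter-∑ P? xs)))
    (h (filter P? xs) (Uniqueₚ.filter⁺ P? uniq) (∈ₚ.∈-filter⁻ P?))

  count≤1 : {P : A → Set} (P? : Decidable P) {xs : List A} → Unique xs →
            (∀ {x y} → x ∈ xs → y ∈ xs → P x → P y → x ≡ y) → (∑[ x ∈ xs ] ⟦ P? x ⟧) ≤ 1
  count≤1 P? uniq h = count≤ P? 1 uniq λ where
    [] _ _ → z≤n
    (_ ∷ []) _ _ → s≤s z≤n
    (x ∷ y ∷ ys) ((x≢y ∷ _) ∷ _) m → contradiction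
      (h (proj₁ (m (here refl))) (proj₁ (m (there (here refl)))) (proj₂ (m (here refl))) (proj₂ (m (there (here refl))))) x≢y

  count≤2 : {P : A → Set} (P? : Decidable P) {xs : List A} → Unique xs →
            (∀ {x y z} → P x → P y → P z → x ≢ y → x ≢ z → y ≢ z → ⊥) → (∑[ x ∈ xs ] ⟦ P? x ⟧) ≤ 2
  count≤2 P? uniq h = count≤ P? 2 uniq λ where
    [] _ _ → z≤n
    (_ ∷ []) _ _ → s≤s z≤n
    (_ ∷ _ ∷ []) _ _ → s≤s (s≤s z≤n)
    (x ∷ y ∷ z ∷ ys) ((x≢y ∷ x≢z ∷ _) ∷ (y≢z ∷ _) ∷ _) m → ⊥-elim
      (h (proj₂ (m (here refl))) (proj₂ (m (there (here refl)))) (proj₂ (m (there (there (here refl))))) x≢y x≢z y≢z)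

  module _ (_≟_ : DecidableEquality A) where

    ∑-pick : {xs : List A} → Unique xs → ∀ {y} → y ∈ xs → (f : A → ℕ) → (∑[ x ∈ xs ] ⟦ y ≟ x ⟧ * f x) ≡ f y
    ∑-pick {x ∷ xs} (x∉ ∷ uniq) {y} y∈ f with y ≟ x
    ... | yes refl = trans (cong₂ _+_ (ℕₚ.*-identityˡ (f x))
            (trans (∑-cong xs λ {z} z∈ → cong (_* f z) (⟦⟧-no (x ≟ z) (All.lookup x∉ z∈))) (∑-zero xs)))
            (ℕₚ.+-identityʳ _)
    ... | no ¬q with y∈
    ...   | here q  = contradiction q ¬q
    ...   | there q = ∑-pick uniq q f

    ∑-pick-1 : {xs : List A} → Unique xs → ∀ {y} → y ∈ xs → (∑[ x ∈ xs ] ⟦ y ≟ x ⟧) ≡ 1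
    ∑-pick-1 {xs} uniq {y} y∈ = trans (∑-cong xs λ {x} _ → sym (ℕₚ.*-identityʳ ⟦ y ≟ x ⟧)) (∑-pick uniq y∈ (λ _ → 1))

  -- Double counting of the graph of h: each solution x contributes the pair (x , h x), and
  -- injectivity leaves at most one x over each y.
  count-injection : {P : A → Set} (P? : Decidable P) {Q : B → Set} (Q? : Decidable Q) (_≟_ : DecidableEquality B)
    {xs : List A} {ys : List B} (h : A → B) → Unique xs → Unique ys →
    (∀ {x} → x ∈ xs → P x → h x ∈ ys × Q (h x)) →
    (∀ {x y} → x ∈ xs → y ∈ xs → P x → P y → h x ≡ h y → x ≡ y) →
    (∑[ x ∈ xs ] ⟦ P? x ⟧) ≤ (∑[ y ∈ ys ] ⟦ Q? y ⟧)
  count-injection {P = P} P? {Q} Q? _≟_ {xs} {ys} h ux uy into inj = begin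
    (∑[ x ∈ xs ] ⟦ P? x ⟧)
      ≤⟨ ∑-mono xs (λ {x} x∈ → lemma x x∈) ⟩
    (∑[ x ∈ xs ] ∑[ y ∈ ys ] ⟦ P? x ×-dec (h x ≟ y) ×-dec Q? y ⟧)
      ≡⟨ ∑-swap xs ys _ ⟩
    (∑[ y ∈ ys ] ∑[ x ∈ xs ] ⟦ P? x ×-dec (h x ≟ y) ×-dec Q? y ⟧)
      ≤⟨ ∑-mono ys (λ {y} _ → lemma₂ y) ⟩
    (∑[ y ∈ ys ] ⟦ Q? y ⟧) ∎
    where
    open ℕₚ.≤-Reasoning
    lemma : ∀ x → x ∈ xs → ⟦ P? x ⟧ ≤ (∑[ y ∈ ys ] ⟦ P? x ×-dec (h x ≟ y) ×-dec Q? y ⟧)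
    lemma x x∈ with P? x
    ... | no _ = z≤n
    ... | yes px = let q = into x∈ px in ℕₚ.≤-trans
          (ℕₚ.≤-reflexive (sym (⟦⟧-yes (yes px ×-dec (h x ≟ h x) ×-dec Q? (h x)) (px , refl , proj₂ q))))
          (term≤∑ ys (λ y → ⟦ yes px ×-dec (h x ≟ y) ×-dec Q? y ⟧) (proj₁ q))
    lemma₂ : ∀ y → (∑[ x ∈ xs ] ⟦ P? x ×-dec (h x ≟ y) ×-dec Q? y ⟧) ≤ ⟦ Q? y ⟧
    lemma₂ y with Q? y
    ... | yes qy = count≤1 (λ x → P? x ×-dec (h x ≟ y) ×-dec yes qy) ux
            λ { a∈ b∈ (pa , ea , _) (pb , eb , _) → inj a∈ b∈ pa pb (trans ea (sym eb)) }
    ... | no ¬qy = ℕₚ.≤-reflexive (trans (∑-cong xs λ {x} _ → ⟦⟧-no (P? x ×-dec (h x ≟ y) ×-dec no ¬qy) (λ r → ¬qy (proj₂ (proj₂ r)))) (∑-zero xs))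

  -- If the vertices of a bipartite graph have average degrees above the thresholds, then repeatedly
  -- deleting vertices of low degree leaves a nonempty graph.
  prune : {_~_ : A → B → Set} (_~?_ : ∀ a b → Dec (a ~ b)) (Dr Db : ℕ) (rs : List A) (ss : List B) →
    Unique rs → Unique ss →
    Dr * length rs + Db * length ss < (∑[ r ∈ rs ] ∑[ s ∈ ss ] ⟦ r ~? s ⟧) →
    ∃[ rs′ ] ∃[ ss′ ] (∃[ r ] r ∈ rs′) × Unique rs′ × Unique ss′ × (∀ {r} → r ∈ rs′ → r ∈ rs) × (∀ {s} → s ∈ ss′ → s ∈ ss) ×
      (∀ {r} → r ∈ rs′ → Dr < (∑[ s ∈ ss′ ] ⟦ r ~? s ⟧)) × (∀ {s} → s ∈ ss′ → Db < (∑[ r ∈ rs′ ] ⟦ r ~? s ⟧))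
  prune {A} {B} {_~_} _~?_ Dr Db rs ss = go (length rs + length ss) rs ss ℕₚ.≤-refl
    where
    Goal : List A → List B → Set
    Goal rs ss = ∃[ rs′ ] ∃[ ss′ ] (∃[ r ] r ∈ rs′) × Unique rs′ × Unique ss′ × (∀ {r} → r ∈ rs′ → r ∈ rs) × (∀ {s} → s ∈ ss′ → s ∈ ss) ×
      (∀ {r} → r ∈ rs′ → Dr < (∑[ s ∈ ss′ ] ⟦ r ~? s ⟧)) × (∀ {s} → s ∈ ss′ → Db < (∑[ r ∈ rs′ ] ⟦ r ~? s ⟧))
    removal : ∀ {C : Set} (xs : List C) {x} → Unique xs → x ∈ xs → ∃[ ys ] Unique ys × suc (length ys) ≡ length xs ×
      (∀ {y} → y ∈ ys → y ∈ xs) × (∀ (f : C → ℕ) → ∑ xs f ≡ f x + ∑ ys f)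
    removal (x ∷ xs) (_ ∷ u) (here refl) = xs , u , refl , there , λ f → refl
    removal (x ∷ xs) (x∉ ∷ u) (there x∈) with removal xs u x∈
    ... | ys , u′ , l , sub , eq = x ∷ ys , All.tabulate (λ y∈ → All.lookup x∉ (sub y∈)) ∷ u′ , cong suc l ,
          (λ { (here q) → here q ; (there q) → there (sub q) }) ,
          λ f → trans (cong (f x +_) (eq f)) (solve 3 (λ a b c → a :+ (b :+ c) := b :+ (a :+ c)) refl (f x) _ (∑ ys f))
      where open +-*-Solver using (solve; _:=_; _:+_; _:*_; con)
    -- The strict inequality is invariant: deleting a vertex of degree at most `Dr` (or `Db`) lowers
    -- the left side by exactly that number and the edge count by no more. Its strictness makes the
    -- final graph nonempty.
    go : ∀ n rs ss → length rs + length ss ≤ n → Unique rs → Unique ss →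
         Dr * length rs + Db * length ss < (∑[ r ∈ rs ] ∑[ s ∈ ss ] ⟦ r ~? s ⟧) → Goal rs ss
    go n rs ss len ur us h
      with Any.any? (λ r → (∑[ s ∈ ss ] ⟦ r ~? s ⟧) ℕ.≤? Dr) rs | Any.any? (λ s → (∑[ r ∈ rs ] ⟦ r ~? s ⟧) ℕ.≤? Db) ss
    ... | no ¬r | no ¬s = rs , ss , (let (r , r∈ , _) = ∑>0 rs _ (ℕₚ.≤-<-trans z≤n h) in r , r∈) , ur , us , id , id ,
          (λ r∈ → ℕₚ.≰⇒> λ q → ¬r (lose r∈ q)) , (λ s∈ → ℕₚ.≰⇒> λ q → ¬s (lose s∈ q))
    go n rs ss len ur us h | yes any | _ with find any
    go zero    (_ ∷ _) ss () ur us h | yes any | _ | r , r∈ , low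
    go (suc n) rs ss len ur us h | yes any | _ | r , r∈ , low with removal rs ur r∈
    ... | rs₁ , u₁ , l , sub , eq with go n rs₁ ss (ℕₚ.≤-pred (subst (λ z → z + length ss ≤ suc n) (sym l) len)) u₁ us
              (ℕₚ.+-cancelˡ-< Dr _ _ (ℕₚ.<-≤-trans (subst (_< (∑[ r ∈ rs ] ∑[ s ∈ ss ] ⟦ r ~? s ⟧))
                (trans (cong (λ z → Dr * z + Db * length ss) (sym l))
                   (trans (cong (_+ Db * length ss) (ℕₚ.*-suc Dr (length rs₁))) (ℕₚ.+-assoc Dr _ _))) h)
                (ℕₚ.≤-trans (ℕₚ.≤-reflexive (eq _)) (ℕₚ.+-monoˡ-≤ _ low))))
    ...   | rs′ , ss′ , ne , a , b , c , d , e = rs′ , ss′ , ne , a , b , sub ∘ c , d , e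
    go n rs ss len ur us h | no _ | yes any with find any
    go n rs ss len ur us h | no _ | yes any | s , s∈ , low with removal ss us s∈
    go zero rs (_ ∷ _) len ur us h | no _ | yes any | s , s∈ , low | _ = contradiction (ℕₚ.n≤0⇒n≡0 len) (λ q → ℕₚ.1+n≢0 (ℕₚ.m+n≡0⇒n≡0 (length rs) q))
    go (suc n) rs ss len ur us h | no _ | yes any | s , s∈ , low | ss₁ , u₁ , l , sub , eq
       with go n rs ss₁ (ℕₚ.≤-pred (subst (_≤ suc n) (trans (cong (length rs +_) (sym l)) (ℕₚ.+-suc _ _)) len)) ur u₁
              (ℕₚ.+-cancelˡ-< Db _ _ (ℕₚ.<-≤-trans (subst (_< (∑[ r ∈ rs ] ∑[ s ∈ ss ] ⟦ r ~? s ⟧))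
                (trans (cong (λ z → Dr * length rs + Db * z) (sym l))
                   (trans (cong (Dr * length rs +_) (ℕₚ.*-suc Db (length ss₁)))
                     (solve 3 (λ a b c → a :+ (b :+ c) := b :+ (a :+ c)) refl (Dr * length rs) Db (Db * length ss₁)))) h)
                (ℕₚ.≤-trans (ℕₚ.≤-reflexive (trans (∑-cong rs (λ {r} _ → eq (λ s → ⟦ r ~? s ⟧))) (∑-+ rs (λ r → ⟦ r ~? s ⟧) _))) (ℕₚ.+-monoˡ-≤ _ low))))
       where open +-*-Solver using (solve; _:=_; _:+_; _:*_; con)
    ...   | rs′ , ss′ , ne , a , b , c , d , e = rs′ , ss′ , ne , a , b , c , sub ∘ d , e

-- Univariate polynomials and formal derivatives in characteristic p

module Univariate (𝔽 : Field) where
  open FieldTheory 𝔽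

  -- Coefficients in increasing order of degree. Trailing zeros are allowed, so `length` is one more
  -- than a bound for the degree, and polynomials are compared through their values.
  Poly : Set
  Poly = List F

  ev : Poly → F → F
  ev []       x = 𝟘
  ev (c ∷ cs) x = c ⊕ x ⊗ ev cs x

  infixl 6 _+ᴾ_
  infixl 7 _*ᴾ_ _·ᴾ_

  _+ᴾ_ : Poly → Poly → Poly
  []       +ᴾ q        = q
  (a ∷ as) +ᴾ []       = a ∷ as
  (a ∷ as) +ᴾ (b ∷ bs) = (a ⊕ b) ∷ (as +ᴾ bs)

  _·ᴾ_ : F → Poly → Poly
  c ·ᴾ q = map (c ⊗_) q

  _*ᴾ_ : Poly → Poly → Poly
  []       *ᴾ q = []
  (a ∷ as) *ᴾ q = a ·ᴾ q +ᴾ (𝟘 ∷ as *ᴾ q)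

  -- The recursion (c + x q)′ = q + x q′ produces the integer factors of the formal derivative by
  -- repeated addition.
  D : Poly → Poly
  D []           = []
  D (_ ∷ [])     = []
  D (_ ∷ b ∷ bs) = (b ∷ bs) +ᴾ (𝟘 ∷ D (b ∷ bs))

  ev-+ : ∀ p q x → ev (p +ᴾ q) x ≡ ev p x ⊕ ev q x
  ev-+ []       q        x = sym (⊕-identityˡ _)
  ev-+ (a ∷ as) []       x = sym (⊕-identityʳ _)
  ev-+ (a ∷ as) (b ∷ bs) x = trans (cong (λ z → a ⊕ b ⊕ x ⊗ z) (ev-+ as bs x))
    (solve 5 (λ a b x u v → a :+ b :+ x :* (u :+ v) := a :+ x :* u :+ (b :+ x :* v)) refl a b x (ev as x) (ev bs x))

  ev-· : ∀ c q x → ev (c ·ᴾ q) x ≡ c ⊗ ev q x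
  ev-· c []       x = sym (⊗-zeroʳ c)
  ev-· c (b ∷ bs) x = trans (cong (λ z → c ⊗ b ⊕ x ⊗ z) (ev-· c bs x))
    (solve 4 (λ c b x u → c :* b :+ x :* (c :* u) := c :* (b :+ x :* u)) refl c b x (ev bs x))

  ev-* : ∀ p q x → ev (p *ᴾ q) x ≡ ev p x ⊗ ev q x
  ev-* []       q x = sym (⊗-zeroˡ _)
  ev-* (a ∷ as) q x = trans (ev-+ (a ·ᴾ q) (𝟘 ∷ as *ᴾ q) x)
    (trans (cong₂ (λ u v → u ⊕ (𝟘 ⊕ x ⊗ v)) (ev-· a q x) (ev-* as q x))
    (trans (cong (a ⊗ ev q x ⊕_) (⊕-identityˡ _))
    (solve 4 (λ a x u v → a :* v :+ x :* (u :* v) := (a :+ x :* u) :* v) refl a x (ev as x) (ev q x))))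

  ev-D-∷ : ∀ c cs x → ev (D (c ∷ cs)) x ≡ ev cs x ⊕ x ⊗ ev (D cs) x
  ev-D-∷ c []       x = sym (trans (⊕-identityˡ _) (⊗-zeroʳ x))
  ev-D-∷ c (b ∷ bs) x = trans (ev-+ (b ∷ bs) (𝟘 ∷ D (b ∷ bs)) x) (cong (ev (b ∷ bs) x ⊕_) (⊕-identityˡ _))

  ev-D-+ : ∀ p q x → ev (D (p +ᴾ q)) x ≡ ev (D p) x ⊕ ev (D q) x
  ev-D-+ []       q        x = sym (⊕-identityˡ _)
  ev-D-+ (a ∷ as) []       x = sym (⊕-identityʳ _)
  ev-D-+ (a ∷ as) (b ∷ bs) x
    rewrite ev-D-∷ (a ⊕ b) (as +ᴾ bs) x | ev-D-∷ a as x | ev-D-∷ b bs x | ev-+ as bs x | ev-D-+ as bs x =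
    solve 5 (λ u v x s t → u :+ v :+ x :* (s :+ t) := u :+ x :* s :+ (v :+ x :* t)) refl
      (ev as x) (ev bs x) x (ev (D as) x) (ev (D bs) x)

  ev-D-· : ∀ c q x → ev (D (c ·ᴾ q)) x ≡ c ⊗ ev (D q) x
  ev-D-· c []       x = sym (⊗-zeroʳ c)
  ev-D-· c (b ∷ bs) x
    rewrite ev-D-∷ (c ⊗ b) (c ·ᴾ bs) x | ev-D-∷ b bs x | ev-· c bs x | ev-D-· c bs x =
    solve 4 (λ c u x s → c :* u :+ x :* (c :* s) := c :* (u :+ x :* s)) refl c (ev bs x) x (ev (D bs) x)

  ev-D-* : ∀ p q x → ev (D (p *ᴾ q)) x ≡ ev (D p) x ⊗ ev q x ⊕ ev p x ⊗ ev (D q) x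
  ev-D-* []       q x = sym (trans (cong₂ _⊕_ (⊗-zeroˡ _) (⊗-zeroˡ _)) (⊕-identityˡ _))
  ev-D-* (a ∷ as) q x
    rewrite ev-D-+ (a ·ᴾ q) (𝟘 ∷ as *ᴾ q) x | ev-D-· a q x | ev-D-∷ 𝟘 (as *ᴾ q) x
          | ev-* as q x | ev-D-* as q x | ev-D-∷ a as x =
    solve 6 (λ a x u u′ v v′ → a :* v′ :+ (u :* v :+ x :* (u′ :* v :+ u :* v′)) := (u :+ x :* u′) :* v :+ (a :+ x :* u) :* v′)
      refl a x (ev as x) (ev (D as) x) (ev q x) (ev (D q) x)

  length-+ᴾ : ∀ p q → length (p +ᴾ q) ≡ length p ⊔ length q
  length-+ᴾ []       q        = refl
  length-+ᴾ (a ∷ as) []       = refl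
  length-+ᴾ (a ∷ as) (b ∷ bs) = cong suc (length-+ᴾ as bs)

  length-+ᴾ-≤ : ∀ {n} p q → length p ≤ n → length q ≤ n → length (p +ᴾ q) ≤ n
  length-+ᴾ-≤ p q hp hq = ℕₚ.≤-trans (ℕₚ.≤-reflexive (length-+ᴾ p q)) (ℕₚ.⊔-lub hp hq)

  length-·ᴾ : ∀ c q → length (c ·ᴾ q) ≡ length q
  length-·ᴾ c q = Listₚ.length-map (c ⊗_) q

  length-*ᴾ-≤ : ∀ {m n} p q → length p ≤ suc m → length q ≤ suc n → length (p *ᴾ q) ≤ suc (m + n)
  length-*ᴾ-≤ []           q hp hq = z≤n
  length-*ᴾ-≤ {m} {n} (a ∷ [])     q hp hq = length-+ᴾ-≤ (a ·ᴾ q) (𝟘 ∷ [])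
    (ℕₚ.≤-trans (ℕₚ.≤-reflexive (length-·ᴾ a q)) (ℕₚ.≤-trans hq (s≤s (ℕₚ.m≤n+m n m)))) (s≤s z≤n)
  length-*ᴾ-≤ {suc m} {n} (a ∷ b ∷ bs) q (s≤s hp) hq = length-+ᴾ-≤ (a ·ᴾ q) (𝟘 ∷ (b ∷ bs) *ᴾ q)
    (ℕₚ.≤-trans (ℕₚ.≤-reflexive (length-·ᴾ a q)) (ℕₚ.≤-trans hq (s≤s (ℕₚ.m≤n+m n (suc m)))))
    (s≤s (length-*ᴾ-≤ (b ∷ bs) q hp hq))

  length-D-≤ : ∀ {n} p → length p ≤ suc n → length (D p) ≤ n
  length-D-≤ []           h       = z≤n
  length-D-≤ (_ ∷ [])     h       = z≤n
  length-D-≤ {suc n} (_ ∷ b ∷ bs) (s≤s h) = length-+ᴾ-≤ (b ∷ bs) (𝟘 ∷ D (b ∷ bs)) h (s≤s (length-D-≤ (b ∷ bs) h))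

  -- Quotient by x - r in Horner form; the remainder is `ev p r`.
  _/ᴾ_ : Poly → F → Poly
  []       /ᴾ r = []
  (c ∷ cs) /ᴾ r = cs +ᴾ r ·ᴾ (cs /ᴾ r)

  length-/ᴾ-≤ : ∀ {n} p r → length p ≤ suc n → length (p /ᴾ r) ≤ n
  length-/ᴾ-≤ []       r h = z≤n
  length-/ᴾ-≤ {n} (c ∷ cs) r (s≤s h) = length-+ᴾ-≤ cs (r ·ᴾ (cs /ᴾ r)) h
    (ℕₚ.≤-trans (ℕₚ.≤-reflexive (length-·ᴾ r (cs /ᴾ r))) (length-/ᴾ-≤ cs r (ℕₚ.m≤n⇒m≤1+n h)))

  ev-/ᴾ : ∀ p r x → ev p x ≡ (x ⊖ r) ⊗ ev (p /ᴾ r) x ⊕ ev p r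
  ev-/ᴾ []       r x = sym (trans (⊕-identityʳ _) (⊗-zeroʳ _))
  ev-/ᴾ (c ∷ cs) r x
    rewrite ev-+ cs (r ·ᴾ (cs /ᴾ r)) x | ev-· r (cs /ᴾ r) x | ev-/ᴾ cs r x =
    solve 5 (λ c x r q e → c :+ x :* ((x :- r) :* q :+ e) := (x :- r) :* ((x :- r) :* q :+ e :+ r :* q) :+ (c :+ r :* e))
      refl c x r (ev (cs /ᴾ r) x) (ev cs r)

  ev-/ᴾ-root : ∀ p r x → ev p r ≡ 𝟘 → ev p x ≡ (x ⊖ r) ⊗ ev (p /ᴾ r) x
  ev-/ᴾ-root p r x h = trans (ev-/ᴾ p r x) (trans (cong ((x ⊖ r) ⊗ ev (p /ᴾ r) x ⊕_) h) (⊕-identityʳ _))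

  ≢⇒⊖≢𝟘 : ∀ {x y} → x ≢ y → x ⊖ y ≢ 𝟘
  ≢⇒⊖≢𝟘 x≢y q = x≢y (⊖≡𝟘⇒≡ q)

  Vanishes : Poly → Set
  Vanishes p = ∀ x → ev p x ≡ 𝟘

  roots⇒vanishes : ∀ p rs → Unique rs → (∀ {r} → r ∈ rs → ev p r ≡ 𝟘) → length p ≤ length rs → Vanishes p
  roots⇒vanishes []       rs       u h len x = refl
  roots⇒vanishes (c ∷ cs) (r ∷ rs) (r∉ ∷ u) h len x =
    trans (ev-/ᴾ-root (c ∷ cs) r x (h (here refl))) (trans (cong ((x ⊖ r) ⊗_)
      (roots⇒vanishes ((c ∷ cs) /ᴾ r) rs u
        (λ {y} y∈ → ⊗≡𝟘 (y ⊖ r) _ (trans (sym (ev-/ᴾ-root (c ∷ cs) r y (h (here refl)))) (h (there y∈)))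
                     (≢⇒⊖≢𝟘 (≢-sym (All.lookup r∉ y∈))))
        (length-/ᴾ-≤ (c ∷ cs) r len) x)) (⊗-zeroʳ _))

  others : F → List F
  others r = filter (λ x → ¬? (x ≟ r)) elems

  others-unique : ∀ r → Unique (others r)
  others-unique r = Uniqueₚ.filter⁺ (λ x → ¬? (x ≟ r)) elems-unique

  ∈-others : ∀ {r x} → x ∈ others r → x ≢ r
  ∈-others {r} x∈ = proj₂ (∈ₚ.∈-filter⁻ (λ x → ¬? (x ≟ r)) {xs = elems} x∈)

  -- r ∷ others r lists all of F, so it has p elements.
  others-length : ∀ r → p ≤ suc (length (others r))
  others-length r = subst (_≤ suc (length (others r))) elems-length (lemma elems elems-unique)
    where
    lemma : ∀ xs → Unique xs → length xs ≤ suc (length (filter (λ x → ¬? (x ≟ r)) xs))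
    lemma []       _ = z≤n
    lemma (x ∷ xs) (x∉ ∷ u) with x ≟ r
    ... | no  _    = s≤s (lemma xs u)
    ... | yes refl = s≤s (ℕₚ.≤-reflexive (cong length (sym (Listₚ.filter-all (λ y → ¬? (y ≟ x)) (All.map ≢-sym x∉)))))

  vanishes-off⇒vanishes : ∀ p′ r → (∀ x → x ≢ r → ev p′ x ≡ 𝟘) → suc (length p′) ≤ p → Vanishes p′
  vanishes-off⇒vanishes p′ r h len = roots⇒vanishes p′ (others r) (others-unique r) (λ x∈ → h _ (∈-others x∈))
    (ℕₚ.≤-pred (ℕₚ.≤-trans len (others-length r)))

  -- Values determine coefficients only up to length p, as x^p - x shows. The constant coefficient
  -- is the value at 0; the tail then vanishes at the p - 1 other points, which is enough because it
  -- is shorter by one.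
  vanishes⇒coefficients : ∀ p′ → length p′ ≤ p → Vanishes p′ → All (_≡ 𝟘) p′
  vanishes⇒coefficients []       len h = []
  vanishes⇒coefficients (c ∷ cs) len h = c≡𝟘 ∷ vanishes⇒coefficients cs (ℕₚ.<⇒≤ len)
    (vanishes-off⇒vanishes cs 𝟘 (λ x x≢ → ⊗≡𝟘 x _ (trans (sym (⊕-identityˡ _)) (trans (cong (_⊕ x ⊗ ev cs x) (sym c≡𝟘)) (h x))) x≢) len)
    where
    c≡𝟘 : c ≡ 𝟘
    c≡𝟘 = trans (sym (trans (cong (c ⊕_) (⊗-zeroˡ _)) (⊕-identityʳ c))) (h 𝟘)

  coefficients⇒vanishes : ∀ {p′} → All (_≡ 𝟘) p′ → Vanishes p′
  coefficients⇒vanishes []         x = refl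
  coefficients⇒vanishes (refl ∷ h) x = trans (⊕-identityˡ _) (trans (cong (x ⊗_) (coefficients⇒vanishes h x)) (⊗-zeroʳ x))

  vanishes-D : ∀ p′ → length p′ ≤ p → Vanishes p′ → Vanishes (D p′)
  vanishes-D p′ len h = lemma (vanishes⇒coefficients p′ len h)
    where
    lemma : ∀ {p′} → All (_≡ 𝟘) p′ → Vanishes (D p′)
    lemma []                  x = refl
    lemma {c ∷ cs} (_ ∷ h) x = trans (ev-D-∷ c cs x)
      (trans (cong₂ (λ u v → u ⊕ x ⊗ v) (coefficients⇒vanishes h x) (lemma h x)) (trans (⊕-identityˡ _) (⊗-zeroʳ x)))

  -- The derivative is defined on coefficients, so the passage from equal values to equal
  -- derivatives goes through the vanishing coefficients of the difference.
  D-ext : ∀ p′ q′ → length p′ ≤ p → length q′ ≤ p → (∀ x → ev p′ x ≡ ev q′ x) → ∀ x → ev (D p′) x ≡ ev (D q′) x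
  D-ext p′ q′ lp lq h x = ⊖≡𝟘⇒≡ (trans (sym (lemma₂ x))
    (vanishes-D (p′ +ᴾ (⊝ 𝟙) ·ᴾ q′) (length-+ᴾ-≤ p′ _ lp (subst (_≤ p) (sym (length-·ᴾ (⊝ 𝟙) q′)) lq))
      (λ y → trans (lemma₁ y) (≡⇒⊖≡𝟘 (h y))) x))
    where
    neg : ∀ u v → u ⊕ (⊝ 𝟙) ⊗ v ≡ u ⊖ v
    neg u v = trans (cong (λ z → u ⊕ (⊝ z) ⊗ v) (sym fromℤ-1))
      (solve 2 (λ u v → u :+ (:- con ℤ.1ℤ) :* v := u :- v) refl u v)
    lemma₁ : ∀ y → ev (p′ +ᴾ (⊝ 𝟙) ·ᴾ q′) y ≡ ev p′ y ⊖ ev q′ y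
    lemma₁ y = trans (ev-+ p′ _ y) (trans (cong (ev p′ y ⊕_) (ev-· (⊝ 𝟙) q′ y)) (neg _ _))
    lemma₂ : ∀ y → ev (D (p′ +ᴾ (⊝ 𝟙) ·ᴾ q′)) y ≡ ev (D p′) y ⊖ ev (D q′) y
    lemma₂ y = trans (ev-D-+ p′ _ y) (trans (cong (ev (D p′) y ⊕_) (ev-D-· (⊝ 𝟙) q′ y)) (neg _ _))

  module _ (Q : Poly) (x₀ : F) (Qx₀≢𝟘 : ev Q x₀ ≢ 𝟘) where
    private
      δ : Poly
      δ = ⊝ x₀ ∷ 𝟙 ∷ []

      ev-δ : ∀ x → ev δ x ≡ x ⊖ x₀
      ev-δ x = trans (cong (λ z → ⊝ x₀ ⊕ x ⊗ (z ⊕ x ⊗ 𝟘)) (sym fromℤ-1)) (trans (cong (λ z → ⊝ x₀ ⊕ x ⊗ (fromℤ ℤ.1ℤ ⊕ x ⊗ z)) (sym fromℤ-0))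
        (solve 2 (λ x x₀ → :- x₀ :+ x :* (con ℤ.1ℤ :+ x :* con ℤ.0ℤ) := x :- x₀) refl x x₀))

      ev-Dδ : ∀ x → ev (D δ) x ≡ 𝟙
      ev-Dδ x = trans (cong (λ z → (𝟙 ⊕ 𝟘) ⊕ x ⊗ z) refl) (trans (cong (𝟙 ⊕ 𝟘 ⊕_) (⊗-zeroʳ x)) (trans (⊕-identityʳ _) (⊕-identityʳ _)))

      fromℕ : ℕ → F
      fromℕ m = fromℤ (ℤ.+ m)

      -- If P = (x - x₀)^m S then P′Q = PQ′ says, after division by (x - x₀)^(m-1), that Eq m S holds.
      Eq : ℕ → Poly → F → Set
      Eq m S x = (fromℕ m ⊗ ev S x ⊕ (x ⊖ x₀) ⊗ ev (D S) x) ⊗ ev Q x ≡ (x ⊖ x₀) ⊗ ev S x ⊗ ev (D Q) x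

      ev-D-/ᴾ : ∀ S → 2 + length S ≤ p → ev S x₀ ≡ 𝟘 → ∀ x → ev (D S) x ≡ ev (S /ᴾ x₀) x ⊕ (x ⊖ x₀) ⊗ ev (D (S /ᴾ x₀)) x
      ev-D-/ᴾ S len h x = trans (D-ext S (δ *ᴾ (S /ᴾ x₀)) (ℕₚ.m+n≤o⇒n≤o 2 len)
          (ℕₚ.≤-trans (length-*ᴾ-≤ {1} {length S} δ (S /ᴾ x₀) ℕₚ.≤-refl (ℕₚ.m≤n⇒m≤1+n (length-/ᴾ-≤ S x₀ (ℕₚ.n≤1+n _)))) len)
          (λ y → trans (ev-/ᴾ-root S x₀ y h) (sym (trans (ev-* δ (S /ᴾ x₀) y) (cong (_⊗ ev (S /ᴾ x₀) y) (ev-δ y))))) x)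
        (trans (ev-D-* δ (S /ᴾ x₀) x) (trans (cong₂ (λ u v → u ⊗ ev (S /ᴾ x₀) x ⊕ v ⊗ ev (D (S /ᴾ x₀)) x) (ev-Dδ x) (ev-δ x))
          (cong (_⊕ (x ⊖ x₀) ⊗ ev (D (S /ᴾ x₀)) x) (⊗-identityˡ _))))

      gap : ℕ → Poly → Poly
      gap m S = (fromℕ m ·ᴾ S +ᴾ δ *ᴾ D S) *ᴾ Q +ᴾ (⊝ 𝟙) ·ᴾ (δ *ᴾ (S *ᴾ D Q))

      ev-gap : ∀ m S x → ev (gap m S) x ≡
        (fromℕ m ⊗ ev S x ⊕ (x ⊖ x₀) ⊗ ev (D S) x) ⊗ ev Q x ⊖ (x ⊖ x₀) ⊗ ev S x ⊗ ev (D Q) x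
      ev-gap m S x
        rewrite ev-+ ((fromℕ m ·ᴾ S +ᴾ δ *ᴾ D S) *ᴾ Q) ((⊝ 𝟙) ·ᴾ (δ *ᴾ (S *ᴾ D Q))) x
              | ev-* (fromℕ m ·ᴾ S +ᴾ δ *ᴾ D S) Q x | ev-+ (fromℕ m ·ᴾ S) (δ *ᴾ D S) x | ev-· (fromℕ m) S x | ev-* δ (D S) x
              | ev-· (⊝ 𝟙) (δ *ᴾ (S *ᴾ D Q)) x | ev-* δ (S *ᴾ D Q) x | ev-* S (D Q) x | ev-δ x =
        trans (cong (λ z → (fromℕ m ⊗ ev S x ⊕ (x ⊖ x₀) ⊗ ev (D S) x) ⊗ ev Q x ⊕ (⊝ z) ⊗ ((x ⊖ x₀) ⊗ (ev S x ⊗ ev (D Q) x))) (sym fromℤ-1))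
          (solve 4 (λ a d s q → a :+ (:- con ℤ.1ℤ) :* (d :* (s :* q)) := a :- d :* s :* q) refl
            ((fromℕ m ⊗ ev S x ⊕ (x ⊖ x₀) ⊗ ev (D S) x) ⊗ ev Q x) (x ⊖ x₀) (ev S x) (ev (D Q) x))

      length-gap : ∀ m S {s q} → length S ≤ suc s → length Q ≤ suc q → length (gap m S) ≤ suc (suc s + q)
      length-gap m S {s} {q} hs hq = length-+ᴾ-≤ ((fromℕ m ·ᴾ S +ᴾ δ *ᴾ D S) *ᴾ Q) _
        (length-*ᴾ-≤ (fromℕ m ·ᴾ S +ᴾ δ *ᴾ D S) Q
          (length-+ᴾ-≤ (fromℕ m ·ᴾ S) (δ *ᴾ D S) (ℕₚ.≤-trans (ℕₚ.≤-reflexive (length-·ᴾ (fromℕ m) S)) (ℕₚ.m≤n⇒m≤1+n hs))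
            (length-*ᴾ-≤ {1} {s} δ (D S) ℕₚ.≤-refl (ℕₚ.m≤n⇒m≤1+n (length-D-≤ S hs)))) hq)
        (ℕₚ.≤-trans (ℕₚ.≤-reflexive (length-·ᴾ (⊝ 𝟙) (δ *ᴾ (S *ᴾ D Q)))) (length-*ᴾ-≤ {1} {s + q} δ (S *ᴾ D Q) ℕₚ.≤-refl
          (length-*ᴾ-≤ S (D Q) hs (ℕₚ.m≤n⇒m≤1+n (length-D-≤ Q hq)))))

      -- Descent on the multiplicity of the root x₀. At x₀ the equation reads m S(x₀) Q(x₀) = 0, and
      -- m is invertible since 0 < m < p; so S = (x - x₀) S₁. Substitution and division by x - x₀
      -- give `Eq (suc m) S₁` off x₀, hence everywhere by degree, until the length of S is
      -- exhausted.
      descend : ∀ k m S → 0 < m → k + m < p → length S ≤ k → (∀ x → Eq m S x) → 3 + k + length Q ≤ p → Vanishes S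
      descend zero    m [] 0<m m<p len eq bound x = refl
      descend (suc k) m S 0<m m<p len eq bound x =
        trans (ev-/ᴾ-root S x₀ x Sx₀≡𝟘) (trans (cong ((x ⊖ x₀) ⊗_) (S₁-vanishes x)) (⊗-zeroʳ _))
        where
        Sx₀≡𝟘 : ev S x₀ ≡ 𝟘
        Sx₀≡𝟘 = ⊗≡𝟘 (fromℕ m) _ (⊗≡𝟘 (ev Q x₀) _ (trans
          (solve 5 (λ m s s′ q x → q :* (m :* s) := (m :* s :+ (x :- x) :* s′) :* q) refl (fromℕ m) (ev S x₀) (ev (D S) x₀) (ev Q x₀) x₀)
          (trans (eq x₀) (trans (cong (λ z → z ⊗ ev S x₀ ⊗ ev (D Q) x₀) (⊖-self x₀)) (trans (cong (_⊗ ev (D Q) x₀) (⊗-zeroˡ _)) (⊗-zeroˡ _)))))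
          Qx₀≢𝟘) (char m 0<m (ℕₚ.≤-trans (s≤s (ℕₚ.m≤n+m m (suc k))) m<p))
        S₁ : Poly
        S₁ = S /ᴾ x₀
        len₁ : length S₁ ≤ k
        len₁ = length-/ᴾ-≤ S x₀ len
        eq-off : ∀ x → x ≢ x₀ → ev (gap (suc m) S₁) x ≡ 𝟘
        eq-off x x≢ = trans (ev-gap (suc m) S₁ x) (⊗≡𝟘 (x ⊖ x₀) _ (trans
          (cong (λ z → (x ⊖ x₀) ⊗ ((z ⊗ ev S₁ x ⊕ (x ⊖ x₀) ⊗ ev (D S₁) x) ⊗ ev Q x ⊖ (x ⊖ x₀) ⊗ ev S₁ x ⊗ ev (D Q) x)) (fromℤ-+ ℤ.1ℤ (ℤ.+ m)))
          (trans (solve 6 (λ m s s′ q q′ d → d :* (((con ℤ.1ℤ :+ m) :* s :+ d :* s′) :* q :- d :* s :* q′)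
                     := (m :* (d :* s) :+ d :* (s :+ d :* s′)) :* q :- d :* (d :* s) :* q′) refl
                   (fromℕ m) (ev S₁ x) (ev (D S₁) x) (ev Q x) (ev (D Q) x) (x ⊖ x₀))
            (trans (cong₂ (λ u v → (fromℕ m ⊗ u ⊕ (x ⊖ x₀) ⊗ v) ⊗ ev Q x ⊖ (x ⊖ x₀) ⊗ u ⊗ ev (D Q) x)
                     (sym (ev-/ᴾ-root S x₀ x Sx₀≡𝟘))
                     (sym (ev-D-/ᴾ S (ℕₚ.≤-trans (s≤s (s≤s (ℕₚ.m≤n⇒m≤1+n len))) (ℕₚ.m+n≤o⇒m≤o (4 + k) bound)) Sx₀≡𝟘 x)))
              (≡⇒⊖≡𝟘 (eq x))))) (≢⇒⊖≢𝟘 x≢))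
        S₁-vanishes : Vanishes S₁
        S₁-vanishes = descend k (suc m) S₁ (s≤s z≤n) (subst (_< p) (sym (ℕₚ.+-suc k m)) m<p) len₁
          (λ y → ⊖≡𝟘⇒≡ (trans (sym (ev-gap (suc m) S₁ y)) (vanishes-off⇒vanishes (gap (suc m) S₁) x₀ eq-off
            (ℕₚ.≤-trans (s≤s (length-gap (suc m) S₁ {k} {length Q} (ℕₚ.m≤n⇒m≤1+n len₁) (ℕₚ.n≤1+n _)))
              (ℕₚ.≤-trans (ℕₚ.n≤1+n _) bound)) y)))
          (ℕₚ.≤-trans (ℕₚ.n≤1+n _) bound)

      vanishing-root : ∀ P → 4 + length P + length Q ≤ p → ev P x₀ ≡ 𝟘 →
        (∀ x → ev (D P) x ⊗ ev Q x ≡ ev P x ⊗ ev (D Q) x) → Vanishes P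
      vanishing-root P bound root eq x = trans (ev-/ᴾ-root P x₀ x root) (trans (cong ((x ⊖ x₀) ⊗_)
        (descend (length P) 1 (P /ᴾ x₀) (s≤s z≤n)
          (ℕₚ.≤-trans (ℕₚ.≤-trans (ℕₚ.≤-reflexive (cong suc (ℕₚ.+-comm (length P) 1))) (ℕₚ.+-monoˡ-≤ (length P) {2} {4} (s≤s (s≤s z≤n)))) (ℕₚ.m+n≤o⇒m≤o (4 + length P) bound))
          (length-/ᴾ-≤ P x₀ (ℕₚ.n≤1+n _))
          (λ y → trans (cong (λ z → (z ⊗ ev (P /ᴾ x₀) y ⊕ (y ⊖ x₀) ⊗ ev (D (P /ᴾ x₀)) y) ⊗ ev Q y) fromℤ-1)
            (trans (cong (λ z → (z ⊕ (y ⊖ x₀) ⊗ ev (D (P /ᴾ x₀)) y) ⊗ ev Q y) (⊗-identityˡ _))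
            (trans (cong (_⊗ ev Q y) (sym (ev-D-/ᴾ P (ℕₚ.≤-trans (s≤s (s≤s (ℕₚ.m≤n+m _ 2))) (ℕₚ.m+n≤o⇒m≤o (4 + length P) bound)) root y)))
            (trans (eq y) (cong (_⊗ ev (D Q) y) (ev-/ᴾ-root P x₀ y root))))))
          (ℕₚ.≤-trans (ℕₚ.n≤1+n _) bound) x)) (⊗-zeroʳ _))

    -- The quotient P / Q has derivative zero, which in characteristic p makes it constant only in
    -- small degree. The combination `R` vanishes at x₀ and satisfies the same equation with Q, so
    -- `vanishing-root` applies to it.
    wronskian≡𝟘⇒proportional : ∀ P → 4 + (length P ⊔ length Q) + length Q ≤ p →
      (∀ x → ev (D P) x ⊗ ev Q x ≡ ev P x ⊗ ev (D Q) x) → ∀ x → ev P x ⊗ ev Q x₀ ≡ ev P x₀ ⊗ ev Q x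
    wronskian≡𝟘⇒proportional P bound eq x = ⊖≡𝟘⇒≡ (trans
        (solve 4 (λ a b c d → a :* b :- c :* d := b :* a :+ (:- c) :* d) refl (ev P x) (ev Q x₀) (ev P x₀) (ev Q x))
        (trans (sym (ev-R x)) (vanishing-root R
          (subst (λ z → 4 + z + length Q ≤ p) (sym lenR) bound)
          (trans (ev-R x₀) (trans (solve 2 (λ a b → a :* b :+ (:- b) :* a := con ℤ.0ℤ) refl (ev Q x₀) (ev P x₀)) fromℤ-0))
          (λ y → trans (cong (_⊗ ev Q y) (ev-DR y)) (trans
            (solve 5 (λ a b p′ q′ q → (a :* p′ :+ (:- b) :* q′) :* q := a :* (p′ :* q) :+ (:- b) :* (q′ :* q)) refl
              (ev Q x₀) (ev P x₀) (ev (D P) y) (ev (D Q) y) (ev Q y))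
            (trans (cong (λ z → ev Q x₀ ⊗ z ⊕ (⊝ ev P x₀) ⊗ (ev (D Q) y ⊗ ev Q y)) (eq y)) (trans
              (solve 5 (λ a b p q′ q → a :* (p :* q′) :+ (:- b) :* (q′ :* q) := (a :* p :+ (:- b) :* q) :* q′) refl
                (ev Q x₀) (ev P x₀) (ev P y) (ev (D Q) y) (ev Q y))
              (cong (_⊗ ev (D Q) y) (sym (ev-R y))))))) x)))
      where
      R : Poly
      R = ev Q x₀ ·ᴾ P +ᴾ (⊝ ev P x₀) ·ᴾ Q
      lenR : length R ≡ length P ⊔ length Q
      lenR = trans (length-+ᴾ (ev Q x₀ ·ᴾ P) _) (cong₂ _⊔_ (length-·ᴾ (ev Q x₀) P) (length-·ᴾ (⊝ ev P x₀) Q))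
      ev-R : ∀ y → ev R y ≡ ev Q x₀ ⊗ ev P y ⊕ (⊝ ev P x₀) ⊗ ev Q y
      ev-R y = trans (ev-+ (ev Q x₀ ·ᴾ P) _ y) (cong₂ _⊕_ (ev-· (ev Q x₀) P y) (ev-· (⊝ ev P x₀) Q y))
      ev-DR : ∀ y → ev (D R) y ≡ ev Q x₀ ⊗ ev (D P) y ⊕ (⊝ ev P x₀) ⊗ ev (D Q) y
      ev-DR y = trans (ev-D-+ (ev Q x₀ ·ᴾ P) _ y) (cong₂ _⊕_ (ev-D-· (ev Q x₀) P y) (ev-D-· (⊝ ev P x₀) Q y))

-- Polynomials on F³ and their restrictions to lines

module Trivariate (𝔽 : Field) where
  open Counting
  open FieldTheory 𝔽
  open Univariate 𝔽

  Triple : Set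
  Triple = F × F × F

  -- Polynomials enter only through values, derivatives and degree bounds, so the trees stay
  -- unnormalised. Laws such as `∂-comm` are identities of values, not of trees.
  data Expr : Set where
    const   : F → Expr
    U V Y   : Expr
    _⊞_ _⊠_ : Expr → Expr → Expr

  infixl 6 _⊞_
  infixl 7 _⊠_

  eval : Expr → Triple → F
  eval (const c) _         = c
  eval U (u , v , y)       = u
  eval V (u , v , y)       = v
  eval Y (u , v , y)       = y
  eval (e ⊞ e′) P          = eval e P ⊕ eval e′ P
  eval (e ⊠ e′) P          = eval e P ⊗ eval e′ P

  ∂ : Triple → Expr → Expr
  ∂ δ (const c)       = const 𝟘
  ∂ (a , b , c) U     = const a
  ∂ (a , b , c) V     = const b
  ∂ (a , b , c) Y     = const c
  ∂ δ (e ⊞ e′)        = ∂ δ e ⊞ ∂ δ e′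
  ∂ δ (e ⊠ e′)        = ∂ δ e ⊠ e′ ⊞ e ⊠ ∂ δ e′

  deg : Expr → ℕ
  deg (const c) = 0
  deg U         = 1
  deg V         = 1
  deg Y         = 1
  deg (e ⊞ e′)  = deg e ⊔ deg e′
  deg (e ⊠ e′)  = deg e + deg e′

  deg-∂ : ∀ δ e → deg (∂ δ e) ≤ deg e
  deg-∂ δ (const c) = z≤n
  deg-∂ δ U         = z≤n
  deg-∂ δ V         = z≤n
  deg-∂ δ Y         = z≤n
  deg-∂ δ (e ⊞ e′)  = ℕₚ.⊔-mono-≤ (deg-∂ δ e) (deg-∂ δ e′)
  deg-∂ δ (e ⊠ e′)  = ℕₚ.⊔-lub (ℕₚ.+-monoˡ-≤ (deg e′) (deg-∂ δ e)) (ℕₚ.+-monoʳ-≤ (deg e) (deg-∂ δ e′))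

  infixl 6 _+ᵀ_
  _+ᵀ_ : Triple → Triple → Triple
  (a , b , c) +ᵀ (a′ , b′ , c′) = a ⊕ a′ , b ⊕ b′ , c ⊕ c′

  infixl 7 _·ᵀ_
  _·ᵀ_ : F → Triple → Triple
  k ·ᵀ (a , b , c) = k ⊗ a , k ⊗ b , k ⊗ c

  ∂-linear : ∀ δ k δ′ e P → eval (∂ (δ +ᵀ k ·ᵀ δ′) e) P ≡ eval (∂ δ e) P ⊕ k ⊗ eval (∂ δ′ e) P
  ∂-linear δ k δ′ (const c) P = sym (trans (⊕-identityˡ _) (⊗-zeroʳ k))
  ∂-linear δ k δ′ U P = refl
  ∂-linear δ k δ′ V P = refl
  ∂-linear δ k δ′ Y P = refl
  ∂-linear δ k δ′ (e ⊞ e′) P = trans (cong₂ _⊕_ (∂-linear δ k δ′ e P) (∂-linear δ k δ′ e′ P))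
    (solve 5 (λ k a b c d → a :+ k :* b :+ (c :+ k :* d) := a :+ c :+ k :* (b :+ d)) refl
      k (eval (∂ δ e) P) (eval (∂ δ′ e) P) (eval (∂ δ e′) P) (eval (∂ δ′ e′) P))
  ∂-linear δ k δ′ (e ⊠ e′) P = trans (cong₂ (λ x y → x ⊗ eval e′ P ⊕ eval e P ⊗ y) (∂-linear δ k δ′ e P) (∂-linear δ k δ′ e′ P))
    (solve 7 (λ k a b c d e e′ → (a :+ k :* b) :* e′ :+ e :* (c :+ k :* d) := a :* e′ :+ e :* c :+ k :* (b :* e′ :+ e :* d)) refl
      k (eval (∂ δ e) P) (eval (∂ δ′ e) P) (eval (∂ δ e′) P) (eval (∂ δ′ e′) P) (eval e P) (eval e′ P))

  ∂-comm : ∀ δ δ′ e P → eval (∂ δ (∂ δ′ e)) P ≡ eval (∂ δ′ (∂ δ e)) P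
  ∂-comm δ δ′ (const c) P = refl
  ∂-comm δ δ′ U P = refl
  ∂-comm δ δ′ V P = refl
  ∂-comm δ δ′ Y P = refl
  ∂-comm δ δ′ (e ⊞ e′) P = cong₂ _⊕_ (∂-comm δ δ′ e P) (∂-comm δ δ′ e′ P)
  ∂-comm δ δ′ (e ⊠ e′) P = trans (cong₂ (λ x y → x ⊗ eval e′ P ⊕ eval (∂ δ′ e) P ⊗ eval (∂ δ e′) P ⊕ (eval (∂ δ e) P ⊗ eval (∂ δ′ e′) P ⊕ eval e P ⊗ y)) (∂-comm δ δ′ e P) (∂-comm δ δ′ e′ P))
    (solve 4 (λ s t u v → s :+ t :+ (u :+ v) := s :+ u :+ (t :+ v)) refl
      (eval (∂ δ′ (∂ δ e)) P ⊗ eval e′ P) (eval (∂ δ′ e) P ⊗ eval (∂ δ e′) P) (eval (∂ δ e) P ⊗ eval (∂ δ′ e′) P) (eval e P ⊗ eval (∂ δ′ (∂ δ e′)) P))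

  record Line : Set where
    constructor line
    field base dir : Triple
  open Line public

  at : Line → F → Triple
  at ℓ t = base ℓ +ᵀ t ·ᵀ dir ℓ

  restrict : Line → Expr → Poly
  restrict ℓ (const c) = c ∷ []
  restrict (line (a , _ , _) (a′ , _ , _)) U = a ∷ a′ ∷ []
  restrict (line (_ , b , _) (_ , b′ , _)) V = b ∷ b′ ∷ []
  restrict (line (_ , _ , c) (_ , _ , c′)) Y = c ∷ c′ ∷ []
  restrict ℓ (e ⊞ e′)  = restrict ℓ e +ᴾ restrict ℓ e′
  restrict ℓ (e ⊠ e′)  = restrict ℓ e *ᴾ restrict ℓ e′

  length-restrict : ∀ ℓ e → length (restrict ℓ e) ≤ suc (deg e)
  length-restrict ℓ (const c) = s≤s z≤n
  length-restrict ℓ U = s≤s (s≤s z≤n)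
  length-restrict ℓ V = s≤s (s≤s z≤n)
  length-restrict ℓ Y = s≤s (s≤s z≤n)
  length-restrict ℓ (e ⊞ e′) = length-+ᴾ-≤ (restrict ℓ e) (restrict ℓ e′)
    (ℕₚ.≤-trans (length-restrict ℓ e) (s≤s (ℕₚ.m≤m⊔n _ _))) (ℕₚ.≤-trans (length-restrict ℓ e′) (s≤s (ℕₚ.m≤n⊔m (deg e) _)))
  length-restrict ℓ (e ⊠ e′) = length-*ᴾ-≤ (restrict ℓ e) (restrict ℓ e′) (length-restrict ℓ e) (length-restrict ℓ e′)

  private
    ev-linear : ∀ a b t → a ⊕ t ⊗ (b ⊕ t ⊗ 𝟘) ≡ a ⊕ t ⊗ b
    ev-linear a b t = cong (λ z → a ⊕ t ⊗ z) (trans (cong (b ⊕_) (⊗-zeroʳ t)) (⊕-identityʳ b))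
    ev-constant : ∀ c t → c ⊕ t ⊗ 𝟘 ≡ c
    ev-constant c t = trans (cong (c ⊕_) (⊗-zeroʳ t)) (⊕-identityʳ c)
    ev-D-linear : ∀ b t → (b ⊕ 𝟘) ⊕ t ⊗ 𝟘 ≡ b
    ev-D-linear b t = trans (ev-constant _ t) (⊕-identityʳ b)

  ev-restrict : ∀ ℓ e t → ev (restrict ℓ e) t ≡ eval e (at ℓ t)
  ev-restrict ℓ (const c) t = ev-constant c t
  ev-restrict ℓ U t = ev-linear _ _ t
  ev-restrict ℓ V t = ev-linear _ _ t
  ev-restrict ℓ Y t = ev-linear _ _ t
  ev-restrict ℓ (e ⊞ e′) t = trans (ev-+ (restrict ℓ e) (restrict ℓ e′) t) (cong₂ _⊕_ (ev-restrict ℓ e t) (ev-restrict ℓ e′ t))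
  ev-restrict ℓ (e ⊠ e′) t = trans (ev-* (restrict ℓ e) (restrict ℓ e′) t) (cong₂ _⊗_ (ev-restrict ℓ e t) (ev-restrict ℓ e′ t))

  ev-D-restrict : ∀ ℓ e t → ev (D (restrict ℓ e)) t ≡ eval (∂ (dir ℓ) e) (at ℓ t)
  ev-D-restrict ℓ (const c) t = refl
  ev-D-restrict ℓ U t = ev-D-linear _ t
  ev-D-restrict ℓ V t = ev-D-linear _ t
  ev-D-restrict ℓ Y t = ev-D-linear _ t
  ev-D-restrict ℓ (e ⊞ e′) t = trans (ev-D-+ (restrict ℓ e) (restrict ℓ e′) t) (cong₂ _⊕_ (ev-D-restrict ℓ e t) (ev-D-restrict ℓ e′ t))
  ev-D-restrict ℓ (e ⊠ e′) t = trans (ev-D-* (restrict ℓ e) (restrict ℓ e′) t)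
    (cong₂ _⊕_ (cong₂ _⊗_ (ev-D-restrict ℓ e t) (ev-restrict ℓ e′ t)) (cong₂ _⊗_ (ev-restrict ℓ e t) (ev-D-restrict ℓ e′ t)))

  VanishesOn : Expr → Line → Set
  VanishesOn e ℓ = ∀ t → eval e (at ℓ t) ≡ 𝟘

  vanishesOn? : ∀ e ℓ → Dec (VanishesOn e ℓ)
  vanishesOn? e ℓ = map′ (λ h t → All.lookup h (elems-complete t)) (λ h → All.tabulate (λ {t} _ → h t))
    (All.all? (λ t → eval e (at ℓ t) ≟ 𝟘) elems)

  roots⇒vanishesOn : ∀ e ℓ ts → Unique ts → (∀ {t} → t ∈ ts → eval e (at ℓ t) ≡ 𝟘) → deg e < length ts → VanishesOn e ℓ
  roots⇒vanishesOn e ℓ ts u h d t = trans (sym (ev-restrict ℓ e t))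
    (roots⇒vanishes (restrict ℓ e) ts u (λ {r} r∈ → trans (ev-restrict ℓ e r) (h r∈)) (ℕₚ.≤-trans (length-restrict ℓ e) d) t)

  vanishesOn-∂ : ∀ e ℓ → deg e < p → VanishesOn e ℓ → VanishesOn (∂ (dir ℓ) e) ℓ
  vanishesOn-∂ e ℓ d h t = trans (sym (ev-D-restrict ℓ e t))
    (vanishes-D (restrict ℓ e) (ℕₚ.≤-trans (length-restrict ℓ e) d) (λ s → trans (ev-restrict ℓ e s) (h s)) t)

  proportionalOn : ∀ P Q ℓ k → deg P ≤ k → deg Q ≤ k → 6 + (k + k) ≤ p →
    (∀ t → eval (∂ (dir ℓ) P) (at ℓ t) ⊗ eval Q (at ℓ t) ≡ eval P (at ℓ t) ⊗ eval (∂ (dir ℓ) Q) (at ℓ t)) →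
    ∀ t₀ → eval Q (at ℓ t₀) ≢ 𝟘 → ∀ t → eval P (at ℓ t) ⊗ eval Q (at ℓ t₀) ≡ eval P (at ℓ t₀) ⊗ eval Q (at ℓ t)
  proportionalOn P Q ℓ k dP dQ bound eq t₀ Q≢ t =
    subst₂ _≡_ (cong₂ _⊗_ (ev-restrict ℓ P t) (ev-restrict ℓ Q t₀)) (cong₂ _⊗_ (ev-restrict ℓ P t₀) (ev-restrict ℓ Q t))
      (wronskian≡𝟘⇒proportional (restrict ℓ Q) t₀ (λ q → Q≢ (trans (sym (ev-restrict ℓ Q t₀)) q)) (restrict ℓ P)
        (ℕₚ.≤-trans (ℕₚ.+-mono-≤ (ℕₚ.+-monoʳ-≤ 4 (ℕₚ.⊔-lub lP lQ)) lQ) (ℕₚ.≤-trans (ℕₚ.≤-reflexive (cong (5 +_) (ℕₚ.+-suc k k))) bound))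
        (λ s → trans (cong₂ _⊗_ (ev-D-restrict ℓ P s) (ev-restrict ℓ Q s))
          (trans (eq s) (sym (cong₂ _⊗_ (ev-restrict ℓ P s) (ev-D-restrict ℓ Q s))))) t)
    where
    lP : length (restrict ℓ P) ≤ suc k
    lP = ℕₚ.≤-trans (length-restrict ℓ P) (s≤s dP)
    lQ : length (restrict ℓ Q) ≤ suc k
    lQ = ℕₚ.≤-trans (length-restrict ℓ Q) (s≤s dQ)

  ∂^ : ℕ → Triple → Expr → Expr
  ∂^ zero    δ e = e
  ∂^ (suc j) δ e = ∂^ j δ (∂ δ e)

  ∂^-suc : ∀ j δ e → ∂^ (suc j) δ e ≡ ∂ δ (∂^ j δ e)
  ∂^-suc zero    δ e = refl
  ∂^-suc (suc j) δ e = ∂^-suc j δ (∂ δ e)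

  deg-∂^ : ∀ j δ e → deg (∂^ j δ e) ≤ deg e
  deg-∂^ zero    δ e = ℕₚ.≤-refl
  deg-∂^ (suc j) δ e = ℕₚ.≤-trans (deg-∂^ j δ (∂ δ e)) (deg-∂ δ e)

  -- Taylor expansion at t₀ without factorials: once the derivative along ℓ vanishes on ℓ, the
  -- function is proportional to the constant 1 there, hence equal to its value at t₀, which is
  -- zero.
  derivatives≡𝟘⇒vanishesOn : ∀ e ℓ t₀ → 6 + (deg e + deg e) ≤ p →
    (∀ j → j ≤ deg e → eval (∂^ j (dir ℓ) e) (at ℓ t₀) ≡ 𝟘) → VanishesOn e ℓ
  derivatives≡𝟘⇒vanishesOn e ℓ t₀ bound h = go (suc (deg e)) e (restrict ℓ e) (length-restrict ℓ e) (ev-restrict ℓ e)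
      (ℕₚ.≤-trans (s≤s (ℕₚ.≤-trans (ℕₚ.m≤n+m _ (5 + deg e)) ℕₚ.≤-refl)) bound) ℕₚ.≤-refl (λ j → h j ∘ ℕₚ.≤-pred)
    where
    -- The bound `deg` need not drop under ∂. A list L with the values of f on ℓ is carried along
    -- instead; each derivative shortens it by one.
    go : ∀ k f L → length L ≤ k → (∀ t → ev L t ≡ eval f (at ℓ t)) → k ≤ p → deg f ≤ deg e →
         (∀ j → j < k → eval (∂^ j (dir ℓ) f) (at ℓ t₀) ≡ 𝟘) → VanishesOn f ℓ
    go zero    f [] len eq k≤p d h t = sym (eq t)
    go (suc k) f L len eq k≤p d h t = begin
      eval f (at ℓ t)             ≡⟨ ⊗-𝟙 _ ⟨
      eval f (at ℓ t) ⊗ 𝟙         ≡⟨ proportionalOn f (const 𝟙) ℓ (deg e) d z≤n bound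
                                       (λ s → trans (cong (_⊗ 𝟙) (∂f≡𝟘 s)) (trans (⊗-zeroˡ 𝟙) (sym (⊗-zeroʳ _)))) t₀ 𝟙≢𝟘 t ⟩
      eval f (at ℓ t₀) ⊗ 𝟙        ≡⟨ ⊗-𝟙 _ ⟩
      eval f (at ℓ t₀)            ≡⟨ h 0 (s≤s z≤n) ⟩
      𝟘 ∎
      where
      open ≡-Reasoning
      ⊗-𝟙 : ∀ x → x ⊗ 𝟙 ≡ x
      ⊗-𝟙 = ⊗-identityʳ
      deg-small : suc (deg f) ≤ p
      deg-small = ℕₚ.≤-trans (s≤s d) (ℕₚ.≤-trans (s≤s (ℕₚ.m≤n+m _ (5 + deg e))) bound)
      ∂f≡𝟘 : VanishesOn (∂ (dir ℓ) f) ℓ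
      ∂f≡𝟘 = go k (∂ (dir ℓ) f) (D L) (length-D-≤ L len)
        (λ s → trans (D-ext L (restrict ℓ f) (ℕₚ.≤-trans len k≤p) (ℕₚ.≤-trans (length-restrict ℓ f) deg-small)
                 (λ r → trans (eq r) (sym (ev-restrict ℓ f r))) s) (ev-D-restrict ℓ f s))
        (ℕₚ.<⇒≤ k≤p) (ℕₚ.≤-trans (deg-∂ (dir ℓ) f) d) (λ j j<k → h (suc j) (s≤s j<k))

  -- Zeros of e on ℓ, counted through a list of objects lying over the points of ℓ.
  weighted-roots : ∀ {A : Set} {P : A → Set} (P? : Decidable P) (xs : List A) (key : A → F) e ℓ μ →
    (∀ v → (∑[ x ∈ xs ] ⟦ P? x ×-dec (key x ≟ v) ⟧) ≤ μ) → (∀ {x} → x ∈ xs → P x → eval e (at ℓ (key x)) ≡ 𝟘) →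
    ¬ VanishesOn e ℓ → (∑[ x ∈ xs ] ⟦ P? x ⟧) ≤ deg e * μ
  weighted-roots {P = P} P? xs key e ℓ μ mult root ¬van = begin
    (∑[ x ∈ xs ] ⟦ P? x ⟧)
      ≡⟨ ∑-cong xs (λ {x} x∈ → fibre x x∈) ⟩
    (∑[ x ∈ xs ] ∑[ v ∈ elems ] ⟦ root? v ⟧ * ⟦ P? x ×-dec (key x ≟ v) ⟧)
      ≡⟨ ∑-swap xs elems _ ⟩
    (∑[ v ∈ elems ] ∑[ x ∈ xs ] ⟦ root? v ⟧ * ⟦ P? x ×-dec (key x ≟ v) ⟧)
      ≡⟨ ∑-cong elems (λ {v} _ → ∑-*ˡ xs ⟦ root? v ⟧ _) ⟩
    (∑[ v ∈ elems ] ⟦ root? v ⟧ * (∑[ x ∈ xs ] ⟦ P? x ×-dec (key x ≟ v) ⟧))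
      ≤⟨ ∑-mono elems (λ {v} _ → ℕₚ.*-monoʳ-≤ ⟦ root? v ⟧ (mult v)) ⟩
    (∑[ v ∈ elems ] ⟦ root? v ⟧ * μ)
      ≡⟨ ∑-*ʳ elems μ _ ⟩
    (∑[ v ∈ elems ] ⟦ root? v ⟧) * μ
      ≤⟨ ℕₚ.*-monoˡ-≤ μ (count≤ root? (deg e) elems-unique (λ ys u sub → ℕₚ.≮⇒≥
           (λ lt → ¬van (roots⇒vanishesOn e ℓ ys u (λ t∈ → proj₂ (sub t∈)) lt)))) ⟩
    deg e * μ ∎
    where
    open ℕₚ.≤-Reasoning
    root? : ∀ v → Dec (eval e (at ℓ v) ≡ 𝟘)
    root? v = eval e (at ℓ v) ≟ 𝟘
    fibre : ∀ x → x ∈ xs → ⟦ P? x ⟧ ≡ (∑[ v ∈ elems ] ⟦ root? v ⟧ * ⟦ P? x ×-dec (key x ≟ v) ⟧)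
    fibre x x∈ with P? x
    ... | no ¬px = sym (trans (∑-cong elems (λ {v} _ → trans (cong (⟦ root? v ⟧ *_) (⟦⟧-no (no ¬px ×-dec (key x ≟ v)) (¬px ∘ proj₁))) (ℕₚ.*-zeroʳ ⟦ root? v ⟧))) (∑-zero elems))
    ... | yes px = sym (trans (∑-cong elems (λ {v} _ → trans (ℕₚ.*-comm ⟦ root? v ⟧ _)
            (cong (_* ⟦ root? v ⟧) (⟦⟧-cong (yes px ×-dec (key x ≟ v)) (key x ≟ v) proj₂ (px ,_)))))
          (trans (∑-pick _≟_ elems-unique (elems-complete (key x)) (λ v → ⟦ root? v ⟧)) (⟦⟧-yes (root? (key x)) (root x∈ px))))

  at-𝟘 : ∀ P δ → at (line P δ) 𝟘 ≡ P
  at-𝟘 (a , b , c) (a′ , b′ , c′) = cong₂ _,_ (lemma a a′) (cong₂ _,_ (lemma b b′) (lemma c c′))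
    where
    lemma : ∀ x y → x ⊕ 𝟘 ⊗ y ≡ x
    lemma x y = trans (cong (x ⊕_) (⊗-zeroˡ y)) (⊕-identityʳ x)

  -- Needed to differentiate an identity of values such as `∂-comm` once more. On the line through P
  -- in direction δ the difference is the zero function of degree below p, so its derivative
  -- vanishes too.
  ∂-ext : ∀ e e′ δ → deg e < p → deg e′ < p → (∀ P → eval e P ≡ eval e′ P) → ∀ P → eval (∂ δ e) P ≡ eval (∂ δ e′) P
  ∂-ext e e′ δ d d′ h P = ⊖≡𝟘⇒≡ (trans (sym (difference (∂ δ e) (∂ δ e′) P)) (trans (cong (eval (∂ δ e) P ⊕_) (sym (trans (cong (_⊕ (⊝ 𝟙) ⊗ eval (∂ δ e′) P) (⊗-zeroˡ _)) (⊕-identityˡ _))))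
      (subst (λ Q → eval (∂ δ (e ⊞ const (⊝ 𝟙) ⊠ e′)) Q ≡ 𝟘) (at-𝟘 P δ)
        (vanishesOn-∂ (e ⊞ const (⊝ 𝟙) ⊠ e′) (line P δ) (ℕₚ.≤-trans (s≤s (ℕₚ.≤-reflexive refl)) (ℕₚ.⊔-lub d d′))
          (λ t → trans (difference e e′ _) (≡⇒⊖≡𝟘 (h (at (line P δ) t)))) 𝟘))))
    where
    difference : ∀ e e′ Q → eval (e ⊞ const (⊝ 𝟙) ⊠ e′) Q ≡ eval e Q ⊖ eval e′ Q
    difference e e′ Q = trans (cong (λ z → eval e Q ⊕ (⊝ z) ⊗ eval e′ Q) (sym fromℤ-1))
      (solve 2 (λ u v → u :+ (:- con ℤ.1ℤ) :* v := u :- v) refl (eval e Q) (eval e′ Q))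

-- Linear algebra and interpolation: a polynomial vanishing at prescribed points

module Interpolation (𝔽 : Field) where
  open FieldTheory 𝔽
  open Univariate 𝔽 using (≢⇒⊖≢𝟘)
  open Trivariate 𝔽
  open import Algebra.Properties.Semiring.Sum (CommutativeRing.semiring ringF)
    using (sum; sum-remove; sum-cong-≗; sum-replicate-zero; *-distribˡ-sum; ∑-distrib-+)
  open import Data.Vec.Functional using (insertAt)
  import Data.Vec.Functional.Properties as Vecₚ
  open import Data.Fin using (punchIn; punchOut; remQuot; combine; toℕ)

  sum-zero : ∀ n {t : Fin n → F} → (∀ i → t i ≡ 𝟘) → sum t ≡ 𝟘
  sum-zero n h = trans (sum-cong-≗ h) (sum-replicate-zero n)

  sum-single : ∀ {n} (t : Fin n → F) i → (∀ j → j ≢ i → t j ≡ 𝟘) → sum t ≡ t i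
  sum-single {suc n} t i h = trans (sum-remove {i = i} t) (trans (cong (t i ⊕_)
    (sum-zero n (λ j → h (punchIn i j) (Finₚ.punchInᵢ≢i i j)))) (⊕-identityʳ _))

  module _ {n m : ℕ} (M : Fin (suc m) → Fin (suc n) → F) (i₀ : Fin (suc m)) (π≢𝟘 : M i₀ Fin.zero ≢ 𝟘) where
    private
      π : F
      π = M i₀ Fin.zero
      ratio : Fin m → F
      ratio i = M (punchIn i₀ i) Fin.zero ⊗ inv π

    reduced : Fin m → Fin n → F
    reduced i j = M (punchIn i₀ i) (Fin.suc j) ⊖ ratio i ⊗ M i₀ (Fin.suc j)

    module _ (c′ : Fin m → F) (h : ∀ j → sum (λ i → c′ i ⊗ reduced i j) ≡ 𝟘) where
      private
        s : F
        s = sum (λ i → c′ i ⊗ ratio i)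

        scale-s : ∀ x → s ⊗ x ≡ sum (λ i → c′ i ⊗ ratio i ⊗ x)
        scale-s x = trans (⊗-comm s x) (trans (*-distribˡ-sum x (λ i → c′ i ⊗ ratio i)) (sum-cong-≗ (λ i → ⊗-comm x (c′ i ⊗ ratio i))))

        absorb : ∀ x (t : Fin m → F) → (⊝ s) ⊗ x ⊕ sum t ≡ sum (λ i → t i ⊖ c′ i ⊗ ratio i ⊗ x)
        absorb x t = trans (cong ((⊝ s) ⊗ x ⊕_) split) (solve 3 (λ s x r → (:- s) :* x :+ (r :+ s :* x) := r) refl s x r)
          where
          r : F
          r = sum (λ i → t i ⊖ c′ i ⊗ ratio i ⊗ x)
          split : sum t ≡ r ⊕ s ⊗ x
          split = trans (sum-cong-≗ (λ i → solve 2 (λ a b → a := a :- b :+ b) refl (t i) (c′ i ⊗ ratio i ⊗ x)))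
            (trans (∑-distrib-+ (λ i → t i ⊖ c′ i ⊗ ratio i ⊗ x) (λ i → c′ i ⊗ ratio i ⊗ x)) (cong (r ⊕_) (sym (scale-s x))))

      -- The pivot row receives the coefficient -s with s = Σ c′ i ⊗ ratio i: this cancels the first
      -- column and undoes the elimination in the others.
      extended : Fin (suc m) → F
      extended = insertAt c′ i₀ (⊝ s)

      private
        expand : ∀ j → sum (λ i → extended i ⊗ M i j) ≡ (⊝ s) ⊗ M i₀ j ⊕ sum (λ i → c′ i ⊗ M (punchIn i₀ i) j)
        expand j = trans (sum-remove {i = i₀} (λ i → extended i ⊗ M i j)) (cong₂ _⊕_
          (cong (_⊗ M i₀ j) (Vecₚ.insertAt-lookup c′ i₀ (⊝ s)))
          (sum-cong-≗ (λ i → cong (_⊗ M (punchIn i₀ i) j) (Vecₚ.insertAt-punchIn c′ i₀ (⊝ s) i))))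

        cancel : ∀ c a → c ⊗ a ⊖ c ⊗ (a ⊗ inv π) ⊗ π ≡ 𝟘
        cancel c a = trans (cong (λ z → c ⊗ a ⊕ ⊝ z) (trans
          (solve 4 (λ c a v q → c :* (a :* v) :* q := c :* a :* (q :* v)) refl c a (inv π) π)
          (trans (cong (c ⊗ a ⊗_) (inverse π π≢𝟘)) (⊗-identityʳ (c ⊗ a))))) (⊖-self (c ⊗ a))

      extended-equations : ∀ j → sum (λ i → extended i ⊗ M i j) ≡ 𝟘
      extended-equations Fin.zero = trans (expand Fin.zero) (trans (absorb π (λ i → c′ i ⊗ M (punchIn i₀ i) Fin.zero))
        (sum-zero m (λ i → cancel (c′ i) (M (punchIn i₀ i) Fin.zero))))
      extended-equations (Fin.suc j) = trans (expand (Fin.suc j)) (trans (absorb (M i₀ (Fin.suc j)) (λ i → c′ i ⊗ M (punchIn i₀ i) (Fin.suc j)))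
        (trans (sum-cong-≗ (λ i → solve 4 (λ c a r b → c :* a :- c :* r :* b := c :* (a :- r :* b)) refl
          (c′ i) (M (punchIn i₀ i) (Fin.suc j)) (ratio i) (M i₀ (Fin.suc j)))) (h j)))

      extended-nonzero : (∃[ i ] c′ i ≢ 𝟘) → ∃[ i ] extended i ≢ 𝟘
      extended-nonzero (i , c′i≢𝟘) = punchIn i₀ i , λ q → c′i≢𝟘 (trans (sym (Vecₚ.insertAt-punchIn c′ i₀ (⊝ s) i)) q)

  -- Gaussian elimination column by column: a zero column is dropped, otherwise a row with nonzero
  -- first entry serves as pivot and is removed together with the column. Rows stay more numerous
  -- than columns.
  kernel : ∀ n m → n < m → (M : Fin m → Fin n → F) →
           Σ[ c ∈ (Fin m → F) ] (∃[ i ] c i ≢ 𝟘) × (∀ j → sum (λ i → c i ⊗ M i j) ≡ 𝟘)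
  kernel zero    (suc m) _   M = (λ _ → 𝟙) , (Fin.zero , 𝟙≢𝟘) , λ ()
  kernel (suc n) (suc m) (s≤s n<m) M with Finₚ.any? (λ i → ¬? (M i Fin.zero ≟ 𝟘))
  ... | no none = let (c , nz , h) = kernel n (suc m) (ℕₚ.m≤n⇒m≤1+n n<m) (λ i j → M i (Fin.suc j)) in
        c , nz , λ { Fin.zero → sum-zero (suc m) (λ i → trans (cong (c i ⊗_) (zero-column i)) (⊗-zeroʳ (c i))) ; (Fin.suc j) → h j }
    where
    zero-column : ∀ i → M i Fin.zero ≡ 𝟘
    zero-column i with M i Fin.zero ≟ 𝟘
    ... | yes q = q
    ... | no ¬q = contradiction (i , ¬q) none
  ... | yes (i₀ , π≢𝟘) = let (c , nz , h) = kernel n m n<m (reduced M i₀ π≢𝟘) in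
        extended M i₀ π≢𝟘 c h , extended-nonzero M i₀ π≢𝟘 c h nz , extended-equations M i₀ π≢𝟘 c h

  prodᴱ : ∀ n → (Fin n → Expr) → Expr
  prodᴱ zero    t = const 𝟙
  prodᴱ (suc n) t = t Fin.zero ⊠ prodᴱ n (t ∘ Fin.suc)

  sumᴱ : ∀ n → (Fin n → Expr) → Expr
  sumᴱ zero    t = const 𝟘
  sumᴱ (suc n) t = t Fin.zero ⊞ sumᴱ n (t ∘ Fin.suc)

  eval-sumᴱ : ∀ n t P → eval (sumᴱ n t) P ≡ sum (λ i → eval (t i) P)
  eval-sumᴱ zero    t P = refl
  eval-sumᴱ (suc n) t P = cong (eval (t Fin.zero) P ⊕_) (eval-sumᴱ n (t ∘ Fin.suc) P)

  deg-sumᴱ : ∀ n t {k} → (∀ i → deg (t i) ≤ k) → deg (sumᴱ n t) ≤ k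
  deg-sumᴱ zero    t h = z≤n
  deg-sumᴱ (suc n) t h = ℕₚ.⊔-lub (h Fin.zero) (deg-sumᴱ n (t ∘ Fin.suc) (h ∘ Fin.suc))

  deg-prodᴱ : ∀ n t → (∀ i → deg (t i) ≤ 1) → deg (prodᴱ n t) ≤ n
  deg-prodᴱ zero    t h = z≤n
  deg-prodᴱ (suc n) t h = ℕₚ.+-mono-≤ (h Fin.zero) (deg-prodᴱ n (t ∘ Fin.suc) (h ∘ Fin.suc))

  eval-prodᴱ-zero : ∀ n t P i → eval (t i) P ≡ 𝟘 → eval (prodᴱ n t) P ≡ 𝟘
  eval-prodᴱ-zero (suc n) t P Fin.zero    h = trans (cong (_⊗ eval (prodᴱ n (t ∘ Fin.suc)) P) h) (⊗-zeroˡ _)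
  eval-prodᴱ-zero (suc n) t P (Fin.suc i) h = trans (cong (eval (t Fin.zero) P ⊗_) (eval-prodᴱ-zero n (t ∘ Fin.suc) P i h)) (⊗-zeroʳ _)

  eval-prodᴱ-nonzero : ∀ n t P → (∀ i → eval (t i) P ≢ 𝟘) → eval (prodᴱ n t) P ≢ 𝟘
  eval-prodᴱ-nonzero zero    t P h = 𝟙≢𝟘
  eval-prodᴱ-nonzero (suc n) t P h = ⊗≢𝟘 (h Fin.zero) (eval-prodᴱ-nonzero n (t ∘ Fin.suc) P (h ∘ Fin.suc))

  node : ∀ {n} → Fin n → F
  node i = fromℤ (ℤ.+ toℕ i)

  fromℤ-injective-< : ∀ a b → a < b → b < p → fromℤ (ℤ.+ a) ≢ fromℤ (ℤ.+ b)
  fromℤ-injective-< a b lt b<p q with ℕₚ.m≤n⇒∃[o]m+o≡n lt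
  ... | o , refl = char (suc o) (s≤s z≤n) (ℕₚ.≤-<-trans (ℕₚ.≤-trans (ℕₚ.m≤n+m (suc o) a) (ℕₚ.≤-reflexive (ℕₚ.+-suc a o))) b<p)
    (trans (sym (solve 2 (λ x y → x :+ y :- x := y) refl (fromℤ (ℤ.+ a)) (fromℤ (ℤ.+ suc o))))
      (trans (cong (_⊖ fromℤ (ℤ.+ a)) (trans (sym (fromℤ-+ (ℤ.+ a) (ℤ.+ suc o))) (trans (cong (λ z → fromℤ (ℤ.+ z)) (ℕₚ.+-suc a o)) (sym q)))) (⊖-self _)))

  node-injective : ∀ {n} → n ≤ p → (i j : Fin n) → node i ≡ node j → i ≡ j
  node-injective n≤p i j q with ℕₚ.<-cmp (toℕ i) (toℕ j)
  ... | tri≈ _ e _ = Finₚ.toℕ-injective e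
  ... | tri< lt _ _ = ⊥-elim (fromℤ-injective-< (toℕ i) (toℕ j) lt (ℕₚ.≤-trans (Finₚ.toℕ<n j) n≤p) q)
  ... | tri> _ _ gt = ⊥-elim (fromℤ-injective-< (toℕ j) (toℕ i) gt (ℕₚ.≤-trans (Finₚ.toℕ<n i) n≤p) (sym q))

  lagrange : ∀ {n} → Expr → Fin (suc n) → Expr
  lagrange {n} X i = prodᴱ n (λ j → X ⊞ const (⊝ node (punchIn i j)))

  eval-lagrange-≡ : ∀ {n} → suc n ≤ p → ∀ X (i : Fin (suc n)) P → eval X P ≡ node i → eval (lagrange X i) P ≢ 𝟘
  eval-lagrange-≡ {n} n<p X i P h = eval-prodᴱ-nonzero n _ P (λ j q → Finₚ.punchInᵢ≢i i j
    (sym (node-injective n<p i (punchIn i j) (trans (sym h) (⊖≡𝟘⇒≡ q)))))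

  eval-lagrange-≢ : ∀ {n} X (i k : Fin (suc n)) P → eval X P ≡ node k → i ≢ k → eval (lagrange X i) P ≡ 𝟘
  eval-lagrange-≢ {n} X i k P h i≢k = eval-prodᴱ-zero n _ P (punchOut i≢k)
    (≡⇒⊖≡𝟘 (trans h (cong node (sym (Finₚ.punchIn-punchOut i≢k)))))

  deg-lagrange : ∀ {n} X (i : Fin (suc n)) → deg X ≤ 1 → deg (lagrange X i) ≤ n
  deg-lagrange {n} X i h = deg-prodᴱ n _ (λ j → ℕₚ.⊔-lub h z≤n)

  module _ (d N : ℕ) (d<p : suc d ≤ p) (index : Fin N → Fin (suc d) × Fin (suc d) × Fin (suc d))
           (index-injective : ∀ i j → index i ≡ index j → i ≡ j) where
    private
      basis : Fin (suc d) × Fin (suc d) × Fin (suc d) → Expr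
      basis (i , j , k) = lagrange U i ⊠ (lagrange V j ⊠ lagrange Y k)

      gridPoint : Fin (suc d) × Fin (suc d) × Fin (suc d) → Triple
      gridPoint (i , j , k) = node i , node j , node k

      deg-basis : ∀ t → deg (basis t) ≤ d + (d + d)
      deg-basis (i , j , k) = ℕₚ.+-mono-≤ (deg-lagrange U i ℕₚ.≤-refl) (ℕₚ.+-mono-≤ (deg-lagrange V j ℕₚ.≤-refl) (deg-lagrange Y k ℕₚ.≤-refl))

      basis-≢𝟘 : ∀ t → eval (basis t) (gridPoint t) ≢ 𝟘
      basis-≢𝟘 t@(i , j , k) = ⊗≢𝟘 (eval-lagrange-≡ d<p U i (gridPoint t) refl)
        (⊗≢𝟘 (eval-lagrange-≡ d<p V j (gridPoint t) refl) (eval-lagrange-≡ d<p Y k (gridPoint t) refl))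

      basis-≡𝟘 : ∀ t t′ → t ≢ t′ → eval (basis t) (gridPoint t′) ≡ 𝟘
      basis-≡𝟘 (i , j , k) t′@(i′ , j′ , k′) t≢ with i Fin.≟ i′ | j Fin.≟ j′ | k Fin.≟ k′
      ... | yes refl | yes refl | yes refl = contradiction refl t≢
      ... | no a | _ | _ = trans (cong (_⊗ eval (lagrange V j ⊠ lagrange Y k) (gridPoint t′)) (eval-lagrange-≢ U i i′ (gridPoint t′) refl a)) (⊗-zeroˡ _)
      ... | yes _ | no b | _ = trans (cong (λ z → eval (lagrange U i) (gridPoint t′) ⊗ (z ⊗ eval (lagrange Y k) (gridPoint t′)))
              (eval-lagrange-≢ V j j′ (gridPoint t′) refl b))
            (trans (cong (eval (lagrange U i) (gridPoint t′) ⊗_) (⊗-zeroˡ _)) (⊗-zeroʳ _))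
      ... | yes _ | yes _ | no e = trans (cong (λ z → eval (lagrange U i) (gridPoint t′) ⊗ (eval (lagrange V j) (gridPoint t′) ⊗ z))
              (eval-lagrange-≢ Y k k′ (gridPoint t′) refl e))
            (trans (cong (eval (lagrange U i) (gridPoint t′) ⊗_) (⊗-zeroʳ _)) (⊗-zeroʳ _))

    -- The basis consists of products of Lagrange polynomials at the grid {0, ..., d}³, each of
    -- degree at most 3d, and there are fewer conditions than coefficients. A coefficient is, up to
    -- a nonzero factor, the value at its grid point. This yields a point where f is nonzero, which
    -- is stronger than a nonzero formal polynomial.
    interpolate : ∀ (Ps : List Triple) → length Ps < N →
      ∃[ f ] deg f ≤ d + (d + d) × (∀ {P} → P ∈ Ps → eval f P ≡ 𝟘) × (∃[ P ] eval f P ≢ 𝟘)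
    interpolate Ps few = from-kernel (kernel (length Ps) N few (λ i j → eval (basis (index i)) (List.lookup Ps j)))
      where
      lookup-index : ∀ {P Ps} (P∈ : P ∈ Ps) → P ≡ List.lookup Ps (Any.index P∈)
      lookup-index (here refl) = refl
      lookup-index (there P∈)  = lookup-index P∈
      from-kernel : Σ[ c ∈ (Fin N → F) ] (∃[ i ] c i ≢ 𝟘) × (∀ j → sum (λ i → c i ⊗ eval (basis (index i)) (List.lookup Ps j)) ≡ 𝟘) →
        ∃[ f ] deg f ≤ d + (d + d) × (∀ {P} → P ∈ Ps → eval f P ≡ 𝟘) × (∃[ P ] eval f P ≢ 𝟘)
      from-kernel (c , (i₁ , c≢𝟘) , eqs) = sumᴱ N term , deg-sumᴱ N term (λ i → deg-basis (index i)) ,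
          (λ {P} P∈ → trans (eval-sumᴱ N term P) (subst (λ Q → sum (λ i → c i ⊗ eval (basis (index i)) Q) ≡ 𝟘) (sym (lookup-index P∈)) (eqs (Any.index P∈)))) ,
          gridPoint (index i₁) ,
          λ q → ⊗≢𝟘 c≢𝟘 (basis-≢𝟘 (index i₁)) (trans (sym (trans (eval-sumᴱ N term (gridPoint (index i₁)))
            (sum-single (λ i → eval (term i) (gridPoint (index i₁))) i₁ (λ i i≢ → trans (cong (c i ⊗_) (basis-≡𝟘 (index i) (index i₁) (i≢ ∘ index-injective i i₁))) (⊗-zeroʳ _))))) q)
        where
        term : Fin N → Expr
        term i = const (c i) ⊠ basis (index i)

  interpolation : ∀ d (Ps : List Triple) → suc d ≤ p → length Ps < suc d * (suc d * suc d) →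
    ∃[ f ] deg f ≤ d + (d + d) × (∀ {P} → P ∈ Ps → eval f P ≡ 𝟘) × (∃[ P ] eval f P ≢ 𝟘)
  interpolation d Ps d<p few = interpolate d (suc d * (suc d * suc d)) d<p index index-injective Ps few
    where
    index : Fin (suc d * (suc d * suc d)) → Fin (suc d) × Fin (suc d) × Fin (suc d)
    index i = proj₁ (remQuot {suc d} (suc d * suc d) i) , remQuot {suc d} (suc d) (proj₂ (remQuot {suc d} (suc d * suc d) i))
    recombine : ∀ i → combine (proj₁ (index i)) (uncurry combine (proj₂ (index i))) ≡ i
    recombine i = trans (cong (combine (proj₁ (index i))) (Finₚ.combine-remQuot {suc d} (suc d) (proj₂ (remQuot {suc d} (suc d * suc d) i))))
      (Finₚ.combine-remQuot {suc d} (suc d * suc d) i)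
    index-injective : ∀ i j → index i ≡ index j → i ≡ j
    index-injective i j q = trans (sym (recombine i)) (trans (cong (λ t → combine (proj₁ t) (uncurry combine (proj₂ t))) q) (recombine j))

-- Red and blue lines, and the inflections of slices of a surface

module RedBlue (𝔽 : Field) where
  open Counting
  open FieldTheory 𝔽
  open Trivariate 𝔽
  open Interpolation 𝔽 using (interpolation)

  first-failure : {P : ℕ → Set} → (∀ j → Dec (P j)) → ∀ n → ∃[ o ] o ≤ n × (∀ j → j < o → P j) × (o < n → ¬ P o)
  first-failure P? zero    = 0 , z≤n , (λ _ ()) , λ ()
  first-failure P? (suc n) with first-failure P? n
  ... | o , o≤n , below , fails with o ℕ.<? n
  ...   | yes o<n = o , ℕₚ.m≤n⇒m≤1+n o≤n , below , λ _ → fails o<n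
  ...   | no ¬o<n with ℕₚ.≤-antisym o≤n (ℕₚ.≮⇒≥ ¬o<n)
  ...     | refl with P? o
  ...       | yes q = suc o , ℕₚ.≤-refl , (λ j j<o → [ below j , (λ { refl → q }) ]′ (ℕₚ.m≤n⇒m<n∨m≡n (ℕₚ.≤-pred j<o))) , λ lt → contradiction lt (ℕₚ.n≮n (suc o))
  ...       | no ¬q = o , ℕₚ.n≤1+n o , below , λ _ → ¬q

  v̂ ŷ : Triple
  v̂ = 𝟘 , 𝟙 , 𝟘
  ŷ = 𝟘 , 𝟘 , 𝟙

  module _ {Fr : Set} (A m C : Fr → F) where

    -- On a red line v = m r is constant, on a blue one u = m s is. The two can meet only over (u ,
    -- v) = (m s , m r), and do so exactly when `Incident r s` holds.
    red blue : Fr → Line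
    red  r = line (𝟘 , m r , ⊝ C r) (𝟙 , 𝟘 , A r)
    blue s = line (m s , 𝟘 , ⊝ C s) (𝟘 , 𝟙 , A s)

    Incident : Fr → Fr → Set
    Incident r s = A r ⊗ m s ⊖ C r ≡ A s ⊗ m r ⊖ C s

    meet : ∀ {r s} → Incident r s → at (red r) (m s) ≡ at (blue s) (m r)
    meet {r} {s} h = cong₂ _,_ (trans (cong₂ _⊕_ refl (⊗-identityʳ (m s))) (trans (⊕-identityˡ _) (sym (trans (cong (m s ⊕_) (⊗-zeroʳ (m r))) (⊕-identityʳ _)))))
      (cong₂ _,_ (trans (cong (m r ⊕_) (⊗-zeroʳ (m s))) (trans (⊕-identityʳ _) (sym (trans (⊕-identityˡ _) (⊗-identityʳ (m r))))))
        (trans (solve 3 (λ c m a → :- c :+ m :* a := a :* m :- c) refl (C r) (m s) (A r)) (trans h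
          (solve 3 (λ c m a → a :* m :- c := :- c :+ m :* a) refl (C s) (m r) (A s)))))

  -- Calculus at a point P of the surface g = 0, where X = ∂(1,0,α), g_y = ∂ŷ g and g_v = ∂v̂ g.
  module Jets (g : Expr) (deg-g : deg g < p) (α : F) where
    X : Expr → Expr
    X = ∂ (𝟙 , 𝟘 , α)

    gy gv : Expr
    gy = ∂ ŷ g
    gv = ∂ v̂ g

    -- Second derivative of y along the slices v = const of the surface, cleared of denominators.
    inflection : Expr
    inflection = gy ⊠ gy ⊠ X (X g) ⊞ const (⊝ two) ⊠ gy ⊠ X g ⊠ X gy ⊞ X g ⊠ X g ⊠ ∂ ŷ gy

    -- Numerator of the second derivative of g_v / g_y in the direction X.
    bending : Expr
    bending = gy ⊠ gy ⊠ X (X gv) ⊞ const (⊝ 𝟙) ⊠ gy ⊠ gv ⊠ X (X gy) ⊞ const (⊝ two) ⊠ gy ⊠ X gy ⊠ X gv ⊞ const two ⊠ gv ⊠ X gy ⊠ X gy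

    triple-eq : ∀ {a b c a′ b′ c′ : F} → a ≡ a′ → b ≡ b′ → c ≡ c′ → (a , b , c) ≡ (a′ , b′ , c′)
    triple-eq refl refl refl = refl

    shear : ∀ α′ → (𝟙 , 𝟘 , α) ≡ (𝟙 , 𝟘 , α′) +ᵀ (α ⊖ α′) ·ᵀ ŷ
    shear α′ = triple-eq (sym (trans (cong (𝟙 ⊕_) (⊗-zeroʳ _)) (⊕-identityʳ _))) (sym (trans (⊕-identityˡ _) (⊗-zeroʳ _)))
      (trans (solve 2 (λ a b → a := b :+ (a :- b)) refl α α′) (cong (α′ ⊕_) (sym (⊗-identityʳ _))))

    X-shear : ∀ α′ e P → eval (X e) P ≡ eval (∂ (𝟙 , 𝟘 , α′) e) P ⊕ (α ⊖ α′) ⊗ eval (∂ ŷ e) P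
    X-shear α′ e P = trans (cong (λ δ → eval (∂ δ e) P) (shear α′)) (∂-linear (𝟙 , 𝟘 , α′) (α ⊖ α′) ŷ e P)

    W-shear : ∀ a e P → eval (∂ (𝟘 , 𝟙 , a) e) P ≡ eval (∂ v̂ e) P ⊕ a ⊗ eval (∂ ŷ e) P
    W-shear a e P = trans (cong (λ δ → eval (∂ δ e) P) (triple-eq (sym (trans (⊕-identityˡ _) (⊗-zeroʳ _)))
      (sym (trans (cong (𝟙 ⊕_) (⊗-zeroʳ _)) (⊕-identityʳ _))) (sym (trans (⊕-identityˡ _) (⊗-identityʳ _))))) (∂-linear v̂ a ŷ e P)

    -- The value of `inflection` does not depend on α, because y ↦ y - α u leaves the second
    -- derivative of y along a slice unchanged. So two vanishing derivatives in any other red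
    -- direction α′ suffice.
    inflection≡𝟘 : ∀ α′ P → eval (∂ (𝟙 , 𝟘 , α′) g) P ≡ 𝟘 → eval (∂ (𝟙 , 𝟘 , α′) (∂ (𝟙 , 𝟘 , α′) g)) P ≡ 𝟘 →
                   eval inflection P ≡ 𝟘
    inflection≡𝟘 α′ P h₁ h₂ = trans
      (cong₂ (λ u w → b ⊗ b ⊗ w ⊕ (⊝ two) ⊗ b ⊗ u ⊗ eval (X gy) P ⊕ u ⊗ u ⊗ c) Xg XXg)
      (trans (cong (λ z → b ⊗ b ⊗ (k ⊗ a ⊕ k ⊗ (a ⊕ k ⊗ c)) ⊕ (⊝ two) ⊗ b ⊗ (k ⊗ b) ⊗ z ⊕ k ⊗ b ⊗ (k ⊗ b) ⊗ c) Xgy)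
        (trans (solve 4 (λ b k a c → b :* b :* (k :* a :+ k :* (a :+ k :* c)) :+ (:- con (ℤ.+ 2)) :* b :* (k :* b) :* (a :+ k :* c) :+ k :* b :* (k :* b) :* c
                   := con ℤ.0ℤ) refl b k a c) fromℤ-0))
      where
      X′ : Expr → Expr
      X′ = ∂ (𝟙 , 𝟘 , α′)
      b k a c : F
      b = eval gy P
      k = α ⊖ α′
      a = eval (X′ gy) P
      c = eval (∂ ŷ gy) P
      Xgy : eval (X gy) P ≡ a ⊕ k ⊗ c
      Xgy = X-shear α′ gy P
      Xg : eval (X g) P ≡ k ⊗ b
      Xg = trans (X-shear α′ g P) (trans (cong (_⊕ k ⊗ b) h₁) (⊕-identityˡ _))
      X′Xg : eval (X′ (X g)) P ≡ k ⊗ a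
      X′Xg = trans (∂-comm (𝟙 , 𝟘 , α′) (𝟙 , 𝟘 , α) g P) (trans (X-shear α′ (X′ g) P)
        (trans (cong₂ (λ u v → u ⊕ k ⊗ v) h₂ (∂-comm ŷ (𝟙 , 𝟘 , α′) g P)) (⊕-identityˡ _)))
      XXg : eval (X (X g)) P ≡ k ⊗ a ⊕ k ⊗ (a ⊕ k ⊗ c)
      XXg = trans (X-shear α′ (X g) P) (cong₂ (λ u v → u ⊕ k ⊗ v) X′Xg (trans (∂-comm ŷ (𝟙 , 𝟘 , α) g P) Xgy))

    -- Differentiating the inflection polynomial along a blue line of slope a yields the bending of the red one.
    bending≡𝟘 : ∀ a P → eval (X g) P ≡ 𝟘 → eval (X (X g)) P ≡ 𝟘 → eval (∂ (𝟘 , 𝟙 , a) g) P ≡ 𝟘 →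
                eval (∂ (𝟘 , 𝟙 , a) inflection) P ≡ 𝟘 → eval bending P ≡ 𝟘
    bending≡𝟘 a P Xg XXg Wg WP = trans (trans
        (cong (λ z → b ⊗ b ⊗ xxc ⊕ (⊝ z) ⊗ b ⊗ c ⊗ xxb ⊕ (⊝ two) ⊗ b ⊗ xb ⊗ xc ⊕ two ⊗ c ⊗ xb ⊗ xb) (sym fromℤ-1))
        (trans (cong (λ c → b ⊗ b ⊗ xxc ⊕ (⊝ fromℤ ℤ.1ℤ) ⊗ b ⊗ c ⊗ xxb ⊕ (⊝ two) ⊗ b ⊗ xb ⊗ xc ⊕ two ⊗ c ⊗ xb ⊗ xb) c≡)
          (solve 6 (λ b a xxc xxb xb xc →
               b :* b :* xxc :+ (:- con ℤ.1ℤ) :* b :* (:- (a :* b)) :* xxb :+ (:- con (ℤ.+ 2)) :* b :* xb :* xc :+ con (ℤ.+ 2) :* (:- (a :* b)) :* xb :* xb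
               := b :* b :* (xxc :+ a :* xxb) :+ (:- con (ℤ.+ 2)) :* b :* (xc :+ a :* xb) :* xb)
             refl b a xxc xxb xb xc)))
      (trans (sym expanded) WP)
      where
      W : Expr → Expr
      W = ∂ (𝟘 , 𝟙 , a)
      b c xb xc xxb xxc wb wxb gyy wgyy : F
      b = eval gy P
      c = eval gv P
      xb = eval (X gy) P
      xc = eval (X gv) P
      xxb = eval (X (X gy)) P
      xxc = eval (X (X gv)) P
      wb = eval (W gy) P
      wxb = eval (W (X gy)) P
      gyy = eval (∂ ŷ gy) P
      wgyy = eval (W (∂ ŷ gy)) P
      c≡ : c ≡ ⊝ (a ⊗ b)
      c≡ = ⊖≡𝟘⇒≡ (trans (solve 3 (λ c a b → c :- (:- (a :* b)) := c :+ a :* b) refl c a b) (trans (sym (W-shear a g P)) Wg))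
      WXg : eval (W (X g)) P ≡ xc ⊕ a ⊗ xb
      WXg = trans (W-shear a (X g) P) (cong₂ (λ u v → u ⊕ a ⊗ v) (∂-comm v̂ (𝟙 , 𝟘 , α) g P) (∂-comm ŷ (𝟙 , 𝟘 , α) g P))
      small : ∀ δ δ′ → deg (∂ δ (∂ δ′ g)) < p
      small δ δ′ = ℕₚ.≤-<-trans (ℕₚ.≤-trans (deg-∂ δ (∂ δ′ g)) (deg-∂ δ′ g)) deg-g
      swapX : ∀ δ → eval (∂ δ (X (X g))) P ≡ eval (X (X (∂ δ g))) P
      swapX δ = trans (∂-comm δ (𝟙 , 𝟘 , α) (X g) P)
        (∂-ext (∂ δ (X g)) (X (∂ δ g)) (𝟙 , 𝟘 , α) (small δ (𝟙 , 𝟘 , α)) (small (𝟙 , 𝟘 , α) δ) (∂-comm δ (𝟙 , 𝟘 , α) g) P)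
      WXXg : eval (W (X (X g))) P ≡ xxc ⊕ a ⊗ xxb
      WXXg = trans (W-shear a (X (X g)) P) (cong₂ (λ u v → u ⊕ a ⊗ v) (swapX v̂) (swapX ŷ))
      -- Every term has a factor `X g` or `X (X g)`, zero at P. Only the parts where W falls on this
      -- factor survive, and the term with the square of `X g` disappears altogether.
      expanded : eval (W inflection) P ≡ b ⊗ b ⊗ (xxc ⊕ a ⊗ xxb) ⊕ (⊝ two) ⊗ b ⊗ (xc ⊕ a ⊗ xb) ⊗ xb
      expanded = trans (cong₂ (λ u w → ((wb ⊗ b ⊕ b ⊗ wb) ⊗ w ⊕ b ⊗ b ⊗ eval (W (X (X g))) P)
            ⊕ ((((𝟘 ⊗ b ⊕ (⊝ two) ⊗ wb) ⊗ u ⊕ (⊝ two) ⊗ b ⊗ eval (W (X g)) P) ⊗ xb) ⊕ (⊝ two) ⊗ b ⊗ u ⊗ wxb)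
            ⊕ ((eval (W (X g)) P ⊗ u ⊕ u ⊗ eval (W (X g)) P) ⊗ gyy ⊕ u ⊗ u ⊗ wgyy)) (trans Xg (sym fromℤ-0)) (trans XXg (sym fromℤ-0)))
        (trans (cong₂ (λ x y → ((wb ⊗ b ⊕ b ⊗ wb) ⊗ fromℤ ℤ.0ℤ ⊕ b ⊗ b ⊗ y)
            ⊕ ((((𝟘 ⊗ b ⊕ (⊝ two) ⊗ wb) ⊗ fromℤ ℤ.0ℤ ⊕ (⊝ two) ⊗ b ⊗ x) ⊗ xb) ⊕ (⊝ two) ⊗ b ⊗ fromℤ ℤ.0ℤ ⊗ wxb)
            ⊕ ((x ⊗ fromℤ ℤ.0ℤ ⊕ fromℤ ℤ.0ℤ ⊗ x) ⊗ gyy ⊕ fromℤ ℤ.0ℤ ⊗ fromℤ ℤ.0ℤ ⊗ wgyy)) WXg WXXg)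
          (solve 9 (λ wb b y x xb wxb gyy wgyy o → ((wb :* b :+ b :* wb) :* con ℤ.0ℤ :+ b :* b :* y)
            :+ ((((o :* b :+ (:- con (ℤ.+ 2)) :* wb) :* con ℤ.0ℤ :+ (:- con (ℤ.+ 2)) :* b :* x) :* xb) :+ (:- con (ℤ.+ 2)) :* b :* con ℤ.0ℤ :* wxb)
            :+ ((x :* con ℤ.0ℤ :+ con ℤ.0ℤ :* x) :* gyy :+ con ℤ.0ℤ :* con ℤ.0ℤ :* wgyy)
            := b :* b :* y :+ (:- con (ℤ.+ 2)) :* b :* x :* xb) refl wb b (xxc ⊕ a ⊗ xxb) (xc ⊕ a ⊗ xb) xb wxb gyy wgyy 𝟘))

    deg-∂∂ : ∀ δ δ′ → deg (∂ δ (∂ δ′ g)) ≤ deg g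
    deg-∂∂ δ δ′ = ℕₚ.≤-trans (deg-∂ δ (∂ δ′ g)) (deg-∂ δ′ g)

    deg-∂∂∂ : ∀ δ δ′ δ″ → deg (∂ δ (∂ δ′ (∂ δ″ g))) ≤ deg g
    deg-∂∂∂ δ δ′ δ″ = ℕₚ.≤-trans (deg-∂ δ (∂ δ′ (∂ δ″ g))) (deg-∂∂ δ′ δ″)

    deg-inflection : ∀ {D} → deg g ≤ D → deg inflection ≤ D + D + D
    deg-inflection h = ℕₚ.⊔-lub (ℕₚ.⊔-lub
      (ℕₚ.+-mono-≤ (ℕₚ.+-mono-≤ (le (deg-∂ ŷ g)) (le (deg-∂ ŷ g))) (le (deg-∂∂ _ _)))
      (ℕₚ.+-mono-≤ (ℕₚ.+-mono-≤ (le (deg-∂ ŷ g)) (le (deg-∂ _ g))) (le (deg-∂∂ _ _))))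
      (ℕₚ.+-mono-≤ (ℕₚ.+-mono-≤ (le (deg-∂ _ g)) (le (deg-∂ _ g))) (le (deg-∂∂ _ _)))
      where
      le : ∀ {n} → n ≤ deg g → n ≤ _
      le q = ℕₚ.≤-trans q h

    deg-bending : ∀ {D} → deg g ≤ D → deg bending ≤ D + D + D
    deg-bending h = ℕₚ.⊔-lub (ℕₚ.⊔-lub (ℕₚ.⊔-lub
      (ℕₚ.+-mono-≤ (ℕₚ.+-mono-≤ (le (deg-∂ ŷ g)) (le (deg-∂ ŷ g))) (le (deg-∂∂∂ _ _ _)))
      (ℕₚ.+-mono-≤ (ℕₚ.+-mono-≤ (le (deg-∂ ŷ g)) (le (deg-∂ v̂ g))) (le (deg-∂∂∂ _ _ _))))
      (ℕₚ.+-mono-≤ (ℕₚ.+-mono-≤ (le (deg-∂ ŷ g)) (le (deg-∂∂ _ _))) (le (deg-∂∂ _ _))))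
      (ℕₚ.+-mono-≤ (ℕₚ.+-mono-≤ (le (deg-∂ v̂ g)) (le (deg-∂∂ _ _))) (le (deg-∂∂ _ _)))
      where
      le : ∀ {n} → n ≤ deg g → n ≤ _
      le q = ℕₚ.≤-trans q h

    -- The bending of g_v / g_y along a red line is g_y⁻³ times its second derivative.
    linear-slope : ∀ {D} v c → deg g ≤ D → 8 + (D + D + (D + D)) ≤ p → let ℓ = line (𝟘 , v , c) (𝟙 , 𝟘 , α) in
      VanishesOn bending ℓ → ∀ t₀ → eval gy (at ℓ t₀) ≢ 𝟘 →
      ∃[ γ ] ∃[ δ ] ∀ t → eval gv (at ℓ t) ≡ (γ ⊗ t ⊕ δ) ⊗ eval gy (at ℓ t)
    linear-slope {D} v c dg bound van t₀ gy≢ = γ , δ , slope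
      where
      ℓ : Line
      ℓ = line (𝟘 , v , c) (𝟙 , 𝟘 , α)
      w b² : Expr
      w = X gv ⊠ gy ⊞ const (⊝ 𝟙) ⊠ gv ⊠ X gy
      b² = gy ⊠ gy
      k : ℕ
      k = suc (D + D)
      bound′ : 6 + (k + k) ≤ p
      bound′ = ℕₚ.≤-trans (ℕₚ.≤-reflexive (cong (7 +_) (ℕₚ.+-suc (D + D) (D + D)))) bound
      le : ∀ {n} → n ≤ deg g → n ≤ D
      le q = ℕₚ.≤-trans q dg
      B B₀ : F → F
      B t = eval gy (at ℓ t)
      B₀ t = eval gv (at ℓ t)
      bb : B t₀ ⊗ B t₀ ≢ 𝟘
      bb = ⊗≢𝟘 gy≢ gy≢
      γ δ : F
      γ = eval w (at ℓ t₀) ⊗ inv (B t₀ ⊗ B t₀)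
      Q : Expr
      Q = gv ⊞ const (⊝ γ) ⊠ U ⊠ gy
      δ = eval Q (at ℓ t₀) ⊗ inv (B t₀)
      divide : ∀ {x y z u} → y ≢ 𝟘 → x ⊗ y ≡ z ⊗ u → x ≡ z ⊗ inv y ⊗ u
      divide {x} {y} {z} {u} y≢ h = ⊗-cancelˡ y≢ (trans (⊗-comm y x) (trans h (trans (sym (⊗-identityˡ (z ⊗ u)))
        (trans (cong (_⊗ (z ⊗ u)) (sym (inverse y y≢))) (solve 4 (λ y i z u → y :* i :* (z :* u) := y :* (z :* i :* u)) refl y (inv y) z u)))))
      -- First integration: w / g_y² is the derivative of g_v / g_y, and the vanishing of `bending`
      -- makes its own derivative zero.
      w≡ : ∀ t → eval w (at ℓ t) ≡ γ ⊗ (B t ⊗ B t)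
      w≡ t = divide bb (proportionalOn w b² ℓ k
        (ℕₚ.≤-trans (ℕₚ.⊔-lub (ℕₚ.+-mono-≤ (le (deg-∂∂ _ _)) (le (deg-∂ ŷ g))) (ℕₚ.+-mono-≤ (le (deg-∂ v̂ g)) (le (deg-∂∂ _ _)))) (ℕₚ.n≤1+n _))
        (ℕₚ.≤-trans (ℕₚ.+-mono-≤ (le (deg-∂ ŷ g)) (le (deg-∂ ŷ g))) (ℕₚ.n≤1+n _)) bound′ eq t₀ bb t)
        where
        eq : ∀ t → eval (X w) (at ℓ t) ⊗ eval b² (at ℓ t) ≡ eval w (at ℓ t) ⊗ eval (X b²) (at ℓ t)
        eq t = trans (cong (λ z → (xxc ⊗ b ⊕ xc ⊗ xb ⊕ ((z ⊗ c′ ⊕ (⊝ 𝟙) ⊗ xc) ⊗ xb ⊕ (⊝ 𝟙) ⊗ c′ ⊗ xxb)) ⊗ (b ⊗ b)) (sym fromℤ-0))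
          (trans (cong (λ z → (xxc ⊗ b ⊕ xc ⊗ xb ⊕ ((fromℤ ℤ.0ℤ ⊗ c′ ⊕ (⊝ z) ⊗ xc) ⊗ xb ⊕ (⊝ z) ⊗ c′ ⊗ xxb)) ⊗ (b ⊗ b)) (sym fromℤ-1))
          (trans (solve 6 (λ b c′ xb xc xxb xxc → (xxc :* b :+ xc :* xb :+ ((con ℤ.0ℤ :* c′ :+ (:- con ℤ.1ℤ) :* xc) :* xb :+ (:- con ℤ.1ℤ) :* c′ :* xxb)) :* (b :* b)
             := b :* (b :* b :* xxc :+ (:- con ℤ.1ℤ) :* b :* c′ :* xxb :+ (:- con (ℤ.+ 2)) :* b :* xb :* xc :+ con (ℤ.+ 2) :* c′ :* xb :* xb)
                :+ (xc :* b :+ (:- con ℤ.1ℤ) :* c′ :* xb) :* (xb :* b :+ b :* xb)) refl b c′ xb xc xxb xxc)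
          (trans (cong (λ z → b ⊗ (b ⊗ b ⊗ xxc ⊕ (⊝ z) ⊗ b ⊗ c′ ⊗ xxb ⊕ (⊝ two) ⊗ b ⊗ xb ⊗ xc ⊕ two ⊗ c′ ⊗ xb ⊗ xb) ⊕ (xc ⊗ b ⊕ (⊝ z) ⊗ c′ ⊗ xb) ⊗ (xb ⊗ b ⊕ b ⊗ xb)) fromℤ-1)
            (trans (cong (λ z → b ⊗ z ⊕ (xc ⊗ b ⊕ (⊝ 𝟙) ⊗ c′ ⊗ xb) ⊗ (xb ⊗ b ⊕ b ⊗ xb)) (van t)) (trans (cong (_⊕ (xc ⊗ b ⊕ (⊝ 𝟙) ⊗ c′ ⊗ xb) ⊗ (xb ⊗ b ⊕ b ⊗ xb)) (⊗-zeroʳ b)) (⊕-identityˡ _))))))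
          where
          b c′ xb xc xxb xxc : F
          b = B t
          c′ = B₀ t
          xb = eval (X gy) (at ℓ t)
          xc = eval (X gv) (at ℓ t)
          xxb = eval (X (X gy)) (at ℓ t)
          xxc = eval (X (X gv)) (at ℓ t)
      at-U : ∀ t → 𝟘 ⊕ t ⊗ 𝟙 ≡ t
      at-U t = trans (⊕-identityˡ _) (⊗-identityʳ t)
      -- Second integration: (Q / g_y)′ = w / g_y² - γ = 0.
      Q≡ : ∀ t → eval Q (at ℓ t) ≡ δ ⊗ B t
      Q≡ t = divide gy≢ (proportionalOn Q gy ℓ k
        (ℕₚ.⊔-lub (ℕₚ.≤-trans (le (deg-∂ v̂ g)) (ℕₚ.≤-trans (ℕₚ.m≤m+n D D) (ℕₚ.n≤1+n _))) (s≤s (ℕₚ.≤-trans (le (deg-∂ ŷ g)) (ℕₚ.m≤m+n D D))))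
        (ℕₚ.≤-trans (le (deg-∂ ŷ g)) (ℕₚ.≤-trans (ℕₚ.m≤m+n D D) (ℕₚ.n≤1+n _))) bound′ eq t₀ gy≢ t)
        where
        eq : ∀ t → eval (X Q) (at ℓ t) ⊗ eval gy (at ℓ t) ≡ eval Q (at ℓ t) ⊗ eval (X gy) (at ℓ t)
        eq t = trans (cong (λ z → (xc ⊕ ((z ⊗ u ⊕ (⊝ γ) ⊗ 𝟙) ⊗ b ⊕ (⊝ γ) ⊗ u ⊗ xb)) ⊗ b) (sym fromℤ-0))
          (trans (cong (λ z → (xc ⊕ ((fromℤ ℤ.0ℤ ⊗ u ⊕ (⊝ γ) ⊗ z) ⊗ b ⊕ (⊝ γ) ⊗ u ⊗ xb)) ⊗ b) (sym fromℤ-1))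
          (trans (solve 6 (λ b c′ xb xc γ u → (xc :+ ((con ℤ.0ℤ :* u :+ (:- γ) :* con ℤ.1ℤ) :* b :+ (:- γ) :* u :* xb)) :* b
             := (xc :* b :+ (:- con ℤ.1ℤ) :* c′ :* xb :- γ :* (b :* b)) :+ (c′ :+ (:- γ) :* u :* b) :* xb) refl b c′ xb xc γ u)
          (trans (cong (λ z → (xc ⊗ b ⊕ (⊝ z) ⊗ c′ ⊗ xb ⊖ γ ⊗ (b ⊗ b)) ⊕ (c′ ⊕ (⊝ γ) ⊗ u ⊗ b) ⊗ xb) fromℤ-1)
            (trans (cong (_⊕ (c′ ⊕ (⊝ γ) ⊗ u ⊗ b) ⊗ xb) (≡⇒⊖≡𝟘 (w≡ t))) (⊕-identityˡ _)))))
          where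
          b c′ xb xc u : F
          b = B t
          c′ = B₀ t
          xb = eval (X gy) (at ℓ t)
          xc = eval (X gv) (at ℓ t)
          u = 𝟘 ⊕ t ⊗ 𝟙
      slope : ∀ t → B₀ t ≡ (γ ⊗ t ⊕ δ) ⊗ B t
      slope t = trans (solve 4 (λ c γ u b → c := c :+ (:- γ) :* u :* b :+ γ :* u :* b) refl (B₀ t) γ (𝟘 ⊕ t ⊗ 𝟙) (B t))
        (trans (cong₂ (λ z u → z ⊕ γ ⊗ u ⊗ B t) (Q≡ t) (at-U t))
          (solve 4 (λ δ b γ t → δ :* b :+ γ :* t :* b := (γ :* t :+ δ) :* b) refl δ (B t) γ t))

-- Many red-blue incidences force a regulus

module Regulus (𝔽 : Field) where
  open Counting
  open FieldTheory 𝔽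
  open Trivariate 𝔽
  open Interpolation 𝔽 using (interpolation)
  open RedBlue 𝔽

  -- The points of a blue line are told apart by v = m r, those of a red line by u = m s; so `multR`
  -- and `multS` bound by μ the lines of one colour through a point of a line of the other. The
  -- inequality `few` says that D + 1 points on each red line impose fewer conditions than there are
  -- coefficients. The relation `_~_` may be any part of the incidence relation.
  module _ {Fr : Set} (_≟ᶠ_ : DecidableEquality Fr) (A m C : Fr → F) (R S : List Fr) (uR : Unique R) (uS : Unique S)
           {_~_ : Fr → Fr → Set} (_~?_ : ∀ r s → Dec (r ~ s)) (incident : ∀ {r s} → r ~ s → Incident A m C r s)
           (K d μ : ℕ)
           (multR : ∀ {s} → s ∈ S → ∀ v → (∑[ r ∈ R ] ⟦ (r ~? s) ×-dec (m r ≟ v) ⟧) ≤ μ)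
           (multS : ∀ {r} → r ∈ R → ∀ u → (∑[ s ∈ S ] ⟦ (r ~? s) ×-dec (m s ≟ u) ⟧) ≤ μ)
           (few : length R * suc (d + (d + d)) < suc d * (suc d * suc d))
           (bound : 8 + (d + (d + d) + (d + (d + d)) + (d + (d + d) + (d + (d + d)))) ≤ p)
           where

    private
      D T : ℕ
      D = d + (d + d)
      T = (D + D + D) * μ

      D<p : suc D ≤ p
      D<p = ℕₚ.≤-trans (ℕₚ.+-mono-≤ {1} {8} {D} (s≤s z≤n) (ℕₚ.≤-trans (ℕₚ.m≤m+n D D) (ℕₚ.m≤m+n (D + D) (D + D)))) bound

      samples : List F
      samples = List.take (suc D) elems

      samples-length : length samples ≡ suc D
      samples-length = trans (Listₚ.length-take (suc D) elems) (ℕₚ.m≤n⇒m⊓n≡m (subst (suc D ≤_) (sym elems-length) D<p))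

      redPoints : List Triple
      redPoints = List.map (λ rt → at (red A m C (proj₁ rt)) (proj₂ rt)) (cartesianProduct R samples)

      redPoints-length : length redPoints ≡ length R * suc D
      redPoints-length = trans (Listₚ.length-map _ (cartesianProduct R samples))
        (trans (length-cartesianProduct R samples) (cong (length R *_) samples-length))

    module Surface (f : Expr) (deg-f : deg f ≤ D) (on-red : ∀ {P} → P ∈ redPoints → eval f P ≡ 𝟘)
                   (P* : Triple) (f≢𝟘 : eval f P* ≢ 𝟘)
                   -- the order of vanishing in the y-direction along a line, where suc D stands for infinity
                   (o : Line → ℕ) (below : ∀ ℓ j → j < o ℓ → VanishesOn (∂^ j ŷ f) ℓ)
                   (fails : ∀ ℓ → o ℓ < suc D → ¬ VanishesOn (∂^ (o ℓ) ŷ f) ℓ) where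

      fⱼ : ℕ → Expr
      fⱼ j = ∂^ j ŷ f

      deg-fⱼ : ∀ j → deg (fⱼ j) ≤ D
      deg-fⱼ j = ℕₚ.≤-trans (deg-∂^ j ŷ f) deg-f

      ρ β : Fr → Line
      ρ = red A m C
      β = blue A m C

      pt : Fr → Fr → Triple
      pt r s = at (ρ r) (m s)

      pt-blue : ∀ {r s} → r ~ s → pt r s ≡ at (β s) (m r)
      pt-blue = meet A m C ∘ incident

      -- At a good incidence both lines have the same order o, and fₒ is nonzero at the point. For o
      -- > 0 the derivative of order o - 1 then vanishes on both lines, while its own y-derivative
      -- is nonzero there.
      Good BadR BadS Bad∞ : Fr → Fr → Set
      Good r s = r ~ s × o (ρ r) ≡ o (β s) × o (ρ r) < suc D × eval (fⱼ (o (ρ r))) (pt r s) ≢ 𝟘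
      BadR r s = r ~ s × o (ρ r) < suc D × eval (fⱼ (o (ρ r))) (pt r s) ≡ 𝟘
      BadS r s = r ~ s × o (β s) < suc D × eval (fⱼ (o (β s))) (pt r s) ≡ 𝟘
      Bad∞ r s = r ~ s × ¬ (o (β s) < suc D)

      good? : ∀ r s → Dec (Good r s)
      good? r s = (r ~? s) ×-dec (o (ρ r) ℕ.≟ o (β s)) ×-dec (o (ρ r) ℕ.<? suc D) ×-dec ¬? (eval (fⱼ (o (ρ r))) (pt r s) ≟ 𝟘)

      badR? : ∀ r s → Dec (BadR r s)
      badR? r s = (r ~? s) ×-dec (o (ρ r) ℕ.<? suc D) ×-dec (eval (fⱼ (o (ρ r))) (pt r s) ≟ 𝟘)

      badS? : ∀ r s → Dec (BadS r s)
      badS? r s = (r ~? s) ×-dec (o (β s) ℕ.<? suc D) ×-dec (eval (fⱼ (o (β s))) (pt r s) ≟ 𝟘)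

      bad∞? : ∀ r s → Dec (Bad∞ r s)
      bad∞? r s = (r ~? s) ×-dec ¬? (o (β s) ℕ.<? suc D)

      -- If the orders differ, the derivative belonging to the smaller order vanishes on the other
      -- line, hence at the common point. This point is then one of the few zeros of that derivative
      -- on its own line.
      classify : ∀ {r s} → r ~ s → Good r s ⊎ (BadR r s ⊎ (BadS r s ⊎ Bad∞ r s))
      classify {r} {s} e with o (β s) ℕ.<? suc D
      ... | no q = inj₂ (inj₂ (inj₂ (e , q)))
      ... | yes s<∞ with eval (fⱼ (o (β s))) (pt r s) ≟ 𝟘
      ...   | yes z = inj₂ (inj₂ (inj₁ (e , s<∞ , z)))
      ...   | no ¬z with ℕₚ.<-cmp (o (ρ r)) (o (β s))
      ...     | tri> _ _ gt = contradiction (below (ρ r) (o (β s)) gt (m s)) ¬z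
      ...     | tri≈ _ eq _ = inj₁ (e , eq , subst (_< suc D) (sym eq) s<∞ , λ z → ¬z (subst (λ j → eval (fⱼ j) (pt r s) ≡ 𝟘) eq z))
      ...     | tri< lt _ _ = inj₂ (inj₁ (e , ℕₚ.<-trans lt s<∞ ,
                  trans (cong (eval (fⱼ (o (ρ r)))) (pt-blue e)) (below (β s) (o (ρ r)) lt (m r))))

      multS≤ : ∀ {r} → r ∈ R → {P : Fr → Set} (P? : Decidable P) → (∀ {s} → P s → r ~ s) → ∀ u → (∑[ s ∈ S ] ⟦ P? s ×-dec (m s ≟ u) ⟧) ≤ μ
      multS≤ {r} r∈ P? h u = ℕₚ.≤-trans (∑-mono S (λ {s} _ → ⟦⟧-mono (P? s ×-dec (m s ≟ u)) ((r ~? s) ×-dec (m s ≟ u)) (λ (a , b) → h a , b))) (multS r∈ u)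

      multR≤ : ∀ {s} → s ∈ S → {P : Fr → Set} (P? : Decidable P) → (∀ {r} → P r → r ~ s) → ∀ v → (∑[ r ∈ R ] ⟦ P? r ×-dec (m r ≟ v) ⟧) ≤ μ
      multR≤ {s} s∈ P? h v = ℕₚ.≤-trans (∑-mono R (λ {r} _ → ⟦⟧-mono (P? r ×-dec (m r ≟ v)) ((r ~? s) ×-dec (m r ≟ v)) (λ (a , b) → h a , b))) (multR s∈ v)

      badR-count : ∀ {r} → r ∈ R → (∑[ s ∈ S ] ⟦ badR? r s ⟧) ≤ D * μ
      badR-count {r} r∈ = go (o (ρ r) ℕ.<? suc D)
        where
        go : Dec (o (ρ r) < suc D) → (∑[ s ∈ S ] ⟦ badR? r s ⟧) ≤ D * μ
        go (no q)  = ℕₚ.≤-trans (ℕₚ.≤-reflexive (trans (∑-cong S (λ {s} _ → ⟦⟧-no (badR? r s) (λ h → q (proj₁ (proj₂ h))))) (∑-zero S))) z≤n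
        go (yes q) = ℕₚ.≤-trans (weighted-roots (badR? r) S m (fⱼ (o (ρ r))) (ρ r) μ
          (multS≤ r∈ (badR? r) proj₁) (λ _ h → proj₂ (proj₂ h)) (fails (ρ r) q)) (ℕₚ.*-monoˡ-≤ μ (deg-fⱼ (o (ρ r))))

      badS-count : ∀ {s} → s ∈ S → (∑[ r ∈ R ] ⟦ badS? r s ⟧) ≤ D * μ
      badS-count {s} s∈ = go (o (β s) ℕ.<? suc D)
        where
        go : Dec (o (β s) < suc D) → (∑[ r ∈ R ] ⟦ badS? r s ⟧) ≤ D * μ
        go (no q)  = ℕₚ.≤-trans (ℕₚ.≤-reflexive (trans (∑-cong R (λ {r} _ → ⟦⟧-no (badS? r s) (λ h → q (proj₁ (proj₂ h))))) (∑-zero R))) z≤n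
        go (yes q) = ℕₚ.≤-trans (weighted-roots (λ r → badS? r s) R m (fⱼ (o (β s))) (β s) μ
          (multR≤ s∈ (λ r → badS? r s) proj₁) (λ {r} _ h → trans (cong (eval (fⱼ (o (β s)))) (sym (pt-blue (proj₁ h)))) (proj₂ (proj₂ h))) (fails (β s) q)) (ℕₚ.*-monoˡ-≤ μ (deg-fⱼ (o (β s))))

      -- A blue line of infinite order forces f to vanish on the whole plane u = m s, which cannot happen for many s.
      bad∞-count : ∀ {r} → r ∈ R → (∑[ s ∈ S ] ⟦ bad∞? r s ⟧) ≤ D * μ
      bad∞-count {r} r∈ = ℕₚ.≤-trans (weighted-roots (bad∞? r) S m f transversal μ (multS≤ r∈ (bad∞? r) proj₁)
          (λ {s} _ (_ , q) → trans (cong (eval f) (on-transversal (m s))) (plane s q)) not-vanishing) (ℕₚ.*-monoˡ-≤ μ deg-f)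
        where
        u* v* y* : F
        u* = proj₁ P*
        v* = proj₁ (proj₂ P*)
        y* = proj₂ (proj₂ P*)
        transversal : Line
        transversal = line (𝟘 , v* , y*) (𝟙 , 𝟘 , 𝟘)
        on-transversal : ∀ t → at transversal t ≡ (t , v* , y*)
        on-transversal t = cong₂ _,_ (trans (⊕-identityˡ _) (⊗-identityʳ t)) (cong₂ _,_ (lemma v*) (lemma y*))
          where
          lemma : ∀ x → x ⊕ t ⊗ 𝟘 ≡ x
          lemma x = trans (cong (x ⊕_) (⊗-zeroʳ t)) (⊕-identityʳ x)
        not-vanishing : ¬ VanishesOn f transversal
        not-vanishing h = f≢𝟘 (trans (cong (eval f) (sym (on-transversal u*))) (h u*))
        plane : ∀ s → ¬ (o (β s) < suc D) → eval f (m s , v* , y*) ≡ 𝟘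
        plane s q = trans (cong (eval f) (sym top)) (derivatives≡𝟘⇒vanishesOn f vertical 𝟘
            (ℕₚ.≤-trans (ℕₚ.+-mono-≤ {6} {8} {deg f + deg f} (ℕₚ.m≤n⇒m≤1+n (ℕₚ.n≤1+n 6)) (ℕₚ.≤-trans (ℕₚ.+-mono-≤ deg-f deg-f) (ℕₚ.m≤m+n (D + D) (D + D)))) bound)
            (λ j j≤ → trans (cong (eval (fⱼ j)) (at-𝟘 _ ŷ)) (below (β s) j (ℕₚ.<-≤-trans (s≤s (ℕₚ.≤-trans j≤ deg-f)) (ℕₚ.≮⇒≥ q)) v*)) (y* ⊖ y₀))
          where
          y₀ : F
          y₀ = ⊝ C s ⊕ v* ⊗ A s
          vertical : Line
          vertical = line (at (β s) v*) ŷ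
          top : at vertical (y* ⊖ y₀) ≡ (m s , v* , y*)
          top = cong₂ _,_ (trans (cong₂ _⊕_ (trans (cong (m s ⊕_) (⊗-zeroʳ v*)) (⊕-identityʳ _)) (⊗-zeroʳ _)) (⊕-identityʳ _))
            (cong₂ _,_ (trans (cong₂ _⊕_ (trans (⊕-identityˡ _) (⊗-identityʳ v*)) (⊗-zeroʳ _)) (⊕-identityʳ _))
              (trans (cong (y₀ ⊕_) (⊗-identityʳ _)) (solve 2 (λ a b → a :+ (b :- a) := b) refl y₀ y*)))

      good-count : (∑[ r ∈ R ] ∑[ s ∈ S ] ⟦ r ~? s ⟧) ≤
                   (∑[ r ∈ R ] ∑[ s ∈ S ] ⟦ good? r s ⟧) + (length R * (D * μ) + (length S * (D * μ) + length R * (D * μ)))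
      good-count = begin
        (∑[ r ∈ R ] ∑[ s ∈ S ] ⟦ r ~? s ⟧)
          ≤⟨ ∑-mono R (λ {r} _ → ∑-mono S (λ {s} _ → four r s)) ⟩
        (∑[ r ∈ R ] ∑[ s ∈ S ] (⟦ good? r s ⟧ + (⟦ badR? r s ⟧ + (⟦ badS? r s ⟧ + ⟦ bad∞? r s ⟧))))
          ≡⟨ split (λ r s → ⟦ good? r s ⟧) (λ r s → ⟦ badR? r s ⟧ + (⟦ badS? r s ⟧ + ⟦ bad∞? r s ⟧)) ⟩
        G + (∑[ r ∈ R ] ∑[ s ∈ S ] (⟦ badR? r s ⟧ + (⟦ badS? r s ⟧ + ⟦ bad∞? r s ⟧)))
          ≡⟨ cong (G +_) (split (λ r s → ⟦ badR? r s ⟧) (λ r s → ⟦ badS? r s ⟧ + ⟦ bad∞? r s ⟧)) ⟩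
        G + ((∑[ r ∈ R ] ∑[ s ∈ S ] ⟦ badR? r s ⟧) + (∑[ r ∈ R ] ∑[ s ∈ S ] (⟦ badS? r s ⟧ + ⟦ bad∞? r s ⟧)))
          ≡⟨ cong (λ z → G + ((∑[ r ∈ R ] ∑[ s ∈ S ] ⟦ badR? r s ⟧) + z)) (split (λ r s → ⟦ badS? r s ⟧) (λ r s → ⟦ bad∞? r s ⟧)) ⟩
        G + ((∑[ r ∈ R ] ∑[ s ∈ S ] ⟦ badR? r s ⟧) + ((∑[ r ∈ R ] ∑[ s ∈ S ] ⟦ badS? r s ⟧) + (∑[ r ∈ R ] ∑[ s ∈ S ] ⟦ bad∞? r s ⟧)))
          ≤⟨ ℕₚ.+-monoʳ-≤ G (ℕₚ.+-mono-≤ (∑-bound R (D * μ) badR-count)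
               (ℕₚ.+-mono-≤ (ℕₚ.≤-trans (ℕₚ.≤-reflexive (∑-swap R S (λ r s → ⟦ badS? r s ⟧))) (∑-bound S (D * μ) badS-count))
                            (∑-bound R (D * μ) bad∞-count))) ⟩
        G + (length R * (D * μ) + (length S * (D * μ) + length R * (D * μ))) ∎
        where
        open ℕₚ.≤-Reasoning
        G : ℕ
        G = ∑[ r ∈ R ] ∑[ s ∈ S ] ⟦ good? r s ⟧
        split : (a b : Fr → Fr → ℕ) → (∑[ r ∈ R ] ∑[ s ∈ S ] (a r s + b r s)) ≡ (∑[ r ∈ R ] ∑[ s ∈ S ] a r s) + (∑[ r ∈ R ] ∑[ s ∈ S ] b r s)
        split a b = trans (∑-cong R (λ {r} _ → ∑-+ S (a r) (b r))) (∑-+ R (λ r → ∑ S (a r)) (λ r → ∑ S (b r)))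
        four : ∀ r s → ⟦ r ~? s ⟧ ≤ ⟦ good? r s ⟧ + (⟦ badR? r s ⟧ + (⟦ badS? r s ⟧ + ⟦ bad∞? r s ⟧))
        four r s = ℕₚ.≤-trans (⟦⟧-≤+ (r ~? s) (good? r s) (badR? r s ⊎-dec (badS? r s ⊎-dec bad∞? r s)) classify)
          (ℕₚ.+-monoʳ-≤ ⟦ good? r s ⟧ (ℕₚ.≤-trans (⟦⟧-≤+ (badR? r s ⊎-dec (badS? r s ⊎-dec bad∞? r s)) (badR? r s) (badS? r s ⊎-dec bad∞? r s) id)
            (ℕₚ.+-monoʳ-≤ ⟦ badR? r s ⟧ (⟦⟧-≤+ (badS? r s ⊎-dec bad∞? r s) (badS? r s) (bad∞? r s) id))))

      red-on-surface : ∀ {r} → r ∈ R → VanishesOn f (ρ r)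
      red-on-surface {r} r∈ = roots⇒vanishesOn f (ρ r) samples (Uniqueₚ.take⁺ (suc D) elems-unique)
        (λ t∈ → on-red (∈ₚ.∈-map⁺ (λ rt → at (ρ (proj₁ rt)) (proj₂ rt)) (∈ₚ.∈-cartesianProduct⁺ r∈ t∈)))
        (subst (deg f <_) (sym samples-length) (s≤s deg-f))

      module _ (R′ S′ : List Fr) (uR′ : Unique R′) (uS′ : Unique S′) (R′⊆R : ∀ {r} → r ∈ R′ → r ∈ R) (S′⊆S : ∀ {s} → s ∈ S′ → s ∈ S)
               (richR : ∀ {r} → r ∈ R′ → K + T < (∑[ s ∈ S′ ] ⟦ good? r s ⟧))
               (richS : ∀ {s} → s ∈ S′ → T < (∑[ r ∈ R′ ] ⟦ good? r s ⟧)) {r₀ : Fr} (r₀∈ : r₀ ∈ R′) where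

        restrictR : ∀ {s} → s ∈ S → {P : Fr → Set} (P? : Decidable P) → (∀ {r} → P r → r ~ s) → ∀ v → (∑[ r ∈ R′ ] ⟦ P? r ×-dec (m r ≟ v) ⟧) ≤ μ
        restrictR s∈ P? h v = ℕₚ.≤-trans (count-injection (λ r → P? r ×-dec (m r ≟ v)) (λ r → P? r ×-dec (m r ≟ v)) _≟ᶠ_ id uR′ uR
          (λ r∈ q → R′⊆R r∈ , q) (λ _ _ _ _ q → q)) (multR≤ s∈ P? h v)

        restrictS : ∀ {r} → r ∈ R → {P : Fr → Set} (P? : Decidable P) → (∀ {s} → P s → r ~ s) → ∀ u → (∑[ s ∈ S′ ] ⟦ P? s ×-dec (m s ≟ u) ⟧) ≤ μ
        restrictS r∈ P? h u = ℕₚ.≤-trans (count-injection (λ s → P? s ×-dec (m s ≟ u)) (λ s → P? s ×-dec (m s ≟ u)) _≟ᶠ_ id uS′ uS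
          (λ s∈ q → S′⊆S s∈ , q) (λ _ _ _ _ q → q)) (multS≤ r∈ P? h u)

        witness : ∃[ s ] s ∈ S′ × 0 < ⟦ good? r₀ s ⟧
        witness = ∑>0 S′ _ (ℕₚ.≤-<-trans z≤n (richR r₀∈))

        s₀ : Fr
        s₀ = proj₁ witness

        good₀ : Good r₀ s₀
        good₀ = ⟦⟧>0 (good? r₀ s₀) (proj₂ (proj₂ witness))

        -- f vanishes on every red line, by D + 1 zeros against degree D; so there is a last
        -- derivative g that still vanishes on the red line of r₀.
        order>0 : 0 < o (ρ r₀)
        order>0 = ℕₚ.n≢0⇒n>0 (λ eq → fails (ρ r₀) (proj₁ (proj₂ (proj₂ good₀)))
          (subst (λ j → VanishesOn (fⱼ j) (ρ r₀)) (sym eq) (red-on-surface (R′⊆R r₀∈))))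

        j : ℕ
        j = ℕ.pred (o (ρ r₀))

        o≡ : o (ρ r₀) ≡ suc j
        o≡ = sym (ℕₚ.suc-pred (o (ρ r₀)) {{ℕ.>-nonZero order>0}})

        g : Expr
        g = fⱼ j

        dg : deg g ≤ D
        dg = deg-fⱼ j

        module J = Jets g (ℕₚ.≤-<-trans dg D<p) (A r₀)

        g-red : ∀ r → o (ρ r) ≡ suc j → VanishesOn g (ρ r)
        g-red r eq = below (ρ r) j (ℕₚ.≤-reflexive (sym eq))

        g-blue : ∀ s → o (β s) ≡ suc j → VanishesOn g (β s)
        g-blue s eq = below (β s) j (ℕₚ.≤-reflexive (sym eq))

        small : ∀ e → deg e ≤ D → deg e < p
        small e h = ℕₚ.≤-<-trans h D<p

        T<p : suc (D + D + D) ≤ p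
        T<p = ℕₚ.≤-trans (ℕₚ.+-mono-≤ {1} {8} (s≤s z≤n) (ℕₚ.+-monoʳ-≤ (D + D) (ℕₚ.m≤m+n D D))) bound

        order-blue : ∀ {s} → Good r₀ s → o (β s) ≡ suc j
        order-blue (_ , eq , _) = trans (sym eq) o≡

        order-red : ∀ {r s} → o (β s) ≡ suc j → Good r s → o (ρ r) ≡ suc j
        order-red eqs (_ , eq , _) = trans eq eqs

        -- The good neighbours of s have the order of s, which is that of r₀. So g vanishes on their
        -- red lines, and `inflection` at their meeting points with the blue line. More than T = 3D
        -- μ neighbours, at most μ at each point, give more zeros than the degree 3D allows.
        inflection-on-blue : ∀ {s} → s ∈ S′ → Good r₀ s → VanishesOn J.inflection (β s)
        inflection-on-blue {s} s∈ gs = decidable-stable (vanishesOn? J.inflection (β s)) (λ ¬q →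
            contradiction (weighted-roots (λ r → good? r s) R′ m J.inflection (β s) μ
              (restrictR (S′⊆S s∈) (λ r → good? r s) proj₁) (λ {r} _ gr → trans (cong (eval J.inflection) (sym (pt-blue (proj₁ gr)))) (at-red r gr)) ¬q)
              (ℕₚ.<⇒≱ (ℕₚ.≤-<-trans (ℕₚ.*-monoˡ-≤ μ (J.deg-inflection dg)) (richS s∈))))
          where
          at-red : ∀ r → Good r s → eval J.inflection (pt r s) ≡ 𝟘
          at-red r gr = J.inflection≡𝟘 (A r) (pt r s) (Xg≡𝟘 (m s)) (vanishesOn-∂ (∂ (𝟙 , 𝟘 , A r) g) (ρ r) (small (∂ (𝟙 , 𝟘 , A r) g) (ℕₚ.≤-trans (deg-∂ _ g) dg)) Xg≡𝟘 (m s))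
            where
            Xg≡𝟘 : VanishesOn (∂ (𝟙 , 𝟘 , A r) g) (ρ r)
            Xg≡𝟘 = vanishesOn-∂ g (ρ r) (small g dg) (g-red r (order-red (order-blue gs) gr))

        Xg≡𝟘 : VanishesOn (J.X g) (ρ r₀)
        Xg≡𝟘 = vanishesOn-∂ g (ρ r₀) (small g dg) (g-red r₀ o≡)

        bending-at : ∀ {s} → s ∈ S′ → Good r₀ s → eval J.bending (pt r₀ s) ≡ 𝟘
        bending-at {s} s∈ gs = J.bending≡𝟘 (A s) (pt r₀ s) (Xg≡𝟘 (m s))
          (vanishesOn-∂ (J.X g) (ρ r₀) (small (J.X g) (ℕₚ.≤-trans (deg-∂ _ g) dg)) Xg≡𝟘 (m s))
          (trans (cong (eval (∂ (𝟘 , 𝟙 , A s) g)) (pt-blue (proj₁ gs))) (vanishesOn-∂ g (β s) (small g dg) (g-blue s (order-blue gs)) (m r₀)))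
          (trans (cong (eval (∂ (𝟘 , 𝟙 , A s) J.inflection)) (pt-blue (proj₁ gs)))
            (vanishesOn-∂ J.inflection (β s) (ℕₚ.≤-<-trans (J.deg-inflection dg) T<p) (inflection-on-blue s∈ gs) (m r₀)))

        bending-on-red : VanishesOn J.bending (ρ r₀)
        bending-on-red = decidable-stable (vanishesOn? J.bending (ρ r₀)) (λ ¬q →
            contradiction (weighted-roots (good? r₀) S′ m J.bending (ρ r₀) μ
              (restrictS (R′⊆R r₀∈) (good? r₀) proj₁) bending-at ¬q)
              (ℕₚ.<⇒≱ (ℕₚ.≤-<-trans (ℕₚ.*-monoˡ-≤ μ (J.deg-bending dg)) (ℕₚ.≤-<-trans (ℕₚ.m≤n+m T K) (richR r₀∈)))))

        gy≢𝟘 : ∀ {s} → Good r₀ s → eval J.gy (pt r₀ s) ≢ 𝟘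
        gy≢𝟘 {s} (_ , _ , _ , q) z = q (trans (cong (λ e → eval e (pt r₀ s)) (trans (cong (λ i → ∂^ i ŷ f) o≡) (∂^-suc j ŷ f))) z)

        -- As g vanishes on the blue line of s, its derivative in direction (0 , 1 , A s) is zero,
        -- so A s = - g_v / g_y at the meeting point. By `linear-slope` this is an affine function
        -- of m s.
        conclusion : ∃[ γ ] ∃[ δ ] K < (∑[ s ∈ S ] ⟦ (r₀ ~? s) ×-dec (A s ≟ γ ⊗ m s ⊕ δ) ⟧)
        conclusion = from-slope (J.linear-slope (m r₀) (⊝ C r₀) dg bound bending-on-red (m s₀) (gy≢𝟘 good₀))
          where
          Slope : F → F → Set
          Slope γ δ = ∀ t → eval J.gv (at (ρ r₀) t) ≡ (γ ⊗ t ⊕ δ) ⊗ eval J.gy (at (ρ r₀) t)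
          slope-of : ∀ {γ δ} → Slope γ δ → ∀ s → Good r₀ s → A s ≡ (⊝ γ) ⊗ m s ⊕ (⊝ δ)
          slope-of {γ} {δ} slope s gs = ⊗-cancelˡ (gy≢𝟘 gs) (⊖≡𝟘⇒≡ (trans
            (solve 5 (λ b a γ t δ → b :* a :- b :* ((:- γ) :* t :+ (:- δ)) := (γ :* t :+ δ) :* b :+ a :* b) refl (eval J.gy (pt r₀ s)) (A s) γ (m s) δ)
            (trans (cong (_⊕ A s ⊗ eval J.gy (pt r₀ s)) (sym (slope (m s)))) (trans (sym (J.W-shear (A s) g (pt r₀ s)))
              (trans (cong (eval (∂ (𝟘 , 𝟙 , A s) g)) (pt-blue (proj₁ gs))) (vanishesOn-∂ g (β s) (small g dg) (g-blue s (order-blue gs)) (m r₀)))))))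
          from-slope : ∃[ γ ] ∃[ δ ] Slope γ δ → ∃[ γ ] ∃[ δ ] K < (∑[ s ∈ S ] ⟦ (r₀ ~? s) ×-dec (A s ≟ γ ⊗ m s ⊕ δ) ⟧)
          from-slope (γ , δ , slope) = ⊝ γ , ⊝ δ , ℕₚ.<-≤-trans (ℕₚ.≤-<-trans (ℕₚ.m≤m+n K T) (richR r₀∈))
              (count-injection (good? r₀) (λ s → (r₀ ~? s) ×-dec (A s ≟ (⊝ γ) ⊗ m s ⊕ (⊝ δ))) _≟ᶠ_ id uS′ uS
                (λ {s} s∈ gs → S′⊆S s∈ , proj₁ gs , slope-of slope s gs) (λ _ _ _ _ q → q))

    -- The bad incidences number at most 2Dμ per red and Dμ per blue line. Pruning the good ones
    -- with thresholds K + T and T leaves blue lines rich enough for `inflection`, and red lines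
    -- rich enough for `bending` and for more than K lines of a regulus.
    many-edges⇒regulus : (K + T + (D * μ + D * μ)) * length R + (T + D * μ) * length S < (∑[ r ∈ R ] ∑[ s ∈ S ] ⟦ r ~? s ⟧) →
      ∃[ r ] r ∈ R × (∃[ γ ] ∃[ δ ] K < (∑[ s ∈ S ] ⟦ (r ~? s) ×-dec (A s ≟ γ ⊗ m s ⊕ δ) ⟧))
    many-edges⇒regulus edges = from-surface
        (interpolation d redPoints (ℕₚ.≤-trans (s≤s (ℕₚ.m≤m+n d (d + d))) D<p) (subst (_< suc d * (suc d * suc d)) (sym redPoints-length) few))
      where
      Goal : Set
      Goal = ∃[ r ] r ∈ R × (∃[ γ ] ∃[ δ ] K < (∑[ s ∈ S ] ⟦ (r ~? s) ×-dec (A s ≟ γ ⊗ m s ⊕ δ) ⟧))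
      module _ (f : Expr) (deg-f : deg f ≤ D) (on-red : ∀ {P} → P ∈ redPoints → eval f P ≡ 𝟘) (P* : Triple) (f≢𝟘 : eval f P* ≢ 𝟘)
               (o : Line → ℕ) (below : ∀ ℓ j → j < o ℓ → VanishesOn (∂^ j ŷ f) ℓ)
               (fails : ∀ ℓ → o ℓ < suc D → ¬ VanishesOn (∂^ (o ℓ) ŷ f) ℓ) where
        open Surface f deg-f on-red P* f≢𝟘 o below fails
        many-good : (K + T) * length R + T * length S < (∑[ r ∈ R ] ∑[ s ∈ S ] ⟦ good? r s ⟧)
        many-good = ℕₚ.+-cancelʳ-< (length R * (D * μ) + (length S * (D * μ) + length R * (D * μ))) _ _
          (ℕₚ.<-≤-trans (subst (_< (∑[ r ∈ R ] ∑[ s ∈ S ] ⟦ r ~? s ⟧)) (rearrange K T (D * μ) (length R) (length S)) edges) good-count)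
          where
          rearrange : ∀ k t d r s → (k + t + (d + d)) * r + (t + d) * s ≡ (k + t) * r + t * s + (r * d + (s * d + r * d))
          rearrange = solveℕ 5 (λ k t d r s → (k ∔ t ∔ (d ∔ d)) ∙ r ∔ (t ∔ d) ∙ s ≐ (k ∔ t) ∙ r ∔ t ∙ s ∔ (r ∙ d ∔ (s ∙ d ∔ r ∙ d))) refl
            where open +-*-Solver using () renaming (solve to solveℕ; _:=_ to _≐_; _:+_ to _∔_; _:*_ to _∙_)
        from-order : Goal
        from-order = let (R′ , S′ , (r₀ , r₀∈) , uR′ , uS′ , R′⊆R , S′⊆S , richR , richS) = prune good? (K + T) T R S uR uS many-good in
          r₀ , R′⊆R r₀∈ , conclusion R′ S′ uR′ uS′ R′⊆R S′⊆S richR richS r₀∈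
      from-surface : ∃[ f ] deg f ≤ D × (∀ {P} → P ∈ redPoints → eval f P ≡ 𝟘) × (∃[ P ] eval f P ≢ 𝟘) → Goal
      from-surface (f , deg-f , on-red , P* , f≢𝟘) = from-order f deg-f on-red P* f≢𝟘
        (λ ℓ → proj₁ (order ℓ)) (λ ℓ → proj₁ (proj₂ (proj₂ (order ℓ)))) (λ ℓ → proj₂ (proj₂ (proj₂ (order ℓ))))
        where
        order : (ℓ : Line) → ∃[ o ] o ≤ suc D × (∀ j → j < o → VanishesOn (∂^ j ŷ f) ℓ) × (o < suc D → ¬ VanishesOn (∂^ o ŷ f) ℓ)
        order ℓ = first-failure (λ j → vanishesOn? (∂^ j ŷ f) ℓ) (suc D)

-- The plane: distances, circles and lines

module Plane (𝔽 : Field) where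
  open Counting
  open FieldTheory 𝔽
  open Univariate 𝔽

  Pt : Set
  Pt = F × F

  infix 4 _≟ᴾ_
  _≟ᴾ_ : DecidableEquality Pt
  _≟ᴾ_ = ×ₚ.≡-dec _≟_ _≟_

  plane : List Pt
  plane = cartesianProduct elems elems

  plane-unique : Unique plane
  plane-unique = Uniqueₚ.cartesianProduct⁺ elems-unique elems-unique

  plane-complete : ∀ z → z ∈ plane
  plane-complete (x , y) = ∈ₚ.∈-cartesianProduct⁺ (elems-complete x) (elems-complete y)

  plane-length : length plane ≡ p * p
  plane-length = trans (length-cartesianProduct elems elems) (cong₂ _*_ elems-length elems-length)

  infixl 6 _-ᴾ_
  _-ᴾ_ : Pt → Pt → Pt
  (x , y) -ᴾ (x′ , y′) = x ⊖ x′ , y ⊖ y′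

  nrm : Pt → F
  nrm (x , y) = x ⊗ x ⊕ y ⊗ y

  infix 7 _∙_ _⨯_
  _∙_ _⨯_ : Pt → Pt → F
  (x , y) ∙ (x′ , y′) = x ⊗ x′ ⊕ y ⊗ y′
  (x , y) ⨯ (x′ , y′) = x ⊗ y′ ⊖ y ⊗ x′

  dist² : Pt → Pt → F
  dist² a b = nrm (a -ᴾ b)

  nrm≡𝟘 : ∀ z → nrm z ≡ 𝟘 → z ≡ (𝟘 , 𝟘)
  nrm≡𝟘 (x , y) h = cong₂ _,_ (anisotropic x y h) (anisotropicʳ x y h)

  -ᴾ≡𝟘 : ∀ {a b} → a -ᴾ b ≡ (𝟘 , 𝟘) → a ≡ b
  -ᴾ≡𝟘 h = cong₂ _,_ (⊖≡𝟘⇒≡ (cong proj₁ h)) (⊖≡𝟘⇒≡ (cong proj₂ h))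

  dist²≡𝟘 : ∀ {a b} → dist² a b ≡ 𝟘 → a ≡ b
  dist²≡𝟘 {a} {b} h = -ᴾ≡𝟘 (nrm≡𝟘 (a -ᴾ b) h)

  dist²-self : ∀ a → dist² a a ≡ 𝟘
  dist²-self (x , y) = trans (solve 2 (λ x y → (x :- x) :* (x :- x) :+ (y :- y) :* (y :- y) := con ℤ.0ℤ) refl x y) fromℤ-0

  -- By the identity |n|² (u ⨯ v) = (n ∙ u)(n ⨯ v) - (n ∙ v)(n ⨯ u), where |n|² ≠ 0 by anisotropy.
  orthogonal⇒parallel : ∀ n u v → n ≢ (𝟘 , 𝟘) → n ∙ u ≡ 𝟘 → n ∙ v ≡ 𝟘 → u ⨯ v ≡ 𝟘
  orthogonal⇒parallel n@(a , b) u@(x , y) v@(z , w) n≢ hu hv = ⊗≡𝟘 (nrm n) _ (trans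
    (solve 6 (λ a b x y z w → (a :* a :+ b :* b) :* (x :* w :- y :* z) := (a :* x :+ b :* y) :* (a :* w :- b :* z) :- (a :* z :+ b :* w) :* (a :* y :- b :* x))
      refl a b x y z w)
    (trans (cong₂ (λ s t → s ⊗ (n ⨯ v) ⊖ t ⊗ (n ⨯ u)) hu hv) (trans (cong₂ (λ s t → s ⊖ t) (⊗-zeroˡ _) (⊗-zeroˡ _)) (⊖-self 𝟘))))
    (n≢ ∘ nrm≡𝟘 n)

  no-three-collinear : ∀ c x y z → dist² x c ≡ dist² y c → dist² x c ≡ dist² z c → (y -ᴾ x) ⨯ (z -ᴾ x) ≡ 𝟘 →
                       x ≢ y → x ≢ z → y ≢ z → ⊥
  no-three-collinear c x y z hy hz par x≢y x≢z y≢z = y≢z (sym (-ᴾ≡𝟘 (nrm≡𝟘 (z -ᴾ y) (trans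
      (lemma (proj₁ x) (proj₂ x) (proj₁ y) (proj₂ y) (proj₁ z) (proj₂ z))
      (trans (cong₂ (λ s t → s ⊕ t ⊖ two ⊗ dot) (sym dd) (sym ee)) (trans (solve 1 (λ d → d :+ d :- con (ℤ.+ 2) :* d := con ℤ.0ℤ) refl dot) fromℤ-0))))))
    where
    N² M² dot : F
    N² = nrm (y -ᴾ x)
    M² = nrm (z -ᴾ x)
    dot = (y -ᴾ x) ∙ (z -ᴾ x)
    lemma : ∀ a b c d e f → (e ⊖ c) ⊗ (e ⊖ c) ⊕ (f ⊖ d) ⊗ (f ⊖ d) ≡
      ((c ⊖ a) ⊗ (c ⊖ a) ⊕ (d ⊖ b) ⊗ (d ⊖ b)) ⊕ ((e ⊖ a) ⊗ (e ⊖ a) ⊕ (f ⊖ b) ⊗ (f ⊖ b)) ⊖ two ⊗ ((c ⊖ a) ⊗ (e ⊖ a) ⊕ (d ⊖ b) ⊗ (f ⊖ b))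
    lemma = solve 6 (λ a b c d e f → (e :- c) :* (e :- c) :+ (f :- d) :* (f :- d) :=
      ((c :- a) :* (c :- a) :+ (d :- b) :* (d :- b)) :+ ((e :- a) :* (e :- a) :+ (f :- b) :* (f :- b)) :- con (ℤ.+ 2) :* ((c :- a) :* (e :- a) :+ (d :- b) :* (f :- b))) refl
    -- With u = y - x and v = z - x parallel and |u|² + 2u·(x-c) = 0 = |v|² + 2v·(x-c), both |u|² and |v|² equal u·v.
    power : ∀ {w} → dist² x c ≡ dist² w c → nrm (w -ᴾ x) ≡ ⊝ (two ⊗ ((w -ᴾ x) ∙ (x -ᴾ c)))
    power {w} h = ⊖≡𝟘⇒≡ (trans (sym (expand (proj₁ w) (proj₂ w) (proj₁ x) (proj₂ x) (proj₁ c) (proj₂ c))) (≡⇒⊖≡𝟘 (sym h)))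
      where
      expand : ∀ a b e f i j → ((a ⊖ i) ⊗ (a ⊖ i) ⊕ (b ⊖ j) ⊗ (b ⊖ j)) ⊖ ((e ⊖ i) ⊗ (e ⊖ i) ⊕ (f ⊖ j) ⊗ (f ⊖ j)) ≡
        ((a ⊖ e) ⊗ (a ⊖ e) ⊕ (b ⊖ f) ⊗ (b ⊖ f)) ⊖ (⊝ (two ⊗ ((a ⊖ e) ⊗ (e ⊖ i) ⊕ (b ⊖ f) ⊗ (f ⊖ j))))
      expand = solve 6 (λ a b e f i j → ((a :- i) :* (a :- i) :+ (b :- j) :* (b :- j)) :- ((e :- i) :* (e :- i) :+ (f :- j) :* (f :- j)) :=
        ((a :- e) :* (a :- e) :+ (b :- f) :* (b :- f)) :- (:- (con (ℤ.+ 2) :* ((a :- e) :* (e :- i) :+ (b :- f) :* (f :- j))))) refl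
    parallel : ∀ u v q → u ⨯ v ≡ 𝟘 → nrm u ⊗ (v ∙ q) ≡ (u ∙ v) ⊗ (u ∙ q)
    parallel (a , b) (e , f) (i , j) h = ⊖≡𝟘⇒≡ (trans (solve 6 (λ a b e f i j →
        (a :* a :+ b :* b) :* (e :* i :+ f :* j) :- (a :* e :+ b :* f) :* (a :* i :+ b :* j) := (a :* f :- b :* e) :* (a :* j :- b :* i)) refl a b e f i j)
      (trans (cong (_⊗ (a ⊗ j ⊖ b ⊗ i)) h) (⊗-zeroˡ _)))
    neg2 : ∀ n q → n ⊗ (⊝ (two ⊗ q)) ≡ ⊝ (two ⊗ (n ⊗ q))
    neg2 = solve 2 (λ n q → n :* (:- (con (ℤ.+ 2) :* q)) := :- (con (ℤ.+ 2) :* (n :* q))) refl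
    par′ : (z -ᴾ x) ⨯ (y -ᴾ x) ≡ 𝟘
    par′ = trans (solve 4 (λ a b c d → a :* d :- b :* c := :- (c :* b :- d :* a)) refl (proj₁ (z -ᴾ x)) (proj₂ (z -ᴾ x)) (proj₁ (y -ᴾ x)) (proj₂ (y -ᴾ x)))
      (trans (cong ⊝_ par) (trans (sym (⊕-identityˡ _)) (⊖-self 𝟘)))
    ee : dot ≡ M²
    ee = ⊗-cancelˡ (λ h → x≢y (sym (dist²≡𝟘 h))) (begin
      N² ⊗ dot                                       ≡⟨ ⊗-comm _ _ ⟩
      dot ⊗ N²                                       ≡⟨ cong (dot ⊗_) (power hy) ⟩
      dot ⊗ (⊝ (two ⊗ ((y -ᴾ x) ∙ (x -ᴾ c))))         ≡⟨ neg2 _ _ ⟩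
      ⊝ (two ⊗ (dot ⊗ ((y -ᴾ x) ∙ (x -ᴾ c))))         ≡⟨ cong (λ t → ⊝ (two ⊗ t)) (parallel (y -ᴾ x) (z -ᴾ x) (x -ᴾ c) par) ⟨
      ⊝ (two ⊗ (N² ⊗ ((z -ᴾ x) ∙ (x -ᴾ c))))          ≡⟨ neg2 _ _ ⟨
      N² ⊗ (⊝ (two ⊗ ((z -ᴾ x) ∙ (x -ᴾ c))))          ≡⟨ cong (N² ⊗_) (power hz) ⟨
      N² ⊗ M²                                        ∎)
      where open ≡-Reasoning
    dd : dot ≡ N²
    dd = ⊗-cancelˡ (λ h → x≢z (sym (dist²≡𝟘 h))) (begin
      M² ⊗ dot                                       ≡⟨ ⊗-comm _ _ ⟩
      dot ⊗ M²                                       ≡⟨ cong (dot ⊗_) (power hz) ⟩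
      dot ⊗ (⊝ (two ⊗ ((z -ᴾ x) ∙ (x -ᴾ c))))         ≡⟨ neg2 _ _ ⟩
      ⊝ (two ⊗ (dot ⊗ ((z -ᴾ x) ∙ (x -ᴾ c))))         ≡⟨ cong (λ t → ⊝ (two ⊗ (t ⊗ ((z -ᴾ x) ∙ (x -ᴾ c))))) dot-comm ⟩
      ⊝ (two ⊗ (((z -ᴾ x) ∙ (y -ᴾ x)) ⊗ ((z -ᴾ x) ∙ (x -ᴾ c)))) ≡⟨ cong (λ t → ⊝ (two ⊗ t)) (parallel (z -ᴾ x) (y -ᴾ x) (x -ᴾ c) par′) ⟨
      ⊝ (two ⊗ (M² ⊗ ((y -ᴾ x) ∙ (x -ᴾ c))))          ≡⟨ neg2 _ _ ⟨
      M² ⊗ (⊝ (two ⊗ ((y -ᴾ x) ∙ (x -ᴾ c))))          ≡⟨ cong (M² ⊗_) (power hy) ⟨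
      M² ⊗ N²                                        ∎)
      where
      open ≡-Reasoning
      dot-comm : dot ≡ (z -ᴾ x) ∙ (y -ᴾ x)
      dot-comm = cong₂ _⊕_ (⊗-comm _ _) (⊗-comm _ _)

  no-three-on-normal : ∀ n c x y z → n ≢ (𝟘 , 𝟘) → dist² x c ≡ dist² y c → dist² x c ≡ dist² z c →
    n ∙ (y -ᴾ x) ≡ 𝟘 → n ∙ (z -ᴾ x) ≡ 𝟘 → x ≢ y → x ≢ z → y ≢ z → ⊥
  no-three-on-normal n c x y z n≢ hy hz oy oz = no-three-collinear c x y z hy hz (orthogonal⇒parallel n (y -ᴾ x) (z -ᴾ x) n≢ oy oz)

  -- Common points of circles about c and c′ differ by vectors orthogonal to c - c′. They lie on a
  -- line, which meets a circle at most twice.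
  no-three-on-circles : ∀ c c′ x y z → c ≢ c′ → dist² x c ≡ dist² y c → dist² x c ≡ dist² z c →
    dist² x c′ ≡ dist² y c′ → dist² x c′ ≡ dist² z c′ → x ≢ y → x ≢ z → y ≢ z → ⊥
  no-three-on-circles c c′ x y z c≢ hy hz hy′ hz′ = no-three-on-normal (c -ᴾ c′) c x y z (c≢ ∘ -ᴾ≡𝟘) hy hz (orth y hy hy′) (orth z hz hz′)
    where
    orth : ∀ w → dist² x c ≡ dist² w c → dist² x c′ ≡ dist² w c′ → (c -ᴾ c′) ∙ (w -ᴾ x) ≡ 𝟘
    orth w h h′ = ⊗≡𝟘 two _ (trans (identity (proj₁ c) (proj₂ c) (proj₁ c′) (proj₂ c′) (proj₁ x) (proj₂ x) (proj₁ w) (proj₂ w))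
      (trans (cong₂ (λ s t → (s ⊖ dist² w c) ⊖ (t ⊖ dist² w c′)) h h′) (trans (cong₂ _⊖_ (⊖-self _) (⊖-self _)) (⊖-self 𝟘)))) two≢𝟘
      where
      identity : ∀ a b a′ b′ s t u v → two ⊗ ((a ⊖ a′) ⊗ (u ⊖ s) ⊕ (b ⊖ b′) ⊗ (v ⊖ t)) ≡
        ((((s ⊖ a) ⊗ (s ⊖ a) ⊕ (t ⊖ b) ⊗ (t ⊖ b)) ⊖ ((u ⊖ a) ⊗ (u ⊖ a) ⊕ (v ⊖ b) ⊗ (v ⊖ b)))
         ⊖ (((s ⊖ a′) ⊗ (s ⊖ a′) ⊕ (t ⊖ b′) ⊗ (t ⊖ b′)) ⊖ ((u ⊖ a′) ⊗ (u ⊖ a′) ⊕ (v ⊖ b′) ⊗ (v ⊖ b′))))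
      identity = solve 8 (λ a b a′ b′ s t u v → con (ℤ.+ 2) :* ((a :- a′) :* (u :- s) :+ (b :- b′) :* (v :- t)) :=
        ((((s :- a) :* (s :- a) :+ (t :- b) :* (t :- b)) :- ((u :- a) :* (u :- a) :+ (v :- b) :* (v :- b)))
         :- (((s :- a′) :* (s :- a′) :+ (t :- b′) :* (t :- b′)) :- ((u :- a′) :* (u :- a′) :+ (v :- b′) :* (v :- b′))))) refl

  -- The equation κ |z|² + ξ ∙ z + η = 0 covers circles and lines alike. `Nontrivial` excludes the
  -- zero equation only; a nonzero constant counts as an empty circle, harmless in upper bounds.
  record GenCircle : Set where
    constructor genCircle
    field
      κ : F
      ξ : Pt
      η : F

  open GenCircle public

  infix 4 _lies-on_ _lies-on?_
  value : GenCircle → Pt → F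
  value G z = κ G ⊗ nrm z ⊕ ξ G ∙ z ⊕ η G

  _lies-on_ : Pt → GenCircle → Set
  z lies-on G = value G z ≡ 𝟘

  _lies-on?_ : ∀ z G → Dec (z lies-on G)
  z lies-on? G = value G z ≟ 𝟘

  Nontrivial : GenCircle → Set
  Nontrivial G = ¬ (κ G ≡ 𝟘 × ξ G ≡ (𝟘 , 𝟘) × η G ≡ 𝟘)

  quadratic-roots≤2 : ∀ a b c → ¬ (a ≡ 𝟘 × b ≡ 𝟘 × c ≡ 𝟘) → (∑[ x ∈ elems ] ⟦ ev (c ∷ b ∷ a ∷ []) x ≟ 𝟘 ⟧) ≤ 2
  quadratic-roots≤2 a b c nontrivial = count≤ (λ x → ev (c ∷ b ∷ a ∷ []) x ≟ 𝟘) 2 elems-unique (λ ys u sub →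
    ℕₚ.≮⇒≥ (λ 2<len → conclude (vanishes⇒coefficients (c ∷ b ∷ a ∷ []) 2<p
      (roots⇒vanishes (c ∷ b ∷ a ∷ []) ys u (λ y∈ → proj₂ (sub y∈)) 2<len))))
    where
    conclude : All (_≡ 𝟘) (c ∷ b ∷ a ∷ []) → ⊥
    conclude (c≡ ∷ b≡ ∷ a≡ ∷ []) = nontrivial (a≡ , b≡ , c≡)

  -- On a line x = const the equation is a quadratic in y with higher coefficients κ and ξ₂. If both
  -- vanish, it involves x alone and is cut by lines y = const instead.
  genCircle-size : ∀ G → Nontrivial G → (∑[ z ∈ plane ] ⟦ z lies-on? G ⟧) ≤ p * 2
  genCircle-size G@(genCircle k (b₁ , b₂) c) nontrivial = go ((k ≟ 𝟘) ×-dec (b₂ ≟ 𝟘))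
    where
    open ℕₚ.≤-Reasoning
    in-x : ∀ x y → k ≡ 𝟘 → b₂ ≡ 𝟘 → ev (c ∷ b₁ ∷ 𝟘 ∷ []) x ≡ value G (x , y)
    in-x x y refl refl = trans (cong (λ o → c ⊕ x ⊗ (b₁ ⊕ x ⊗ (o ⊕ x ⊗ o))) (sym fromℤ-0)) (trans
      (solve 4 (λ x y b c → c :+ x :* (b :+ x :* (con ℤ.0ℤ :+ x :* con ℤ.0ℤ)) := con ℤ.0ℤ :* (x :* x :+ y :* y) :+ (b :* x :+ con ℤ.0ℤ :* y) :+ c) refl x y b₁ c)
      (cong (λ o → o ⊗ (x ⊗ x ⊕ y ⊗ y) ⊕ (b₁ ⊗ x ⊕ o ⊗ y) ⊕ c) fromℤ-0))
    in-y : ∀ x y → ev (k ⊗ (x ⊗ x) ⊕ b₁ ⊗ x ⊕ c ∷ b₂ ∷ k ∷ []) y ≡ value G (x , y)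
    in-y x y = trans (cong (λ o → k ⊗ (x ⊗ x) ⊕ b₁ ⊗ x ⊕ c ⊕ y ⊗ (b₂ ⊕ y ⊗ o)) (trans (cong (k ⊕_) (⊗-zeroʳ y)) (⊕-identityʳ k)))
      (solve 6 (λ k b b₂ c x y → k :* (x :* x) :+ b :* x :+ c :+ y :* (b₂ :+ y :* k) := k :* (x :* x :+ y :* y) :+ (b :* x :+ b₂ :* y) :+ c) refl k b₁ b₂ c x y)
    go : Dec (k ≡ 𝟘 × b₂ ≡ 𝟘) → (∑[ z ∈ plane ] ⟦ z lies-on? G ⟧) ≤ p * 2
    go (yes (k≡ , b≡)) = begin
      (∑[ z ∈ plane ] ⟦ z lies-on? G ⟧)                        ≡⟨ ∑-cartesianProduct elems elems _ ⟩
      (∑[ x ∈ elems ] ∑[ y ∈ elems ] ⟦ (x , y) lies-on? G ⟧)   ≡⟨ ∑-swap elems elems _ ⟩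
      (∑[ y ∈ elems ] ∑[ x ∈ elems ] ⟦ (x , y) lies-on? G ⟧)   ≤⟨ ∑-bound elems 2 (λ {y} _ → ℕₚ.≤-trans
          (∑-mono elems (λ {x} _ → ⟦⟧-mono ((x , y) lies-on? G) (ev (c ∷ b₁ ∷ 𝟘 ∷ []) x ≟ 𝟘) (trans (in-x x y k≡ b≡))))
          (quadratic-roots≤2 𝟘 b₁ c (λ (_ , b₁≡ , c≡) → nontrivial (k≡ , cong₂ _,_ b₁≡ b≡ , c≡)))) ⟩
      length elems * 2                                         ≡⟨ cong (_* 2) elems-length ⟩
      p * 2 ∎
    go (no nonzero) = begin
      (∑[ z ∈ plane ] ⟦ z lies-on? G ⟧)                        ≡⟨ ∑-cartesianProduct elems elems _ ⟩
      (∑[ x ∈ elems ] ∑[ y ∈ elems ] ⟦ (x , y) lies-on? G ⟧)   ≤⟨ ∑-bound elems 2 (λ {x} _ → ℕₚ.≤-trans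
          (∑-mono elems (λ {y} _ → ⟦⟧-mono ((x , y) lies-on? G) (ev (k ⊗ (x ⊗ x) ⊕ b₁ ⊗ x ⊕ c ∷ b₂ ∷ k ∷ []) y ≟ 𝟘) (trans (in-y x y))))
          (quadratic-roots≤2 k b₂ (k ⊗ (x ⊗ x) ⊕ b₁ ⊗ x ⊕ c) (λ (k≡ , b≡ , _) → nonzero (k≡ , b≡)))) ⟩
      length elems * 2                                         ≡⟨ cong (_* 2) elems-length ⟩
      p * 2 ∎

  -- Subtracting κ times the equation of a circle about c from that of G leaves a line with normal n
  -- = 2κ c + ξ. As x lies on the nontrivial G, n = 0 is possible only if κ ≠ 0 and c is the centre
  -- of G.
  no-three-on-genCircle : ∀ G c x y z → Nontrivial G → ¬ (κ G ≢ 𝟘 × (two ⊗ κ G ⊗ proj₁ c ⊕ proj₁ (ξ G) , two ⊗ κ G ⊗ proj₂ c ⊕ proj₂ (ξ G)) ≡ (𝟘 , 𝟘)) →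
    x lies-on G → y lies-on G → z lies-on G → dist² x c ≡ dist² y c → dist² x c ≡ dist² z c → x ≢ y → x ≢ z → y ≢ z → ⊥
  no-three-on-genCircle G@(genCircle k (b₁ , b₂) e) c@(c₁ , c₂) x y z nontrivial general hx hy hz dy dz = no-three-on-normal n c x y z n≢ dy dz (orth y hy dy) (orth z hz dz)
    where
    n : Pt
    n = two ⊗ k ⊗ c₁ ⊕ b₁ , two ⊗ k ⊗ c₂ ⊕ b₂
    n≢ : n ≢ (𝟘 , 𝟘)
    n≢ q with k ≟ 𝟘
    ... | no k≢ = general (k≢ , q)
    ... | yes refl = nontrivial (refl , b≡ , trans (sym (trans (cong₂ (λ s t → s ⊕ t ⊕ e) (⊗-zeroˡ _)
              (trans (cong₂ (λ u v → u ⊗ proj₁ x ⊕ v ⊗ proj₂ x) (cong proj₁ b≡) (cong proj₂ b≡)) (trans (cong₂ _⊕_ (⊗-zeroˡ _) (⊗-zeroˡ _)) (⊕-identityˡ 𝟘))))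
              (trans (cong (_⊕ e) (⊕-identityˡ 𝟘)) (⊕-identityˡ e)))) hx)
      where
      kill : ∀ c b → two ⊗ 𝟘 ⊗ c ⊕ b ≡ b
      kill c b = trans (cong (_⊕ b) (trans (cong (_⊗ c) (⊗-zeroʳ two)) (⊗-zeroˡ c))) (⊕-identityˡ b)
      b≡ : (b₁ , b₂) ≡ (𝟘 , 𝟘)
      b≡ = cong₂ _,_ (trans (sym (kill c₁ b₁)) (cong proj₁ q)) (trans (sym (kill c₂ b₂)) (cong proj₂ q))
    orth : ∀ w → w lies-on G → dist² x c ≡ dist² w c → n ∙ (w -ᴾ x) ≡ 𝟘
    orth w hw dw = trans (identity k b₁ b₂ e c₁ c₂ (proj₁ x) (proj₂ x) (proj₁ w) (proj₂ w))
      (trans (cong₂ _⊕_ (trans (cong₂ _⊖_ hw hx) (⊖-self 𝟘)) (trans (cong (k ⊗_) (≡⇒⊖≡𝟘 dw)) (⊗-zeroʳ k))) (⊕-identityˡ 𝟘))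
      where
      identity : ∀ k b₁ b₂ e c₁ c₂ s t u v → (two ⊗ k ⊗ c₁ ⊕ b₁) ⊗ (u ⊖ s) ⊕ (two ⊗ k ⊗ c₂ ⊕ b₂) ⊗ (v ⊖ t) ≡
        ((k ⊗ (u ⊗ u ⊕ v ⊗ v) ⊕ (b₁ ⊗ u ⊕ b₂ ⊗ v) ⊕ e) ⊖ (k ⊗ (s ⊗ s ⊕ t ⊗ t) ⊕ (b₁ ⊗ s ⊕ b₂ ⊗ t) ⊕ e))
        ⊕ k ⊗ (((s ⊖ c₁) ⊗ (s ⊖ c₁) ⊕ (t ⊖ c₂) ⊗ (t ⊖ c₂)) ⊖ ((u ⊖ c₁) ⊗ (u ⊖ c₁) ⊕ (v ⊖ c₂) ⊗ (v ⊖ c₂)))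
      identity = solve 10 (λ k b₁ b₂ e c₁ c₂ s t u v → (con (ℤ.+ 2) :* k :* c₁ :+ b₁) :* (u :- s) :+ (con (ℤ.+ 2) :* k :* c₂ :+ b₂) :* (v :- t) :=
        ((k :* (u :* u :+ v :* v) :+ (b₁ :* u :+ b₂ :* v) :+ e) :- (k :* (s :* s :+ t :* t) :+ (b₁ :* s :+ b₂ :* t) :+ e))
        :+ k :* (((s :- c₁) :* (s :- c₁) :+ (t :- c₂) :* (t :- c₂)) :- ((u :- c₁) :* (u :- c₁) :+ (v :- c₂) :* (v :- c₂)))) refl

-- Mirror images and half-angle coordinates

module Frames (𝔽 : Field) where
  open Counting
  open FieldTheory 𝔽
  open Plane 𝔽

  infixl 7 _✶_
  infixl 6 _+ᴾ_
  -- ✶ is the multiplication of F(i), with (a , b) standing for a + b i.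
  _✶_ _+ᴾ_ : Pt → Pt → Pt
  (a , b) ✶ (c , d) = a ⊗ c ⊖ b ⊗ d , a ⊗ d ⊕ b ⊗ c
  (a , b) +ᴾ (c , d) = a ⊕ c , b ⊕ d

  conj : Pt → Pt
  conj (a , b) = a , ⊝ b

  -- Complex arithmetic on pairs of solver expressions.
  private
    ℂ : ℕ → Set
    ℂ n = Polynomial n × Polynomial n
    _·_ _∔_ : ∀ {n} → ℂ n → ℂ n → ℂ n
    (a , b) · (c , d) = a :* c :- b :* d , a :* d :+ b :* c
    (a , b) ∔ (c , d) = a :+ c , b :+ d
    bar : ∀ {n} → ℂ n → ℂ n
    bar (a , b) = a , :- b
    _-ℂ_ : ∀ {n} → ℂ n → ℂ n → ℂ n
    (a , b) -ℂ (c , d) = a :- c , b :- d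
    inner outer : ∀ {n} → ℂ n → ℂ n → Polynomial n
    inner (a , b) (c , d) = a :* c :+ b :* d
    outer (a , b) (c , d) = a :* d :- b :* c
    infixl 7 _·_
    infixl 6 _∔_ _-ℂ_

  nrm-✶ : ∀ z w → nrm (z ✶ w) ≡ nrm z ⊗ nrm w
  nrm-✶ (a , b) (c , d) = solve 4 (λ a b c d → let z = (a , b) ; w = (c , d) in inner (z · w) (z · w) := inner z z :* inner w w) refl a b c d

  nrm-conj : ∀ z → nrm (conj z) ≡ nrm z
  nrm-conj (a , b) = solve 2 (λ a b → a :* a :+ (:- b) :* (:- b) := a :* a :+ b :* b) refl a b

  nrm-origin : nrm (𝟘 , 𝟘) ≡ 𝟘
  nrm-origin = trans (cong₂ _⊕_ (⊗-zeroˡ 𝟘) (⊗-zeroˡ 𝟘)) (⊕-identityˡ 𝟘)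

  nrm≢𝟘 : ∀ {z} → z ≢ (𝟘 , 𝟘) → nrm z ≢ 𝟘
  nrm≢𝟘 z≢ = z≢ ∘ nrm≡𝟘 _

  nrm≢𝟘⇒ : ∀ {z} → nrm z ≢ 𝟘 → z ≢ (𝟘 , 𝟘)
  nrm≢𝟘⇒ h refl = h nrm-origin

  ✶≢𝟘 : ∀ {z w} → z ≢ (𝟘 , 𝟘) → w ≢ (𝟘 , 𝟘) → z ✶ w ≢ (𝟘 , 𝟘)
  ✶≢𝟘 {z} {w} z≢ w≢ = nrm≢𝟘⇒ (λ h → ⊗≢𝟘 (nrm≢𝟘 z≢) (nrm≢𝟘 w≢) (trans (sym (nrm-✶ z w)) h))

  conj≢𝟘 : ∀ {z} → z ≢ (𝟘 , 𝟘) → conj z ≢ (𝟘 , 𝟘)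
  conj≢𝟘 {z} z≢ = nrm≢𝟘⇒ (λ h → nrm≢𝟘 z≢ (trans (sym (nrm-conj z)) h))

  -- The reflection in the perpendicular bisector of a b maps a′ to b′.
  Mirror : Pt → Pt → Pt → Pt → Set
  Mirror a b a′ b′ = ∃[ k ] b′ ≡ (proj₁ a′ ⊕ k ⊗ proj₁ (b -ᴾ a) , proj₂ a′ ⊕ k ⊗ proj₂ (b -ᴾ a)) ×
                            k ⊗ nrm (b -ᴾ a) ≡ nrm (b -ᴾ a) ⊖ two ⊗ ((a′ -ᴾ a) ∙ (b -ᴾ a))

  mirror-dist² : ∀ {a b a′ b′} → Mirror a b a′ b′ → dist² a′ a ≡ dist² b′ b
  mirror-dist² {a₁ , a₂} {b₁ , b₂} {a₁′ , a₂′} (k , refl , hk) = sym (⊖≡𝟘⇒≡ (trans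
    (solve 7 (λ a₁ a₂ b₁ b₂ u v k →
      let n = (b₁ :- a₁ , b₂ :- a₂) ; w = (u :- a₁ , v :- a₂) ; w′ = ((u :+ k :* (b₁ :- a₁)) :- b₁ , (v :+ k :* (b₂ :- a₂)) :- b₂) in
      inner w′ w′ :- inner w w := (k :- con ℤ.1ℤ) :* (k :* inner n n :- (inner n n :- con (ℤ.+ 2) :* inner w n))) refl a₁ a₂ b₁ b₂ a₁′ a₂′ k)
    (trans (cong ((k ⊖ fromℤ ℤ.1ℤ) ⊗_) (≡⇒⊖≡𝟘 hk)) (⊗-zeroʳ _))))

  mirror-unique-image : ∀ {a b a′ b′ b″} → a ≢ b → Mirror a b a′ b′ → Mirror a b a′ b″ → b′ ≡ b″
  mirror-unique-image {a} {b} {a′} a≢b (k , refl , hk) (k′ , refl , hk′) = cong (λ k → proj₁ a′ ⊕ k ⊗ proj₁ (b -ᴾ a) , proj₂ a′ ⊕ k ⊗ proj₂ (b -ᴾ a))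
    (⊗-cancelˡ {nrm (b -ᴾ a)} (λ h → a≢b (sym (dist²≡𝟘 h))) (trans (⊗-comm _ k) (trans hk (trans (sym hk′) (⊗-comm k′ _)))))

  mirror-unique-source : ∀ {a b a′ a″ b′} → a ≢ b → Mirror a b a′ b′ → Mirror a b a″ b′ → a′ ≡ a″
  mirror-unique-source {a} {b} {a′} {a″} a≢b (k , refl , hk) (k′ , q , hk′) = cong₂ _,_ (cancel (cong proj₁ q)) (cancel (cong proj₂ q))
    where
    N : F
    N = nrm (b -ᴾ a)
    -- both factors solve N k = 2 (b′ - a)·(b - a) - N
    factor : ∀ k′ a″ → k′ ⊗ N ≡ N ⊖ two ⊗ ((a″ -ᴾ a) ∙ (b -ᴾ a)) →
             N ⊗ k′ ≡ two ⊗ (((proj₁ a″ ⊕ k′ ⊗ proj₁ (b -ᴾ a) , proj₂ a″ ⊕ k′ ⊗ proj₂ (b -ᴾ a)) -ᴾ a) ∙ (b -ᴾ a)) ⊖ N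
    factor k′ (u , v) h = ⊖≡𝟘⇒≡ (trans (solve 7 (λ a₁ a₂ b₁ b₂ u v k →
        let n = (b₁ :- a₁ , b₂ :- a₂) ; w = (u :- a₁ , v :- a₂) ; w′ = ((u :+ k :* (b₁ :- a₁)) :- a₁ , (v :+ k :* (b₂ :- a₂)) :- a₂) in
        inner n n :* k :- (con (ℤ.+ 2) :* inner w′ n :- inner n n) := :- (k :* inner n n :- (inner n n :- con (ℤ.+ 2) :* inner w n))) refl
        (proj₁ a) (proj₂ a) (proj₁ b) (proj₂ b) u v k′) (trans (cong ⊝_ (≡⇒⊖≡𝟘 h)) (trans (sym (⊕-identityˡ _)) (⊖-self 𝟘))))
    k≡k′ : k ≡ k′
    k≡k′ = ⊗-cancelˡ {N} (λ h → a≢b (sym (dist²≡𝟘 h))) (trans (factor k a′ hk) (trans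
      (cong (λ z → two ⊗ ((z -ᴾ a) ∙ (b -ᴾ a)) ⊖ N) q) (sym (factor k′ a″ hk′))))
    cancel : ∀ {x y n} → x ⊕ k ⊗ n ≡ y ⊕ k′ ⊗ n → x ≡ y
    cancel {x} {y} {n} h = trans (solve 2 (λ x m → x := x :+ m :- m) refl x (k ⊗ n)) (trans (cong₂ _⊖_ h (cong (_⊗ n) k≡k′))
      (solve 2 (λ y m → y :+ m :- m := y) refl y (k′ ⊗ n)))

  -- A vector w of the same norm as e is (g / conj g) e for a half-angle vector g.
  Half : Pt → Pt → Pt → Set
  Half e g w = g ✶ e ≡ conj g ✶ w

  module _ (e : Pt) (e≢ : e ≢ (𝟘 , 𝟘)) where

    -- For |w| = |e| the sum e + w halves the angle, and (e + w) conj e divided by its conjugate is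
    -- w / e. The formula degenerates at w = -e, where w / e = -1 = i / conj i.
    half : Pt → Pt
    half w with e +ᴾ w ≟ᴾ (𝟘 , 𝟘)
    ... | yes _ = 𝟘 , 𝟙
    ... | no  _ = (e +ᴾ w) ✶ conj e

    half≢𝟘 : ∀ w → half w ≢ (𝟘 , 𝟘)
    half≢𝟘 w with e +ᴾ w ≟ᴾ (𝟘 , 𝟘)
    ... | yes _ = λ q → 𝟙≢𝟘 (cong proj₂ q)
    ... | no  h = ✶≢𝟘 h (conj≢𝟘 e≢)

    half-spec : ∀ w → nrm w ≡ nrm e → Half e (half w) w
    half-spec w@(w₁ , w₂) h with e +ᴾ w ≟ᴾ (𝟘 , 𝟘)
    ... | no _ = cong₂ _,_
          (⊖≡𝟘⇒≡ (trans (solve 4 (λ a b c d → let e = (a , b) ; w = (c , d) ; g = (e ∔ w) · bar e in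
             proj₁ (g · e) :- proj₁ (bar g · w) := a :* (inner e e :- inner w w)) refl (proj₁ e) (proj₂ e) w₁ w₂) (vanish (proj₁ e))))
          (⊖≡𝟘⇒≡ (trans (solve 4 (λ a b c d → let e = (a , b) ; w = (c , d) ; g = (e ∔ w) · bar e in
             proj₂ (g · e) :- proj₂ (bar g · w) := b :* (inner e e :- inner w w)) refl (proj₁ e) (proj₂ e) w₁ w₂) (vanish (proj₂ e))))
      where
      vanish : ∀ x → x ⊗ (nrm e ⊖ nrm w) ≡ 𝟘
      vanish x = trans (cong (x ⊗_) (≡⇒⊖≡𝟘 (sym h))) (⊗-zeroʳ x)
    ... | yes q = cong₂ _,_
          (⊖≡𝟘⇒≡ (trans (solve 6 (λ a b c d z u → (z :* a :- u :* b) :- (z :* c :- (:- u) :* d) := z :* (a :- c) :- u :* (b :+ d)) refl (proj₁ e) (proj₂ e) w₁ w₂ 𝟘 𝟙)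
             (trans (cong₂ (λ s t → s ⊖ 𝟙 ⊗ t) (⊗-zeroˡ _) (cong proj₂ q)) (trans (cong (λ t → 𝟘 ⊖ t) (⊗-zeroʳ 𝟙)) (⊖-self 𝟘)))))
          (⊖≡𝟘⇒≡ (trans (solve 6 (λ a b c d z u → (z :* b :+ u :* a) :- (z :* d :+ (:- u) :* c) := z :* (b :- d) :+ u :* (a :+ c)) refl (proj₁ e) (proj₂ e) w₁ w₂ 𝟘 𝟙)
             (trans (cong₂ (λ s t → s ⊕ 𝟙 ⊗ t) (⊗-zeroˡ _) (cong proj₁ q)) (trans (cong (λ t → 𝟘 ⊕ t) (⊗-zeroʳ 𝟙)) (⊕-identityˡ 𝟘)))))

    -- Coordinates relative to an origin x of the point a with half-angle vector g.
    H : Pt → Pt → Pt → Pt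
    H x a g = (a -ᴾ x) ✶ conj (g ✶ e)

    -- Write n = b - a and z* for conj z. The reflection turns w = a′ - a into w′ = b′ - b with w′
    -- n* + n w* = 0. Inserting w = g e / g* and w′ = g′ e / g′* gives Re (n g* g′* e*) = 0, and
    -- this real part is the difference of the two sides. The condition is a symplectic form in the
    -- vectors (g , H x a g) and (g′ , H x b g′) of F⁴.
    symplectic : ∀ x {a b a′ b′} g g′ → Mirror a b a′ b′ → Half e g (a′ -ᴾ a) → Half e g′ (b′ -ᴾ b) →
                 g ∙ H x b g′ ≡ g′ ∙ H x a g
    symplectic x@(x₁ , x₂) {a@(a₁ , a₂)} {b@(b₁ , b₂)} {a′@(u₁ , u₂)} {b′} g@(g₁ , g₂) g′@(g₁′ , g₂′) (k , refl , hk) hg hg′ = ⊖≡𝟘⇒≡ (⊗≡𝟘 two _ (begin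
        two ⊗ (g ∙ H x b g′ ⊖ g′ ∙ H x a g)
          ≡⟨ solve 12 (λ x₁ x₂ a₁ a₂ b₁ b₂ g₁ g₂ h₁ h₂ e₁ e₂ →
               let x = (x₁ , x₂) ; a = (a₁ , a₂) ; b = (b₁ , b₂) ; g = (g₁ , g₂) ; h = (h₁ , h₂) ; e = (e₁ , e₂) in
               con (ℤ.+ 2) :* (inner g ((b -ℂ x) · bar (h · e)) :- inner h ((a -ℂ x) · bar (g · e)))
               := con (ℤ.+ 2) :* proj₁ ((b -ℂ a) · bar g · bar h · bar e)) refl x₁ x₂ a₁ a₂ b₁ b₂ g₁ g₂ g₁′ g₂′ (proj₁ e) (proj₂ e) ⟩
        two ⊗ proj₁ (n ✶ conj g ✶ conj g′ ✶ conj e)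
          ≡⟨ solve 12 (λ n₁ n₂ g₁ g₂ h₁ h₂ e₁ e₂ w₁ w₂ v₁ v₂ →
               let n = (n₁ , n₂) ; g = (g₁ , g₂) ; h = (h₁ , h₂) ; e = (e₁ , e₂) ; w = (w₁ , w₂) ; v = (v₁ , v₂) in
               con (ℤ.+ 2) :* proj₁ (n · bar g · bar h · bar e) :=
                 proj₁ (bar n · g · ((h · e) -ℂ (bar h · v))) :+ proj₁ (g · bar h · (v · bar n ∔ n · bar w)) :+ proj₁ (n · bar h · bar ((g · e) -ℂ (bar g · w))))
               refl (proj₁ n) (proj₂ n) g₁ g₂ g₁′ g₂′ (proj₁ e) (proj₂ e) (proj₁ w) (proj₂ w) (proj₁ w′) (proj₂ w′) ⟩
        proj₁ (conj n ✶ g ✶ ((g′ ✶ e) -ᴾ (conj g′ ✶ w′))) ⊕ proj₁ (g ✶ conj g′ ✶ (w′ ✶ conj n +ᴾ n ✶ conj w)) ⊕ proj₁ (n ✶ conj g′ ✶ conj ((g ✶ e) -ᴾ (conj g ✶ w)))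
          ≡⟨ cong₂ _⊕_ (cong₂ _⊕_ (cong (λ z → proj₁ (conj n ✶ g ✶ z)) (self hg′)) (cong (λ z → proj₁ (g ✶ conj g′ ✶ z)) reflected))
               (cong (λ z → proj₁ (n ✶ conj g′ ✶ conj z)) (self hg)) ⟩
        proj₁ (conj n ✶ g ✶ (𝟘 , 𝟘)) ⊕ proj₁ (g ✶ conj g′ ✶ (𝟘 , 𝟘)) ⊕ proj₁ (n ✶ conj g′ ✶ conj (𝟘 , 𝟘))
          ≡⟨ cong₂ _⊕_ (cong₂ _⊕_ (zero-product (conj n ✶ g)) (zero-product (g ✶ conj g′)))
               (trans (cong (λ z → proj₁ (n ✶ conj g′ ✶ (𝟘 , z))) neg-zero) (zero-product (n ✶ conj g′))) ⟩
        𝟘 ⊕ 𝟘 ⊕ 𝟘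
          ≡⟨ trans (cong (_⊕ 𝟘) (⊕-identityˡ 𝟘)) (⊕-identityˡ 𝟘) ⟩
        𝟘 ∎) two≢𝟘)
      where
      open ≡-Reasoning
      n w w′ : Pt
      n = b -ᴾ a
      w = a′ -ᴾ a
      w′ = b′ -ᴾ b
      neg-zero : ⊝ 𝟘 ≡ 𝟘
      neg-zero = trans (sym (⊕-identityˡ _)) (⊖-self 𝟘)
      self : ∀ {y z : Pt} → y ≡ z → y -ᴾ z ≡ (𝟘 , 𝟘)
      self refl = cong₂ _,_ (⊖-self _) (⊖-self _)
      zero-product : ∀ z → proj₁ (z ✶ (𝟘 , 𝟘)) ≡ 𝟘
      zero-product z = trans (cong₂ _⊖_ (⊗-zeroʳ _) (⊗-zeroʳ _)) (⊖-self 𝟘)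
      reflected : w′ ✶ conj n +ᴾ n ✶ conj w ≡ (𝟘 , 𝟘)
      reflected = cong₂ _,_
        (trans (solve 7 (λ a₁ a₂ b₁ b₂ u v k →
          let n = (b₁ :- a₁ , b₂ :- a₂) ; w = (u :- a₁ , v :- a₂) ; w′ = ((u :+ k :* (b₁ :- a₁)) :- b₁ , (v :+ k :* (b₂ :- a₂)) :- b₂) in
          proj₁ (w′ · bar n ∔ n · bar w) := k :* inner n n :- (inner n n :- con (ℤ.+ 2) :* inner w n)) refl a₁ a₂ b₁ b₂ u₁ u₂ k) (≡⇒⊖≡𝟘 hk))
        (trans (solve 7 (λ a₁ a₂ b₁ b₂ u v k →
          let n = (b₁ :- a₁ , b₂ :- a₂) ; w = (u :- a₁ , v :- a₂) ; w′ = ((u :+ k :* (b₁ :- a₁)) :- b₁ , (v :+ k :* (b₂ :- a₂)) :- b₂) in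
          proj₂ (w′ · bar n ∔ n · bar w) := con ℤ.0ℤ) refl a₁ a₂ b₁ b₂ u₁ u₂ k) fromℤ-0)

    g✶e≢𝟘 : ∀ {g} → g ≢ (𝟘 , 𝟘) → conj (g ✶ e) ≢ (𝟘 , 𝟘)
    g✶e≢𝟘 g≢ = conj≢𝟘 (✶≢𝟘 g≢ e≢)

    -- The origins x for which the first coordinate of H x a g vanishes.
    badLine : Pt → Pt → GenCircle
    badLine a g = let c = conj (g ✶ e) in genCircle 𝟘 (⊝ proj₁ c , proj₂ c) (proj₁ a ⊗ proj₁ c ⊖ proj₂ a ⊗ proj₂ c)

    badLine-value : ∀ x a g → value (badLine a g) x ≡ proj₁ (H x a g)
    badLine-value (x , y) (a , b) g = trans (cong (λ o → o ⊗ (x ⊗ x ⊕ y ⊗ y) ⊕ ((⊝ proj₁ c) ⊗ x ⊕ proj₂ c ⊗ y) ⊕ (a ⊗ proj₁ c ⊖ b ⊗ proj₂ c)) (sym fromℤ-0))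
      (solve 6 (λ x y a b c d → con ℤ.0ℤ :* (x :* x :+ y :* y) :+ ((:- c) :* x :+ d :* y) :+ (a :* c :- b :* d) := (a :- x) :* c :- (b :- y) :* d) refl x y a b (proj₁ c) (proj₂ c))
      where
      c : Pt
      c = conj (g ✶ e)

    badLine-nontrivial : ∀ a {g} → g ≢ (𝟘 , 𝟘) → Nontrivial (badLine a g)
    badLine-nontrivial a {g} g≢ (_ , ξ≡ , _) = g✶e≢𝟘 g≢ (cong₂ _,_ (trans (sym (neg-neg _)) (trans (cong ⊝_ (cong proj₁ ξ≡)) neg-zero)) (cong proj₂ ξ≡))
      where
      neg-zero : ⊝ 𝟘 ≡ 𝟘
      neg-zero = trans (sym (⊕-identityˡ _)) (⊖-self 𝟘)
      neg-neg : ∀ x → ⊝ (⊝ x) ≡ x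
      neg-neg = solve 1 (λ x → :- (:- x) := x) refl

    -- The origins x for which H x a g and H x a″ g″ are parallel.
    conflictCircle : Pt → Pt → Pt → Pt → GenCircle
    conflictCircle a a″ g g″ = let z = conj (conj (g ✶ e)) ✶ conj (g″ ✶ e) in genCircle (proj₂ z)
      ( proj₁ z ⊗ (proj₂ a ⊖ proj₂ a″) ⊖ proj₂ z ⊗ (proj₁ a ⊕ proj₁ a″) , proj₁ z ⊗ (proj₁ a″ ⊖ proj₁ a) ⊖ proj₂ z ⊗ (proj₂ a ⊕ proj₂ a″))
      (proj₂ z ⊗ (a ∙ a″) ⊕ proj₁ z ⊗ (a ⨯ a″))

    conflictCircle-value : ∀ x a a″ g g″ → value (conflictCircle a a″ g g″) x ≡ H x a g ⨯ H x a″ g″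
    conflictCircle-value (x , y) (a , b) (a″ , b″) g g″ = solve 10 (λ x y a b s t c d u v →
        let p = (x , y) ; q = (a , b) ; r = (s , t) ; c₁ = (c , d) ; c₂ = (u , v) ; z = bar c₁ · c₂ in
        proj₂ z :* inner p p :+ ((proj₁ z :* (b :- t) :- proj₂ z :* (a :+ s)) :* x :+ (proj₁ z :* (s :- a) :- proj₂ z :* (b :+ t)) :* y) :+ (proj₂ z :* inner q r :+ proj₁ z :* outer q r)
        := outer ((q -ℂ p) · c₁) ((r -ℂ p) · c₂)) refl x y a b a″ b″ (proj₁ c) (proj₂ c) (proj₁ c″) (proj₂ c″)
      where
      c c″ : Pt
      c = conj (g ✶ e)
      c″ = conj (g″ ✶ e)

    conflictCircle-nontrivial : ∀ {a a″ g g″} → a ≢ a″ → g ≢ (𝟘 , 𝟘) → g″ ≢ (𝟘 , 𝟘) → Nontrivial (conflictCircle a a″ g g″)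
    conflictCircle-nontrivial {a} {a″} {g} {g″} a≢ g≢ g″≢ (κ≡ , ξ≡ , _) = a≢ (cong₂ _,_ first second)
      where
      z : Pt
      z = conj (conj (g ✶ e)) ✶ conj (g″ ✶ e)
      z₁≢𝟘 : proj₁ z ≢ 𝟘
      z₁≢𝟘 q = ✶≢𝟘 (conj≢𝟘 (g✶e≢𝟘 g≢)) (g✶e≢𝟘 g″≢) (cong₂ _,_ q κ≡)
      drop : ∀ s t → proj₁ z ⊗ s ⊖ proj₂ z ⊗ t ≡ 𝟘 → s ≡ 𝟘
      drop s t h = ⊗≡𝟘 (proj₁ z) s (trans (solve 2 (λ m n → m := m :- n :+ n) refl (proj₁ z ⊗ s) (proj₂ z ⊗ t))
        (trans (cong₂ (λ i j → i ⊕ j ⊗ t) h κ≡) (trans (⊕-identityˡ _) (⊗-zeroˡ t)))) z₁≢𝟘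
      first : proj₁ a ≡ proj₁ a″
      first = sym (⊖≡𝟘⇒≡ (drop _ _ (cong proj₂ ξ≡)))
      second : proj₂ a ≡ proj₂ a″
      second = ⊖≡𝟘⇒≡ (drop _ _ (cong proj₁ ξ≡))

    -- The points whose coordinates lie on the line A = γ m + δ, C = γ₂ m + δ₂.
    regulusCircle : Pt → F → F → F → F → GenCircle
    regulusCircle x γ δ γ₂ δ₂ = genCircle l (proj₁ ν ⊖ two ⊗ l ⊗ proj₁ x , proj₂ ν ⊖ two ⊗ l ⊗ proj₂ x) (l ⊗ nrm x ⊖ ν ∙ x ⊕ 𝟙)
      where
      l : F
      l = (δ₂ ⊗ γ ⊖ δ ⊗ γ₂) ⊗ nrm e
      ν : Pt
      ν = (γ ⊕ δ₂ , γ₂ ⊖ δ) ✶ e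

    -- At the origin x the equation takes the value 1.
    regulusCircle-nontrivial : ∀ x γ δ γ₂ δ₂ → Nontrivial (regulusCircle x γ δ γ₂ δ₂)
    regulusCircle-nontrivial x@(x₁ , x₂) γ δ γ₂ δ₂ (l≡ , ξ≡ , η≡) = 𝟙≢𝟘 (trans (solve 8 (λ l n₁ n₂ x₁ x₂ o t z → o := (l :* (x₁ :* x₁ :+ x₂ :* x₂) :- (n₁ :* x₁ :+ n₂ :* x₂) :+ o)
            :+ ((n₁ :- con (ℤ.+ 2) :* l :* x₁) :* x₁ :+ (n₂ :- con (ℤ.+ 2) :* l :* x₂) :* x₂) :+ l :* (x₁ :* x₁ :+ x₂ :* x₂)) refl l (proj₁ ν) (proj₂ ν) x₁ x₂ 𝟙 𝟘 𝟘)
        (trans (cong₂ _⊕_ (cong₂ _⊕_ η≡ (cong₂ (λ s t → s ⊗ x₁ ⊕ t ⊗ x₂) (cong proj₁ ξ≡) (cong proj₂ ξ≡))) (cong (_⊗ nrm x) l≡))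
          (trans (cong₂ _⊕_ (trans (⊕-identityˡ _) (trans (cong₂ _⊕_ (⊗-zeroˡ x₁) (⊗-zeroˡ x₂)) (⊕-identityˡ 𝟘))) (⊗-zeroˡ _)) (⊕-identityˡ 𝟘))))
      where
      l : F
      l = (δ₂ ⊗ γ ⊖ δ ⊗ γ₂) ⊗ nrm e
      ν : Pt
      ν = (γ ⊕ δ₂ , γ₂ ⊖ δ) ✶ e

    -- With β = (b - x) conj e the coordinate H is β conj g. Division by H₀ gives 1 = β₁ A - β₀ C
    -- and m = -β₁ C - β₀ A; the affine formulas for A and C turn this into 1 = m P + Q and m S′ =
    -- -R. Eliminating m leaves (1 - Q) S′ + P R = 0, in which the mixed quadratic terms cancel and
    -- a multiple of |β|² remains.
    regulusCircle-∋ : ∀ x b g γ δ γ₂ δ₂ A C m → proj₁ (H x b g) ≢ 𝟘 → let H₀ = proj₁ (H x b g) in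
      proj₂ g ≡ H₀ ⊗ A → proj₁ g ≡ ⊝ (H₀ ⊗ C) → proj₂ (H x b g) ≡ H₀ ⊗ m → A ≡ γ ⊗ m ⊕ δ → C ≡ γ₂ ⊗ m ⊕ δ₂ →
      b lies-on regulusCircle x γ δ γ₂ δ₂
    regulusCircle-∋ x b g γ δ γ₂ δ₂ A C m H₀≢ gA gC Hm A≡ C≡ = trans shape (trans (cong (_⊕ P ⊗ R) product) (trans
        (cong (λ z → P ⊗ z ⊕ P ⊗ R) (trans eq₂ refl)) (trans (solve 2 (λ p r → p :* (:- r) :+ p :* r := con ℤ.0ℤ) refl P R) fromℤ-0)))
      where
      H₀ β₀ β₁ P Q R S′ : F
      H₀ = proj₁ (H x b g)
      β₀ = proj₁ ((b -ᴾ x) ✶ conj e)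
      β₁ = proj₂ ((b -ᴾ x) ✶ conj e)
      P = γ ⊗ β₁ ⊖ γ₂ ⊗ β₀
      Q = δ ⊗ β₁ ⊖ δ₂ ⊗ β₀
      R = δ₂ ⊗ β₁ ⊕ δ ⊗ β₀
      S′ = 𝟙 ⊕ γ₂ ⊗ β₁ ⊕ γ ⊗ β₀
      H₀-form : H₀ ≡ β₀ ⊗ proj₁ g ⊕ β₁ ⊗ proj₂ g
      H₀-form = solve 8 (λ b₁ b₂ x₁ x₂ g₁ g₂ e₁ e₂ → let u = (b₁ , b₂) -ℂ (x₁ , x₂) ; g = (g₁ , g₂) ; e = (e₁ , e₂) ; β = u · bar e in
        proj₁ (u · bar (g · e)) := proj₁ β :* g₁ :+ proj₂ β :* g₂) refl (proj₁ b) (proj₂ b) (proj₁ x) (proj₂ x) (proj₁ g) (proj₂ g) (proj₁ e) (proj₂ e)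
      H₁-form : proj₂ (H x b g) ≡ β₁ ⊗ proj₁ g ⊖ β₀ ⊗ proj₂ g
      H₁-form = solve 8 (λ b₁ b₂ x₁ x₂ g₁ g₂ e₁ e₂ → let u = (b₁ , b₂) -ℂ (x₁ , x₂) ; g = (g₁ , g₂) ; e = (e₁ , e₂) ; β = u · bar e in
        proj₂ (u · bar (g · e)) := proj₂ β :* g₁ :- proj₁ β :* g₂) refl (proj₁ b) (proj₂ b) (proj₁ x) (proj₂ x) (proj₁ g) (proj₂ g) (proj₁ e) (proj₂ e)
      eq₁ : 𝟙 ≡ m ⊗ P ⊕ Q
      eq₁ = ⊗-cancelˡ H₀≢ (begin
        H₀ ⊗ 𝟙                                  ≡⟨ ⊗-identityʳ H₀ ⟩
        H₀                                      ≡⟨ H₀-form ⟩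
        β₀ ⊗ proj₁ g ⊕ β₁ ⊗ proj₂ g             ≡⟨ cong₂ (λ s t → β₀ ⊗ s ⊕ β₁ ⊗ t) (trans gC (cong (λ c → ⊝ (H₀ ⊗ c)) C≡)) (trans gA (cong (H₀ ⊗_) A≡)) ⟩
        β₀ ⊗ (⊝ (H₀ ⊗ (γ₂ ⊗ m ⊕ δ₂))) ⊕ β₁ ⊗ (H₀ ⊗ (γ ⊗ m ⊕ δ))
          ≡⟨ solve 8 (λ β₀ β₁ h γ δ γ₂ δ₂ m → β₀ :* (:- (h :* (γ₂ :* m :+ δ₂))) :+ β₁ :* (h :* (γ :* m :+ δ)) := h :* (m :* (γ :* β₁ :- γ₂ :* β₀) :+ (δ :* β₁ :- δ₂ :* β₀)))
               refl β₀ β₁ H₀ γ δ γ₂ δ₂ m ⟩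
        H₀ ⊗ (m ⊗ P ⊕ Q) ∎)
        where open ≡-Reasoning
      eq₂ : m ⊗ S′ ≡ ⊝ R
      eq₂ = ⊗-cancelˡ H₀≢ (begin
        H₀ ⊗ (m ⊗ S′)                           ≡⟨ cong (λ o → H₀ ⊗ (m ⊗ (o ⊕ γ₂ ⊗ β₁ ⊕ γ ⊗ β₀))) (sym fromℤ-1) ⟩
        H₀ ⊗ (m ⊗ (fromℤ ℤ.1ℤ ⊕ γ₂ ⊗ β₁ ⊕ γ ⊗ β₀))
          ≡⟨ solve 8 (λ β₀ β₁ h γ δ γ₂ δ₂ m → h :* (m :* (con ℤ.1ℤ :+ γ₂ :* β₁ :+ γ :* β₀)) :=
               h :* m :- (β₁ :* (:- (h :* (γ₂ :* m :+ δ₂))) :- β₀ :* (h :* (γ :* m :+ δ))) :+ h :* (:- (δ₂ :* β₁ :+ δ :* β₀))) refl β₀ β₁ H₀ γ δ γ₂ δ₂ m ⟩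
        H₀ ⊗ m ⊖ (β₁ ⊗ (⊝ (H₀ ⊗ (γ₂ ⊗ m ⊕ δ₂))) ⊖ β₀ ⊗ (H₀ ⊗ (γ ⊗ m ⊕ δ))) ⊕ H₀ ⊗ (⊝ R)
          ≡⟨ cong₂ (λ s t → H₀ ⊗ m ⊖ (β₁ ⊗ s ⊖ β₀ ⊗ t) ⊕ H₀ ⊗ (⊝ R)) (trans gC (cong (λ c → ⊝ (H₀ ⊗ c)) C≡)) (trans gA (cong (H₀ ⊗_) A≡)) ⟨
        H₀ ⊗ m ⊖ (β₁ ⊗ proj₁ g ⊖ β₀ ⊗ proj₂ g) ⊕ H₀ ⊗ (⊝ R)
          ≡⟨ cong (_⊕ H₀ ⊗ (⊝ R)) (trans (cong₂ _⊖_ (sym Hm) (sym H₁-form)) (⊖-self _)) ⟩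
        𝟘 ⊕ H₀ ⊗ (⊝ R)                          ≡⟨ ⊕-identityˡ _ ⟩
        H₀ ⊗ (⊝ R) ∎)
        where open ≡-Reasoning
      product : (𝟙 ⊖ Q) ⊗ S′ ≡ P ⊗ (m ⊗ S′)
      product = trans (cong (λ o → (o ⊖ Q) ⊗ S′) eq₁) (solve 4 (λ m P Q S → (m :* P :+ Q :- Q) :* S := P :* (m :* S)) refl m P Q S′)
      shape : value (regulusCircle x γ δ γ₂ δ₂) b ≡ (𝟙 ⊖ Q) ⊗ S′ ⊕ P ⊗ R
      shape = trans (cong (λ o → l ⊗ nrm b ⊕ ξ (regulusCircle x γ δ γ₂ δ₂) ∙ b ⊕ (l ⊗ nrm x ⊖ ν ∙ x ⊕ o)) (sym fromℤ-1)) (trans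
        (solve 10 (λ b₁ b₂ x₁ x₂ e₁ e₂ γ δ γ₂ δ₂ →
          let b = (b₁ , b₂) ; x = (x₁ , x₂) ; e = (e₁ , e₂) ; l = (δ₂ :* γ :- δ :* γ₂) :* inner e e ; ν = (γ :+ δ₂ , γ₂ :- δ) · e
              β = (b -ℂ x) · bar e ; β₀ = proj₁ β ; β₁ = proj₂ β in
          l :* inner b b :+ ((proj₁ ν :- con (ℤ.+ 2) :* l :* x₁) :* b₁ :+ (proj₂ ν :- con (ℤ.+ 2) :* l :* x₂) :* b₂) :+ (l :* inner x x :- inner ν x :+ con ℤ.1ℤ)
          := (con ℤ.1ℤ :- (δ :* β₁ :- δ₂ :* β₀)) :* (con ℤ.1ℤ :+ γ₂ :* β₁ :+ γ :* β₀) :+ (γ :* β₁ :- γ₂ :* β₀) :* (δ₂ :* β₁ :+ δ :* β₀))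
          refl (proj₁ b) (proj₂ b) (proj₁ x) (proj₂ x) (proj₁ e) (proj₂ e) γ δ γ₂ δ₂)
        (cong (λ o → (o ⊖ Q) ⊗ (o ⊕ γ₂ ⊗ β₁ ⊕ γ ⊗ β₀) ⊕ P ⊗ R) fromℤ-1))
        where
        l : F
        l = (δ₂ ⊗ γ ⊖ δ ⊗ γ₂) ⊗ nrm e
        ν : Pt
        ν = (γ ⊕ δ₂ , γ₂ ⊖ δ) ✶ e

-- Mirror pairs of segments and the choice of a generic origin

module Mirrors (𝔽 : Field) where
  open Counting
  open FieldTheory 𝔽
  open Plane 𝔽
  open Frames 𝔽
  open RedBlue 𝔽 using (Incident)

  Segment : Set
  Segment = Pt × Pt

  infix 4 _≟ˢ_
  _≟ˢ_ : DecidableEquality Segment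
  _≟ˢ_ = ×ₚ.≡-dec _≟ᴾ_ _≟ᴾ_

  mirror? : ∀ a b a′ b′ → Dec (Mirror a b a′ b′)
  mirror? a b a′ b′ = map′ (λ any → let (k , _ , h) = find any in k , h) (λ (k , h) → lose (elems-complete k) h)
    (Any.any? (λ k → (b′ ≟ᴾ (proj₁ a′ ⊕ k ⊗ proj₁ (b -ᴾ a) , proj₂ a′ ⊕ k ⊗ proj₂ (b -ᴾ a)))
       ×-dec (k ⊗ nrm (b -ᴾ a) ≟ nrm (b -ᴾ a) ⊖ two ⊗ ((a′ -ᴾ a) ∙ (b -ᴾ a)))) elems)

  Mirrored : Segment → Segment → Set
  Mirrored (a , a′) (b , b′) = a ≢ b × Mirror a b a′ b′

  _mirrored?_ : ∀ r s → Dec (Mirrored r s)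
  (a , a′) mirrored? (b , b′) = ¬? (a ≟ᴾ b) ×-dec mirror? a b a′ b′

  vector : Segment → Pt
  vector (a , a′) = a′ -ᴾ a

  mirrored-sources : ∀ {r r″ s} → Mirrored r s → Mirrored r″ s → r ≢ r″ → proj₁ r ≢ proj₁ r″
  mirrored-sources {a , a′} {_ , a″} (a≢b , h) (_ , h″) r≢ refl = r≢ (cong (a ,_) (mirror-unique-source a≢b h h″))

  mirrored-images : ∀ {r s s″} → Mirrored r s → Mirrored r s″ → s ≢ s″ → proj₁ s ≢ proj₁ s″
  mirrored-images {r} {b , b′} (a≢b , h) (_ , h″) s≢ refl = s≢ (cong (b ,_) (mirror-unique-image a≢b h h″))

  pigeonhole : ∀ {X : Set} (xs : List X) (f : X → ℕ) (k : ℕ) → 0 < length xs → ∑ xs f ≤ length xs * k → ∃[ x ] f x ≤ k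
  pigeonhole (x ∷ xs) f k _ h with f x ℕ.≤? k
  ... | yes q = x , q
  pigeonhole (x ∷ []) f k _ h | no ¬q = contradiction (ℕₚ.≤-trans (ℕₚ.≤-reflexive (sym (ℕₚ.+-identityʳ _))) (ℕₚ.≤-trans h (ℕₚ.≤-reflexive (ℕₚ.+-identityʳ k)))) ¬q
  pigeonhole (x ∷ y ∷ ys) f k _ h | no ¬q = pigeonhole (y ∷ ys) f k (s≤s z≤n)
    (ℕₚ.+-cancelˡ-≤ k _ _ (ℕₚ.≤-trans (ℕₚ.+-monoˡ-≤ (∑ (y ∷ ys) f) (ℕₚ.<⇒≤ (ℕₚ.≰⇒> ¬q))) h))

  module _ (S : List Segment) (uS : Unique S) (e : Pt) (e≢ : e ≢ (𝟘 , 𝟘)) (same-norm : ∀ {s} → s ∈ S → nrm (vector s) ≡ nrm e)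
           (N : ℕ) (deg-out : ∀ {r} → r ∈ S → (∑[ s ∈ S ] ⟦ r mirrored? s ⟧) ≤ N)
           (deg-in : ∀ {s} → s ∈ S → (∑[ r ∈ S ] ⟦ r mirrored? s ⟧) ≤ N) where

    g : Segment → Pt
    g s = half e e≢ (vector s)

    g≢𝟘 : ∀ s → g s ≢ (𝟘 , 𝟘)
    g≢𝟘 s = half≢𝟘 e e≢ (vector s)

    h : Pt → Segment → Pt
    h x s = H e e≢ x (proj₁ s) (g s)

    bad : Segment → GenCircle
    bad s = badLine e e≢ (proj₁ s) (g s)

    conflict : Segment → Segment → GenCircle
    conflict r s = conflictCircle e e≢ (proj₁ r) (proj₁ s) (g r) (g s)

    ConflictR ConflictS : Pt → Segment → Segment → Segment → Set
    ConflictR x r s r″ = Mirrored r″ s × r ≢ r″ × x lies-on conflict r r″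
    ConflictS x r s s″ = Mirrored r s″ × s ≢ s″ × x lies-on conflict s s″

    conflictR? : ∀ x r s r″ → Dec (ConflictR x r s r″)
    conflictR? x r s r″ = (r″ mirrored? s) ×-dec ¬? (r ≟ˢ r″) ×-dec (x lies-on? conflict r r″)

    conflictS? : ∀ x r s s″ → Dec (ConflictS x r s s″)
    conflictS? x r s s″ = (r mirrored? s″) ×-dec ¬? (s ≟ˢ s″) ×-dec (x lies-on? conflict s s″)

    -- The cost measures what the origin x spoils for a mirror pair: possible coincidences of m
    -- among the segments mirrored to s or from r. A vanishing denominator is charged N, so that a
    -- cost of at most Δ < N excludes it.
    conflictsR conflictsS cost : Pt → Segment → Segment → ℕ
    conflictsR x r s = ∑[ r″ ∈ S ] ⟦ conflictR? x r s r″ ⟧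
    conflictsS x r s = ∑[ s″ ∈ S ] ⟦ conflictS? x r s s″ ⟧
    cost x r s = N * ⟦ x lies-on? bad r ⟧ + N * ⟦ x lies-on? bad s ⟧ + conflictsR x r s + conflictsS x r s

    I : ℕ
    I = ∑[ r ∈ S ] ∑[ s ∈ S ] ⟦ r mirrored? s ⟧

    -- Each of the four summands is at most 2Np: a line of at most 2p points with weight N, or at
    -- most N generalized circles of at most 2p points each.
    edge-cost : ∀ {r s} → r ∈ S → s ∈ S → Mirrored r s → (∑[ x ∈ plane ] cost x r s) ≤ 8 * (N * p)
    edge-cost {r} {s} r∈ s∈ rs = begin
      (∑[ x ∈ plane ] cost x r s)
        ≡⟨ trans (∑-+ plane (λ x → N * ⟦ x lies-on? bad r ⟧ + N * ⟦ x lies-on? bad s ⟧ + conflictsR x r s) (λ x → conflictsS x r s))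
             (cong (_+ (∑[ x ∈ plane ] conflictsS x r s)) (trans (∑-+ plane (λ x → N * ⟦ x lies-on? bad r ⟧ + N * ⟦ x lies-on? bad s ⟧) (λ x → conflictsR x r s))
               (cong (_+ (∑[ x ∈ plane ] conflictsR x r s)) (∑-+ plane (λ x → N * ⟦ x lies-on? bad r ⟧) (λ x → N * ⟦ x lies-on? bad s ⟧))))) ⟩
      (∑[ x ∈ plane ] N * ⟦ x lies-on? bad r ⟧) + (∑[ x ∈ plane ] N * ⟦ x lies-on? bad s ⟧) + (∑[ x ∈ plane ] conflictsR x r s) + (∑[ x ∈ plane ] conflictsS x r s)
        ≤⟨ ℕₚ.+-mono-≤ (ℕₚ.+-mono-≤ (ℕₚ.+-mono-≤ (line-cost r) (line-cost s)) costR) costS ⟩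
      N * (p * 2) + N * (p * 2) + N * (p * 2) + N * (p * 2)
        ≡⟨ arithmetic N p ⟩
      8 * (N * p) ∎
      where
      open ℕₚ.≤-Reasoning
      arithmetic : ∀ N p → N * (p * 2) + N * (p * 2) + N * (p * 2) + N * (p * 2) ≡ 8 * (N * p)
      arithmetic = solveℕ 2 (λ N p → let a = N ⊡ (p ⊡ κℕ 2) in a ∔ a ∔ a ∔ a ≐ κℕ 8 ⊡ (N ⊡ p)) refl
        where open +-*-Solver using () renaming (solve to solveℕ; _:=_ to _≐_; _:+_ to _∔_; _:*_ to _⊡_; con to κℕ)
      line-cost : ∀ s → (∑[ x ∈ plane ] N * ⟦ x lies-on? bad s ⟧) ≤ N * (p * 2)
      line-cost s = ℕₚ.≤-trans (ℕₚ.≤-reflexive (∑-*ˡ plane N _)) (ℕₚ.*-monoʳ-≤ N (genCircle-size (bad s) (badLine-nontrivial e e≢ (proj₁ s) (g≢𝟘 s))))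
      costR : (∑[ x ∈ plane ] conflictsR x r s) ≤ N * (p * 2)
      costR = begin
        (∑[ x ∈ plane ] ∑[ r″ ∈ S ] ⟦ conflictR? x r s r″ ⟧)    ≡⟨ ∑-swap plane S _ ⟩
        (∑[ r″ ∈ S ] ∑[ x ∈ plane ] ⟦ conflictR? x r s r″ ⟧)    ≤⟨ ∑-mono S (λ {r″} _ → one r″) ⟩
        (∑[ r″ ∈ S ] ⟦ r″ mirrored? s ⟧ * (p * 2))              ≡⟨ ∑-*ʳ S (p * 2) _ ⟩
        (∑[ r″ ∈ S ] ⟦ r″ mirrored? s ⟧) * (p * 2)              ≤⟨ ℕₚ.*-monoˡ-≤ (p * 2) (deg-in s∈) ⟩
        N * (p * 2) ∎
        where
        one : ∀ r″ → (∑[ x ∈ plane ] ⟦ conflictR? x r s r″ ⟧) ≤ ⟦ r″ mirrored? s ⟧ * (p * 2)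
        one r″ = go ((r″ mirrored? s) ×-dec ¬? (r ≟ˢ r″))
          where
          go : Dec (Mirrored r″ s × r ≢ r″) → (∑[ x ∈ plane ] ⟦ conflictR? x r s r″ ⟧) ≤ ⟦ r″ mirrored? s ⟧ * (p * 2)
          go (no ¬q) = ℕₚ.≤-trans (ℕₚ.≤-reflexive (trans (∑-cong plane (λ {x} _ → ⟦⟧-no (conflictR? x r s r″) (λ (a , b , _) → ¬q (a , b)))) (∑-zero plane))) z≤n
          go (yes (r″s , r≢)) = ℕₚ.≤-trans (∑-mono plane (λ {x} _ → ⟦⟧-mono (conflictR? x r s r″) (x lies-on? conflict r r″) (proj₂ ∘ proj₂)))
            (ℕₚ.≤-trans (genCircle-size (conflict r r″) (conflictCircle-nontrivial e e≢ (mirrored-sources rs r″s r≢) (g≢𝟘 r) (g≢𝟘 r″)))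
              (ℕₚ.≤-reflexive (sym (trans (cong (_* (p * 2)) (⟦⟧-yes (r″ mirrored? s) r″s)) (ℕₚ.*-identityˡ _)))))
      costS : (∑[ x ∈ plane ] conflictsS x r s) ≤ N * (p * 2)
      costS = begin
        (∑[ x ∈ plane ] ∑[ s″ ∈ S ] ⟦ conflictS? x r s s″ ⟧)    ≡⟨ ∑-swap plane S _ ⟩
        (∑[ s″ ∈ S ] ∑[ x ∈ plane ] ⟦ conflictS? x r s s″ ⟧)    ≤⟨ ∑-mono S (λ {s″} _ → one s″) ⟩
        (∑[ s″ ∈ S ] ⟦ r mirrored? s″ ⟧ * (p * 2))              ≡⟨ ∑-*ʳ S (p * 2) _ ⟩
        (∑[ s″ ∈ S ] ⟦ r mirrored? s″ ⟧) * (p * 2)              ≤⟨ ℕₚ.*-monoˡ-≤ (p * 2) (deg-out r∈) ⟩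
        N * (p * 2) ∎
        where
        one : ∀ s″ → (∑[ x ∈ plane ] ⟦ conflictS? x r s s″ ⟧) ≤ ⟦ r mirrored? s″ ⟧ * (p * 2)
        one s″ = go ((r mirrored? s″) ×-dec ¬? (s ≟ˢ s″))
          where
          go : Dec (Mirrored r s″ × s ≢ s″) → (∑[ x ∈ plane ] ⟦ conflictS? x r s s″ ⟧) ≤ ⟦ r mirrored? s″ ⟧ * (p * 2)
          go (no ¬q) = ℕₚ.≤-trans (ℕₚ.≤-reflexive (trans (∑-cong plane (λ {x} _ → ⟦⟧-no (conflictS? x r s s″) (λ (a , b , _) → ¬q (a , b)))) (∑-zero plane))) z≤n
          go (yes (rs″ , s≢)) = ℕₚ.≤-trans (∑-mono plane (λ {x} _ → ⟦⟧-mono (conflictS? x r s s″) (x lies-on? conflict s s″) (proj₂ ∘ proj₂)))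
            (ℕₚ.≤-trans (genCircle-size (conflict s s″) (conflictCircle-nontrivial e e≢ (mirrored-images rs rs″ s≢) (g≢𝟘 s) (g≢𝟘 s″)))
              (ℕₚ.≤-reflexive (sym (trans (cong (_* (p * 2)) (⟦⟧-yes (r mirrored? s″) rs″)) (ℕₚ.*-identityˡ _)))))

    total-cost : Pt → ℕ
    total-cost x = ∑[ r ∈ S ] ∑[ s ∈ S ] ⟦ r mirrored? s ⟧ * cost x r s

    p>0 : 0 < p
    p>0 = ℕₚ.<-trans (s≤s z≤n) 2<p

    -- An average over the p² origins: all of them together pay at most 8Np for each of the I mirror
    -- pairs.
    good-origin : ∃[ x ] p * total-cost x ≤ 8 * (N * I)
    good-origin = pigeonhole plane (λ x → p * total-cost x) (8 * (N * I)) (subst (0 <_) (sym plane-length) (ℕₚ.*-mono-≤ p>0 p>0)) (begin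
      (∑[ x ∈ plane ] p * total-cost x)
        ≡⟨ ∑-*ˡ plane p total-cost ⟩
      p * (∑[ x ∈ plane ] ∑[ r ∈ S ] ∑[ s ∈ S ] ⟦ r mirrored? s ⟧ * cost x r s)
        ≡⟨ cong (p *_) (trans (∑-swap plane S _) (∑-cong S (λ _ → ∑-swap plane S _))) ⟩
      p * (∑[ r ∈ S ] ∑[ s ∈ S ] ∑[ x ∈ plane ] ⟦ r mirrored? s ⟧ * cost x r s)
        ≡⟨ cong (p *_) (∑-cong S (λ {r} _ → ∑-cong S (λ {s} _ → ∑-*ˡ plane ⟦ r mirrored? s ⟧ (λ x → cost x r s)))) ⟩
      p * (∑[ r ∈ S ] ∑[ s ∈ S ] ⟦ r mirrored? s ⟧ * (∑[ x ∈ plane ] cost x r s))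
        ≤⟨ ℕₚ.*-monoʳ-≤ p (∑-mono S (λ {r} r∈ → ∑-mono S (λ {s} s∈ → ⟦⟧*-mono (r mirrored? s) (edge-cost r∈ s∈)))) ⟩
      p * (∑[ r ∈ S ] ∑[ s ∈ S ] ⟦ r mirrored? s ⟧ * (8 * (N * p)))
        ≡⟨ cong (p *_) (trans (∑-cong S (λ _ → ∑-*ʳ S (8 * (N * p)) _)) (∑-*ʳ S (8 * (N * p)) _)) ⟩
      p * (I * (8 * (N * p)))
        ≡⟨ trans (arithmetic p I N) (cong (_* (8 * (N * I))) (sym plane-length)) ⟩
      length plane * (8 * (N * I)) ∎)
      where
      open ℕₚ.≤-Reasoning
      arithmetic : ∀ p I N → p * (I * (8 * (N * p))) ≡ p * p * (8 * (N * I))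
      arithmetic = solveℕ 3 (λ p I N → p ⊡ (I ⊡ (κℕ 8 ⊡ (N ⊡ p))) ≐ p ⊡ p ⊡ (κℕ 8 ⊡ (N ⊡ I))) refl
        where open +-*-Solver using () renaming (solve to solveℕ; _:=_ to _≐_; _:*_ to _⊡_; con to κℕ)

    module Coordinates (x : Pt) where
      -- The relation `symplectic` is homogeneous in the vector (g , h) of a segment. Scaling the
      -- first coordinate of h to 1 leaves three affine coordinates and turns the relation into
      -- `Incident`.
      H₀ A m C : Segment → F
      H₀ s = proj₁ (h x s)
      A s = proj₂ (g s) ⊗ inv (H₀ s)
      C s = ⊝ (proj₁ (g s) ⊗ inv (H₀ s))
      m s = proj₂ (h x s) ⊗ inv (H₀ s)

      private
        undo : ∀ {y} z → y ≢ 𝟘 → y ⊗ (z ⊗ inv y) ≡ z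
        undo {y} z y≢ = trans (solve 3 (λ y z i → y :* (z :* i) := z :* (y :* i)) refl y z (inv y)) (trans (cong (z ⊗_) (inverse y y≢)) (⊗-identityʳ z))

      module _ {s} (H₀≢ : H₀ s ≢ 𝟘) where
        g₂≡ : proj₂ (g s) ≡ H₀ s ⊗ A s
        g₂≡ = sym (undo (proj₂ (g s)) H₀≢)
        g₁≡ : proj₁ (g s) ≡ ⊝ (H₀ s ⊗ C s)
        g₁≡ = trans (sym (undo (proj₁ (g s)) H₀≢)) (solve 2 (λ y w → y :* w := :- (y :* (:- w))) refl (H₀ s) (proj₁ (g s) ⊗ inv (H₀ s)))
        h₂≡ : proj₂ (h x s) ≡ H₀ s ⊗ m s
        h₂≡ = sym (undo (proj₂ (h x s)) H₀≢)

      incident : ∀ {r s} → r ∈ S → s ∈ S → H₀ r ≢ 𝟘 → H₀ s ≢ 𝟘 → Mirrored r s → Incident A m C r s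
      incident {r} {s} r∈ s∈ r≢ s≢ (_ , mir) = ⊗-cancelˡ (⊗≢𝟘 r≢ s≢) (begin
        H₀ r ⊗ H₀ s ⊗ (A r ⊗ m s ⊖ C r)
          ≡⟨ solve 5 (λ y z a m c → y :* z :* (a :* m :- c) := (:- (y :* c)) :* z :+ (y :* a) :* (z :* m)) refl (H₀ r) (H₀ s) (A r) (m s) (C r) ⟩
        (⊝ (H₀ r ⊗ C r)) ⊗ H₀ s ⊕ (H₀ r ⊗ A r) ⊗ (H₀ s ⊗ m s)
          ≡⟨ cong₂ (λ u v → u ⊗ H₀ s ⊕ v) (sym (g₁≡ r≢)) (cong₂ _⊗_ (sym (g₂≡ r≢)) (sym (h₂≡ s≢))) ⟩
        g r ∙ h x s
          ≡⟨ symplectic e e≢ x (g r) (g s) mir (half-spec e e≢ (vector r) (same-norm r∈)) (half-spec e e≢ (vector s) (same-norm s∈)) ⟩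
        g s ∙ h x r
          ≡⟨ cong₂ (λ u v → u ⊗ H₀ r ⊕ v) (g₁≡ s≢) (cong₂ _⊗_ (g₂≡ s≢) (h₂≡ r≢)) ⟩
        (⊝ (H₀ s ⊗ C s)) ⊗ H₀ r ⊕ (H₀ s ⊗ A s) ⊗ (H₀ r ⊗ m r)
          ≡⟨ solve 5 (λ y z a m c → (:- (y :* c)) :* z :+ (y :* a) :* (z :* m) := z :* y :* (a :* m :- c)) refl (H₀ s) (H₀ r) (A s) (m r) (C s) ⟩
        H₀ r ⊗ H₀ s ⊗ (A s ⊗ m r ⊖ C s) ∎)
        where open ≡-Reasoning

      same-m⇒conflict : ∀ {r s} → H₀ r ≢ 𝟘 → H₀ s ≢ 𝟘 → m r ≡ m s → x lies-on conflict r s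
      same-m⇒conflict {r} {s} r≢ s≢ m≡ = trans (conflictCircle-value e e≢ x (proj₁ r) (proj₁ s) (g r) (g s))
        (≡⇒⊖≡𝟘 (trans (cong (H₀ r ⊗_) (trans (h₂≡ s≢) (cong (H₀ s ⊗_) (sym m≡))))
          (trans (solve 3 (λ a b c → a :* (b :* c) := (a :* c) :* b) refl (H₀ r) (H₀ s) (m r)) (cong (_⊗ H₀ s) (sym (h₂≡ r≢))))))

      -- Incidence with r expresses C s through A s and m s. Once A s is affine in m s, so is C s,
      -- and `regulusCircle-∋` applies.
      on-regulus⇒on-circle : ∀ {r s} γ δ → r ∈ S → s ∈ S → H₀ r ≢ 𝟘 → H₀ s ≢ 𝟘 → Mirrored r s → A s ≡ γ ⊗ m s ⊕ δ →
        proj₁ s lies-on regulusCircle e e≢ x γ δ (γ ⊗ m r ⊖ A r) (δ ⊗ m r ⊕ C r)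
      on-regulus⇒on-circle {r} {s} γ δ r∈ s∈ r≢ s≢ rs A≡ = regulusCircle-∋ e e≢ x (proj₁ s) (g s) γ δ (γ ⊗ m r ⊖ A r) (δ ⊗ m r ⊕ C r) (A s) (C s) (m s) s≢
        (g₂≡ s≢) (g₁≡ s≢) (h₂≡ s≢) A≡ (begin
          C s
            ≡⟨ solve 5 (λ c a m a′ m′ → c := a :* m′ :- (a :* m′ :- c)) refl (C s) (A s) (m s) (A r) (m r) ⟩
          A s ⊗ m r ⊖ (A s ⊗ m r ⊖ C s)
            ≡⟨ cong₂ (λ u v → u ⊗ m r ⊖ v) A≡ (sym (incident r∈ s∈ r≢ s≢ rs)) ⟩
          (γ ⊗ m s ⊕ δ) ⊗ m r ⊖ (A r ⊗ m s ⊖ C r)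
            ≡⟨ solve 6 (λ γ δ m n a c → (γ :* m :+ δ) :* n :- (a :* m :- c) := (γ :* n :- a) :* m :+ (δ :* n :+ c)) refl γ δ (m s) (m r) (A r) (C r) ⟩
          (γ ⊗ m r ⊖ A r) ⊗ m s ⊕ (δ ⊗ m r ⊕ C r) ∎)
        where open ≡-Reasoning

      bad⇒H₀≡𝟘 : ∀ s → H₀ s ≡ 𝟘 → x lies-on bad s
      bad⇒H₀≡𝟘 s q = trans (badLine-value e e≢ x (proj₁ s) (g s)) q

-- Bounding the mirror pairs of segments of one length

module MirrorBound (𝔽 : Field) where
  open Counting
  open FieldTheory 𝔽
  open Plane 𝔽
  open Frames 𝔽
  open RedBlue 𝔽 using (Incident)
  open Regulus 𝔽 using (many-edges⇒regulus)
  open Mirrors 𝔽 using (Segment; _≟ˢ_; Mirrored; _mirrored?_; vector; mirrored-images)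

  private
    summand₁ : ∀ a b c d → a ≤ a + b + c + d
    summand₁ a b c d = ℕₚ.≤-trans (ℕₚ.m≤m+n a b) (ℕₚ.≤-trans (ℕₚ.m≤m+n (a + b) c) (ℕₚ.m≤m+n (a + b + c) d))
    summand₂ : ∀ a b c d → b ≤ a + b + c + d
    summand₂ a b c d = ℕₚ.≤-trans (ℕₚ.m≤n+m b a) (ℕₚ.≤-trans (ℕₚ.m≤m+n (a + b) c) (ℕₚ.m≤m+n (a + b + c) d))
    summand₃ : ∀ a b c d → c ≤ a + b + c + d
    summand₃ a b c d = ℕₚ.≤-trans (ℕₚ.m≤n+m c (a + b)) (ℕₚ.m≤m+n (a + b + c) d)

  module _ (E : List Pt) (uE : Unique E) (K : ℕ) (not-rich : ∀ G → Nontrivial G → (∑[ b ∈ E ] ⟦ b lies-on? G ⟧) ≤ K)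
           (S : List Segment) (uS : Unique S) (S⊆E : ∀ {s} → s ∈ S → proj₁ s ∈ E)
           (e : Pt) (e≢ : e ≢ (𝟘 , 𝟘)) (same-norm : ∀ {s} → s ∈ S → nrm (vector s) ≡ nrm e)
           (N : ℕ) (deg-out : ∀ {r} → r ∈ S → (∑[ s ∈ S ] ⟦ r mirrored? s ⟧) ≤ N)
           (deg-in : ∀ {s} → s ∈ S → (∑[ r ∈ S ] ⟦ r mirrored? s ⟧) ≤ N)
           (Δ q c : ℕ) (Δ<N : Δ < N) (16N≤ : 16 * N ≤ suc Δ * p) where

    private
      module M = Mirrors 𝔽
      n I : ℕ
      n = length S
      I = ∑[ r ∈ S ] ∑[ s ∈ S ] ⟦ r mirrored? s ⟧
      cost : Pt → Segment → Segment → ℕ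
      cost = M.cost S uS e e≢ same-norm N deg-out deg-in

    module _ (x : Pt) (cheap : p * (∑[ r ∈ S ] ∑[ s ∈ S ] ⟦ r mirrored? s ⟧ * cost x r s) ≤ 8 * (N * I)) where

      open M.Coordinates S uS e e≢ same-norm N deg-out deg-in x

      -- Only the cheap mirror pairs are kept: their coordinates are defined, and few of them share
      -- a value of m.
      _~_ : Segment → Segment → Set
      r ~ s = (r ∈ S × s ∈ S) × Mirrored r s × cost x r s ≤ Δ

      ∈S? : ∀ s → Dec (s ∈ S)
      ∈S? s = Any.any? (s ≟ˢ_) S

      _~?_ : ∀ r s → Dec (r ~ s)
      r ~? s = (∈S? r ×-dec ∈S? s) ×-dec (r mirrored? s) ×-dec (cost x r s ℕ.≤? Δ)

      Ĩ : ℕ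
      Ĩ = ∑[ r ∈ S ] ∑[ s ∈ S ] ⟦ r ~? s ⟧

      lost : ℕ
      lost = ∑[ r ∈ S ] ∑[ s ∈ S ] ⟦ (r mirrored? s) ×-dec ¬? (cost x r s ℕ.≤? Δ) ⟧

      I≤ : I ≤ Ĩ + lost
      I≤ = ℕₚ.≤-trans (∑-mono S (λ {r} r∈ → ℕₚ.≤-trans (∑-mono S (λ {s} s∈ → split r s r∈ s∈))
          (ℕₚ.≤-reflexive (∑-+ S (λ s → ⟦ r ~? s ⟧) (λ s → ⟦ (r mirrored? s) ×-dec ¬? (cost x r s ℕ.≤? Δ) ⟧)))))
        (ℕₚ.≤-reflexive (∑-+ S (λ r → ∑[ s ∈ S ] ⟦ r ~? s ⟧) (λ r → ∑[ s ∈ S ] ⟦ (r mirrored? s) ×-dec ¬? (cost x r s ℕ.≤? Δ) ⟧)))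
        where
        split : ∀ r s → r ∈ S → s ∈ S → ⟦ r mirrored? s ⟧ ≤ ⟦ r ~? s ⟧ + ⟦ (r mirrored? s) ×-dec ¬? (cost x r s ℕ.≤? Δ) ⟧
        split r s r∈ s∈ = ⟦⟧-≤+ (r mirrored? s) (r ~? s) ((r mirrored? s) ×-dec ¬? (cost x r s ℕ.≤? Δ)) (decide (cost x r s ℕ.≤? Δ))
          where
          decide : Dec (cost x r s ≤ Δ) → Mirrored r s → r ~ s ⊎ (Mirrored r s × ¬ (cost x r s ≤ Δ))
          decide (yes a) rs = inj₁ ((r∈ , s∈) , rs , a)
          decide (no ¬a) rs = inj₂ (rs , ¬a)

      lost-cost : suc Δ * lost ≤ (∑[ r ∈ S ] ∑[ s ∈ S ] ⟦ r mirrored? s ⟧ * cost x r s)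
      lost-cost = ℕₚ.≤-trans (ℕₚ.≤-reflexive (sym (trans (∑-cong S (λ _ → ∑-*ˡ S (suc Δ) _)) (∑-*ˡ S (suc Δ) _))))
        (∑-mono S (λ {r} _ → ∑-mono S (λ {s} _ → one r s (r mirrored? s) (cost x r s ℕ.≤? Δ))))
        where
        one : ∀ r s (d : Dec (Mirrored r s)) (d′ : Dec (cost x r s ≤ Δ)) → suc Δ * ⟦ d ×-dec ¬? d′ ⟧ ≤ ⟦ d ⟧ * cost x r s
        one r s (no _)  d′       = ℕₚ.≤-reflexive (ℕₚ.*-zeroʳ (suc Δ))
        one r s (yes _) (yes _)  = ℕₚ.≤-trans (ℕₚ.≤-reflexive (ℕₚ.*-zeroʳ (suc Δ))) z≤n
        one r s (yes _) (no ¬a)  = ℕₚ.≤-trans (ℕₚ.≤-reflexive (ℕₚ.*-identityʳ (suc Δ))) (ℕₚ.≤-trans (ℕₚ.≰⇒> ¬a) (ℕₚ.≤-reflexive (sym (ℕₚ.*-identityˡ _))))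

      -- Markov's inequality: each lost pair costs at least Δ + 1, the total cost is at most 8NI /
      -- p, and 16N ≤ (Δ + 1) p.
      2lost≤I : 2 * lost ≤ I
      2lost≤I = ℕₚ.*-cancelˡ-≤ (8 * N) {{ℕ.>-nonZero (ℕₚ.*-mono-< (s≤s (z≤n {7})) (ℕₚ.≤-<-trans z≤n Δ<N))}} (begin
        8 * N * (2 * lost)       ≡⟨ solve-1 N lost ⟩
        16 * N * lost            ≤⟨ ℕₚ.*-monoˡ-≤ lost 16N≤ ⟩
        suc Δ * p * lost         ≡⟨ solve-2 Δ p lost ⟩
        p * (suc Δ * lost)       ≤⟨ ℕₚ.*-monoʳ-≤ p lost-cost ⟩
        p * (∑[ r ∈ S ] ∑[ s ∈ S ] ⟦ r mirrored? s ⟧ * cost x r s) ≤⟨ cheap ⟩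
        8 * (N * I)              ≡⟨ ℕₚ.*-assoc 8 N I ⟨
        8 * N * I ∎)
        where
        open ℕₚ.≤-Reasoning
        open +-*-Solver using () renaming (solve to solveℕ; _:=_ to _≐_; _:+_ to _∔_; _:*_ to _⊡_; con to κℕ)
        solve-1 : ∀ N l → 8 * N * (2 * l) ≡ 16 * N * l
        solve-1 = solveℕ 2 (λ N l → κℕ 8 ⊡ N ⊡ (κℕ 2 ⊡ l) ≐ κℕ 16 ⊡ N ⊡ l) refl
        solve-2 : ∀ Δ p l → suc Δ * p * l ≡ p * (suc Δ * l)
        solve-2 = solveℕ 3 (λ Δ p l → (κℕ 1 ∔ Δ) ⊡ p ⊡ l ≐ p ⊡ ((κℕ 1 ∔ Δ) ⊡ l)) refl

      I≤2Ĩ : I ≤ 2 * Ĩ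
      I≤2Ĩ = ℕₚ.+-cancelʳ-≤ I I (2 * Ĩ) (begin
        I + I                    ≡⟨ cong (I +_) (ℕₚ.+-identityʳ I) ⟨
        2 * I                    ≤⟨ ℕₚ.*-monoʳ-≤ 2 I≤ ⟩
        2 * (Ĩ + lost)           ≡⟨ ℕₚ.*-distribˡ-+ 2 Ĩ lost ⟩
        2 * Ĩ + 2 * lost         ≤⟨ ℕₚ.+-monoʳ-≤ (2 * Ĩ) 2lost≤I ⟩
        2 * Ĩ + I ∎)
        where open ℕₚ.≤-Reasoning

      H₀≢ : ∀ {r s} → r ~ s → H₀ r ≢ 𝟘 × H₀ s ≢ 𝟘
      H₀≢ {r} {s} (_ , _ , low) = too-high r (summand₁ (penalty r) (penalty s) _ _) , too-high s (summand₂ (penalty r) (penalty s) _ _)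
        where
        penalty : Segment → ℕ
        penalty y = N * ⟦ x lies-on? M.bad S uS e e≢ same-norm N deg-out deg-in y ⟧
        too-high : ∀ y → penalty y ≤ cost x r s → H₀ y ≢ 𝟘
        too-high y le q = ℕₚ.<⇒≱ Δ<N (ℕₚ.≤-trans (ℕₚ.≤-reflexive (sym (trans (cong (N *_) (⟦⟧-yes (x lies-on? M.bad S uS e e≢ same-norm N deg-out deg-in y) (bad⇒H₀≡𝟘 y q))) (ℕₚ.*-identityʳ N))))
          (ℕₚ.≤-trans le low))

      incident~ : ∀ {r s} → r ~ s → Incident A m C r s
      incident~ rs@((r∈ , s∈) , mir , _) = incident r∈ s∈ (proj₁ (H₀≢ rs)) (proj₂ (H₀≢ rs)) mir

      module _ (R′ S′ : List Segment) (uR′ : Unique R′) (uS′ : Unique S′) (R′⊆S : ∀ {r} → r ∈ R′ → r ∈ S) (S′⊆S : ∀ {s} → s ∈ S′ → s ∈ S) where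

        -- The bound is Δ + 1: one segment y with the given value of m, while all others conflict
        -- with y at s and are counted in the cost of (y , s).
        multR : ∀ {s} → s ∈ S′ → ∀ v → (∑[ r ∈ R′ ] ⟦ (r ~? s) ×-dec (m r ≟ v) ⟧) ≤ suc Δ
        multR {s} s∈ v = count≤ (λ r → (r ~? s) ×-dec (m r ≟ v)) (suc Δ) uR′ bound
          where
          bound : ∀ ys → Unique ys → (∀ {y} → y ∈ ys → y ∈ R′ × (y ~ s × m y ≡ v)) → length ys ≤ suc Δ
          bound []       _        _   = z≤n
          bound (y ∷ ys) (y∉ ∷ u) sub = s≤s (ℕₚ.≤-trans (ℕₚ.≤-reflexive (trans (length-∑ ys) (∑-cong ys (λ {z} z∈ → sym (⟦⟧-yes (conf? z) (conf z z∈))))))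
            (ℕₚ.≤-trans (count-injection conf? conf? _≟ˢ_ id u uS (λ z∈ h → R′⊆S (proj₁ (sub (there z∈))) , h) (λ _ _ _ _ q → q))
              (ℕₚ.≤-trans (summand₃ (N * ⟦ x lies-on? M.bad S uS e e≢ same-norm N deg-out deg-in y ⟧) (N * ⟦ x lies-on? M.bad S uS e e≢ same-norm N deg-out deg-in s ⟧) _ _) (proj₂ (proj₂ (proj₁ (proj₂ (sub (here refl)))))))))
            where
            conf? : ∀ z → Dec (M.ConflictR S uS e e≢ same-norm N deg-out deg-in x y s z)
            conf? = M.conflictR? S uS e e≢ same-norm N deg-out deg-in x y s
            conf : ∀ z → z ∈ ys → M.ConflictR S uS e e≢ same-norm N deg-out deg-in x y s z
            conf z z∈ = let (_ , ys~ , my) = sub (here refl) ; (_ , zs~ , mz) = sub (there z∈) in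
              proj₁ (proj₂ zs~) , All.lookup y∉ z∈ , same-m⇒conflict (proj₁ (H₀≢ ys~)) (proj₁ (H₀≢ zs~)) (trans my (sym mz))

        multS : ∀ {r} → r ∈ R′ → ∀ v → (∑[ s ∈ S′ ] ⟦ (r ~? s) ×-dec (m s ≟ v) ⟧) ≤ suc Δ
        multS {r} r∈ v = count≤ (λ s → (r ~? s) ×-dec (m s ≟ v)) (suc Δ) uS′ bound
          where
          bound : ∀ ys → Unique ys → (∀ {y} → y ∈ ys → y ∈ S′ × (r ~ y × m y ≡ v)) → length ys ≤ suc Δ
          bound []       _        _   = z≤n
          bound (y ∷ ys) (y∉ ∷ u) sub = s≤s (ℕₚ.≤-trans (ℕₚ.≤-reflexive (trans (length-∑ ys) (∑-cong ys (λ {z} z∈ → sym (⟦⟧-yes (conf? z) (conf z z∈))))))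
            (ℕₚ.≤-trans (count-injection conf? conf? _≟ˢ_ id u uS (λ z∈ h → S′⊆S (proj₁ (sub (there z∈))) , h) (λ _ _ _ _ q → q))
              (ℕₚ.≤-trans (ℕₚ.m≤n+m _ _) (proj₂ (proj₂ (proj₁ (proj₂ (sub (here refl)))))))))
            where
            conf? : ∀ z → Dec (M.ConflictS S uS e e≢ same-norm N deg-out deg-in x r y z)
            conf? = M.conflictS? S uS e e≢ same-norm N deg-out deg-in x r y
            conf : ∀ z → z ∈ ys → M.ConflictS S uS e e≢ same-norm N deg-out deg-in x r y z
            conf z z∈ = let (_ , ry~ , my) = sub (here refl) ; (_ , rz~ , mz) = sub (there z∈) in
              proj₁ (proj₂ rz~) , All.lookup y∉ z∈ , same-m⇒conflict (proj₂ (H₀≢ ry~)) (proj₂ (H₀≢ rz~)) (trans my (sym mz))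

        -- A regulus with more than K lines would put more than K points of E on a generalized circle.
        no-regulus : ∀ {r} γ δ → r ∈ R′ → ¬ (K < (∑[ s ∈ S′ ] ⟦ (r ~? s) ×-dec (A s ≟ γ ⊗ m s ⊕ δ) ⟧))
        no-regulus {r} γ δ r∈ h = ℕₚ.<⇒≱ h (ℕₚ.≤-trans (count-injection (λ s → (r ~? s) ×-dec (A s ≟ γ ⊗ m s ⊕ δ)) (λ b → b lies-on? G) _≟ᴾ_ proj₁ uS′ uE
            (λ {s} s∈ (rs , A≡) → S⊆E (S′⊆S s∈) , on-regulus⇒on-circle γ δ (R′⊆S r∈) (S′⊆S s∈) (proj₁ (H₀≢ rs)) (proj₂ (H₀≢ rs)) (proj₁ (proj₂ rs)) A≡)
            (λ {s} {s″} _ _ (rs , _) (rs″ , _) q → decidable-stable (s ≟ˢ s″) (λ s≢ → mirrored-images (proj₁ (proj₂ rs)) (proj₁ (proj₂ rs″)) s≢ q)))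
          (not-rich G (regulusCircle-nontrivial e e≢ x γ δ _ _)))
          where
          G : GenCircle
          G = regulusCircle e e≢ x γ δ (γ ⊗ m r ⊖ A r) (δ ⊗ m r ⊕ C r)

      module _ (2K+90cμ≤q : 2 * K + 90 * (c * suc Δ) ≤ q) (24μn≤qc : 24 * (suc Δ * n) ≤ q * c) (8+36c≤p : 8 + 36 * c ≤ p) where
        private
          d D μ : ℕ
          -- Then D = 9c, and D + 1 points on each of 3c² red lines are 27c³ + 3c² conditions, fewer
          -- than the (3c + 1)³ coefficients.
          d = 3 * c
          D = d + (d + d)
          μ = suc Δ
          T : ℕ
          T = (D + D + D) * μ

          open +-*-Solver using () renaming (solve to solveℕ; _:=_ to _≐_; _:+_ to _∔_; _:*_ to _⊡_; con to κℕ)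

          bound : 8 + (D + D + (D + D)) ≤ p
          bound = ℕₚ.≤-trans (ℕₚ.≤-reflexive (cong (8 +_) (lemma c))) 8+36c≤p
            where
            lemma : ∀ c → let d = 3 * c ; D = d + (d + d) in D + D + (D + D) ≡ 36 * c
            lemma = solveℕ 1 (λ c → let d = κℕ 3 ⊡ c ; D = d ∔ (d ∔ d) in D ∔ D ∔ (D ∔ D) ≐ κℕ 36 ⊡ c) refl

          few : ∀ {k} → k ≤ 3 * (c * c) → k * suc D < suc d * (suc d * suc d)
          few {k} k≤ = ℕₚ.≤-<-trans (ℕₚ.*-monoˡ-≤ (suc D) k≤) (ℕₚ.≤-trans (ℕₚ.m≤m+n _ (24 * (c * c) + 9 * c)) (ℕₚ.≤-reflexive (lemma c)))
            where
            lemma : ∀ c → let d = 3 * c ; D = d + (d + d) in suc (3 * (c * c) * suc D) + (24 * (c * c) + 9 * c) ≡ suc d * (suc d * suc d)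
            lemma = solveℕ 1 (λ c → let d = κℕ 3 ⊡ c ; D = d ∔ (d ∔ d) in
              κℕ 1 ∔ κℕ 3 ⊡ (c ⊡ c) ⊡ (κℕ 1 ∔ D) ∔ (κℕ 24 ⊡ (c ⊡ c) ∔ κℕ 9 ⊡ c) ≐ (κℕ 1 ∔ d) ⊡ ((κℕ 1 ∔ d) ⊡ (κℕ 1 ∔ d))) refl

          contradict : ∀ R′ S′ → Unique R′ → Unique S′ → (∀ {r} → r ∈ R′ → r ∈ S) → (∀ {s} → s ∈ S′ → s ∈ S) → length R′ ≤ 3 * (c * c) →
            (K + T + (D * μ + D * μ)) * length R′ + (T + D * μ) * length S′ < (∑[ r ∈ R′ ] ∑[ s ∈ S′ ] ⟦ r ~? s ⟧) → ⊥
          contradict R′ S′ uR′ uS′ R′⊆ S′⊆ short edges =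
            let (r , r∈ , γ , δ , many) = many-edges⇒regulus _≟ˢ_ A m C R′ S′ uR′ uS′ _~?_ incident~ K d μ
                  (multR R′ S′ uR′ uS′ R′⊆ S′⊆) (multS R′ S′ uR′ uS′ R′⊆ S′⊆) (few short) bound edges
            in no-regulus R′ S′ uR′ uS′ R′⊆ S′⊆ γ δ r∈ many

          coefficient₁ : 2 * (K + T + (D * μ + D * μ)) ≤ q
          coefficient₁ = ℕₚ.≤-trans (ℕₚ.≤-reflexive (lemma c K μ)) 2K+90cμ≤q
            where
            lemma : ∀ c K μ → let d = 3 * c ; D = d + (d + d) in 2 * (K + (D + D + D) * μ + (D * μ + D * μ)) ≡ 2 * K + 90 * (c * μ)
            lemma = solveℕ 3 (λ c K μ → let d = κℕ 3 ⊡ c ; D = d ∔ (d ∔ d) in κℕ 2 ⊡ (K ∔ (D ∔ D ∔ D) ⊡ μ ∔ (D ⊡ μ ∔ D ⊡ μ)) ≐ κℕ 2 ⊡ K ∔ κℕ 90 ⊡ (c ⊡ μ)) refl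

          coefficient₂ : T + D * μ ≤ K + T + (D * μ + D * μ)
          coefficient₂ = ℕₚ.+-mono-≤ (ℕₚ.m≤n+m T K) (ℕₚ.m≤m+n (D * μ) (D * μ))

          T+Dμ : T + D * μ ≡ 36 * (c * μ)
          T+Dμ = lemma c μ
            where
            lemma : ∀ c μ → let d = 3 * c ; D = d + (d + d) in (D + D + D) * μ + D * μ ≡ 36 * (c * μ)
            lemma = solveℕ 2 (λ c μ → let d = κℕ 3 ⊡ c ; D = d ∔ (d ∔ d) in (D ∔ D ∔ D) ⊡ μ ∔ D ⊡ μ ≐ κℕ 36 ⊡ (c ⊡ μ)) refl

          many-rows : ∀ (R′ S′ : List Segment) → (∀ {r} → r ∈ R′ → q < (∑[ s ∈ S′ ] ⟦ r ~? s ⟧)) → suc q * length R′ ≤ (∑[ r ∈ R′ ] ∑[ s ∈ S′ ] ⟦ r ~? s ⟧)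
          many-rows R′ S′ h = ℕₚ.≤-trans (ℕₚ.≤-reflexive (trans (ℕₚ.*-comm (suc q) (length R′)) (sym (∑-const R′ (suc q))))) (∑-mono R′ h)

        -- With at most 3c² red lines, the degrees on both sides supply enough edges. Otherwise 3c²
        -- red lines are selected; they keep all their neighbours, and `24μn≤qc` absorbs the
        -- contribution of S′.
        finish : ∀ R′ S′ → Unique R′ → Unique S′ → (∃[ r ] r ∈ R′) → (∀ {r} → r ∈ R′ → r ∈ S) → (∀ {s} → s ∈ S′ → s ∈ S) → length S′ ≤ n →
          (∀ {r} → r ∈ R′ → q < (∑[ s ∈ S′ ] ⟦ r ~? s ⟧)) → (∀ {s} → s ∈ S′ → q < (∑[ r ∈ R′ ] ⟦ r ~? s ⟧)) → ⊥
        finish R′ S′ uR′ uS′ nonempty R′⊆ S′⊆ lenS′ richR richS = go (length R′ ℕ.≤? 3 * (c * c))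
          where
          open ℕₚ.≤-Reasoning
          a : ℕ
          a = K + T + (D * μ + D * μ)
          positive : ∀ {xs : List Segment} → (∃[ x ] x ∈ xs) → 0 < length xs
          positive {_ ∷ _} _ = s≤s z≤n
          go : Dec (length R′ ≤ 3 * (c * c)) → ⊥
          go (yes short) = contradict R′ S′ uR′ uS′ R′⊆ S′⊆ short (ℕₚ.*-cancelˡ-< 2 _ _ (begin-strict
            2 * (a * length R′ + (T + D * μ) * length S′)
              ≤⟨ ℕₚ.*-monoʳ-≤ 2 (ℕₚ.+-monoʳ-≤ (a * length R′) (ℕₚ.*-monoˡ-≤ (length S′) coefficient₂)) ⟩
            2 * (a * length R′ + a * length S′)
              ≡⟨ solveℕ 3 (λ a r s → κℕ 2 ⊡ (a ⊡ r ∔ a ⊡ s) ≐ κℕ 2 ⊡ a ⊡ r ∔ κℕ 2 ⊡ a ⊡ s) refl a (length R′) (length S′) ⟩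
            2 * a * length R′ + 2 * a * length S′
              ≤⟨ ℕₚ.+-mono-≤ (ℕₚ.*-monoˡ-≤ (length R′) coefficient₁) (ℕₚ.*-monoˡ-≤ (length S′) coefficient₁) ⟩
            q * length R′ + q * length S′
              <⟨ ℕₚ.+-mono-<-≤ (ℕₚ.*-monoˡ-< (length R′) {{ℕ.>-nonZero (positive nonempty)}} (ℕₚ.n<1+n q)) (ℕₚ.*-monoˡ-≤ (length S′) (ℕₚ.n≤1+n q)) ⟩
            suc q * length R′ + suc q * length S′
              ≤⟨ ℕₚ.+-mono-≤ (many-rows R′ S′ richR) (ℕₚ.≤-trans (ℕₚ.≤-trans (ℕₚ.≤-reflexive (trans (ℕₚ.*-comm (suc q) (length S′)) (sym (∑-const S′ (suc q))))) (∑-mono S′ richS))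
                   (ℕₚ.≤-reflexive (∑-swap S′ R′ (λ s r → ⟦ r ~? s ⟧)))) ⟩
            X + X
              ≡⟨ cong (X +_) (ℕₚ.+-identityʳ X) ⟨
            2 * X ∎))
            where
            X : ℕ
            X = ∑[ r ∈ R′ ] ∑[ s ∈ S′ ] ⟦ r ~? s ⟧
          go (no long) = contradict R₁ S′ (Uniqueₚ.take⁺ k uR′) uS′ (R′⊆ ∘ R₁⊆) S′⊆ (ℕₚ.≤-reflexive lenR₁) (ℕₚ.*-cancelˡ-< 2 _ _ (begin-strict
            2 * (a * length R₁ + (T + D * μ) * length S′)
              ≡⟨ ℕₚ.*-distribˡ-+ 2 (a * length R₁) _ ⟩
            2 * (a * length R₁) + 2 * ((T + D * μ) * length S′)
              ≡⟨ cong₂ _+_ (sym (ℕₚ.*-assoc 2 a (length R₁))) (cong (λ z → 2 * (z * length S′)) T+Dμ) ⟩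
            2 * a * length R₁ + 2 * (36 * (c * μ) * length S′)
              ≤⟨ ℕₚ.+-mono-≤ (ℕₚ.*-monoˡ-≤ (length R₁) coefficient₁) (ℕₚ.*-monoʳ-≤ 2 (ℕₚ.*-monoʳ-≤ (36 * (c * μ)) lenS′)) ⟩
            q * length R₁ + 2 * (36 * (c * μ) * n)
              ≡⟨ cong (q * length R₁ +_) (solveℕ 3 (λ c μ n → κℕ 2 ⊡ (κℕ 36 ⊡ (c ⊡ μ) ⊡ n) ≐ κℕ 3 ⊡ (c ⊡ (κℕ 24 ⊡ (μ ⊡ n)))) refl c μ n) ⟩
            q * length R₁ + 3 * (c * (24 * (μ * n)))
              ≤⟨ ℕₚ.+-monoʳ-≤ (q * length R₁) (ℕₚ.*-monoʳ-≤ 3 (ℕₚ.*-monoʳ-≤ c 24μn≤qc)) ⟩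
            q * length R₁ + 3 * (c * (q * c))
              ≡⟨ cong (q * length R₁ +_) (trans (solveℕ 2 (λ c q → κℕ 3 ⊡ (c ⊡ (q ⊡ c)) ≐ q ⊡ (κℕ 3 ⊡ (c ⊡ c))) refl c q) (cong (q *_) (sym lenR₁))) ⟩
            q * length R₁ + q * length R₁
              <⟨ ℕₚ.+-mono-<-≤ (ℕₚ.*-monoˡ-< (length R₁) {{ℕ.>-nonZero R₁-positive}} (ℕₚ.n<1+n q)) (ℕₚ.*-monoˡ-≤ (length R₁) (ℕₚ.n≤1+n q)) ⟩
            suc q * length R₁ + suc q * length R₁
              ≤⟨ ℕₚ.+-mono-≤ (many-rows R₁ S′ (richR ∘ R₁⊆)) (many-rows R₁ S′ (richR ∘ R₁⊆)) ⟩
            X + X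
              ≡⟨ cong (X +_) (ℕₚ.+-identityʳ X) ⟨
            2 * X ∎))
            where
            k : ℕ
            k = 3 * (c * c)
            R₁ : List Segment
            R₁ = List.take k R′
            X : ℕ
            X = ∑[ r ∈ R₁ ] ∑[ s ∈ S′ ] ⟦ r ~? s ⟧
            lenR₁ : length R₁ ≡ k
            lenR₁ = trans (Listₚ.length-take k R′) (ℕₚ.m≤n⇒m⊓n≡m (ℕₚ.<⇒≤ (ℕₚ.≰⇒> long)))
            R₁⊆ : ∀ {r} → r ∈ R₁ → r ∈ R′
            R₁⊆ {r} r∈ = subst (r ∈_) (Listₚ.take++drop≡id k R′) (∈ₚ.∈-++⁺ˡ r∈)
            n>0 : 0 < n
            n>0 = positive (let (r , r∈) = nonempty in r , R′⊆ r∈)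
            c>0 : 0 < c
            c>0 = ℕₚ.n≢0⇒n>0 (λ c≡0 → ℕₚ.<⇒≱ (ℕₚ.*-mono-< (s≤s (z≤n {23})) (ℕₚ.*-mono-< (s≤s (z≤n {Δ})) n>0))
              (ℕₚ.≤-trans 24μn≤qc (ℕₚ.≤-reflexive (trans (cong (q *_) c≡0) (ℕₚ.*-zeroʳ q)))))
            R₁-positive : 0 < length R₁
            R₁-positive = subst (0 <_) (sym lenR₁) (ℕₚ.*-mono-< (s≤s (z≤n {2})) (ℕₚ.*-mono-< c>0 c>0))

    -- More than 4qn mirror pairs leave more than 2qn cheap ones, hence by pruning a graph with all
    -- degrees above q. The first condition is twice the coefficient K + 5Dμ of `many-edges⇒regulus`
    -- at D = 9c.
    mirror-bound : 2 * K + 90 * (c * suc Δ) ≤ q → 24 * (suc Δ * n) ≤ q * c → 8 + 36 * c ≤ p → I ≤ 4 * (q * n)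
    mirror-bound h₁ h₂ h₃ = ℕₚ.≮⇒≥ (λ 4qn<I → impossible 4qn<I (M.good-origin S uS e e≢ same-norm N deg-out deg-in))
      where
      impossible : 4 * (q * n) < I → ∃[ x ] p * (∑[ r ∈ S ] ∑[ s ∈ S ] ⟦ r mirrored? s ⟧ * cost x r s) ≤ 8 * (N * I) → ⊥
      impossible 4qn<I (x , cheap) =
        let (R′ , S′ , nonempty , uR′ , uS′ , R′⊆ , S′⊆ , richR , richS) = prune (_~?_ x cheap) q q S S uS uS
              (ℕₚ.*-cancelˡ-< 2 _ _ (ℕₚ.<-≤-trans (subst (_< I) (arithmetic q n) 4qn<I) (I≤2Ĩ x cheap)))
        in finish x cheap h₁ h₂ h₃ R′ S′ uR′ uS′ nonempty R′⊆ S′⊆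
             (ℕₚ.≤-trans (ℕₚ.≤-reflexive (length-∑ S′)) (ℕₚ.≤-trans (shorter S′ uS′ S′⊆) (ℕₚ.≤-reflexive (sym (length-∑ S))))) richR richS
        where
        arithmetic : ∀ q n → 4 * (q * n) ≡ 2 * (q * n + q * n)
        arithmetic = solveℕ 2 (λ q n → κℕ 4 ⊡ (q ⊡ n) ≐ κℕ 2 ⊡ (q ⊡ n ∔ q ⊡ n)) refl
          where open +-*-Solver using () renaming (solve to solveℕ; _:=_ to _≐_; _:+_ to _∔_; _:*_ to _⊡_; con to κℕ)
        shorter : ∀ S′ → Unique S′ → (∀ {s} → s ∈ S′ → s ∈ S) → ∑ S′ (λ _ → 1) ≤ ∑ S (λ _ → 1)
        shorter S′ u sub = count-injection (λ _ → yes tt) (λ _ → yes tt) _≟ˢ_ id u uS (λ s∈ _ → sub s∈ , tt) (λ _ _ _ _ q → q)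

-- Perpendicular bisectors and weighted incidences

module Bisectors (𝔽 : Field) where
  open Counting
  open FieldTheory 𝔽
  open Plane 𝔽
  open Frames 𝔽 using (Mirror; mirror-unique-image)

  PLine : Set
  PLine = F × F × F

  infix 4 _≟ᴸ_
  _≟ᴸ_ : DecidableEquality PLine
  _≟ᴸ_ = ×ₚ.≡-dec _≟_ (×ₚ.≡-dec _≟_ _≟_)

  On : Pt → PLine → Set
  On (x , y) (α , β , γ) = α ⊗ x ⊕ β ⊗ y ≡ γ

  on? : ∀ c ℓ → Dec (On c ℓ)
  on? (x , y) (α , β , γ) = α ⊗ x ⊕ β ⊗ y ≟ γ

  -- Each line of the plane has exactly one equation x + β y = γ or y = γ.
  steep flat : List PLine
  steep = map (λ (β , γ) → 𝟙 , β , γ) plane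
  flat  = map (λ γ → 𝟘 , 𝟙 , γ) elems

  lines : List PLine
  lines = steep ++ flat

  lines-unique : Unique lines
  lines-unique = Uniqueₚ.++⁺ (Uniqueₚ.map⁺ (λ q → cong proj₂ q) plane-unique) (Uniqueₚ.map⁺ (λ q → cong (proj₂ ∘ proj₂) q) elems-unique)
    (λ (s , f) → let (_ , _ , q) = ∈ₚ.∈-map⁻ (λ (β , γ) → 𝟙 , β , γ) s ; (_ , _ , q′) = ∈ₚ.∈-map⁻ (λ γ → 𝟘 , 𝟙 , γ) f in
      𝟙≢𝟘 (cong proj₁ (trans (sym q) q′)))

  ∑-lines : (f : PLine → ℕ) → ∑ lines f ≡ (∑[ β ∈ elems ] ∑[ γ ∈ elems ] f (𝟙 , β , γ)) + (∑[ γ ∈ elems ] f (𝟘 , 𝟙 , γ))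
  ∑-lines f = trans (∑-++ steep flat f) (cong₂ _+_ (trans (∑-map (λ (β , γ) → 𝟙 , β , γ) plane f) (∑-cartesianProduct elems elems _)) (∑-map (λ γ → 𝟘 , 𝟙 , γ) elems f))

  lines-through : ∀ c → (∑[ ℓ ∈ lines ] ⟦ on? c ℓ ⟧) ≡ suc p
  lines-through c@(x , y) = trans (∑-lines (λ ℓ → ⟦ on? c ℓ ⟧)) (trans (cong₂ _+_
      (trans (∑-cong elems (λ {β} _ → ∑-pick-1 _≟_ elems-unique (elems-complete (𝟙 ⊗ x ⊕ β ⊗ y)))) (trans (sym (length-∑ elems)) elems-length))
      (∑-pick-1 _≟_ elems-unique (elems-complete (𝟘 ⊗ x ⊕ 𝟙 ⊗ y)))) (ℕₚ.+-comm p 1))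

  lines-length : length lines ≡ p * p + p
  lines-length = trans (Listₚ.length-++ steep) (cong₂ _+_ (trans (Listₚ.length-map _ plane) plane-length) (trans (Listₚ.length-map _ elems) elems-length))

  line-through-two : ∀ {c c′} → c ≢ c′ → (∑[ ℓ ∈ lines ] ⟦ on? c ℓ ×-dec on? c′ ℓ ⟧) ≤ 1
  line-through-two {c@(x , y)} {c′@(x′ , y′)} c≢ = count≤1 (λ ℓ → on? c ℓ ×-dec on? c′ ℓ) lines-unique
      (λ ℓ∈ ℓ′∈ (h , h′) (k , k′) → unique (shape ℓ∈) (shape ℓ′∈) h h′ k k′)
    where
    Shape : PLine → Set
    Shape (α , β , γ) = α ≡ 𝟙 ⊎ (α ≡ 𝟘 × β ≡ 𝟙)
    shape : ∀ {ℓ} → ℓ ∈ lines → Shape ℓ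
    shape ℓ∈ with ∈ₚ.∈-++⁻ steep ℓ∈
    ... | inj₁ s with ∈ₚ.∈-map⁻ (λ (β , γ) → 𝟙 , β , γ) s
    ...   | _ , _ , refl = inj₁ refl
    shape ℓ∈ | inj₂ f with ∈ₚ.∈-map⁻ (λ γ → 𝟘 , 𝟙 , γ) f
    ...   | _ , _ , refl = inj₂ (refl , refl)
    steep-y : ∀ {β γ} → 𝟙 ⊗ x ⊕ β ⊗ y ≡ γ → 𝟙 ⊗ x′ ⊕ β ⊗ y′ ≡ γ → x ⊖ x′ ≡ β ⊗ (y′ ⊖ y)
    steep-y {β} h h′ = ⊖≡𝟘⇒≡ (trans (solve 5 (λ x x′ y y′ β → x :- x′ :- β :* (y′ :- y) := (x :+ β :* y) :- (x′ :+ β :* y′)) refl x x′ y y′ β)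
      (≡⇒⊖≡𝟘 (trans (cong (_⊕ β ⊗ y) (sym (⊗-identityˡ x))) (trans h (trans (sym h′) (cong (_⊕ β ⊗ y′) (⊗-identityˡ x′)))))))
    flat-y : ∀ {γ} → 𝟘 ⊗ x ⊕ 𝟙 ⊗ y ≡ γ → 𝟘 ⊗ x′ ⊕ 𝟙 ⊗ y′ ≡ γ → y′ ⊖ y ≡ 𝟘
    flat-y h h′ = ≡⇒⊖≡𝟘 (trans (sym (flat-form x′ y′)) (trans h′ (trans (sym h) (flat-form x y))))
      where
      flat-form : ∀ u v → 𝟘 ⊗ u ⊕ 𝟙 ⊗ v ≡ v
      flat-form u v = trans (cong₂ _⊕_ (⊗-zeroˡ u) (⊗-identityˡ v)) (⊕-identityˡ v)
    same-y⇒⊥ : ∀ {β γ} → 𝟙 ⊗ x ⊕ β ⊗ y ≡ γ → 𝟙 ⊗ x′ ⊕ β ⊗ y′ ≡ γ → y′ ⊖ y ≡ 𝟘 → ⊥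
    same-y⇒⊥ {β} h h′ q = c≢ (cong₂ _,_ (⊖≡𝟘⇒≡ (trans (steep-y h h′) (trans (cong (β ⊗_) q) (⊗-zeroʳ β)))) (sym (⊖≡𝟘⇒≡ q)))
    unique : ∀ {ℓ ℓ′} → Shape ℓ → Shape ℓ′ → On c ℓ → On c′ ℓ → On c ℓ′ → On c′ ℓ′ → ℓ ≡ ℓ′
    unique {_ , β , γ} {_ , β′ , γ′} (inj₁ refl) (inj₁ refl) h h′ k k′ with β ≟ β′
    ... | yes refl = cong (λ z → 𝟙 , β , z) (trans (sym h) k)
    ... | no β≢ = ⊥-elim (same-y⇒⊥ h h′ (⊗≡𝟘 (β ⊖ β′) _ (trans (solve 3 (λ a b z → (a :- b) :* z := a :* z :- b :* z) refl β β′ (y′ ⊖ y))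
            (≡⇒⊖≡𝟘 (trans (sym (steep-y h h′)) (steep-y k k′)))) (β≢ ∘ ⊖≡𝟘⇒≡)))
    unique (inj₁ refl) (inj₂ (refl , refl)) h h′ k k′ = ⊥-elim (same-y⇒⊥ h h′ (flat-y k k′))
    unique (inj₂ (refl , refl)) (inj₁ refl) h h′ k k′ = ⊥-elim (same-y⇒⊥ k k′ (flat-y h h′))
    unique {_ , _ , γ} {_ , _ , γ′} (inj₂ (refl , refl)) (inj₂ (refl , refl)) h h′ k k′ = cong (λ z → 𝟘 , 𝟙 , z) (trans (sym h) k)

  half-gap : Pt → Pt → F
  half-gap a b = (nrm b ⊖ nrm a) ⊗ inv two

  -- The value at a = b is arbitrary; the counts of bisectors carry the condition a ≢ b.
  bisector : Pt → Pt → PLine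
  bisector a b with proj₁ (b -ᴾ a) ≟ 𝟘
  ... | no  _ = 𝟙 , proj₂ (b -ᴾ a) ⊗ inv (proj₁ (b -ᴾ a)) , half-gap a b ⊗ inv (proj₁ (b -ᴾ a))
  ... | yes _ = 𝟘 , 𝟙 , half-gap a b ⊗ inv (proj₂ (b -ᴾ a))

  bisector∈lines : ∀ a b → bisector a b ∈ lines
  bisector∈lines a b with proj₁ (b -ᴾ a) ≟ 𝟘
  ... | no  _ = ∈ₚ.∈-++⁺ˡ (∈ₚ.∈-map⁺ (λ (β , γ) → 𝟙 , β , γ) (plane-complete _))
  ... | yes _ = ∈ₚ.∈-++⁺ʳ steep (∈ₚ.∈-map⁺ (λ γ → 𝟘 , 𝟙 , γ) (elems-complete _))

  -- The bisector is a rescaling of the equation (b - a)·z = (|b|² - |a|²) / 2.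
  bisector-scale : ∀ a b → a ≢ b → let (α , β , γ) = bisector a b in
    ∃[ σ ] σ ≢ 𝟘 × proj₁ (b -ᴾ a) ≡ σ ⊗ α × proj₂ (b -ᴾ a) ≡ σ ⊗ β × half-gap a b ≡ σ ⊗ γ
  bisector-scale a b a≢b with proj₁ (b -ᴾ a) ≟ 𝟘
  ... | no n≢ = proj₁ (b -ᴾ a) , n≢ , sym (⊗-identityʳ _) , undo (proj₂ (b -ᴾ a)) n≢ , undo (half-gap a b) n≢
    where
    undo : ∀ z {y} → y ≢ 𝟘 → z ≡ y ⊗ (z ⊗ inv y)
    undo z {y} y≢ = sym (trans (solve 3 (λ y z i → y :* (z :* i) := z :* (y :* i)) refl y z (inv y)) (trans (cong (z ⊗_) (inverse y y≢)) (⊗-identityʳ z)))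
  ... | yes n≡ = proj₂ (b -ᴾ a) , m≢ , trans n≡ (sym (⊗-zeroʳ _)) , sym (⊗-identityʳ _) , undo (half-gap a b) m≢
    where
    m≢ : proj₂ (b -ᴾ a) ≢ 𝟘
    m≢ q = a≢b (sym (-ᴾ≡𝟘 (cong₂ _,_ n≡ q)))
    undo : ∀ z {y} → y ≢ 𝟘 → z ≡ y ⊗ (z ⊗ inv y)
    undo z {y} y≢ = sym (trans (solve 3 (λ y z i → y :* (z :* i) := z :* (y :* i)) refl y z (inv y)) (trans (cong (z ⊗_) (inverse y y≢)) (⊗-identityʳ z)))

  2half-gap : ∀ a b → two ⊗ half-gap a b ≡ nrm b ⊖ nrm a
  2half-gap a b = trans (solve 3 (λ t z i → t :* (z :* i) := z :* (t :* i)) refl two (nrm b ⊖ nrm a) (inv two))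
    (trans (cong ((nrm b ⊖ nrm a) ⊗_) (inverse two two≢𝟘)) (⊗-identityʳ _))

  private
    power-gap : ∀ a b c → dist² a c ⊖ dist² b c ≡ two ⊗ ((b -ᴾ a) ∙ c ⊖ half-gap a b)
    power-gap a@(a₁ , a₂) b@(b₁ , b₂) c@(c₁ , c₂) = trans
      (solve 6 (λ a₁ a₂ b₁ b₂ c₁ c₂ → ((a₁ :- c₁) :* (a₁ :- c₁) :+ (a₂ :- c₂) :* (a₂ :- c₂)) :- ((b₁ :- c₁) :* (b₁ :- c₁) :+ (b₂ :- c₂) :* (b₂ :- c₂))
        := con (ℤ.+ 2) :* ((b₁ :- a₁) :* c₁ :+ (b₂ :- a₂) :* c₂) :- ((b₁ :* b₁ :+ b₂ :* b₂) :- (a₁ :* a₁ :+ a₂ :* a₂))) refl a₁ a₂ b₁ b₂ c₁ c₂)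
      (trans (cong (two ⊗ ((b -ᴾ a) ∙ c) ⊖_) (sym (2half-gap a b)))
        (solve 3 (λ t u v → t :* u :- t :* v := t :* (u :- v)) refl two ((b -ᴾ a) ∙ c) (half-gap a b)))

    on-scaled : ∀ a b c → a ≢ b → ∃[ σ ] σ ≢ 𝟘 × (b -ᴾ a) ∙ c ⊖ half-gap a b ≡ σ ⊗ (proj₁ (bisector a b) ⊗ proj₁ c ⊕ proj₁ (proj₂ (bisector a b)) ⊗ proj₂ c ⊖ proj₂ (proj₂ (bisector a b)))
    on-scaled a b c a≢b with bisector a b | bisector-scale a b a≢b
    ... | α , β , γ | σ , σ≢ , n₁ , n₂ , g = σ , σ≢ , trans
      (cong₂ _⊖_ (cong₂ (λ u v → u ⊗ proj₁ c ⊕ v ⊗ proj₂ c) n₁ n₂) g)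
      (solve 6 (λ σ α β γ x y → σ :* α :* x :+ σ :* β :* y :- σ :* γ := σ :* (α :* x :+ β :* y :- γ)) refl σ α β γ (proj₁ c) (proj₂ c))

  equidistant⇒on : ∀ {a b c} → a ≢ b → dist² a c ≡ dist² b c → On c (bisector a b)
  equidistant⇒on {a} {b} {c} a≢b h = let (σ , σ≢ , q) = on-scaled a b c a≢b in
    ⊖≡𝟘⇒≡ (⊗≡𝟘 σ _ (trans (sym q) (⊗≡𝟘 two _ (trans (sym (power-gap a b c)) (≡⇒⊖≡𝟘 h)) two≢𝟘)) σ≢)

  on⇒equidistant : ∀ {a b c} → a ≢ b → On c (bisector a b) → dist² a c ≡ dist² b c
  on⇒equidistant {a} {b} {c} a≢b h = let (σ , σ≢ , q) = on-scaled a b c a≢b in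
    ⊖≡𝟘⇒≡ (trans (power-gap a b c) (trans (cong (two ⊗_) (trans q (trans (cong (σ ⊗_) (≡⇒⊖≡𝟘 h)) (⊗-zeroʳ σ)))) (⊗-zeroʳ two)))

  -- Both equations are multiples, by σ and σ′, of one normal form, so b′ - a′ = k (b - a) with k =
  -- σ′ / σ. Comparing the constant terms gives the second condition of `Mirror`.
  same-bisector⇒mirror : ∀ {a b a′ b′} → a ≢ b → a′ ≢ b′ → bisector a b ≡ bisector a′ b′ → Mirror a b a′ b′
  same-bisector⇒mirror {a@(a₁ , a₂)} {b@(b₁ , b₂)} {a′@(a₁′ , a₂′)} {b′@(b₁′ , b₂′)} a≢b a′≢b′ eq with bisector a b | bisector a′ b′ | bisector-scale a b a≢b | bisector-scale a′ b′ a′≢b′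
  same-bisector⇒mirror {a@(a₁ , a₂)} {b@(b₁ , b₂)} {a′@(a₁′ , a₂′)} {b′@(b₁′ , b₂′)} a≢b a′≢b′ refl | α , β , γ | _ | σ , σ≢ , n₁ , n₂ , g | σ′ , σ′≢ , n₁′ , n₂′ , g′ =
      k , cong₂ _,_ (move a₁′ b₁′ (scaled n₁ n₁′)) (move a₂′ b₂′ (scaled n₂ n₂′)) , ⊗-cancelˡ k≢ factor
    where
    k : F
    k = σ′ ⊗ inv σ
    k≢ : k ≢ 𝟘
    k≢ = ⊗≢𝟘 σ′≢ (inv≢𝟘 σ≢)
    scaled : ∀ {n n′ t} → n ≡ σ ⊗ t → n′ ≡ σ′ ⊗ t → n′ ≡ k ⊗ n
    scaled {n} {n′} {t} h h′ = trans h′ (sym (trans (cong (k ⊗_) h) (trans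
      (solve 4 (λ s i σ t → s :* i :* (σ :* t) := s :* t :* (σ :* i)) refl σ′ (inv σ) σ t) (trans (cong (σ′ ⊗ t ⊗_) (inverse σ σ≢)) (⊗-identityʳ _)))))
    move : ∀ x y {z} → y ⊖ x ≡ z → y ≡ x ⊕ z
    move x y h = trans (solve 2 (λ x y → y := x :+ (y :- x)) refl x y) (cong (x ⊕_) h)
    N : F
    N = nrm (b -ᴾ a)
    n·a′ : F
    n·a′ = (a′ -ᴾ a) ∙ (b -ᴾ a)
    gaps : nrm b′ ⊖ nrm a′ ≡ k ⊗ (nrm b ⊖ nrm a)
    gaps = trans (sym (2half-gap a′ b′)) (trans (cong (two ⊗_) (scaled g g′)) (trans
      (solve 3 (λ t k h → t :* (k :* h) := k :* (t :* h)) refl two k (half-gap a b)) (cong (k ⊗_) (2half-gap a b))))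
    factor : k ⊗ (k ⊗ N) ≡ k ⊗ (N ⊖ two ⊗ n·a′)
    factor = ⊖≡𝟘⇒≡ (trans
      (solve 7 (λ a₁ a₂ b₁ b₂ u v k → let n₁ = b₁ :- a₁ ; n₂ = b₂ :- a₂ ; N = n₁ :* n₁ :+ n₂ :* n₂ in
         k :* (k :* N) :- k :* (N :- con (ℤ.+ 2) :* ((u :- a₁) :* n₁ :+ (v :- a₂) :* n₂)) :=
         (((u :+ k :* n₁) :* (u :+ k :* n₁) :+ (v :+ k :* n₂) :* (v :+ k :* n₂)) :- (u :* u :+ v :* v)) :- k :* ((b₁ :* b₁ :+ b₂ :* b₂) :- (a₁ :* a₁ :+ a₂ :* a₂)))
        refl a₁ a₂ b₁ b₂ a₁′ a₂′ k)
      (trans (cong (_⊖ k ⊗ (nrm b ⊖ nrm a)) (cong (_⊖ nrm a′) (cong₂ (λ x y → x ⊗ x ⊕ y ⊗ y) (sym (move a₁′ b₁′ (scaled n₁ n₁′))) (sym (move a₂′ b₂′ (scaled n₂ n₂′))))))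
        (≡⇒⊖≡𝟘 gaps)))

  module Incidences (A E : List Pt) (uA : Unique A) (uE : Unique E) where

    isosceles? : ∀ a b c → Dec (a ≢ b × dist² a c ≡ dist² b c)
    isosceles? a b c = ¬? (a ≟ᴾ b) ×-dec (dist² a c ≟ dist² b c)

    has-bisector? : ∀ a b ℓ → Dec (a ≢ b × bisector a b ≡ ℓ)
    has-bisector? a b ℓ = ¬? (a ≟ᴾ b) ×-dec (bisector a b ≟ᴸ ℓ)

    same-bisector? : ∀ a b a′ b′ → Dec ((a ≢ b × a′ ≢ b′) × bisector a b ≡ bisector a′ b′)
    same-bisector? a b a′ b′ = (¬? (a ≟ᴾ b) ×-dec ¬? (a′ ≟ᴾ b′)) ×-dec (bisector a b ≟ᴸ bisector a′ b′)

    -- `energy` is the number B formed for A. The bases run over A and the apices over E, so that A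
    -- may be a pruned part of E.
    triangles energy : ℕ
    triangles = ∑[ a ∈ A ] ∑[ b ∈ A ] ∑[ c ∈ E ] ⟦ isosceles? a b c ⟧
    energy = ∑[ a ∈ A ] ∑[ b ∈ A ] ∑[ a′ ∈ A ] ∑[ b′ ∈ A ] ⟦ same-bisector? a b a′ b′ ⟧

    mult rich : PLine → ℕ
    mult ℓ = ∑[ a ∈ A ] ∑[ b ∈ A ] ⟦ has-bisector? a b ℓ ⟧
    rich ℓ = ∑[ c ∈ E ] ⟦ on? c ℓ ⟧

    private
      ∑-lines-swap : (f : Pt → Pt → PLine → ℕ) → (∑[ ℓ ∈ lines ] ∑[ a ∈ A ] ∑[ b ∈ A ] f a b ℓ) ≡ (∑[ a ∈ A ] ∑[ b ∈ A ] ∑[ ℓ ∈ lines ] f a b ℓ)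
      ∑-lines-swap f = trans (∑-swap lines A _) (∑-cong A (λ _ → ∑-swap lines A _))

      pick : ∀ a b (h : PLine → ℕ) → (∑[ ℓ ∈ lines ] ⟦ has-bisector? a b ℓ ⟧ * h ℓ) ≡ ⟦ ¬? (a ≟ᴾ b) ⟧ * h (bisector a b)
      pick a b h = trans (∑-cong lines (λ {ℓ} _ → trans (cong (_* h ℓ) (⟦⟧-× (¬? (a ≟ᴾ b)) (bisector a b ≟ᴸ ℓ))) (ℕₚ.*-assoc ⟦ ¬? (a ≟ᴾ b) ⟧ _ _)))
        (trans (∑-*ˡ lines ⟦ ¬? (a ≟ᴾ b) ⟧ _) (cong (⟦ ¬? (a ≟ᴾ b) ⟧ *_) (∑-pick _≟ᴸ_ lines-unique (bisector∈lines a b) h)))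

    triangles-by-line : triangles ≡ (∑[ ℓ ∈ lines ] mult ℓ * rich ℓ)
    triangles-by-line = sym (begin
      (∑[ ℓ ∈ lines ] mult ℓ * rich ℓ)
        ≡⟨ ∑-cong lines (λ {ℓ} _ → trans (sym (∑-*ʳ A (rich ℓ) _)) (∑-cong A (λ _ → sym (∑-*ʳ A (rich ℓ) _)))) ⟩
      (∑[ ℓ ∈ lines ] ∑[ a ∈ A ] ∑[ b ∈ A ] ⟦ has-bisector? a b ℓ ⟧ * rich ℓ)
        ≡⟨ ∑-lines-swap (λ a b ℓ → ⟦ has-bisector? a b ℓ ⟧ * rich ℓ) ⟩
      (∑[ a ∈ A ] ∑[ b ∈ A ] ∑[ ℓ ∈ lines ] ⟦ has-bisector? a b ℓ ⟧ * rich ℓ)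
        ≡⟨ ∑-cong A (λ {a} _ → ∑-cong A (λ {b} _ → trans (pick a b rich) (expand a b))) ⟩
      triangles ∎)
      where
      open ≡-Reasoning
      expand : ∀ a b → ⟦ ¬? (a ≟ᴾ b) ⟧ * rich (bisector a b) ≡ (∑[ c ∈ E ] ⟦ isosceles? a b c ⟧)
      expand a b = trans (sym (∑-*ˡ E ⟦ ¬? (a ≟ᴾ b) ⟧ _)) (∑-cong E (λ {c} _ → trans (sym (⟦⟧-× (¬? (a ≟ᴾ b)) (on? c (bisector a b))))
        (⟦⟧-cong (¬? (a ≟ᴾ b) ×-dec on? c (bisector a b)) (isosceles? a b c)
          (λ (a≢b , h) → a≢b , on⇒equidistant a≢b h) (λ (a≢b , h) → a≢b , equidistant⇒on a≢b h))))

    ∑-mult : ∑ lines mult ≡ (∑[ a ∈ A ] ∑[ b ∈ A ] ⟦ ¬? (a ≟ᴾ b) ⟧)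
    ∑-mult = trans (∑-lines-swap (λ a b ℓ → ⟦ has-bisector? a b ℓ ⟧)) (∑-cong A (λ {a} _ → ∑-cong A (λ {b} _ →
      trans (∑-cong lines (λ {ℓ} _ → sym (ℕₚ.*-identityʳ _))) (trans (pick a b (λ _ → 1)) (ℕₚ.*-identityʳ _)))))

    ∑-mult≤ : ∑ lines mult ≤ length A * length A
    ∑-mult≤ = ℕₚ.≤-trans (ℕₚ.≤-reflexive ∑-mult) (∑-bound A (length A) (λ {a} _ → ℕₚ.≤-trans (∑-mono A (λ {b} _ → ⟦⟧≤1 (¬? (a ≟ᴾ b)))) (ℕₚ.≤-reflexive (sym (length-∑ A)))))

    ∑-mult≥ : length A * length A ≤ ∑ lines mult + length A
    ∑-mult≥ = begin
      length A * length A                                   ≡⟨ ∑-const A (length A) ⟨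
      (∑[ a ∈ A ] length A)                                 ≤⟨ ∑-mono A (λ {a} a∈ → row a a∈) ⟩
      (∑[ a ∈ A ] ((∑[ b ∈ A ] ⟦ ¬? (a ≟ᴾ b) ⟧) + 1))       ≡⟨ ∑-+ A (λ a → ∑[ b ∈ A ] ⟦ ¬? (a ≟ᴾ b) ⟧) (λ _ → 1) ⟩
      (∑[ a ∈ A ] ∑[ b ∈ A ] ⟦ ¬? (a ≟ᴾ b) ⟧) + ∑ A (λ _ → 1)   ≡⟨ cong₂ _+_ (sym ∑-mult) (sym (length-∑ A)) ⟩
      ∑ lines mult + length A ∎
      where
      open ℕₚ.≤-Reasoning
      row : ∀ a → a ∈ A → length A ≤ (∑[ b ∈ A ] ⟦ ¬? (a ≟ᴾ b) ⟧) + 1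
      row a a∈ = ℕₚ.≤-reflexive (trans (length-∑ A) (trans (∑-cong A (λ {b} _ → complement (a ≟ᴾ b)))
        (trans (∑-+ A (λ b → ⟦ ¬? (a ≟ᴾ b) ⟧) (λ b → ⟦ a ≟ᴾ b ⟧)) (cong ((∑[ b ∈ A ] ⟦ ¬? (a ≟ᴾ b) ⟧) +_) (∑-pick-1 _≟ᴾ_ uA a∈)))))
        where
        complement : ∀ {P : Set} (d : Dec P) → 1 ≡ ⟦ ¬? d ⟧ + ⟦ d ⟧
        complement (yes _) = refl
        complement (no _)  = refl

    ∑-mult² : (∑[ ℓ ∈ lines ] mult ℓ * mult ℓ) ≡ energy
    ∑-mult² = begin
      (∑[ ℓ ∈ lines ] mult ℓ * mult ℓ)
        ≡⟨ ∑-cong lines (λ {ℓ} _ → trans (sym (∑-*ʳ A (mult ℓ) _)) (∑-cong A (λ _ → sym (∑-*ʳ A (mult ℓ) _)))) ⟩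
      (∑[ ℓ ∈ lines ] ∑[ a ∈ A ] ∑[ b ∈ A ] ⟦ has-bisector? a b ℓ ⟧ * mult ℓ)
        ≡⟨ ∑-lines-swap (λ a b ℓ → ⟦ has-bisector? a b ℓ ⟧ * mult ℓ) ⟩
      (∑[ a ∈ A ] ∑[ b ∈ A ] ∑[ ℓ ∈ lines ] ⟦ has-bisector? a b ℓ ⟧ * mult ℓ)
        ≡⟨ ∑-cong A (λ {a} _ → ∑-cong A (λ {b} _ → trans (pick a b mult) (expand a b))) ⟩
      energy ∎
      where
      open ≡-Reasoning
      expand : ∀ a b → ⟦ ¬? (a ≟ᴾ b) ⟧ * mult (bisector a b) ≡ (∑[ a′ ∈ A ] ∑[ b′ ∈ A ] ⟦ same-bisector? a b a′ b′ ⟧)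
      expand a b = trans (sym (∑-*ˡ A ⟦ ¬? (a ≟ᴾ b) ⟧ _)) (∑-cong A (λ {a′} _ → trans (sym (∑-*ˡ A ⟦ ¬? (a ≟ᴾ b) ⟧ _)) (∑-cong A (λ {b′} _ →
        trans (sym (⟦⟧-× (¬? (a ≟ᴾ b)) (has-bisector? a′ b′ (bisector a b)))) (⟦⟧-cong (¬? (a ≟ᴾ b) ×-dec has-bisector? a′ b′ (bisector a b)) (same-bisector? a b a′ b′)
          (λ (x , y , z) → (x , y) , sym z) (λ ((x , y) , z) → x , y , sym z))))))

    ∑-rich : ∑ lines rich ≡ length E * suc p
    ∑-rich = trans (∑-swap lines E _) (trans (∑-cong E (λ {c} _ → lines-through c)) (∑-const E (suc p)))

    private
      off-diagonal : PLine → ℕ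
      off-diagonal ℓ = ∑[ c ∈ E ] ∑[ c′ ∈ E ] ⟦ ¬? (c ≟ᴾ c′) ×-dec (on? c ℓ ×-dec on? c′ ℓ) ⟧

      rich²≤ : ∀ ℓ → rich ℓ * rich ℓ ≤ rich ℓ + off-diagonal ℓ
      rich²≤ ℓ = begin
        rich ℓ * rich ℓ                                            ≡⟨ ∑-* E E _ _ ⟩
        (∑[ c ∈ E ] ∑[ c′ ∈ E ] ⟦ on? c ℓ ⟧ * ⟦ on? c′ ℓ ⟧)
          ≤⟨ ∑-mono E (λ {c} _ → ∑-mono E (λ {c′} _ → split c c′ (c ≟ᴾ c′))) ⟩
        (∑[ c ∈ E ] ∑[ c′ ∈ E ] (⟦ c ≟ᴾ c′ ⟧ * ⟦ on? c′ ℓ ⟧ + ⟦ ¬? (c ≟ᴾ c′) ×-dec (on? c ℓ ×-dec on? c′ ℓ) ⟧))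
          ≡⟨ trans (∑-cong E (λ _ → ∑-+ E _ _)) (∑-+ E _ _) ⟩
        (∑[ c ∈ E ] ∑[ c′ ∈ E ] ⟦ c ≟ᴾ c′ ⟧ * ⟦ on? c′ ℓ ⟧) + off-diagonal ℓ
          ≡⟨ cong (_+ off-diagonal ℓ) (∑-cong E (λ {c} c∈ → ∑-pick _≟ᴾ_ uE c∈ (λ c′ → ⟦ on? c′ ℓ ⟧))) ⟩
        rich ℓ + off-diagonal ℓ ∎
        where
        open ℕₚ.≤-Reasoning
        split : ∀ c c′ (d : Dec (c ≡ c′)) → ⟦ on? c ℓ ⟧ * ⟦ on? c′ ℓ ⟧ ≤ ⟦ d ⟧ * ⟦ on? c′ ℓ ⟧ + ⟦ ¬? d ×-dec (on? c ℓ ×-dec on? c′ ℓ) ⟧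
        split c c′ (yes _) = ℕₚ.≤-trans (ℕₚ.*-monoˡ-≤ ⟦ on? c′ ℓ ⟧ (⟦⟧≤1 (on? c ℓ))) (ℕₚ.m≤m+n _ _)
        split c c′ (no ¬q) = ℕₚ.≤-reflexive (trans (sym (⟦⟧-× (on? c ℓ) (on? c′ ℓ))) (⟦⟧-cong (on? c ℓ ×-dec on? c′ ℓ) (yes ¬q ×-dec (on? c ℓ ×-dec on? c′ ℓ)) (¬q ,_) proj₂))

      ∑-off-diagonal : ∑ lines off-diagonal ≤ length E * length E
      ∑-off-diagonal = ℕₚ.≤-trans (ℕₚ.≤-reflexive (trans (∑-swap lines E _) (∑-cong E (λ _ → ∑-swap lines E _))))
        (∑-bound E (length E) (λ {c} _ → ℕₚ.≤-trans (∑-mono E (λ {c′} _ → one c c′ (c ≟ᴾ c′))) (ℕₚ.≤-reflexive (sym (length-∑ E)))))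
        where
        one : ∀ c c′ (d : Dec (c ≡ c′)) → (∑[ ℓ ∈ lines ] ⟦ ¬? d ×-dec (on? c ℓ ×-dec on? c′ ℓ) ⟧) ≤ 1
        one c c′ (yes q) = ℕₚ.≤-trans (ℕₚ.≤-reflexive (trans (∑-cong lines (λ {ℓ} _ → ⟦⟧-no (¬? (yes q) ×-dec (on? c ℓ ×-dec on? c′ ℓ)) (λ h → proj₁ h q))) (∑-zero lines))) z≤n
        one c c′ (no ¬q) = ℕₚ.≤-trans (∑-mono lines (λ {ℓ} _ → ⟦⟧-mono (yes ¬q ×-dec (on? c ℓ ×-dec on? c′ ℓ)) (on? c ℓ ×-dec on? c′ ℓ) proj₂)) (line-through-two ¬q)

    -- Truncated subtraction keeps the positive parts only, which suffices for upper bounds.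
    excess deviation : ℕ
    excess = ∑[ ℓ ∈ lines ] mult ℓ * (rich ℓ ∸ 1)
    deviation = ∑[ ℓ ∈ lines ] mult ℓ * (p * rich ℓ ∸ length E)

    triangles≤excess : triangles ≤ length A * length A + excess
    triangles≤excess = begin
      triangles                                                        ≡⟨ triangles-by-line ⟩
      (∑[ ℓ ∈ lines ] mult ℓ * rich ℓ)                                 ≤⟨ ∑-mono lines (λ {ℓ} _ → step (mult ℓ) (rich ℓ)) ⟩
      (∑[ ℓ ∈ lines ] (mult ℓ + mult ℓ * (rich ℓ ∸ 1)))                ≡⟨ ∑-+ lines mult _ ⟩
      ∑ lines mult + excess                                            ≤⟨ ℕₚ.+-monoˡ-≤ excess ∑-mult≤ ⟩
      length A * length A + excess ∎
      where
      open ℕₚ.≤-Reasoning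
      step : ∀ m i → m * i ≤ m + m * (i ∸ 1)
      step m zero    = ℕₚ.≤-trans (ℕₚ.≤-reflexive (ℕₚ.*-zeroʳ m)) z≤n
      step m (suc i) = ℕₚ.≤-reflexive (ℕₚ.*-suc m i)

    -- Σ (rich - 1)² ≤ Σ rich² - Σ rich, which counts ordered pairs of distinct points of E on a
    -- common line; two points determine one line.
    excess² : excess * excess ≤ energy * (length E * length E)
    excess² = ℕₚ.≤-trans (cauchy-schwarz lines mult (λ ℓ → rich ℓ ∸ 1)) (ℕₚ.*-mono-≤ (ℕₚ.≤-reflexive ∑-mult²)
      (ℕₚ.+-cancelˡ-≤ (∑ lines rich) _ _ (ℕₚ.≤-trans (ℕₚ.≤-reflexive (sym (∑-+ lines rich _)))
        (ℕₚ.≤-trans (∑-mono lines (λ {ℓ} _ → ℕₚ.≤-trans (step (rich ℓ)) (rich²≤ ℓ))) (ℕₚ.≤-trans (ℕₚ.≤-reflexive (∑-+ lines rich _)) (ℕₚ.+-monoʳ-≤ (∑ lines rich) ∑-off-diagonal))))))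
      where
      step : ∀ i → i + (i ∸ 1) * (i ∸ 1) ≤ i * i
      step zero    = z≤n
      step (suc i) = ℕₚ.≤-trans (ℕₚ.m≤m+n _ i) (ℕₚ.≤-reflexive (solveℕ 1 (λ i → κℕ 1 ∔ i ∔ i ⊡ i ∔ i ≐ (κℕ 1 ∔ i) ⊡ (κℕ 1 ∔ i)) refl i))
        where open +-*-Solver using () renaming (solve to solveℕ; _:=_ to _≐_; _:+_ to _∔_; _:*_ to _⊡_; con to κℕ)

    triangles≤deviation : p * triangles ≤ length A * length A * length E + deviation
    triangles≤deviation = begin
      p * triangles                                                              ≡⟨ trans (cong (p *_) triangles-by-line) (sym (∑-*ˡ lines p _)) ⟩
      (∑[ ℓ ∈ lines ] p * (mult ℓ * rich ℓ))                                     ≤⟨ ∑-mono lines (λ {ℓ} _ → step (mult ℓ) (rich ℓ)) ⟩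
      (∑[ ℓ ∈ lines ] (mult ℓ * length E + mult ℓ * (p * rich ℓ ∸ length E)))    ≡⟨ trans (∑-+ lines _ _) (cong (_+ deviation) (∑-*ʳ lines (length E) mult)) ⟩
      ∑ lines mult * length E + deviation                                        ≤⟨ ℕₚ.+-monoˡ-≤ deviation (ℕₚ.*-monoˡ-≤ (length E) ∑-mult≤) ⟩
      length A * length A * length E + deviation ∎
      where
      open ℕₚ.≤-Reasoning
      step : ∀ m i → p * (m * i) ≤ m * length E + m * (p * i ∸ length E)
      step m i = ℕₚ.≤-trans (ℕₚ.≤-reflexive (trans (sym (ℕₚ.*-assoc p m i)) (trans (cong (_* i) (ℕₚ.*-comm p m)) (ℕₚ.*-assoc m p i))))
        (ℕₚ.≤-trans (ℕₚ.*-monoʳ-≤ m (ℕₚ.m≤n+m∸n (p * i) (length E))) (ℕₚ.≤-reflexive (ℕₚ.*-distribˡ-+ m (length E) _)))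

    -- The variance of the richness over all lines.
    deviation² : deviation * deviation ≤ energy * (2 * (p * p * p * length E))
    deviation² = ℕₚ.≤-trans (cauchy-schwarz lines mult (λ ℓ → p * rich ℓ ∸ N)) (ℕₚ.*-mono-≤ (ℕₚ.≤-reflexive ∑-mult²) variance)
      where
      open ℕₚ.≤-Reasoning
      open +-*-Solver using () renaming (solve to solveℕ; _:=_ to _≐_; _:+_ to _∔_; _:*_ to _⊡_; con to κℕ)
      N : ℕ
      N = length E
      Var : ℕ
      Var = ∑[ ℓ ∈ lines ] (p * rich ℓ ∸ N) * (p * rich ℓ ∸ N)
      square-gap : ∀ x y → (x ∸ y) * (x ∸ y) + 2 * (x * y) ≤ x * x + y * y
      square-gap x y with ℕₚ.≤-total y x
      ... | inj₁ y≤x with ℕₚ.m≤n⇒∃[o]m+o≡n y≤x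
      ...   | o , refl rewrite ℕₚ.m+n∸m≡n y o = ℕₚ.≤-reflexive (solveℕ 2 (λ y o → o ⊡ o ∔ κℕ 2 ⊡ ((y ∔ o) ⊡ y) ≐ (y ∔ o) ⊡ (y ∔ o) ∔ y ⊡ y) refl y o)
      square-gap x y | inj₂ x≤y rewrite ℕₚ.m≤n⇒m∸n≡0 x≤y = 2xy≤x²+y² x y
      variance : Var ≤ 2 * (p * p * p * N)
      variance = ℕₚ.+-cancelʳ-≤ (2 * (p * N) * (N * suc p)) Var _ (begin
        Var + 2 * (p * N) * (N * suc p)
          ≡⟨ cong (Var +_) (trans (cong (2 * (p * N) *_) (sym ∑-rich)) (sym (∑-*ˡ lines (2 * (p * N)) rich))) ⟩
        Var + (∑[ ℓ ∈ lines ] 2 * (p * N) * rich ℓ)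
          ≡⟨ ∑-+ lines _ _ ⟨
        (∑[ ℓ ∈ lines ] ((p * rich ℓ ∸ N) * (p * rich ℓ ∸ N) + 2 * (p * N) * rich ℓ))
          ≤⟨ ∑-mono lines (λ {ℓ} _ → ℕₚ.≤-trans (ℕₚ.≤-reflexive (cong ((p * rich ℓ ∸ N) * (p * rich ℓ ∸ N) +_)
               (solveℕ 3 (λ p N i → κℕ 2 ⊡ (p ⊡ N) ⊡ i ≐ κℕ 2 ⊡ (p ⊡ i ⊡ N)) refl p N (rich ℓ)))) (square-gap (p * rich ℓ) N)) ⟩
        (∑[ ℓ ∈ lines ] (p * rich ℓ * (p * rich ℓ) + N * N))
          ≤⟨ ∑-mono lines (λ {ℓ} _ → ℕₚ.+-monoˡ-≤ (N * N) (ℕₚ.≤-trans (ℕₚ.≤-reflexive (solveℕ 2 (λ p i → p ⊡ i ⊡ (p ⊡ i) ≐ p ⊡ p ⊡ (i ⊡ i)) refl p (rich ℓ)))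
               (ℕₚ.*-monoʳ-≤ (p * p) (rich²≤ ℓ)))) ⟩
        (∑[ ℓ ∈ lines ] (p * p * (rich ℓ + off-diagonal ℓ) + N * N))
          ≡⟨ trans (∑-+ lines _ _) (cong₂ _+_ (trans (∑-*ˡ lines (p * p) _) (cong (p * p *_) (trans (∑-+ lines rich off-diagonal) (cong (_+ ∑ lines off-diagonal) ∑-rich))))
               (trans (∑-const lines (N * N)) (cong (_* (N * N)) lines-length))) ⟩
        p * p * (N * suc p + ∑ lines off-diagonal) + (p * p + p) * (N * N)
          ≤⟨ ℕₚ.+-monoˡ-≤ ((p * p + p) * (N * N)) (ℕₚ.*-monoʳ-≤ (p * p) (ℕₚ.+-monoʳ-≤ (N * suc p) ∑-off-diagonal)) ⟩
        p * p * (N * suc p + N * N) + (p * p + p) * (N * N)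
          ≤⟨ ℕₚ.m≤m+n _ (p * (N * N)) ⟩
        p * p * (N * suc p + N * N) + (p * p + p) * (N * N) + p * (N * N)
          ≡⟨ solveℕ 2 (λ p N → p ⊡ p ⊡ (N ⊡ (κℕ 1 ∔ p) ∔ N ⊡ N) ∔ (p ⊡ p ∔ p) ⊡ (N ⊡ N) ∔ p ⊡ (N ⊡ N) ≐
               p ⊡ p ⊡ p ⊡ N ∔ p ⊡ p ⊡ N ∔ κℕ 2 ⊡ (p ⊡ N) ⊡ (N ⊡ (κℕ 1 ∔ p))) refl p N ⟩
        p * p * p * N + p * p * N + 2 * (p * N) * (N * suc p)
          ≤⟨ ℕₚ.+-monoˡ-≤ (2 * (p * N) * (N * suc p)) (ℕₚ.+-monoʳ-≤ (p * p * p * N) (ℕₚ.*-monoˡ-≤ N (ℕₚ.m≤m*n (p * p) p {{ℕ.>-nonZero (ℕₚ.<-trans (s≤s z≤n) 2<p)}}))) ⟩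
        p * p * p * N + p * p * p * N + 2 * (p * N) * (N * suc p)
          ≡⟨ cong (λ z → p * p * p * N + z + 2 * (p * N) * (N * suc p)) (ℕₚ.+-identityʳ _) ⟨
        2 * (p * p * p * N) + 2 * (p * N) * (N * suc p) ∎)

    -- Cauchy-Schwarz against the constant 1 over all p² + p lines.
    energy≥ : ∑ lines mult * ∑ lines mult ≤ energy * (p * p + p)
    energy≥ = subst₂ _≤_ (cong (λ z → z * z) (∑-cong lines (λ _ → ℕₚ.*-identityʳ _))) (cong₂ _*_ ∑-mult² (trans (sym (length-∑ lines)) lines-length))
      (cauchy-schwarz lines mult (λ _ → 1))

    -- The bisector of a b and the point a′ determine b′.
    energy≤cube : energy ≤ length A * (length A * length A)
    energy≤cube = ∑-bound A (length A * length A) (λ {a} _ → ∑-bound A (length A) (λ {b} _ → ℕₚ.≤-trans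
      (∑-mono A (λ {a′} _ → count≤1 (same-bisector? a b a′) uA (λ _ _ ((x , y) , h) ((_ , y′) , h′) →
        mirror-unique-image x (same-bisector⇒mirror x y h) (same-bisector⇒mirror x y′ h′)))) (ℕₚ.≤-reflexive (sym (length-∑ A)))))

-- Rectangles, distances and the bisector energy

module Rectangles (𝔽 : Field) where
  open Counting
  open FieldTheory 𝔽
  open Plane 𝔽
  open Frames 𝔽 using (Mirror; _+ᴾ_)
  open Bisectors 𝔽

  Corner : Pt → Pt → Pt → Set
  Corner a b c = (b -ᴾ a) ∙ (c -ᴾ a) ≡ 𝟘

  -- Non-degeneracy takes the form a ≠ b and a ≠ d: the norm being anisotropic, a corner with two
  -- nonzero legs does not fit into a line.
  Rectangle : Pt → Pt → Pt → Pt → Set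
  Rectangle a b c d = (Corner a b d × Corner b a c × Corner c b d × Corner d a c) × (a ≢ b × a ≢ d)

  rectangle? : ∀ a b c d → Dec (Rectangle a b c d)
  rectangle? a b c d = (((b -ᴾ a) ∙ (d -ᴾ a) ≟ 𝟘) ×-dec ((a -ᴾ b) ∙ (c -ᴾ b) ≟ 𝟘) ×-dec ((b -ᴾ c) ∙ (d -ᴾ c) ≟ 𝟘) ×-dec ((a -ᴾ d) ∙ (c -ᴾ d) ≟ 𝟘))
    ×-dec (¬? (a ≟ᴾ b) ×-dec ¬? (a ≟ᴾ d))

  -- Here b′ - a′ = k (b - a), and equal lengths force k² = 1. For k = 1 the points a b b′ a′ form a
  -- rectangle unless a = a′; for k = -1 the points a b a′ b′ do unless a = b′.
  mirror-pairs : ∀ {a b a′ b′} → a ≢ b → Mirror a b a′ b′ → dist² a b ≡ dist² a′ b′ →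
    (Rectangle a b b′ a′ ⊎ Rectangle a b a′ b′) ⊎ ((a , b) ≡ (a′ , b′) ⊎ (b , a) ≡ (a′ , b′))
  mirror-pairs {a@(a₁ , a₂)} {b@(b₁ , b₂)} {a′@(u , v)} a≢b (k , refl , hk) same = cases (a ≟ᴾ a′) (a ≟ᴾ b′) (k ≟ 𝟙)
    where
    n w b′ : Pt
    n = b -ᴾ a
    w = a′ -ᴾ a
    b′ = u ⊕ k ⊗ proj₁ n , v ⊕ k ⊗ proj₂ n
    N≢𝟘 : nrm n ≢ 𝟘
    N≢𝟘 h = a≢b (sym (dist²≡𝟘 h))
    k²≡1 : (k ⊖ 𝟙) ⊗ (k ⊕ 𝟙) ≡ 𝟘
    k²≡1 = ⊗≡𝟘 (nrm n) _ (trans (cong (λ o → nrm n ⊗ ((k ⊖ o) ⊗ (k ⊕ o))) (sym fromℤ-1)) (trans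
      (solve 7 (λ a₁ a₂ b₁ b₂ u v k → let n₁ = b₁ :- a₁ ; n₂ = b₂ :- a₂ in
         (n₁ :* n₁ :+ n₂ :* n₂) :* ((k :- con ℤ.1ℤ) :* (k :+ con ℤ.1ℤ)) :=
         ((u :- (u :+ k :* n₁)) :* (u :- (u :+ k :* n₁)) :+ (v :- (v :+ k :* n₂)) :* (v :- (v :+ k :* n₂))) :- ((a₁ :- b₁) :* (a₁ :- b₁) :+ (a₂ :- b₂) :* (a₂ :- b₂)))
        refl a₁ a₂ b₁ b₂ u v k) (≡⇒⊖≡𝟘 (sym same)))) N≢𝟘
    halve : ∀ {x} → two ⊗ x ≡ 𝟘 → x ≡ 𝟘
    halve h = ⊗≡𝟘 two _ h two≢𝟘
    orth⁺ : k ≡ 𝟙 → w ∙ n ≡ 𝟘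
    orth⁺ k≡ = halve (trans (solve 2 (λ N x → con (ℤ.+ 2) :* x := N :- (N :- con (ℤ.+ 2) :* x)) refl (nrm n) (w ∙ n))
      (≡⇒⊖≡𝟘 (trans (sym (⊗-identityˡ (nrm n))) (trans (cong (_⊗ nrm n) (sym k≡)) hk))))
    orth⁻ : k ⊕ 𝟙 ≡ 𝟘 → w ∙ n ≡ nrm n
    orth⁻ k≡ = sym (⊖≡𝟘⇒≡ (halve (trans
      (solve 3 (λ N x k → con (ℤ.+ 2) :* (N :- x) := (N :- con (ℤ.+ 2) :* x) :- k :* N :+ (k :+ con ℤ.1ℤ) :* N) refl (nrm n) (w ∙ n) k)
      (trans (cong₂ _⊕_ (≡⇒⊖≡𝟘 (sym hk)) (trans (cong (_⊗ nrm n) (trans (cong (k ⊕_) fromℤ-1) k≡)) (⊗-zeroˡ _))) (⊕-identityˡ 𝟘)))))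
    -- in the first case k = 1 and the sides a b, a′ b′ point the same way; in the second k = -1
    same-way : k ≡ 𝟙 → b′ ≡ a′ +ᴾ n
    same-way refl = cong₂ _,_ (cong (u ⊕_) (⊗-identityˡ _)) (cong (v ⊕_) (⊗-identityˡ _))
    reversed : k ⊕ 𝟙 ≡ 𝟘 → b′ ≡ a′ -ᴾ n
    reversed k≡ = cong₂ _,_ (lemma u (proj₁ n)) (lemma v (proj₂ n))
      where
      lemma : ∀ x y → x ⊕ k ⊗ y ≡ x ⊖ y
      lemma x y = trans (cong (λ z → x ⊕ z ⊗ y) (trans (solve 2 (λ k o → k := k :+ o :- o) refl k 𝟙) (trans (cong (_⊖ 𝟙) k≡) (⊕-identityˡ _))))
        (trans (cong (λ o → x ⊕ (⊝ o) ⊗ y) (sym fromℤ-1)) (solve 2 (λ x y → x :+ (:- con ℤ.1ℤ) :* y := x :- y) refl x y))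
    corners⁺ : w ∙ n ≡ 𝟘 → let c = a′ +ᴾ n in Corner a b a′ × Corner b a c × Corner c b a′ × Corner a′ a c
    corners⁺ h =
      trans (solve 6 (λ a₁ a₂ b₁ b₂ u v → (b₁ :- a₁) :* (u :- a₁) :+ (b₂ :- a₂) :* (v :- a₂) := (u :- a₁) :* (b₁ :- a₁) :+ (v :- a₂) :* (b₂ :- a₂)) refl a₁ a₂ b₁ b₂ u v) h ,
      trans (solve 6 (λ a₁ a₂ b₁ b₂ u v → (a₁ :- b₁) :* ((u :+ (b₁ :- a₁)) :- b₁) :+ (a₂ :- b₂) :* ((v :+ (b₂ :- a₂)) :- b₂) := :- ((u :- a₁) :* (b₁ :- a₁) :+ (v :- a₂) :* (b₂ :- a₂))) refl a₁ a₂ b₁ b₂ u v) (negate h) ,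
      trans (solve 6 (λ a₁ a₂ b₁ b₂ u v → (b₁ :- (u :+ (b₁ :- a₁))) :* (u :- (u :+ (b₁ :- a₁))) :+ (b₂ :- (v :+ (b₂ :- a₂))) :* (v :- (v :+ (b₂ :- a₂))) := (u :- a₁) :* (b₁ :- a₁) :+ (v :- a₂) :* (b₂ :- a₂)) refl a₁ a₂ b₁ b₂ u v) h ,
      trans (solve 6 (λ a₁ a₂ b₁ b₂ u v → (a₁ :- u) :* ((u :+ (b₁ :- a₁)) :- u) :+ (a₂ :- v) :* ((v :+ (b₂ :- a₂)) :- v) := :- ((u :- a₁) :* (b₁ :- a₁) :+ (v :- a₂) :* (b₂ :- a₂))) refl a₁ a₂ b₁ b₂ u v) (negate h)
      where
      negate : ∀ {x} → x ≡ 𝟘 → ⊝ x ≡ 𝟘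
      negate refl = trans (sym (⊕-identityˡ _)) (⊖-self 𝟘)
    corners⁻ : w ∙ n ≡ nrm n → let d = a′ -ᴾ n in Corner a b d × Corner b a a′ × Corner a′ b d × Corner d a a′
    corners⁻ h =
      trans (solve 6 (λ a₁ a₂ b₁ b₂ u v → (b₁ :- a₁) :* ((u :- (b₁ :- a₁)) :- a₁) :+ (b₂ :- a₂) :* ((v :- (b₂ :- a₂)) :- a₂) := gap a₁ a₂ b₁ b₂ u v) refl a₁ a₂ b₁ b₂ u v) (≡⇒⊖≡𝟘 h) ,
      trans (solve 6 (λ a₁ a₂ b₁ b₂ u v → (a₁ :- b₁) :* (u :- b₁) :+ (a₂ :- b₂) :* (v :- b₂) := :- gap a₁ a₂ b₁ b₂ u v) refl a₁ a₂ b₁ b₂ u v) (negate (≡⇒⊖≡𝟘 h)) ,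
      trans (solve 6 (λ a₁ a₂ b₁ b₂ u v → (b₁ :- u) :* ((u :- (b₁ :- a₁)) :- u) :+ (b₂ :- v) :* ((v :- (b₂ :- a₂)) :- v) := gap a₁ a₂ b₁ b₂ u v) refl a₁ a₂ b₁ b₂ u v) (≡⇒⊖≡𝟘 h) ,
      trans (solve 6 (λ a₁ a₂ b₁ b₂ u v → (a₁ :- (u :- (b₁ :- a₁))) :* (u :- (u :- (b₁ :- a₁))) :+ (a₂ :- (v :- (b₂ :- a₂))) :* (v :- (v :- (b₂ :- a₂))) := :- gap a₁ a₂ b₁ b₂ u v) refl a₁ a₂ b₁ b₂ u v) (negate (≡⇒⊖≡𝟘 h))
      where
      negate : ∀ {x} → x ≡ 𝟘 → ⊝ x ≡ 𝟘
      negate refl = trans (sym (⊕-identityˡ _)) (⊖-self 𝟘)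
      gap : ∀ {m} (a₁ a₂ b₁ b₂ u v : Polynomial m) → Polynomial m
      gap a₁ a₂ b₁ b₂ u v = ((u :- a₁) :* (b₁ :- a₁) :+ (v :- a₂) :* (b₂ :- a₂)) :- ((b₁ :- a₁) :* (b₁ :- a₁) :+ (b₂ :- a₂) :* (b₂ :- a₂))
    back : ∀ x y → x ⊕ (y ⊖ x) ≡ y
    back x y = solve 2 (λ x y → x :+ (y :- x) := y) refl x y
    Corners : Pt → Pt → Set
    Corners c d = Corner a b d × Corner b a c × Corner c b d × Corner d a c
    cases : Dec (a ≡ a′) → Dec (a ≡ b′) → Dec (k ≡ 𝟙) → (Rectangle a b b′ a′ ⊎ Rectangle a b a′ b′) ⊎ ((a , b) ≡ (a′ , b′) ⊎ (b , a) ≡ (a′ , b′))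
    cases (yes refl) _ (yes k≡) = inj₂ (inj₁ (cong (a ,_) (sym (trans (same-way k≡) (cong₂ _,_ (back a₁ b₁) (back a₂ b₂))))))
    cases (no a≢a′) _ (yes k≡) = inj₁ (inj₁ (subst (λ c → Corners c a′) (sym (same-way k≡)) (corners⁺ (orth⁺ k≡)) , a≢b , a≢a′))
    cases _ (no a≢b′) (no k≢) = inj₁ (inj₂ (subst (λ d → Corners a′ d) (sym (reversed k+1≡𝟘)) (corners⁻ (orth⁻ k+1≡𝟘)) , a≢b , a≢b′))
      where
      k+1≡𝟘 : k ⊕ 𝟙 ≡ 𝟘
      k+1≡𝟘 = ⊗≡𝟘 (k ⊖ 𝟙) _ k²≡1 (k≢ ∘ ⊖≡𝟘⇒≡)
    cases _ (yes a≡b′) (no k≢) = inj₂ (inj₂ (cong₂ _,_ (cong₂ _,_ (shift (cong proj₁ eq)) (shift (cong proj₂ eq))) a≡b′))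
      where
      eq : a ≡ a′ -ᴾ n
      eq = trans a≡b′ (reversed (⊗≡𝟘 (k ⊖ 𝟙) _ k²≡1 (k≢ ∘ ⊖≡𝟘⇒≡)))
      shift : ∀ {x y z} → x ≡ z ⊖ (y ⊖ x) → y ≡ z
      shift {x} {y} {z} h = trans (solve 2 (λ x y → y := x :+ (y :- x)) refl x y) (trans (cong (_⊕ (y ⊖ x)) h) (solve 3 (λ x y z → z :- (y :- x) :+ (y :- x) := z) refl x y z))

  module Distances (E : List Pt) (uE : Unique E) where
    open Incidences E E uE uE using (same-bisector?; energy; has-bisector?; mult; ∑-mult²)

    N : ℕ
    N = length E

    occurs? : ∀ δ → Dec (Any (λ ab → dist² (proj₁ ab) (proj₂ ab) ≡ δ) (cartesianProduct E E))
    occurs? δ = Any.any? (λ ab → dist² (proj₁ ab) (proj₂ ab) ≟ δ) (cartesianProduct E E)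

    occurs : ∀ {a b} → a ∈ E → b ∈ E → Any (λ ab → dist² (proj₁ ab) (proj₂ ab) ≡ dist² a b) (cartesianProduct E E)
    occurs a∈ b∈ = lose (∈ₚ.∈-cartesianProduct⁺ a∈ b∈) refl

    distances rectangles# isosceles : ℕ
    distances   = ∑[ δ ∈ elems ] ⟦ occurs? δ ⟧
    rectangles# = ∑[ a ∈ E ] ∑[ b ∈ E ] ∑[ c ∈ E ] ∑[ d ∈ E ] ⟦ rectangle? a b c d ⟧
    isosceles   = ∑[ a ∈ E ] ∑[ b ∈ E ] ∑[ c ∈ E ] ⟦ (dist² a c ≟ dist² b c) ×-dec ¬? (dist² b c ≟ 𝟘) ⟧

    -- Cauchy–Schwarz over the occurring distances.
    by-distance : (f : F → ℕ) → (∀ {δ} → δ ∈ elems → 0 < f δ → Any (λ ab → dist² (proj₁ ab) (proj₂ ab) ≡ δ) (cartesianProduct E E)) →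
      ∑ elems f * ∑ elems f ≤ distances * (∑[ δ ∈ elems ] f δ * f δ)
    by-distance f supported = ℕₚ.≤-trans (ℕₚ.≤-reflexive (cong (λ z → z * z) (∑-cong elems (λ {δ} δ∈ → support δ δ∈ (occurs? δ)))))
      (ℕₚ.≤-trans (cauchy-schwarz elems (λ δ → ⟦ occurs? δ ⟧) f) (ℕₚ.*-monoˡ-≤ (∑[ δ ∈ elems ] f δ * f δ) (∑-mono elems (λ {δ} _ → idempotent (occurs? δ)))))
      where
      idempotent : ∀ {P : Set} (d : Dec P) → ⟦ d ⟧ * ⟦ d ⟧ ≤ ⟦ d ⟧
      idempotent (yes _) = s≤s z≤n
      idempotent (no _)  = z≤n
      support : ∀ δ → δ ∈ elems → (d : Dec _) → f δ ≡ ⟦ d ⟧ * f δ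
      support δ δ∈ (yes _) = sym (ℕₚ.+-identityʳ (f δ))
      support δ δ∈ (no ¬q) = ℕₚ.n≤0⇒n≡0 (ℕₚ.≮⇒≥ (λ lt → ¬q (supported δ∈ lt)))

    private
      congruent? : ∀ a b a′ b′ → Dec (((a ≢ b × a′ ≢ b′) × bisector a b ≡ bisector a′ b′) × dist² a b ≡ dist² a′ b′)
      congruent? a b a′ b′ = same-bisector? a b a′ b′ ×-dec (dist² a b ≟ dist² a′ b′)

      cell? : ∀ ℓ δ a b → Dec ((a ≢ b × bisector a b ≡ ℓ) × dist² a b ≡ δ)
      cell? ℓ δ a b = has-bisector? a b ℓ ×-dec (dist² a b ≟ δ)

      cell : PLine → F → ℕ
      cell ℓ δ = ∑[ a ∈ E ] ∑[ b ∈ E ] ⟦ cell? ℓ δ a b ⟧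

      congruent : ℕ
      congruent = ∑[ a ∈ E ] ∑[ b ∈ E ] ∑[ a′ ∈ E ] ∑[ b′ ∈ E ] ⟦ congruent? a b a′ b′ ⟧

      ∑-cell : ∀ ℓ → mult ℓ ≡ (∑[ δ ∈ elems ] cell ℓ δ)
      ∑-cell ℓ = sym (trans (∑-swap elems E _) (∑-cong E (λ {a} _ → trans (∑-swap elems E _) (∑-cong E (λ {b} _ →
        trans (∑-cong elems (λ {δ} _ → trans (⟦⟧-× (has-bisector? a b ℓ) (dist² a b ≟ δ)) (ℕₚ.*-comm ⟦ has-bisector? a b ℓ ⟧ _)))
          (∑-pick _≟_ elems-unique (elems-complete (dist² a b)) (λ _ → ⟦ has-bisector? a b ℓ ⟧)))))))

      cell-supported : ∀ ℓ {δ} → 0 < cell ℓ δ → Any (λ ab → dist² (proj₁ ab) (proj₂ ab) ≡ δ) (cartesianProduct E E)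
      cell-supported ℓ {δ} lt = let (a , a∈ , lt₁) = ∑>0 E _ lt ; (b , b∈ , lt₂) = ∑>0 E _ lt₁ in
        subst (λ δ → Any (λ ab → dist² (proj₁ ab) (proj₂ ab) ≡ δ) (cartesianProduct E E)) (proj₂ (⟦⟧>0 (cell? ℓ δ a b) lt₂)) (occurs a∈ b∈)

      ∑-cell² : (∑[ ℓ ∈ lines ] ∑[ δ ∈ elems ] cell ℓ δ * cell ℓ δ) ≡ congruent
      ∑-cell² = begin
        (∑[ ℓ ∈ lines ] ∑[ δ ∈ elems ] cell ℓ δ * cell ℓ δ)
          ≡⟨ ∑-cong lines (λ {ℓ} _ → ∑-cong elems (λ {δ} _ → trans (sym (∑-*ʳ E (cell ℓ δ) _)) (∑-cong E (λ _ → sym (∑-*ʳ E (cell ℓ δ) _))))) ⟩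
        (∑[ ℓ ∈ lines ] ∑[ δ ∈ elems ] ∑[ a ∈ E ] ∑[ b ∈ E ] ⟦ cell? ℓ δ a b ⟧ * cell ℓ δ)
          ≡⟨ trans (∑-cong lines (λ _ → trans (∑-swap elems E _) (∑-cong E (λ _ → ∑-swap elems E _)))) (trans (∑-swap lines E _) (∑-cong E (λ _ → ∑-swap lines E _))) ⟩
        (∑[ a ∈ E ] ∑[ b ∈ E ] ∑[ ℓ ∈ lines ] ∑[ δ ∈ elems ] ⟦ cell? ℓ δ a b ⟧ * cell ℓ δ)
          ≡⟨ ∑-cong E (λ {a} _ → ∑-cong E (λ {b} _ → trans (pick a b) (expand a b))) ⟩
        congruent ∎
        where
        open ≡-Reasoning
        pick : ∀ a b → (∑[ ℓ ∈ lines ] ∑[ δ ∈ elems ] ⟦ cell? ℓ δ a b ⟧ * cell ℓ δ) ≡ ⟦ ¬? (a ≟ᴾ b) ⟧ * cell (bisector a b) (dist² a b)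
        pick a b = trans (∑-cong lines (λ {ℓ} _ → trans (∑-cong elems (λ {δ} _ → trans (cong (_* cell ℓ δ) (⟦⟧-× (has-bisector? a b ℓ) (dist² a b ≟ δ))) (ℕₚ.*-assoc ⟦ has-bisector? a b ℓ ⟧ _ _)))
            (trans (∑-*ˡ elems ⟦ has-bisector? a b ℓ ⟧ _) (cong (⟦ has-bisector? a b ℓ ⟧ *_) (∑-pick _≟_ elems-unique (elems-complete (dist² a b)) (cell ℓ))))))
          (trans (∑-cong lines (λ {ℓ} _ → trans (cong (_* cell ℓ (dist² a b)) (⟦⟧-× (¬? (a ≟ᴾ b)) (bisector a b ≟ᴸ ℓ))) (ℕₚ.*-assoc ⟦ ¬? (a ≟ᴾ b) ⟧ _ _)))
            (trans (∑-*ˡ lines ⟦ ¬? (a ≟ᴾ b) ⟧ _) (cong (⟦ ¬? (a ≟ᴾ b) ⟧ *_) (∑-pick _≟ᴸ_ lines-unique (bisector∈lines a b) (λ ℓ → cell ℓ (dist² a b))))))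
        expand : ∀ a b → ⟦ ¬? (a ≟ᴾ b) ⟧ * cell (bisector a b) (dist² a b) ≡ (∑[ a′ ∈ E ] ∑[ b′ ∈ E ] ⟦ congruent? a b a′ b′ ⟧)
        expand a b = trans (sym (∑-*ˡ E ⟦ ¬? (a ≟ᴾ b) ⟧ _)) (∑-cong E (λ {a′} _ → trans (sym (∑-*ˡ E ⟦ ¬? (a ≟ᴾ b) ⟧ _)) (∑-cong E (λ {b′} _ →
          trans (sym (⟦⟧-× (¬? (a ≟ᴾ b)) (cell? (bisector a b) (dist² a b) a′ b′)))
            (⟦⟧-cong (¬? (a ≟ᴾ b) ×-dec cell? (bisector a b) (dist² a b) a′ b′) (congruent? a b a′ b′)
              (λ (x , (y , z) , t) → ((x , y) , sym z) , sym t) (λ (((x , y) , z) , t) → x , (y , sym z) , sym t))))))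

      congruent≤ : congruent ≤ 2 * (rectangles# + N * N)
      congruent≤ = begin
        congruent
          ≤⟨ ∑-mono E (λ {a} a∈ → ∑-mono E (λ {b} b∈ → row a b a∈ b∈)) ⟩
        (∑[ a ∈ E ] ∑[ b ∈ E ] (2 * □ a b + 2))
          ≡⟨ ∑-cong E (λ {a} _ → trans (∑-+ E (λ b → 2 * □ a b) (λ _ → 2)) (cong₂ _+_ (∑-*ˡ E 2 (□ a)) (∑-const E 2))) ⟩
        (∑[ a ∈ E ] (2 * ∑ E (□ a) + N * 2))
          ≡⟨ trans (∑-+ E (λ a → 2 * ∑ E (□ a)) (λ _ → N * 2)) (cong₂ _+_ (∑-*ˡ E 2 (λ a → ∑ E (□ a))) (∑-const E (N * 2))) ⟩
        2 * rectangles# + N * (N * 2)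
          ≡⟨ solveℕ 2 (λ r N → κℕ 2 ⊡ r ∔ N ⊡ (N ⊡ κℕ 2) ≐ κℕ 2 ⊡ (r ∔ N ⊡ N)) refl rectangles# N ⟩
        2 * (rectangles# + N * N) ∎
        where
        open ℕₚ.≤-Reasoning
        open +-*-Solver using () renaming (solve to solveℕ; _:=_ to _≐_; _:+_ to _∔_; _:*_ to _⊡_; con to κℕ)
        □ : Pt → Pt → ℕ
        □ a b = ∑[ c ∈ E ] ∑[ d ∈ E ] ⟦ rectangle? a b c d ⟧
        split : (f g : Pt → Pt → ℕ) → (∑[ a′ ∈ E ] ∑[ b′ ∈ E ] (f a′ b′ + g a′ b′)) ≡ (∑[ a′ ∈ E ] ∑[ b′ ∈ E ] f a′ b′) + (∑[ a′ ∈ E ] ∑[ b′ ∈ E ] g a′ b′)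
        split f g = trans (∑-cong E (λ {a′} _ → ∑-+ E (f a′) (g a′))) (∑-+ E (λ a′ → ∑ E (f a′)) (λ a′ → ∑ E (g a′)))
        single : ∀ {a b} → a ∈ E → b ∈ E → (∑[ a′ ∈ E ] ∑[ b′ ∈ E ] ⟦ ×ₚ.≡-dec _≟ᴾ_ _≟ᴾ_ (a , b) (a′ , b′) ⟧) ≡ 1
        single a∈ b∈ = trans (sym (∑-cartesianProduct E E _)) (∑-pick-1 (×ₚ.≡-dec _≟ᴾ_ _≟ᴾ_) (Uniqueₚ.cartesianProduct⁺ uE uE) (∈ₚ.∈-cartesianProduct⁺ a∈ b∈))
        row : ∀ a b → a ∈ E → b ∈ E → (∑[ a′ ∈ E ] ∑[ b′ ∈ E ] ⟦ congruent? a b a′ b′ ⟧) ≤ 2 * □ a b + 2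
        row a b a∈ b∈ = begin
          (∑[ a′ ∈ E ] ∑[ b′ ∈ E ] ⟦ congruent? a b a′ b′ ⟧)
            ≤⟨ ∑-mono E (λ {a′} _ → ∑-mono E (λ {b′} _ → four a′ b′)) ⟩
          (∑[ a′ ∈ E ] ∑[ b′ ∈ E ] ((⟦ rectangle? a b b′ a′ ⟧ + ⟦ rectangle? a b a′ b′ ⟧) + (⟦ eq? (a , b) (a′ , b′) ⟧ + ⟦ eq? (b , a) (a′ , b′) ⟧)))
            ≡⟨ trans (split (λ a′ b′ → ⟦ rectangle? a b b′ a′ ⟧ + ⟦ rectangle? a b a′ b′ ⟧) (λ a′ b′ → ⟦ eq? (a , b) (a′ , b′) ⟧ + ⟦ eq? (b , a) (a′ , b′) ⟧))
                 (cong₂ _+_ (split (λ a′ b′ → ⟦ rectangle? a b b′ a′ ⟧) (λ a′ b′ → ⟦ rectangle? a b a′ b′ ⟧)) (split (λ a′ b′ → ⟦ eq? (a , b) (a′ , b′) ⟧) (λ a′ b′ → ⟦ eq? (b , a) (a′ , b′) ⟧))) ⟩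
          ((∑[ a′ ∈ E ] ∑[ b′ ∈ E ] ⟦ rectangle? a b b′ a′ ⟧) + □ a b) + ((∑[ a′ ∈ E ] ∑[ b′ ∈ E ] ⟦ eq? (a , b) (a′ , b′) ⟧) + (∑[ a′ ∈ E ] ∑[ b′ ∈ E ] ⟦ eq? (b , a) (a′ , b′) ⟧))
            ≡⟨ cong₂ _+_ (cong (_+ □ a b) (∑-swap E E (λ a′ b′ → ⟦ rectangle? a b b′ a′ ⟧))) (cong₂ _+_ (single a∈ b∈) (single b∈ a∈)) ⟩
          (□ a b + □ a b) + 2
            ≡⟨ cong (λ z → (□ a b + z) + 2) (ℕₚ.+-identityʳ (□ a b)) ⟨
          2 * □ a b + 2 ∎
          where
          eq? : ∀ (x y : Pt × Pt) → Dec (x ≡ y)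
          eq? = ×ₚ.≡-dec _≟ᴾ_ _≟ᴾ_
          four : ∀ a′ b′ → ⟦ congruent? a b a′ b′ ⟧ ≤ (⟦ rectangle? a b b′ a′ ⟧ + ⟦ rectangle? a b a′ b′ ⟧) + (⟦ eq? (a , b) (a′ , b′) ⟧ + ⟦ eq? (b , a) (a′ , b′) ⟧)
          four a′ b′ = ℕₚ.≤-trans (⟦⟧-≤+ (congruent? a b a′ b′) (rectangle? a b b′ a′ ⊎-dec rectangle? a b a′ b′) (eq? (a , b) (a′ , b′) ⊎-dec eq? (b , a) (a′ , b′))
              (λ (((x , y) , z) , t) → mirror-pairs x (same-bisector⇒mirror x y z) t))
            (ℕₚ.+-mono-≤ (⟦⟧-≤+ (rectangle? a b b′ a′ ⊎-dec rectangle? a b a′ b′) (rectangle? a b b′ a′) (rectangle? a b a′ b′) id)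
              (⟦⟧-≤+ (eq? (a , b) (a′ , b′) ⊎-dec eq? (b , a) (a′ , b′)) (eq? (a , b) (a′ , b′)) (eq? (b , a) (a′ , b′)) id))

    energy≤rectangles : energy ≤ distances * (2 * (rectangles# + N * N))
    energy≤rectangles = begin
      energy
        ≡⟨ trans (sym ∑-mult²) (∑-cong lines (λ {ℓ} _ → cong (λ z → z * z) (∑-cell ℓ))) ⟩
      (∑[ ℓ ∈ lines ] ∑ elems (cell ℓ) * ∑ elems (cell ℓ))
        ≤⟨ ∑-mono lines (λ {ℓ} _ → by-distance (cell ℓ) (λ _ → cell-supported ℓ)) ⟩
      (∑[ ℓ ∈ lines ] distances * (∑[ δ ∈ elems ] cell ℓ δ * cell ℓ δ))
        ≡⟨ trans (∑-*ˡ lines distances _) (cong (distances *_) ∑-cell²) ⟩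
      distances * congruent
        ≤⟨ ℕₚ.*-monoʳ-≤ distances congruent≤ ⟩
      distances * (2 * (rectangles# + N * N)) ∎
      where open ℕₚ.≤-Reasoning

    -- Pinned distances from each c, by Cauchy–Schwarz.
    isosceles≥ : N * ((N ∸ 1) * (N ∸ 1)) ≤ distances * isosceles
    isosceles≥ = begin
      N * ((N ∸ 1) * (N ∸ 1))                        ≡⟨ ∑-const E _ ⟨
      (∑[ c ∈ E ] (N ∸ 1) * (N ∸ 1))                 ≤⟨ ∑-mono E (λ {c} c∈ → ℕₚ.≤-trans (ℕₚ.*-mono-≤ (others c c∈) (others c c∈)) (by-distance (pinned c) (λ _ → supported c c∈))) ⟩
      (∑[ c ∈ E ] distances * (∑[ δ ∈ elems ] pinned c δ * pinned c δ))   ≡⟨ trans (∑-*ˡ E distances _) (cong (distances *_) (∑-cong E (λ {c} _ → square c))) ⟩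
      distances * (∑[ c ∈ E ] ∑[ a ∈ E ] ∑[ b ∈ E ] ⟦ (dist² a c ≟ dist² b c) ×-dec ¬? (dist² b c ≟ 𝟘) ⟧)
        ≡⟨ cong (distances *_) (trans (∑-swap E E _) (∑-cong E (λ _ → ∑-swap E E _))) ⟩
      distances * isosceles ∎
      where
      open ℕₚ.≤-Reasoning
      at? : ∀ c δ a → Dec (dist² a c ≡ δ × dist² a c ≢ 𝟘)
      at? c δ a = (dist² a c ≟ δ) ×-dec ¬? (dist² a c ≟ 𝟘)
      pinned : Pt → F → ℕ
      pinned c δ = ∑[ a ∈ E ] ⟦ at? c δ a ⟧
      supported : ∀ c → c ∈ E → ∀ {δ} → 0 < pinned c δ → Any (λ ab → dist² (proj₁ ab) (proj₂ ab) ≡ δ) (cartesianProduct E E)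
      supported c c∈ {δ} lt = let (a , a∈ , lt₁) = ∑>0 E _ lt in
        subst (λ δ → Any (λ ab → dist² (proj₁ ab) (proj₂ ab) ≡ δ) (cartesianProduct E E)) (proj₁ (⟦⟧>0 (at? c δ a) lt₁)) (occurs a∈ c∈)
      ∑-pinned : ∀ c → (∑[ δ ∈ elems ] pinned c δ) ≡ (∑[ a ∈ E ] ⟦ ¬? (dist² a c ≟ 𝟘) ⟧)
      ∑-pinned c = trans (∑-swap elems E _) (∑-cong E (λ {a} _ → trans (∑-cong elems (λ {δ} _ → ⟦⟧-× (dist² a c ≟ δ) (¬? (dist² a c ≟ 𝟘))))
        (∑-pick _≟_ elems-unique (elems-complete (dist² a c)) (λ _ → ⟦ ¬? (dist² a c ≟ 𝟘) ⟧))))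
      others : ∀ c → c ∈ E → N ∸ 1 ≤ (∑[ δ ∈ elems ] pinned c δ)
      others c c∈ = ℕₚ.≤-trans (ℕₚ.∸-monoˡ-≤ 1 (ℕₚ.≤-trans (ℕₚ.≤-reflexive (length-∑ E)) (ℕₚ.≤-trans (∑-mono E (λ {a} _ → one a (c ≟ᴾ a) (dist² a c ≟ 𝟘)))
          (ℕₚ.≤-reflexive (trans (∑-+ E (λ a → ⟦ c ≟ᴾ a ⟧) (λ a → ⟦ ¬? (dist² a c ≟ 𝟘) ⟧)) (cong (_+ (∑[ a ∈ E ] ⟦ ¬? (dist² a c ≟ 𝟘) ⟧)) (∑-pick-1 _≟ᴾ_ uE c∈)))))))
        (ℕₚ.≤-reflexive (sym (∑-pinned c)))
        where
        one : ∀ a (d : Dec (c ≡ a)) (d′ : Dec (dist² a c ≡ 𝟘)) → 1 ≤ ⟦ d ⟧ + ⟦ ¬? d′ ⟧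
        one a (yes _) _        = s≤s z≤n
        one a (no _)  (no _)   = s≤s z≤n
        one a (no c≢) (yes q)  = contradiction (sym (dist²≡𝟘 q)) c≢
      square : ∀ c → (∑[ δ ∈ elems ] pinned c δ * pinned c δ) ≡ (∑[ a ∈ E ] ∑[ b ∈ E ] ⟦ (dist² a c ≟ dist² b c) ×-dec ¬? (dist² b c ≟ 𝟘) ⟧)
      square c = trans (∑-cong elems (λ {δ} _ → sym (∑-*ʳ E (pinned c δ) _))) (trans (∑-swap elems E _) (∑-cong E (λ {a} _ →
        trans (∑-cong elems (λ {δ} _ → trans (cong (_* pinned c δ) (⟦⟧-× (dist² a c ≟ δ) (¬? (dist² a c ≟ 𝟘)))) (ℕₚ.*-assoc ⟦ dist² a c ≟ δ ⟧ _ _)))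
          (trans (∑-pick _≟_ elems-unique (elems-complete (dist² a c)) (λ δ → ⟦ ¬? (dist² a c ≟ 𝟘) ⟧ * pinned c δ)) (trans (sym (∑-*ˡ E ⟦ ¬? (dist² a c ≟ 𝟘) ⟧ (λ b → ⟦ at? c (dist² a c) b ⟧))) (∑-cong E (λ {b} _ →
            trans (sym (⟦⟧-× (¬? (dist² a c ≟ 𝟘)) (at? c (dist² a c) b))) (⟦⟧-cong (¬? (dist² a c ≟ 𝟘) ×-dec at? c (dist² a c) b) ((dist² a c ≟ dist² b c) ×-dec ¬? (dist² b c ≟ 𝟘))
              (λ (x , y , z) → sym y , z) (λ (x , y) → (λ q → y (trans (sym x) q)) , sym x , y))))))))) 

    isosceles-trivial : N ≤ 1 → isosceles ≡ 0
    isosceles-trivial small = trans (∑-cong E (λ {a} _ → trans (∑-cong E (λ {b} b∈ → trans (∑-cong E (λ {c} c∈ →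
        ⟦⟧-no ((dist² a c ≟ dist² b c) ×-dec ¬? (dist² b c ≟ 𝟘)) (λ (_ , h) → h (trans (cong (λ b → dist² b c) (only E small b∈ c∈)) (dist²-self c))))) (∑-zero E))) (∑-zero E))) (∑-zero E)
      where
      only : ∀ (xs : List Pt) {x y} → length xs ≤ 1 → x ∈ xs → y ∈ xs → x ≡ y
      only (_ ∷ [])    _        (here refl) (here refl) = refl
      only (_ ∷ _ ∷ _) (s≤s ())

    distances>0 : 0 < N → 0 < distances
    distances>0 N>0 = let (a , a∈ , _) = ∑>0 E (λ _ → 1) (ℕₚ.<-≤-trans N>0 (ℕₚ.≤-reflexive (length-∑ E))) in
      ℕₚ.≤-trans (ℕₚ.≤-reflexive (sym (trans (∑-cong elems (λ {δ} _ → sym (ℕₚ.*-identityʳ ⟦ dist² a a ≟ δ ⟧))) (∑-pick _≟_ elems-unique (elems-complete (dist² a a)) (λ _ → 1)))))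
        (∑-mono elems (λ {δ} _ → ⟦⟧-mono (dist² a a ≟ δ) (occurs? δ) (λ { refl → occurs a∈ a∈ })))

-- Removing rich circles and lines

module Pruning (𝔽 : Field) where
  open Counting
  open FieldTheory 𝔽
  open Plane 𝔽
  open Bisectors 𝔽

  nontrivial? : ∀ G → Dec (Nontrivial G)
  nontrivial? G = ¬? ((κ G ≟ 𝟘) ×-dec (ξ G ≟ᴾ (𝟘 , 𝟘)) ×-dec (η G ≟ 𝟘))

  genCircles : List GenCircle
  genCircles = map (λ (k , b , c) → genCircle k b c) (cartesianProduct elems (cartesianProduct plane elems))

  genCircles-complete : ∀ G → G ∈ genCircles
  genCircles-complete (genCircle k b c) = ∈ₚ.∈-map⁺ (λ (k , b , c) → genCircle k b c)
    (∈ₚ.∈-cartesianProduct⁺ (elems-complete k) (∈ₚ.∈-cartesianProduct⁺ (plane-complete b) (elems-complete c)))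

  NotRich : ℕ → List Pt → Set
  NotRich K A = ∀ G → Nontrivial G → (∑[ b ∈ A ] ⟦ b lies-on? G ⟧) ≤ K

  find-rich : ∀ K A → NotRich K A ⊎ (∃[ G ] Nontrivial G × K < (∑[ b ∈ A ] ⟦ b lies-on? G ⟧))
  find-rich K A = decide (Any.any? rich? genCircles)
    where
    Rich : GenCircle → Set
    Rich G = Nontrivial G × K < (∑[ b ∈ A ] ⟦ b lies-on? G ⟧)
    rich? : ∀ G → Dec (Rich G)
    rich? G = nontrivial? G ×-dec (K ℕ.<? (∑[ b ∈ A ] ⟦ b lies-on? G ⟧))
    decide : Dec (Any Rich genCircles) → NotRich K A ⊎ (∃[ G ] Rich G)
    decide (yes any) = let (G , _ , h) = find any in inj₂ (G , h)
    decide (no none) = inj₁ (λ G nt → ℕₚ.≮⇒≥ (λ lt → none (lose (genCircles-complete G) (nt , lt))))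

  module _ (E : List Pt) (uE : Unique E) where
    private
      N : ℕ
      N = length E

    T : (A : List Pt) → ℕ
    T A = ∑[ a ∈ A ] ∑[ b ∈ A ] ∑[ c ∈ E ] ⟦ ¬? (a ≟ᴾ b) ×-dec (dist² a c ≟ dist² b c) ⟧

    private
      iso? : ∀ a b c → Dec (a ≢ b × dist² a c ≡ dist² b c)
      iso? a b c = ¬? (a ≟ᴾ b) ×-dec (dist² a c ≟ dist² b c)

      pairs : List Pt → List Pt → ℕ
      pairs A B = ∑[ a ∈ A ] ∑[ b ∈ B ] ∑[ c ∈ E ] ⟦ iso? a b c ⟧

      pairs-sym : ∀ A B → pairs A B ≡ pairs B A
      pairs-sym A B = trans (∑-swap A B _) (∑-cong B (λ {b} _ → ∑-cong A (λ {a} _ → ∑-cong E (λ {c} _ →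
        ⟦⟧-cong (iso? a b c) (iso? b a c) (λ (x , y) → ≢-sym x , sym y) (λ (x , y) → ≢-sym x , sym y)))))

      module _ (G : GenCircle) (nontrivial : Nontrivial G) (A : List Pt) (uA : Unique A) (A≤N : length A ≤ N) where
        Z Z′ : List Pt
        Z = filter (_lies-on? G) A
        Z′ = filter (¬? ∘ (_lies-on? G)) A

        Centre : Pt → Set
        Centre c = κ G ≢ 𝟘 × (two ⊗ κ G ⊗ proj₁ c ⊕ proj₁ (ξ G) , two ⊗ κ G ⊗ proj₂ c ⊕ proj₂ (ξ G)) ≡ (𝟘 , 𝟘)

        centre? : ∀ c → Dec (Centre c)
        centre? c = ¬? (κ G ≟ 𝟘) ×-dec ((two ⊗ κ G ⊗ proj₁ c ⊕ proj₁ (ξ G) , two ⊗ κ G ⊗ proj₂ c ⊕ proj₂ (ξ G)) ≟ᴾ (𝟘 , 𝟘))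

        one-centre : (∑[ c ∈ E ] ⟦ centre? c ⟧) ≤ 1
        one-centre = count≤1 centre? uE (λ _ _ (k≢ , q) (_ , q′) → cong₂ _,_ (cancel k≢ (trans (cong proj₁ q) (sym (cong proj₁ q′)))) (cancel k≢ (trans (cong proj₂ q) (sym (cong proj₂ q′)))))
          where
          cancel : κ G ≢ 𝟘 → ∀ {x y z} → two ⊗ κ G ⊗ x ⊕ z ≡ two ⊗ κ G ⊗ y ⊕ z → x ≡ y
          cancel k≢ {x} {y} {z} h = ⊗-cancelˡ (⊗≢𝟘 two≢𝟘 k≢) (trans (solve 2 (λ u z → u := u :+ z :- z) refl (two ⊗ κ G ⊗ x) z)
            (trans (cong (_⊖ z) h) (solve 2 (λ u z → u :+ z :- z := u) refl (two ⊗ κ G ⊗ y) z)))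

        -- The points in question lie on G and on a circle about c: at most two, unless c is the
        -- centre of G. This exception concerns at most one c, for which the trivial bound N is
        -- used.
        few-apices : ∀ b c → (∑[ a ∈ Z ] ⟦ iso? a b c ⟧) ≤ 2 + ⟦ centre? c ⟧ * N
        few-apices b c = go (centre? c)
          where
          go : (d : Dec (Centre c)) → (∑[ a ∈ Z ] ⟦ iso? a b c ⟧) ≤ 2 + ⟦ d ⟧ * N
          go (yes _) = ℕₚ.≤-trans (∑-mono Z (λ {a} _ → ⟦⟧≤1 (iso? a b c))) (ℕₚ.≤-trans (ℕₚ.≤-trans (ℕₚ.≤-reflexive (sym (length-∑ Z)))
            (ℕₚ.≤-trans (Listₚ.length-filter (_lies-on? G) A) A≤N)) (ℕₚ.≤-trans (ℕₚ.m≤n+m N 2) (ℕₚ.≤-reflexive (cong (2 +_) (sym (ℕₚ.+-identityʳ N))))))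
          go (no general) = ℕₚ.≤-trans (∑-mono Z (λ {a} a∈ → ⟦⟧-mono (iso? a b c) ((a lies-on? G) ×-dec iso? a b c) (λ h → proj₂ (∈ₚ.∈-filter⁻ (_lies-on? G) {xs = A} a∈) , h)))
            (ℕₚ.≤-trans (count≤2 (λ a → (a lies-on? G) ×-dec iso? a b c) (Uniqueₚ.filter⁺ (_lies-on? G) uA)
              (λ {x} {y} {z} (hx , _ , dx) (hy , _ , dy) (hz , _ , dz) → no-three-on-genCircle G c x y z nontrivial general hx hy hz (trans dx (sym dy)) (trans dx (sym dz))))
              (ℕₚ.m≤m+n 2 0))

        pairs-Z : pairs Z A ≤ 3 * (N * N)
        pairs-Z = begin
          pairs Z A
            ≡⟨ pairs-sym Z A ⟩
          (∑[ b ∈ A ] ∑[ a ∈ Z ] ∑[ c ∈ E ] ⟦ iso? b a c ⟧)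
            ≡⟨ ∑-cong A (λ {b} _ → trans (∑-swap Z E _) (∑-cong E (λ {c} _ → ∑-cong Z (λ {a} _ → ⟦⟧-cong (iso? b a c) (iso? a b c) (λ (x , y) → ≢-sym x , sym y) (λ (x , y) → ≢-sym x , sym y))))) ⟩
          (∑[ b ∈ A ] ∑[ c ∈ E ] ∑[ a ∈ Z ] ⟦ iso? a b c ⟧)
            ≤⟨ ∑-bound A (2 * N + N) (λ {b} _ → ℕₚ.≤-trans (∑-mono E (λ {c} _ → few-apices b c)) (row b)) ⟩
          length A * (2 * N + N)
            ≤⟨ ℕₚ.*-monoˡ-≤ (2 * N + N) A≤N ⟩
          N * (2 * N + N)
            ≡⟨ solveℕ 1 (λ N → N ⊡ (κℕ 2 ⊡ N ∔ N) ≐ κℕ 3 ⊡ (N ⊡ N)) refl N ⟩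
          3 * (N * N) ∎
          where
          open ℕₚ.≤-Reasoning
          open +-*-Solver using () renaming (solve to solveℕ; _:=_ to _≐_; _:+_ to _∔_; _:*_ to _⊡_; con to κℕ)
          row : ∀ b → (∑[ c ∈ E ] (2 + ⟦ centre? c ⟧ * N)) ≤ 2 * N + N
          row b = ℕₚ.≤-trans (ℕₚ.≤-reflexive (∑-+ E (λ _ → 2) (λ c → ⟦ centre? c ⟧ * N))) (ℕₚ.+-mono-≤ (ℕₚ.≤-reflexive (trans (∑-const E 2) (ℕₚ.*-comm N 2)))
            (ℕₚ.≤-trans (ℕₚ.≤-reflexive (∑-*ʳ E N _)) (ℕₚ.≤-trans (ℕₚ.*-monoˡ-≤ N one-centre) (ℕₚ.≤-reflexive (ℕₚ.*-identityˡ N)))))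

        -- A lost triangle has a base vertex on G, and by symmetry each of the two positions
        -- accounts for at most 3N² triangles.
        remove-circle : T A ≤ T Z′ + 6 * (N * N)
        remove-circle = begin
          pairs A A                                 ≡⟨ ∑-split (_lies-on? G) A _ ⟩
          pairs Z A + pairs Z′ A                    ≡⟨ cong (pairs Z A +_) (trans (∑-cong Z′ (λ _ → ∑-split (_lies-on? G) A _)) (∑-+ Z′ _ _)) ⟩
          pairs Z A + (pairs Z′ Z + pairs Z′ Z′)
            ≤⟨ ℕₚ.+-mono-≤ pairs-Z (ℕₚ.+-monoˡ-≤ (pairs Z′ Z′) (ℕₚ.≤-trans (ℕₚ.≤-reflexive (pairs-sym Z′ Z))
                 (ℕₚ.≤-trans (∑-mono Z (λ {a} _ → ∑-filter≤ (¬? ∘ (_lies-on? G)) A _)) pairs-Z))) ⟩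
          3 * (N * N) + (3 * (N * N) + pairs Z′ Z′)  ≡⟨ solveℕ 2 (λ n t → κℕ 3 ⊡ n ∔ (κℕ 3 ⊡ n ∔ t) ≐ t ∔ κℕ 6 ⊡ n) refl (N * N) (pairs Z′ Z′) ⟩
          T Z′ + 6 * (N * N) ∎
          where
          open ℕₚ.≤-Reasoning
          open +-*-Solver using () renaming (solve to solveℕ; _:=_ to _≐_; _:+_ to _∔_; _:*_ to _⊡_; con to κℕ)

    Pruned : ℕ → List Pt → Set
    Pruned K A = ∃[ A′ ] Unique A′ × length A′ ≤ N × NotRich K A′ × K * T A ≤ K * T A′ + 6 * (N * N) * length A

    -- Every removed circle takes more than K points and at most 6N² triangles with it.
    prune-circles : ∀ K n A → length A ≤ n → Unique A → length A ≤ N → Pruned K A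
    prune-circles K n A len uA A≤N = go n (find-rich K A) len
      where
      go : ∀ n → NotRich K A ⊎ (∃[ G ] Nontrivial G × K < (∑[ b ∈ A ] ⟦ b lies-on? G ⟧)) → length A ≤ n → Pruned K A
      go _ (inj₁ poor) _ = A , uA , A≤N , poor , ℕₚ.m≤m+n _ _
      go zero (inj₂ (G , _ , h)) len = ⊥-elim (ℕₚ.<⇒≱ h (ℕₚ.≤-trans (ℕₚ.≤-reflexive (sym (length-filter-∑ (_lies-on? G) A))) (ℕₚ.≤-trans (Listₚ.length-filter (_lies-on? G) A) (ℕₚ.≤-trans len z≤n))))
      go (suc n) (inj₂ (G , nontrivial , h)) len = extend (prune-circles K n (Z′ G nontrivial A uA A≤N) (ℕₚ.≤-pred (ℕₚ.<-≤-trans fewer len)) (Uniqueₚ.filter⁺ (¬? ∘ (_lies-on? G)) uA)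
          (ℕₚ.≤-trans (Listₚ.length-filter (¬? ∘ (_lies-on? G)) A) A≤N))
        where
        open ℕₚ.≤-Reasoning
        A₁ : List Pt
        A₁ = Z′ G nontrivial A uA A≤N
        sizes : length A ≡ length (Z G nontrivial A uA A≤N) + length A₁
        sizes = trans (length-∑ A) (trans (∑-split (_lies-on? G) A (λ _ → 1)) (cong₂ _+_ (sym (length-∑ (Z G nontrivial A uA A≤N))) (sym (length-∑ A₁))))
        K≤ : K < length (Z G nontrivial A uA A≤N)
        K≤ = ℕₚ.<-≤-trans h (ℕₚ.≤-reflexive (sym (length-filter-∑ (_lies-on? G) A)))
        fewer : length A₁ < length A
        fewer = ℕₚ.<-≤-trans (ℕₚ.+-monoˡ-< (length A₁) (ℕₚ.≤-<-trans z≤n K≤)) (ℕₚ.≤-reflexive (sym sizes))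
        extend : Pruned K A₁ → Pruned K A
        extend (A′ , u , l , poor , ineq) = A′ , u , l , poor , (begin
          K * T A                                                ≤⟨ ℕₚ.*-monoʳ-≤ K (remove-circle G nontrivial A uA A≤N) ⟩
          K * (T A₁ + 6 * (N * N))                               ≡⟨ ℕₚ.*-distribˡ-+ K (T A₁) _ ⟩
          K * T A₁ + K * (6 * (N * N))                           ≤⟨ ℕₚ.+-mono-≤ ineq (ℕₚ.*-monoˡ-≤ (6 * (N * N)) (ℕₚ.<⇒≤ K≤)) ⟩
          K * T A′ + 6 * (N * N) * length A₁ + length (Z G nontrivial A uA A≤N) * (6 * (N * N))
            ≡⟨ trans (ℕₚ.+-assoc (K * T A′) _ _) (cong (K * T A′ +_) (trans (cong (6 * (N * N) * length A₁ +_) (ℕₚ.*-comm (length (Z G nontrivial A uA A≤N)) _))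
                 (trans (sym (ℕₚ.*-distribˡ-+ (6 * (N * N)) (length A₁) _)) (cong (6 * (N * N) *_) (trans (ℕₚ.+-comm (length A₁) _) (sym sizes)))))) ⟩
          K * T A′ + 6 * (N * N) * length A ∎)

-- Bisector energy of a set without rich circles

module EnergyBound (𝔽 : Field) where
  open Counting
  open FieldTheory 𝔽
  open Plane 𝔽
  open Frames 𝔽
  open Bisectors 𝔽
  open Mirrors 𝔽 using (Segment; _≟ˢ_; Mirrored; _mirrored?_; vector)
  open MirrorBound 𝔽 using (mirror-bound)
  open Pruning 𝔽 using (NotRich)

  module _ (A : List Pt) (uA : Unique A) (N : ℕ) (A≤N : length A ≤ N) where
    open Incidences A A uA uA using (energy; same-bisector?)

    segments : List Segment
    segments = cartesianProduct A A

    segments-unique : Unique segments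
    segments-unique = Uniqueₚ.cartesianProduct⁺ uA uA

    ∈segments : ∀ {s} → s ∈ segments → proj₁ s ∈ A × proj₂ s ∈ A
    ∈segments = ∈ₚ.∈-cartesianProduct⁻ A A

    out in′ : Segment → ℕ
    out r = ∑[ s ∈ segments ] ⟦ r mirrored? s ⟧
    in′ s = ∑[ r ∈ segments ] ⟦ r mirrored? s ⟧

    per-point : ∀ {P : Segment → Set} (P? : Decidable P) → (∀ {a b b′} → P (a , b) → P (a , b′) → b ≡ b′) → (∑[ s ∈ segments ] ⟦ P? s ⟧) ≤ N
    per-point P? unique = begin
      (∑[ s ∈ segments ] ⟦ P? s ⟧)                    ≡⟨ ∑-cartesianProduct A A _ ⟩
      (∑[ a ∈ A ] ∑[ b ∈ A ] ⟦ P? (a , b) ⟧)          ≤⟨ ∑-bound A 1 (λ {a} _ → count≤1 (λ b → P? (a , b)) uA (λ _ _ → unique)) ⟩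
      length A * 1                                    ≡⟨ ℕₚ.*-identityʳ (length A) ⟩
      length A                                        ≤⟨ A≤N ⟩
      N ∎
      where open ℕₚ.≤-Reasoning

    out≤ : ∀ r → out r ≤ N
    out≤ r = per-point (λ s → r mirrored? s) (λ (x , h) (_ , h′) → mirror-unique-image x h h′)

    in≤ : ∀ s → in′ s ≤ N
    in≤ s = per-point (λ r → r mirrored? s) (λ (x , h) (_ , h′) → mirror-unique-source x h h′)

    norm-of : Segment → F
    norm-of s = nrm (vector s)

    S : F → List Segment
    S t = filter (λ s → norm-of s ≟ t) segments

    S-unique : ∀ t → Unique (S t)
    S-unique t = Uniqueₚ.filter⁺ (λ s → norm-of s ≟ t) segments-unique

    ∈S : ∀ {t s} → s ∈ S t → s ∈ segments × norm-of s ≡ t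
    ∈S {t} = ∈ₚ.∈-filter⁻ (λ s → norm-of s ≟ t)

    I : F → ℕ
    I t = ∑[ r ∈ S t ] ∑[ s ∈ S t ] ⟦ r mirrored? s ⟧

    mirrored-norm : ∀ {r s} → Mirrored r s → norm-of r ≡ norm-of s
    mirrored-norm (_ , h) = mirror-dist² h

    ∑-segments : (f : Segment → ℕ) → ∑ segments f ≡ (∑[ t ∈ elems ] ∑ (S t) f)
    ∑-segments f = sym (trans (∑-cong elems (λ {t} _ → ∑-filter (λ s → norm-of s ≟ t) segments f)) (trans (∑-swap elems segments _)
      (∑-cong segments (λ {s} _ → ∑-pick _≟_ elems-unique (elems-complete (norm-of s)) (λ _ → f s)))))

    out-same-norm : ∀ {t r} → r ∈ S t → out r ≡ (∑[ s ∈ S t ] ⟦ r mirrored? s ⟧)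
    out-same-norm {t} {r} r∈ = sym (trans (∑-filter (λ s → norm-of s ≟ t) segments _) (∑-cong segments (λ {s} _ → one s (norm-of s ≟ t) (r mirrored? s))))
      where
      one : ∀ s (d : Dec (norm-of s ≡ t)) (d′ : Dec (Mirrored r s)) → ⟦ d ⟧ * ⟦ d′ ⟧ ≡ ⟦ d′ ⟧
      one s (yes _) d′      = ℕₚ.*-identityˡ ⟦ d′ ⟧
      one s (no _)  (no _)  = refl
      one s (no ¬q) (yes h) = contradiction (trans (sym (mirrored-norm h)) (proj₂ (∈S r∈))) ¬q

    -- Pairs a b and a′ b′ with one bisector are regrouped as the segments a a′ and b b′, which are
    -- mirror images. These have equal lengths, so the count can be split by length.
    energy≤out : energy ≤ ∑ segments out
    energy≤out = begin
      energy
        ≤⟨ ∑-mono A (λ {a} _ → ∑-mono A (λ {b} _ → ∑-mono A (λ {a′} _ → ∑-mono A (λ {b′} _ → ⟦⟧-mono (same-bisector? a b a′ b′) ((a , a′) mirrored? (b , b′))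
             (λ ((x , y) , h) → x , same-bisector⇒mirror x y h))))) ⟩
      (∑[ a ∈ A ] ∑[ b ∈ A ] ∑[ a′ ∈ A ] ∑[ b′ ∈ A ] ⟦ (a , a′) mirrored? (b , b′) ⟧)
        ≡⟨ ∑-cong A (λ _ → ∑-swap A A _) ⟩
      (∑[ a ∈ A ] ∑[ a′ ∈ A ] ∑[ b ∈ A ] ∑[ b′ ∈ A ] ⟦ (a , a′) mirrored? (b , b′) ⟧)
        ≡⟨ sym (trans (∑-cartesianProduct A A _) (∑-cong A (λ _ → ∑-cong A (λ _ → ∑-cartesianProduct A A _)))) ⟩
      ∑ segments out ∎
      where open ℕₚ.≤-Reasoning

    zero-norm : ∑ (S 𝟘) out ≤ N * N
    zero-norm = ℕₚ.≤-trans (∑-bound (S 𝟘) N (λ {r} _ → out≤ r)) (ℕₚ.*-monoˡ-≤ N (ℕₚ.≤-trans (ℕₚ.≤-reflexive (length-filter-∑ (λ s → norm-of s ≟ 𝟘) segments))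
      (per-point (λ s → norm-of s ≟ 𝟘) (λ h h′ → trans (dist²≡𝟘 h) (sym (dist²≡𝟘 h′))))))

    -- Unit distances: two circles of the same radius share at most two points.
    few-segments : ∀ t → length (S t) * length (S t) ≤ 3 * (N * (N * N))
    few-segments t = begin
      length (S t) * length (S t)
        ≡⟨ cong (λ z → z * z) (trans (length-filter-∑ (λ s → norm-of s ≟ t) segments) (trans (∑-cartesianProduct A A _)
             (trans (∑-swap A A _) (∑-cong A (λ _ → sym (ℕₚ.+-identityʳ _)))))) ⟩
      (∑[ c ∈ A ] 1 * deg c) * (∑[ c ∈ A ] 1 * deg c)
        ≤⟨ cauchy-schwarz A (λ _ → 1) deg ⟩
      (∑[ c ∈ A ] 1 * 1) * (∑[ c ∈ A ] deg c * deg c)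
        ≤⟨ ℕₚ.*-mono-≤ (ℕₚ.≤-trans (ℕₚ.≤-reflexive (sym (length-∑ A))) A≤N) degrees² ⟩
      N * (3 * (N * N))
        ≡⟨ solveℕ 1 (λ N → N ⊡ (κℕ 3 ⊡ (N ⊡ N)) ≐ κℕ 3 ⊡ (N ⊡ (N ⊡ N))) refl N ⟩
      3 * (N * (N * N)) ∎
      where
      open ℕₚ.≤-Reasoning
      open +-*-Solver using () renaming (solve to solveℕ; _:=_ to _≐_; _:+_ to _∔_; _:*_ to _⊡_; con to κℕ)
      deg : Pt → ℕ
      deg c = ∑[ a ∈ A ] ⟦ dist² c a ≟ t ⟧
      common : ∀ a a′ (d : Dec (a ≡ a′)) → (∑[ c ∈ A ] ⟦ dist² c a ≟ t ⟧ * ⟦ dist² c a′ ≟ t ⟧) ≤ ⟦ d ⟧ * N + 2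
      common a a′ (yes _) = ℕₚ.≤-trans (∑-mono A (λ {c} _ → ℕₚ.*-mono-≤ (⟦⟧≤1 (dist² c a ≟ t)) (⟦⟧≤1 (dist² c a′ ≟ t))))
        (ℕₚ.≤-trans (ℕₚ.≤-reflexive (sym (length-∑ A))) (ℕₚ.≤-trans A≤N (ℕₚ.≤-trans (ℕₚ.≤-reflexive (sym (ℕₚ.+-identityʳ N))) (ℕₚ.m≤m+n (N + 0) 2))))
      common a a′ (no a≢) = ℕₚ.≤-trans (∑-mono A (λ {c} _ → ℕₚ.≤-reflexive (sym (⟦⟧-× (dist² c a ≟ t) (dist² c a′ ≟ t)))))
        (count≤2 (λ c → (dist² c a ≟ t) ×-dec (dist² c a′ ≟ t)) uA (λ {x} {y} {z} (hx , kx) (hy , ky) (hz , kz) →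
          no-three-on-circles a a′ x y z a≢ (trans hx (sym hy)) (trans hx (sym hz)) (trans kx (sym ky)) (trans kx (sym kz))))
      degrees² : (∑[ c ∈ A ] deg c * deg c) ≤ 3 * (N * N)
      degrees² = begin
        (∑[ c ∈ A ] deg c * deg c)
          ≡⟨ trans (∑-cong A (λ {c} _ → ∑-* A A _ _)) (trans (∑-swap A A _) (∑-cong A (λ _ → ∑-swap A A _))) ⟩
        (∑[ a ∈ A ] ∑[ a′ ∈ A ] ∑[ c ∈ A ] ⟦ dist² c a ≟ t ⟧ * ⟦ dist² c a′ ≟ t ⟧)
          ≤⟨ ∑-mono A (λ {a} _ → ∑-mono A (λ {a′} _ → common a a′ (a ≟ᴾ a′))) ⟩
        (∑[ a ∈ A ] ∑[ a′ ∈ A ] (⟦ a ≟ᴾ a′ ⟧ * N + 2))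
          ≡⟨ ∑-cong A (λ {a} a∈ → trans (∑-+ A (λ a′ → ⟦ a ≟ᴾ a′ ⟧ * N) (λ _ → 2)) (cong₂ _+_ (∑-pick _≟ᴾ_ uA a∈ (λ _ → N)) (∑-const A 2))) ⟩
        (∑[ a ∈ A ] (N + length A * 2))
          ≡⟨ ∑-const A _ ⟩
        length A * (N + length A * 2)
          ≤⟨ ℕₚ.*-mono-≤ A≤N (ℕₚ.+-monoʳ-≤ N (ℕₚ.*-monoˡ-≤ 2 A≤N)) ⟩
        N * (N + N * 2)
          ≡⟨ solveℕ 1 (λ N → N ⊡ (N ∔ N ⊡ κℕ 2) ≐ κℕ 3 ⊡ (N ⊡ N)) refl N ⟩
        3 * (N * N) ∎

    module _ (K : ℕ) (not-rich : NotRich K A) (Δ q c : ℕ) (Δ<N : Δ < N) (16N≤ : 16 * N ≤ suc Δ * p)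
             (2K+90cμ≤q : 2 * K + 90 * (c * suc Δ) ≤ q) (24μn≤qc : ∀ n → n * n ≤ 3 * (N * (N * N)) → 24 * (suc Δ * n) ≤ q * c) (8+36c≤p : 8 + 36 * c ≤ p) where

      I≤ : ∀ t → t ≢ 𝟘 → I t ≤ 4 * (q * length (S t))
      I≤ t t≢ = nonempty (S t) refl
        where
        nonempty : ∀ ss → S t ≡ ss → I t ≤ 4 * (q * length (S t))
        nonempty [] eq = subst (λ ss → (∑[ r ∈ ss ] ∑[ s ∈ ss ] ⟦ r mirrored? s ⟧) ≤ 4 * (q * length ss)) (sym eq) z≤n
        -- Any segment of squared length t serves as the reference vector e; it is nonzero because t
        -- is.
        nonempty (s₀ ∷ ss) eq = mirror-bound A uA K not-rich (S t) (S-unique t) (λ s∈ → proj₁ (∈segments (proj₁ (∈S s∈))))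
          (vector s₀) (λ e≡ → t≢ (trans (sym (proj₂ (∈S s₀∈))) (trans (cong nrm e≡) nrm-origin)))
          (λ s∈ → trans (proj₂ (∈S s∈)) (sym (proj₂ (∈S s₀∈)))) N
          (λ {r} _ → ℕₚ.≤-trans (∑-filter≤ (λ s → norm-of s ≟ t) segments (λ s → ⟦ r mirrored? s ⟧)) (out≤ r))
          (λ {s} _ → ℕₚ.≤-trans (∑-filter≤ (λ s → norm-of s ≟ t) segments (λ r → ⟦ r mirrored? s ⟧)) (in≤ s))
          Δ q c Δ<N 16N≤ 2K+90cμ≤q (24μn≤qc (length (S t)) (few-segments t)) 8+36c≤p
          where
          s₀∈ : s₀ ∈ S t
          s₀∈ = subst (s₀ ∈_) (sym eq) (here refl)

      energy-bound : energy ≤ N * N + 4 * (q * (N * N))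
      energy-bound = begin
        energy                                                        ≤⟨ energy≤out ⟩
        ∑ segments out                                                ≡⟨ ∑-segments out ⟩
        (∑[ t ∈ elems ] ∑ (S t) out)                                  ≤⟨ ∑-mono elems (λ {t} _ → each t (𝟘 ≟ t)) ⟩
        (∑[ t ∈ elems ] (⟦ 𝟘 ≟ t ⟧ * (N * N) + 4 * (q * length (S t))))
          ≡⟨ trans (∑-+ elems _ _) (cong₂ _+_ (∑-pick _≟_ elems-unique (elems-complete 𝟘) (λ _ → N * N)) (trans (∑-*ˡ elems 4 _) (cong (4 *_) (∑-*ˡ elems q _)))) ⟩
        N * N + 4 * (q * (∑[ t ∈ elems ] length (S t)))
          ≡⟨ cong (λ z → N * N + 4 * (q * z)) (trans (∑-cong elems (λ {t} _ → length-∑ (S t))) (trans (sym (∑-segments (λ _ → 1))) (trans (sym (length-∑ segments)) (length-cartesianProduct A A)))) ⟩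
        N * N + 4 * (q * (length A * length A))
          ≤⟨ ℕₚ.+-monoʳ-≤ (N * N) (ℕₚ.*-monoʳ-≤ 4 (ℕₚ.*-monoʳ-≤ q (ℕₚ.*-mono-≤ A≤N A≤N))) ⟩
        N * N + 4 * (q * (N * N)) ∎
        where
        open ℕₚ.≤-Reasoning
        -- Length zero offers no reference vector. Its segments are single points, at most N, each
        -- with at most N mirror images.
        each : ∀ t (d : Dec (𝟘 ≡ t)) → ∑ (S t) out ≤ ⟦ d ⟧ * (N * N) + 4 * (q * length (S t))
        each t (yes refl) = ℕₚ.≤-trans zero-norm (ℕₚ.≤-trans (ℕₚ.≤-reflexive (sym (ℕₚ.+-identityʳ (N * N)))) (ℕₚ.m≤m+n (N * N + 0) _))
        each t (no t≢) = ℕₚ.≤-trans (ℕₚ.≤-reflexive (∑-cong (S t) (λ r∈ → out-same-norm r∈))) (I≤ t (t≢ ∘ sym))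

-- Powers and an approximate seventh root

module Powers where
  open +-*-Solver using (solve; _:=_; _:+_; _:*_; _:^_; con)

  square-cancel-≤ : ∀ {x y} → x * x ≤ y * y → x ≤ y
  square-cancel-≤ {x} {y} h = ℕₚ.≮⇒≥ (λ y<x → ℕₚ.<⇒≱ (ℕₚ.*-mono-< y<x y<x) h)

  ^-cancel-≤ : ∀ k {x y} → x ^ suc k ≤ y ^ suc k → x ≤ y
  ^-cancel-≤ k {x} {y} h = ℕₚ.≮⇒≥ (λ y<x → ℕₚ.<⇒≱ (ℕₚ.^-monoˡ-< (suc k) y<x) h)

  ^-pos : ∀ {x} k → 0 < x → 0 < x ^ k
  ^-pos {suc x} k _ = ℕₚ.m^n>0 (suc x) k

  1≤^ : ∀ {x} k → 0 < x → 1 ≤ x ^ k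
  1≤^ = ^-pos

  ^-distrib-* : ∀ k x y → (x * y) ^ k ≡ x ^ k * y ^ k
  ^-distrib-* zero    x y = refl
  ^-distrib-* (suc k) x y = trans (cong (x * y *_) (^-distrib-* k x y))
    (solve 4 (λ x y a b → x :* y :* (a :* b) := x :* a :* (y :* b)) refl x y (x ^ k) (y ^ k))

  -- The parameters for small sets are powers of N^(1/7). The descent from u = N stops at u = 1 or
  -- when (u - 1)⁷ ≤ N; then u ≤ 2 (u - 1) gives the factor 128 = 2⁷.
  seventh-root : ∀ N → 0 < N → ∃[ u ] 0 < u × N ≤ u ^ 7 × u ^ 7 ≤ 128 * N
  seventh-root N@(suc M) N>0 = descend M (ℕₚ.m≤m*n N (N ^ 6) {{ℕ.>-nonZero (^-pos 6 N>0)}})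
    where
    doubling : ∀ v → suc (suc v) ^ 7 ≤ 128 * suc v ^ 7
    doubling v = ℕₚ.≤-trans (ℕₚ.^-monoˡ-≤ 7 (ℕₚ.≤-trans (ℕₚ.m≤m+n (suc (suc v)) v) (ℕₚ.≤-reflexive (solve 1 (λ v → con 2 :+ v :+ v := con 2 :* (con 1 :+ v)) refl v))))
      (ℕₚ.≤-reflexive (^-distrib-* 7 2 (suc v)))
    descend : ∀ v → N ≤ suc v ^ 7 → ∃[ u ] 0 < u × N ≤ u ^ 7 × u ^ 7 ≤ 128 * N
    descend zero    h = 1 , s≤s z≤n , h , ℕₚ.≤-trans N>0 (ℕₚ.m≤m+n N _)
    descend (suc v) h = [ descend v , (λ h′ → suc (suc v) , s≤s z≤n , h , ℕₚ.≤-trans (doubling v) (ℕₚ.*-monoʳ-≤ 128 h′)) ]′ (ℕₚ.≤-total N (suc v ^ 7))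

-- The bound T⁷ ≲ N¹⁷ for N¹⁴ < p¹⁵

module SmallSets (𝔽 : Field) where
  open Counting
  open Powers
  open FieldTheory 𝔽 using (p; 2<p)
  open Plane 𝔽
  open Bisectors 𝔽 using (module Incidences)
  open Pruning 𝔽 using (T; NotRich; Pruned; prune-circles)
  open EnergyBound 𝔽 using (energy-bound)
  open +-*-Solver using (solve; _:=_; _:+_; _:*_; _:^_; con)

  private
    instance
      p≢0 : NonZero p
      p≢0 = ℕ.>-nonZero (ℕₚ.<-trans (s≤s z≤n) 2<p)

  triangles≤cube : ∀ E uE → T E uE E ≤ length E ^ 3
  triangles≤cube E uE = ℕₚ.≤-trans (∑-bound E (length E * length E) (λ {a} _ → ∑-bound E (length E) (λ {b} _ → ℕₚ.≤-trans
    (∑-mono E (λ {c} _ → ⟦⟧≤1 (Incidences.isosceles? E E uE uE a b c))) (ℕₚ.≤-reflexive (sym (length-∑ E))))))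
    (ℕₚ.≤-reflexive (solve 1 (λ N → N :* (N :* N) := N :^ 3) refl (length E)))

  module _ (E : List Pt) (uE : Unique E) (u : ℕ) (u>0 : 0 < u) (N≤ : length E ≤ u ^ 7) (large : 44 * u ^ 5 ≤ p)
           (μ²≤ : suc (16 * length E / p) * suc (16 * length E / p) ≤ 289 * u) (N>0 : 0 < length E) where
    private
      -- Removing circles costs 6N³ / K ≤ 6u³N² triangles, and an energy of order q N² gives an
      -- excess of order u³N²; this balances K = u⁴ against q of order u⁶. The choice c = u⁵ makes μ
      -- n ≲ q c, where n ≲ N^(3/2) and μ ≲ u^(1/2). The constant is 1532 = 2 + 90 · 17.
      N Δ μ K q c : ℕ
      N = length E
      Δ = 16 * N / p
      μ = suc Δ
      K = u ^ 4
      q = 1532 * u ^ 6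
      c = u ^ 5

      division : 16 * N ≡ 16 * N % p + Δ * p
      division = m≡m%n+[m/n]*n (16 * N) p

      16N≤ : 16 * N ≤ suc Δ * p
      16N≤ = ℕₚ.≤-trans (ℕₚ.≤-reflexive division) (ℕₚ.+-monoˡ-≤ (Δ * p) (ℕₚ.<⇒≤ (m%n<n (16 * N) p)))

      c>0 : 1 ≤ c
      c>0 = 1≤^ 5 u>0

      Δ<N : Δ < N
      Δ<N = ℕₚ.≰⇒> (λ N≤Δ → ℕₚ.<⇒≱ 16<p (ℕₚ.*-cancelˡ-≤ N {{ℕ.>-nonZero N>0}} (begin
        N * p             ≤⟨ ℕₚ.*-monoˡ-≤ p N≤Δ ⟩
        Δ * p             ≤⟨ ℕₚ.m≤n+m (Δ * p) _ ⟩
        16 * N % p + Δ * p ≡⟨ division ⟨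
        16 * N            ≡⟨ ℕₚ.*-comm 16 N ⟩
        N * 16 ∎)))
        where
        open ℕₚ.≤-Reasoning
        16<p : 16 < p
        16<p = ℕₚ.≤-trans (ℕₚ.≤-trans (ℕₚ.m≤m+n 17 27) (ℕₚ.*-monoʳ-≤ 44 c>0)) large

      μ≤ : μ ≤ 17 * u
      μ≤ = square-cancel-≤ (ℕₚ.≤-trans μ²≤ (ℕₚ.≤-trans (ℕₚ.*-monoʳ-≤ 289 (ℕₚ.m≤m*n u u {{ℕ.>-nonZero u>0}})) (ℕₚ.≤-reflexive (solve 1 (λ u → con 289 :* (u :* u) := con 17 :* u :* (con 17 :* u)) refl u))))

      2K+90cμ≤q : 2 * K + 90 * (c * suc Δ) ≤ q
      2K+90cμ≤q = begin
        2 * u ^ 4 + 90 * (u ^ 5 * μ)          ≤⟨ ℕₚ.+-mono-≤ (ℕₚ.*-monoʳ-≤ 2 (ℕₚ.m≤m*n (u ^ 4) (u ^ 2) {{ℕ.>-nonZero (^-pos 2 u>0)}})) (ℕₚ.*-monoʳ-≤ 90 (ℕₚ.*-monoʳ-≤ (u ^ 5) μ≤)) ⟩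
        2 * (u ^ 4 * u ^ 2) + 90 * (u ^ 5 * (17 * u))   ≡⟨ solve 1 (λ u → con 2 :* (u :^ 4 :* u :^ 2) :+ con 90 :* (u :^ 5 :* (con 17 :* u)) := con 1532 :* u :^ 6) refl u ⟩
        1532 * u ^ 6 ∎
        where open ℕₚ.≤-Reasoning

      24μn≤qc : ∀ n → n * n ≤ 3 * (N * (N * N)) → 24 * (suc Δ * n) ≤ q * c
      24μn≤qc n n²≤ = square-cancel-≤ (begin
        24 * (μ * n) * (24 * (μ * n))                  ≡⟨ solve 2 (λ μ n → con 24 :* (μ :* n) :* (con 24 :* (μ :* n)) := con 576 :* ((μ :* μ) :* (n :* n))) refl μ n ⟩
        576 * ((μ * μ) * (n * n))                      ≤⟨ ℕₚ.*-monoʳ-≤ 576 (ℕₚ.*-mono-≤ μ²≤ (ℕₚ.≤-trans n²≤ (ℕₚ.*-monoʳ-≤ 3 (ℕₚ.*-mono-≤ N≤ (ℕₚ.*-mono-≤ N≤ N≤))))) ⟩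
        576 * ((289 * u) * (3 * (u ^ 7 * (u ^ 7 * u ^ 7))))   ≤⟨ enlarge ⟩
        1532 * u ^ 6 * u ^ 5 * (1532 * u ^ 6 * u ^ 5) ∎)
        where
        open ℕₚ.≤-Reasoning
        generic : ∀ a b → 576 * ((289 * a) * (3 * b)) ≤ 1532 * 1532 * (a * b)
        generic a b = ℕₚ.≤-trans (ℕₚ.≤-reflexive (trans (cong (576 *_) (trans (ℕₚ.*-assoc 289 a (3 * b)) (cong (289 *_) (trans (sym (ℕₚ.*-assoc a 3 b)) (trans (cong (_* b) (ℕₚ.*-comm a 3)) (ℕₚ.*-assoc 3 a b))))))
          (trans (sym (ℕₚ.*-assoc 576 289 (3 * (a * b)))) (sym (ℕₚ.*-assoc (576 * 289) 3 (a * b)))))) (ℕₚ.*-monoˡ-≤ (a * b) (ℕₚ.≤ᵇ⇒≤ (576 * 289 * 3) (1532 * 1532) _))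
        enlarge : 576 * ((289 * u) * (3 * (u ^ 7 * (u ^ 7 * u ^ 7)))) ≤ 1532 * u ^ 6 * u ^ 5 * (1532 * u ^ 6 * u ^ 5)
        enlarge = ℕₚ.≤-trans (generic u (u ^ 7 * (u ^ 7 * u ^ 7))) (ℕₚ.≤-reflexive (regroup 1532 u))
          where
          regroup : ∀ k u → k * k * (u * (u ^ 7 * (u ^ 7 * u ^ 7))) ≡ k * u ^ 6 * u ^ 5 * (k * u ^ 6 * u ^ 5)
          regroup = solve 2 (λ k u → k :* k :* (u :* (u :^ 7 :* (u :^ 7 :* u :^ 7))) := k :* u :^ 6 :* u :^ 5 :* (k :* u :^ 6 :* u :^ 5)) refl

      8+36c≤p : 8 + 36 * c ≤ p
      8+36c≤p = ℕₚ.≤-trans (ℕₚ.+-monoˡ-≤ (36 * c) (ℕₚ.*-monoʳ-≤ 8 c>0)) (ℕₚ.≤-trans (ℕₚ.≤-reflexive (sym (ℕₚ.*-distribʳ-+ c 8 36))) large)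

    triangles≤86u³N² : T E uE E ≤ 86 * (u ^ 3 * (N * N))
    triangles≤86u³N² = from-pruned (prune-circles E uE K N E ℕₚ.≤-refl uE ℕₚ.≤-refl)
      where
      open ℕₚ.≤-Reasoning
      M : ℕ
      M = u ^ 3 * (N * N)
      N²≤M : N * N ≤ M
      N²≤M = ℕₚ.m≤n*m (N * N) (u ^ 3) {{ℕ.>-nonZero (^-pos 3 u>0)}}
      from-pruned : Pruned E uE K E → T E uE E ≤ 86 * M
      from-pruned (A , uA , A≤N , poor , ineq) = ℕₚ.*-cancelˡ-≤ K {{ℕ.>-nonZero (^-pos 4 u>0)}} (begin
        K * T E uE E                                   ≤⟨ ineq ⟩
        K * T E uE A + 6 * (N * N) * N                 ≤⟨ ℕₚ.+-mono-≤ (ℕₚ.*-monoʳ-≤ K T-A) (ℕₚ.*-monoʳ-≤ (6 * (N * N)) N≤) ⟩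
        K * (80 * M) + 6 * (N * N) * u ^ 7             ≡⟨ solve 2 (λ u n → u :^ 4 :* (con 80 :* (u :^ 3 :* n)) :+ con 6 :* n :* u :^ 7 := u :^ 4 :* (con 86 :* (u :^ 3 :* n))) refl u (N * N) ⟩
        K * (86 * M) ∎)
        where
        open Incidences A E uA uE
        -- 6129 = 1 + 4 · 1532, and 79² = 6241 is the next square; this leads to 80 = 79 + 1 and 86
        -- = 80 + 6.
        energy≤ : energy ≤ 6129 * (u ^ 6 * (N * N))
        energy≤ = begin
          energy                                        ≤⟨ energy-bound A uA N A≤N K poor Δ q c Δ<N 16N≤ 2K+90cμ≤q 24μn≤qc 8+36c≤p ⟩
          N * N + 4 * (q * (N * N))                     ≤⟨ ℕₚ.+-monoˡ-≤ _ (ℕₚ.m≤n*m (N * N) (u ^ 6) {{ℕ.>-nonZero (^-pos 6 u>0)}}) ⟩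
          u ^ 6 * (N * N) + 4 * (1532 * u ^ 6 * (N * N)) ≡⟨ cong (λ z → u ^ 6 * (N * N) + z) (trans (cong (4 *_) (ℕₚ.*-assoc 1532 (u ^ 6) (N * N))) (sym (ℕₚ.*-assoc 4 1532 (u ^ 6 * (N * N))))) ⟩
          6129 * (u ^ 6 * (N * N)) ∎
        excess≤ : excess ≤ 79 * M
        excess≤ = square-cancel-≤ (begin
          excess * excess                               ≤⟨ excess² ⟩
          energy * (N * N)                              ≤⟨ ℕₚ.*-monoˡ-≤ (N * N) energy≤ ⟩
          6129 * (u ^ 6 * (N * N)) * (N * N)            ≤⟨ ℕₚ.*-monoˡ-≤ (N * N) (ℕₚ.*-monoˡ-≤ (u ^ 6 * (N * N)) (ℕₚ.≤ᵇ⇒≤ 6129 (79 * 79) _)) ⟩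
          79 * 79 * (u ^ 6 * (N * N)) * (N * N)         ≡⟨ regroup 79 u (N * N) ⟩
          79 * M * (79 * M) ∎)
          where
          regroup : ∀ k u n → k * k * (u ^ 6 * n) * n ≡ k * (u ^ 3 * n) * (k * (u ^ 3 * n))
          regroup = solve 3 (λ k u n → k :* k :* (u :^ 6 :* n) :* n := k :* (u :^ 3 :* n) :* (k :* (u :^ 3 :* n))) refl
        T-A : T E uE A ≤ 80 * M
        T-A = begin
          T E uE A                                      ≤⟨ triangles≤excess ⟩
          length A * length A + excess                  ≤⟨ ℕₚ.+-mono-≤ (ℕₚ.≤-trans (ℕₚ.*-mono-≤ A≤N A≤N) N²≤M) excess≤ ⟩
          80 * M ∎

  private
    trivial-range : ∀ {t} N w C → t ≤ N ^ 3 → N ≤ w → w ^ 4 ≤ C → t ^ 7 ≤ C * N ^ 17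
    trivial-range {t} N w C t≤ N≤w w⁴≤C = begin
      t ^ 7             ≤⟨ ℕₚ.^-monoˡ-≤ 7 t≤ ⟩
      (N ^ 3) ^ 7       ≡⟨ trans (ℕₚ.^-*-assoc N 3 7) (ℕₚ.^-distribˡ-+-* N 4 17) ⟩
      N ^ 4 * N ^ 17    ≤⟨ ℕₚ.*-monoˡ-≤ (N ^ 17) (ℕₚ.≤-trans (ℕₚ.^-monoˡ-≤ 4 N≤w) w⁴≤C) ⟩
      C * N ^ 17 ∎
      where open ℕₚ.≤-Reasoning

    main-range : ∀ {t} k m u N C → t ≤ k * (u ^ 3 * (N * N)) → u ^ 7 ≤ m * N → k ^ 7 * m ^ 3 ≤ C → t ^ 7 ≤ C * N ^ 17
    main-range {t} k m u N C t≤ u⁷≤ C≥ = begin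
      t ^ 7                                  ≤⟨ ℕₚ.^-monoˡ-≤ 7 t≤ ⟩
      (k * (u ^ 3 * (N * N))) ^ 7            ≡⟨ expand ⟩
      k ^ 7 * (u ^ 7) ^ 3 * N ^ 14           ≤⟨ ℕₚ.*-monoˡ-≤ (N ^ 14) (ℕₚ.*-monoʳ-≤ (k ^ 7) (ℕₚ.^-monoˡ-≤ 3 u⁷≤)) ⟩
      k ^ 7 * (m * N) ^ 3 * N ^ 14           ≡⟨ collect ⟩
      k ^ 7 * m ^ 3 * N ^ 17                 ≤⟨ ℕₚ.*-monoˡ-≤ (N ^ 17) C≥ ⟩
      C * N ^ 17 ∎
      where
      open ℕₚ.≤-Reasoning
      expand : (k * (u ^ 3 * (N * N))) ^ 7 ≡ k ^ 7 * (u ^ 7) ^ 3 * N ^ 14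
      expand = trans (^-distrib-* 7 k _) (trans (cong (k ^ 7 *_) (trans (^-distrib-* 7 (u ^ 3) (N * N))
        (cong₂ _*_ (trans (ℕₚ.^-*-assoc u 3 7) (sym (ℕₚ.^-*-assoc u 7 3))) (trans (^-distrib-* 7 N N) (sym (ℕₚ.^-distribˡ-+-* N 7 7))))))
        (sym (ℕₚ.*-assoc (k ^ 7) ((u ^ 7) ^ 3) (N ^ 14))))
      collect : k ^ 7 * (m * N) ^ 3 * N ^ 14 ≡ k ^ 7 * m ^ 3 * N ^ 17
      collect = trans (cong (λ z → k ^ 7 * z * N ^ 14) (^-distrib-* 3 m N)) (trans (cong (_* N ^ 14) (sym (ℕₚ.*-assoc (k ^ 7) (m ^ 3) (N ^ 3))))
        (trans (ℕₚ.*-assoc (k ^ 7 * m ^ 3) (N ^ 3) (N ^ 14)) (cong (k ^ 7 * m ^ 3 *_) (sym (ℕₚ.^-distribˡ-+-* N 3 14)))))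

    -- If p < a u⁵, then u⁹⁸ ≤ b¹⁴N¹⁴ ≤ b¹⁴p¹⁵ would force u²³ ≤ b¹⁴a¹⁵, which fails for u ≥ w. In
    -- this way N¹⁴ < p¹⁵ keeps degrees of order u⁵ below p.
    p-large : ∀ a b w u N → 0 < u → u ^ 7 ≤ b * N → N ^ 14 < p ^ 15 → w ≤ u → b ^ 14 * a ^ 15 < w ^ 23 → a * u ^ 5 ≤ p
    p-large a b w u N u>0 u⁷≤ N<p w≤u hyp = ℕₚ.≮⇒≥ λ p< → ℕₚ.<⇒≱ (begin-strict
      u ^ 23 * u ^ 75                ≡⟨ trans (sym (ℕₚ.^-distribˡ-+-* u 23 75)) (sym (ℕₚ.^-*-assoc u 7 14)) ⟩
      (u ^ 7) ^ 14                   ≤⟨ ℕₚ.^-monoˡ-≤ 14 u⁷≤ ⟩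
      (b * N) ^ 14                   ≡⟨ ^-distrib-* 14 b N ⟩
      b ^ 14 * N ^ 14                ≤⟨ ℕₚ.*-monoʳ-≤ (b ^ 14) (ℕₚ.<⇒≤ N<p) ⟩
      b ^ 14 * p ^ 15                ≤⟨ ℕₚ.*-monoʳ-≤ (b ^ 14) (ℕₚ.^-monoˡ-≤ 15 (ℕₚ.<⇒≤ p<)) ⟩
      b ^ 14 * (a * u ^ 5) ^ 15      ≡⟨ trans (cong (b ^ 14 *_) (trans (^-distrib-* 15 a (u ^ 5)) (cong (a ^ 15 *_) (ℕₚ.^-*-assoc u 5 15)))) (sym (ℕₚ.*-assoc (b ^ 14) (a ^ 15) (u ^ 75))) ⟩
      b ^ 14 * a ^ 15 * u ^ 75       <⟨ ℕₚ.*-monoˡ-< (u ^ 75) {{ℕ.>-nonZero (^-pos 75 u>0)}} (ℕₚ.n<1+n (b ^ 14 * a ^ 15)) ⟩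
      suc (b ^ 14 * a ^ 15) * u ^ 75 ∎) (ℕₚ.*-monoˡ-≤ (u ^ 75) (ℕₚ.≤-trans hyp (ℕₚ.^-monoˡ-≤ 23 w≤u)))
      where open ℕₚ.≤-Reasoning

    -- From μ ≲ N / p and N ≤ p^(15/14) follows μ ≲ N^(1/15) ≤ u^(7/15), which is at most u^(1/2).
    power-compare : ∀ k μ u N → 0 < u → N ≤ u ^ 7 → N ^ 14 ≤ p ^ 15 → μ * p ≤ k * N → μ * μ ≤ k * k * u
    power-compare k μ u N u>0 N≤ N≤p μp≤ = ^-cancel-≤ 14 (ℕₚ.*-cancelʳ-≤ _ _ (p ^ 30) {{ℕ.>-nonZero (^-pos 30 (ℕₚ.<-trans (s≤s z≤n) 2<p))}} (begin
        (μ * μ) ^ 15 * p ^ 30                        ≡⟨ trans (cong (_* p ^ 30) (square μ)) (sym (^-distrib-* 30 μ p)) ⟩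
        (μ * p) ^ 30                                 ≤⟨ ℕₚ.^-monoˡ-≤ 30 μp≤ ⟩
        (k * N) ^ 30                                 ≡⟨ trans (^-distrib-* 30 k N) (cong₂ _*_ (sym (square k)) (sym (trans (cong (_* N ^ 2) (ℕₚ.^-*-assoc N 14 2)) (sym (ℕₚ.^-distribˡ-+-* N 28 2))))) ⟩
        (k * k) ^ 15 * ((N ^ 14) ^ 2 * N ^ 2)        ≤⟨ ℕₚ.*-monoʳ-≤ ((k * k) ^ 15) (ℕₚ.*-mono-≤ (ℕₚ.^-monoˡ-≤ 2 N≤p) (ℕₚ.^-monoˡ-≤ 2 N≤)) ⟩
        (k * k) ^ 15 * ((p ^ 15) ^ 2 * (u ^ 7) ^ 2)  ≡⟨ cong ((k * k) ^ 15 *_) (cong₂ _*_ (ℕₚ.^-*-assoc p 15 2) (ℕₚ.^-*-assoc u 7 2)) ⟩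
        (k * k) ^ 15 * (p ^ 30 * u ^ 14)             ≤⟨ ℕₚ.*-monoʳ-≤ ((k * k) ^ 15) (ℕₚ.*-monoʳ-≤ (p ^ 30) (ℕₚ.m≤n*m (u ^ 14) u {{ℕ.>-nonZero u>0}})) ⟩
        (k * k) ^ 15 * (p ^ 30 * u ^ 15)             ≡⟨ trans (cong ((k * k) ^ 15 *_) (ℕₚ.*-comm (p ^ 30) (u ^ 15))) (trans (sym (ℕₚ.*-assoc ((k * k) ^ 15) (u ^ 15) (p ^ 30))) (cong (_* p ^ 30) (sym (^-distrib-* 15 (k * k) u)))) ⟩
        (k * k * u) ^ 15 * p ^ 30 ∎))
      where
      open ℕₚ.≤-Reasoning
      square : ∀ x → (x * x) ^ 15 ≡ x ^ 30
      square x = trans (^-distrib-* 15 x x) (sym (ℕₚ.^-distribˡ-+-* x 15 15))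

    μ-small : ∀ μ u N → 0 < u → N ≤ u ^ 7 → N ^ 14 ≤ p ^ 15 → μ * p ≤ 16 * N + p → μ * μ ≤ 289 * u
    μ-small μ u N u>0 N≤ N≤p μp≤ = by-size (ℕₚ.≤-total N p)
      where
      seventeen : ∀ n → 16 * n + n ≤ 17 * n
      seventeen n = ℕₚ.≤-reflexive (solve 1 (λ n → con 16 :* n :+ n := con 17 :* n) refl n)
      by-size : N ≤ p ⊎ p ≤ N → μ * μ ≤ 289 * u
      by-size (inj₁ le) = ℕₚ.≤-trans (ℕₚ.*-mono-≤ μ≤17 μ≤17) (ℕₚ.m≤m*n 289 u {{ℕ.>-nonZero u>0}})
        where
        μ≤17 : μ ≤ 17
        μ≤17 = ℕₚ.*-cancelʳ-≤ μ 17 p (ℕₚ.≤-trans μp≤ (ℕₚ.≤-trans (ℕₚ.+-monoˡ-≤ p (ℕₚ.*-monoʳ-≤ 16 le)) (seventeen p)))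
      by-size (inj₂ ge) = power-compare 17 μ u N u>0 N≤ N≤p (ℕₚ.≤-trans μp≤ (ℕₚ.≤-trans (ℕₚ.+-monoʳ-≤ (16 * N) ge) (seventeen N)))

  -- For u ≤ 256 the size of E is bounded and T ≤ N³ suffices. From 256 on `p-large` yields 44u⁵ ≤
  -- p, because 128¹⁴ · 44¹⁵ < 256²³.
  small-sets : ∀ E (uE : Unique E) C → (256 ^ 7) ^ 4 ≤ C → 86 ^ 7 * 128 ^ 3 ≤ C → 0 < length E → length E ^ 14 < p ^ 15 →
               T E uE E ^ 7 ≤ C * length E ^ 17
  small-sets E uE C C≥₁ C≥₂ N>0 N<p with seventh-root (length E) N>0
  ... | u , u>0 , N≤ , u⁷≤ = by-size (ℕₚ.≤-total u 256)
    where
    N : ℕ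
    N = length E
    by-size : u ≤ 256 ⊎ 256 ≤ u → T E uE E ^ 7 ≤ C * N ^ 17
    by-size (inj₁ small) = trivial-range N (256 ^ 7) C (triangles≤cube E uE) (ℕₚ.≤-trans N≤ (ℕₚ.^-monoˡ-≤ 7 small)) C≥₁
    by-size (inj₂ big) = main-range 86 128 u N C (triangles≤86u³N² E uE u u>0 N≤
        (p-large 44 128 256 u N u>0 u⁷≤ N<p big (ℕₚ.<ᵇ⇒< (128 ^ 14 * 44 ^ 15) (256 ^ 23) _))
        (μ-small (suc (16 * N / p)) u N u>0 N≤ (ℕₚ.<⇒≤ N<p) (ℕₚ.≤-trans (ℕₚ.≤-reflexive (ℕₚ.+-comm p (16 * N / p * p)))
          (ℕₚ.+-monoˡ-≤ p (ℕₚ.≤-trans (ℕₚ.m≤n+m _ (16 * N % p)) (ℕₚ.≤-reflexive (sym (m≡m%n+[m/n]*n (16 * N) p))))))) N>0) u⁷≤ C≥₂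

-- Combining the two Cauchy-Schwarz bounds

module Dichotomy (𝔽 : Field) where
  open Counting
  open Powers
  open FieldTheory 𝔽 using (p; 2<p; _≟_; 𝟘)
  open Plane 𝔽
  open Bisectors 𝔽 using (module Incidences; lines)
  open Rectangles 𝔽 using (module Distances)
  open Pruning 𝔽 using (T)
  open SmallSets 𝔽 using (small-sets; triangles≤cube)
  open +-*-Solver using (solve; _:=_; _:+_; _:*_; con)

  private
    p>0 : 0 < p
    p>0 = ℕₚ.<-trans (s≤s z≤n) 2<p

    unsquare : ∀ c t m n → t ^ 30 ≤ c ^ 2 * (m ^ 8 * n ^ 50) → t ^ 15 ≤ c * (m ^ 4 * n ^ 25)
    unsquare c t m n h = ^-cancel-≤ 1 (ℕₚ.≤-trans (ℕₚ.≤-reflexive (ℕₚ.^-*-assoc t 15 2)) (ℕₚ.≤-trans h (ℕₚ.≤-reflexive (sym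
      (trans (^-distrib-* 2 c _) (cong (c ^ 2 *_) (trans (^-distrib-* 2 (m ^ 4) (n ^ 25)) (cong₂ _*_ (ℕₚ.^-*-assoc m 4 2) (ℕₚ.^-*-assoc n 25 2)))))))))

    case-small : ∀ s k t m n → t ^ 7 ≤ s * n ^ 17 → t ^ 2 ≤ k * (m * n ^ 2) → t ^ 15 ≤ s * k ^ 4 * (m ^ 4 * n ^ 25)
    case-small s k t m n h₁ h₂ = unsquare (s * k ^ 4) t m n (begin
      t ^ 30                                        ≡⟨ trans (ℕₚ.^-distribˡ-+-* t 14 16) (sym (cong₂ _*_ (ℕₚ.^-*-assoc t 7 2) (ℕₚ.^-*-assoc t 2 8))) ⟩
      (t ^ 7) ^ 2 * (t ^ 2) ^ 8                     ≤⟨ ℕₚ.*-mono-≤ (ℕₚ.^-monoˡ-≤ 2 h₁) (ℕₚ.^-monoˡ-≤ 8 h₂) ⟩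
      (s * n ^ 17) ^ 2 * (k * (m * n ^ 2)) ^ 8      ≡⟨ cong₂ _*_ (trans (^-distrib-* 2 s _) (cong (s ^ 2 *_) (ℕₚ.^-*-assoc n 17 2)))
                                                        (trans (^-distrib-* 8 k _) (cong (k ^ 8 *_) (trans (^-distrib-* 8 m _) (cong (m ^ 8 *_) (ℕₚ.^-*-assoc n 2 8))))) ⟩
      s ^ 2 * n ^ 34 * (k ^ 8 * (m ^ 8 * n ^ 16))   ≡⟨ solve 5 (λ s a k m b → s :* a :* (k :* (m :* b)) := s :* k :* (m :* (a :* b))) refl (s ^ 2) (n ^ 34) (k ^ 8) (m ^ 8) (n ^ 16) ⟩
      s ^ 2 * k ^ 8 * (m ^ 8 * (n ^ 34 * n ^ 16))   ≡⟨ cong₂ _*_ (trans (cong (s ^ 2 *_) (sym (ℕₚ.^-*-assoc k 4 2))) (sym (^-distrib-* 2 s (k ^ 4)))) (cong (m ^ 8 *_) (sym (ℕₚ.^-distribˡ-+-* n 34 16))) ⟩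
      (s * k ^ 4) ^ 2 * (m ^ 8 * n ^ 50) ∎)
      where open ℕₚ.≤-Reasoning

    -- Of the 15 factors b in (t²)¹⁵ eight are bounded by j m and seven by n³. With q¹⁵ ≤ n¹⁴ the
    -- exponents of n add up to 21 + 29 = 50.
    case-deviation : ∀ k j t b m n q → t ^ 2 ≤ k * (b * (q * n)) → b ≤ j * m → b ≤ n ^ 3 → q ^ 15 ≤ n ^ 14 → t ^ 15 ≤ k ^ 8 * j ^ 4 * (m ^ 4 * n ^ 25)
    case-deviation k j t b m n q h₁ h₂ h₃ h₄ = unsquare (k ^ 8 * j ^ 4) t m n (begin
      t ^ 30                                        ≡⟨ ℕₚ.^-*-assoc t 2 15 ⟨
      (t ^ 2) ^ 15                                  ≤⟨ ℕₚ.^-monoˡ-≤ 15 h₁ ⟩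
      (k * (b * (q * n))) ^ 15                      ≡⟨ trans (^-distrib-* 15 k _) (cong (k ^ 15 *_) (trans (^-distrib-* 15 b _) (cong₂ _*_ (ℕₚ.^-distribˡ-+-* b 8 7) (^-distrib-* 15 q n)))) ⟩
      k ^ 15 * (b ^ 8 * b ^ 7 * (q ^ 15 * n ^ 15))  ≤⟨ ℕₚ.*-mono-≤ k¹⁵ (ℕₚ.*-mono-≤ (ℕₚ.*-mono-≤ (ℕₚ.^-monoˡ-≤ 8 h₂) (ℕₚ.^-monoˡ-≤ 7 h₃)) (ℕₚ.*-monoˡ-≤ (n ^ 15) h₄)) ⟩
      k ^ 16 * ((j * m) ^ 8 * (n ^ 3) ^ 7 * (n ^ 14 * n ^ 15))   ≡⟨ cong (k ^ 16 *_) (cong₂ _*_ (cong₂ _*_ (^-distrib-* 8 j m) (ℕₚ.^-*-assoc n 3 7)) (sym (ℕₚ.^-distribˡ-+-* n 14 15))) ⟩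
      k ^ 16 * (j ^ 8 * m ^ 8 * n ^ 21 * n ^ 29)    ≡⟨ solve 5 (λ k j m a b → k :* (j :* m :* a :* b) := k :* j :* (m :* (a :* b))) refl (k ^ 16) (j ^ 8) (m ^ 8) (n ^ 21) (n ^ 29) ⟩
      k ^ 16 * j ^ 8 * (m ^ 8 * (n ^ 21 * n ^ 29))  ≡⟨ cong₂ _*_ (trans (cong₂ _*_ (sym (ℕₚ.^-*-assoc k 8 2)) (sym (ℕₚ.^-*-assoc j 4 2))) (sym (^-distrib-* 2 (k ^ 8) (j ^ 4)))) (cong (m ^ 8 *_) (sym (ℕₚ.^-distribˡ-+-* n 21 29))) ⟩
      (k ^ 8 * j ^ 4) ^ 2 * (m ^ 8 * n ^ 50) ∎)
      where
      open ℕₚ.≤-Reasoning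
      k¹⁵ : k ^ 15 ≤ k ^ 16
      k¹⁵ = grow k
        where
        grow : ∀ k → k ^ 15 ≤ k ^ 16
        grow zero    = z≤n
        grow (suc k) = ℕₚ.m≤n*m (suc k ^ 15) (suc k)

    -- In n⁴⁵ = n¹⁶ n⁴ n²⁵ the first factor is traded for m⁴ q⁸ and the second for q⁷, which
    -- together cancel q¹⁵.
    case-mean : ∀ k j c t m n q → 0 < q → q * t ≤ k * n ^ 3 → n ^ 4 ≤ j * (m * q ^ 2) → n ^ 5 ≤ c * q ^ 8 → t ^ 15 ≤ k ^ 15 * (j ^ 4 * c) * (m ^ 4 * n ^ 25)
    case-mean k j c t m n q q>0 h₁ h₂ h₃ = ℕₚ.*-cancelˡ-≤ (q ^ 15) {{ℕ.>-nonZero (^-pos 15 q>0)}} (begin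
      q ^ 15 * t ^ 15                               ≡⟨ ^-distrib-* 15 q t ⟨
      (q * t) ^ 15                                  ≤⟨ ℕₚ.^-monoˡ-≤ 15 h₁ ⟩
      (k * n ^ 3) ^ 15                              ≡⟨ trans (^-distrib-* 15 k _) (cong (k ^ 15 *_) (trans (ℕₚ.^-*-assoc n 3 15) (trans (ℕₚ.^-distribˡ-+-* n 16 29) (cong₂ _*_ (sym (ℕₚ.^-*-assoc n 4 4)) (ℕₚ.^-distribˡ-+-* n 4 25))))) ⟩
      k ^ 15 * ((n ^ 4) ^ 4 * (n ^ 4 * n ^ 25))     ≤⟨ ℕₚ.*-monoʳ-≤ (k ^ 15) (ℕₚ.*-mono-≤ (ℕₚ.^-monoˡ-≤ 4 h₂) (ℕₚ.*-monoˡ-≤ (n ^ 25) n⁴≤)) ⟩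
      k ^ 15 * ((j * (m * q ^ 2)) ^ 4 * (c * q ^ 7 * n ^ 25))   ≡⟨ cong (λ z → k ^ 15 * (z * (c * q ^ 7 * n ^ 25))) (trans (^-distrib-* 4 j _) (cong (j ^ 4 *_) (trans (^-distrib-* 4 m _) (cong (m ^ 4 *_) (ℕₚ.^-*-assoc q 2 4))))) ⟩
      k ^ 15 * (j ^ 4 * (m ^ 4 * q ^ 8) * (c * q ^ 7 * n ^ 25))
        ≡⟨ solve 7 (λ k j m a c b n → k :* (j :* (m :* a) :* (c :* b :* n)) := (a :* b) :* (k :* (j :* c) :* (m :* n))) refl (k ^ 15) (j ^ 4) (m ^ 4) (q ^ 8) c (q ^ 7) (n ^ 25) ⟩
      q ^ 8 * q ^ 7 * (k ^ 15 * (j ^ 4 * c) * (m ^ 4 * n ^ 25))   ≡⟨ cong (_* (k ^ 15 * (j ^ 4 * c) * (m ^ 4 * n ^ 25))) (sym (ℕₚ.^-distribˡ-+-* q 8 7)) ⟩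
      q ^ 15 * (k ^ 15 * (j ^ 4 * c) * (m ^ 4 * n ^ 25)) ∎)
      where
      open ℕₚ.≤-Reasoning
      grow : ∀ c → c ^ 4 ≤ c ^ 5
      grow zero    = z≤n
      grow (suc c) = ℕₚ.m≤n*m (suc c ^ 4) (suc c)
      n⁴≤ : n ^ 4 ≤ c * q ^ 7
      n⁴≤ = ^-cancel-≤ 4 (begin
        (n ^ 4) ^ 5              ≡⟨ trans (ℕₚ.^-*-assoc n 4 5) (sym (ℕₚ.^-*-assoc n 5 4)) ⟩
        (n ^ 5) ^ 4              ≤⟨ ℕₚ.^-monoˡ-≤ 4 h₃ ⟩
        (c * q ^ 8) ^ 4          ≡⟨ trans (^-distrib-* 4 c _) (cong (c ^ 4 *_) (ℕₚ.^-*-assoc q 8 4)) ⟩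
        c ^ 4 * q ^ 32           ≤⟨ ℕₚ.*-mono-≤ (grow c) (ℕₚ.^-monoʳ-≤ q {{ℕ.>-nonZero q>0}} (ℕₚ.m≤m+n 32 3)) ⟩
        c ^ 5 * q ^ 35           ≡⟨ trans (^-distrib-* 5 c _) (cong (c ^ 5 *_) (ℕₚ.^-*-assoc q 7 5)) ⟨
        (c * q ^ 7) ^ 5 ∎)

    raise : ∀ k s t X W → s ≤ k * t → t ^ 15 ≤ X * W → s ^ 15 ≤ k ^ 15 * X * W
    raise k s t X W h₁ h₂ = begin
      s ^ 15              ≤⟨ ℕₚ.^-monoˡ-≤ 15 h₁ ⟩
      (k * t) ^ 15        ≡⟨ ^-distrib-* 15 k t ⟩
      k ^ 15 * t ^ 15     ≤⟨ ℕₚ.*-monoʳ-≤ (k ^ 15) h₂ ⟩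
      k ^ 15 * (X * W)    ≡⟨ ℕₚ.*-assoc (k ^ 15) X W ⟨
      k ^ 15 * X * W ∎
      where open ℕₚ.≤-Reasoning

    weaken : ∀ {a} X Y W → X ≤ Y → a ≤ X * W → a ≤ Y * W
    weaken X Y W h h′ = ℕₚ.≤-trans h′ (ℕₚ.*-monoˡ-≤ W h)

  module _ (E : List Pt) (uE : Unique E) where
    open Incidences E E uE uE
    open Distances E uE using (distances; rectangles#; isosceles; energy≤rectangles)

    private
      N M t : ℕ
      N = length E
      M = distances * (rectangles# + N * N)
      t = T E uE E

    -- The term N² accounts for triples with a = b, which the count of isosceles triangles admits.
    isosceles≤ : isosceles ≤ N * N + t
    isosceles≤ = begin
      isosceles
        ≤⟨ ∑-mono E (λ {a} a∈ → ∑-mono E (λ {b} _ → ∑-mono E (λ {c} _ → ⟦⟧-≤+ ((dist² a c ≟ dist² b c) ×-dec ¬? (dist² b c ≟ 𝟘)) (a ≟ᴾ b) (isosceles? a b c) (split a b c (a ≟ᴾ b))))) ⟩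
      (∑[ a ∈ E ] ∑[ b ∈ E ] ∑[ c ∈ E ] (⟦ a ≟ᴾ b ⟧ + ⟦ isosceles? a b c ⟧))
        ≡⟨ trans (∑-cong E (λ {a} _ → trans (∑-cong E (λ {b} _ → ∑-+ E (λ _ → ⟦ a ≟ᴾ b ⟧) (λ c → ⟦ isosceles? a b c ⟧))) (∑-+ E (λ b → ∑ E (λ _ → ⟦ a ≟ᴾ b ⟧)) (λ b → ∑ E (λ c → ⟦ isosceles? a b c ⟧)))))
             (∑-+ E (λ a → ∑ E (λ b → ∑ E (λ _ → ⟦ a ≟ᴾ b ⟧))) (λ a → ∑ E (λ b → ∑ E (λ c → ⟦ isosceles? a b c ⟧)))) ⟩
      (∑[ a ∈ E ] ∑[ b ∈ E ] ∑[ c ∈ E ] ⟦ a ≟ᴾ b ⟧) + t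
        ≡⟨ cong (_+ t) (trans (∑-cong E (λ {a} a∈ → trans (∑-cong E (λ {b} _ → ∑-const E ⟦ a ≟ᴾ b ⟧)) (trans (∑-*ˡ E N _) (trans (cong (N *_) (∑-pick-1 _≟ᴾ_ uE a∈)) (ℕₚ.*-identityʳ N))))) (∑-const E N)) ⟩
      N * N + t ∎
      where
      open ℕₚ.≤-Reasoning
      split : ∀ a b c → Dec (a ≡ b) → dist² a c ≡ dist² b c × dist² b c ≢ 𝟘 → a ≡ b ⊎ (a ≢ b × dist² a c ≡ dist² b c)
      split a b c (yes q) _       = inj₁ q
      split a b c (no ¬q) (h , _) = inj₂ (¬q , h)

    private
      energy≤2M : energy ≤ 2 * M
      energy≤2M = ℕₚ.≤-trans energy≤rectangles (ℕₚ.≤-reflexive (solve 2 (λ d r → d :* (con 2 :* r) := con 2 :* (d :* r)) refl distances (rectangles# + N * N)))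

      square : ∀ x → x ^ 2 ≡ x * x
      square x = cong (x *_) (ℕₚ.*-identityʳ x)

      halve : ∀ {x y z} → x ≤ y + z → 2 * y ≤ x → x ≤ 2 * z
      halve {x} {y} {z} h₁ h₂ = ℕₚ.+-cancelˡ-≤ x x (2 * z) (ℕₚ.≤-trans (ℕₚ.≤-reflexive (cong (x +_) (sym (ℕₚ.+-identityʳ x))))
        (ℕₚ.≤-trans (ℕₚ.*-monoʳ-≤ 2 h₁) (ℕₚ.≤-trans (ℕₚ.≤-reflexive (ℕₚ.*-distribˡ-+ 2 y z)) (ℕₚ.+-monoˡ-≤ (2 * z) h₂))))

      module _ (many : 2 * (N * N) < t) where
        open ℕₚ.≤-Reasoning

        2≤N : 2 ≤ N
        2≤N = ℕₚ.*-cancelˡ-≤ (N * N) {{nonZero}} (ℕₚ.≤-trans (ℕₚ.≤-reflexive (ℕₚ.*-comm (N * N) 2)) (ℕₚ.≤-trans (ℕₚ.<⇒≤ many) (ℕₚ.≤-trans (triangles≤cube E uE)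
            (ℕₚ.≤-reflexive (solve 1 (λ N → N :* (N :* (N :* con 1)) := N :* N :* N) refl N)))))
          where
          nonZero : NonZero (N * N)
          nonZero = ℕ.>-nonZero (ℕₚ.n≢0⇒n>0 (λ q → ℕₚ.<⇒≱ (ℕₚ.≤-<-trans z≤n many) (ℕₚ.≤-trans (triangles≤cube E uE)
            (ℕₚ.≤-reflexive (trans (solve 1 (λ N → N :* (N :* (N :* con 1)) := N :* N :* N) refl N) (cong (_* N) q))))))

        small-regime : ∀ s X → s * 8 ^ 4 ≤ X → t ^ 7 ≤ s * N ^ 17 → t ^ 15 ≤ X * (M ^ 4 * N ^ 25)
        small-regime s X s≤ h = weaken (s * 8 ^ 4) X _ s≤ $ case-small s 8 t M N h (begin
          t ^ 2                         ≤⟨ ℕₚ.^-monoˡ-≤ 2 (halve {t} {N * N} {excess} triangles≤excess (ℕₚ.<⇒≤ many)) ⟩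
          (2 * excess) ^ 2              ≡⟨ trans (^-distrib-* 2 2 excess) (cong (4 *_) (square excess)) ⟩
          4 * (excess * excess)         ≤⟨ ℕₚ.*-monoʳ-≤ 4 (ℕₚ.≤-trans excess² (ℕₚ.*-monoˡ-≤ (N * N) energy≤2M)) ⟩
          4 * (2 * M * (N * N))         ≡⟨ solve 2 (λ m n → con 4 :* (con 2 :* m :* n) := con 8 :* (m :* n)) refl M (N * N) ⟩
          8 * (M * (N * N))             ≡⟨ cong (λ z → 8 * (M * z)) (square N) ⟨
          8 * (M * N ^ 2) ∎)

        N⁴≤ : N ^ 4 ≤ 16 * (M * p ^ 2)
        N⁴≤ = begin
          N ^ 4                                         ≡⟨ trans (sym (ℕₚ.^-*-assoc N 2 2)) (trans (square (N ^ 2)) (cong (λ z → z * z) (square N))) ⟩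
          N * N * (N * N)                               ≤⟨ ℕₚ.*-mono-≤ N²≤ N²≤ ⟩
          2 * ∑ lines mult * (2 * ∑ lines mult)         ≡⟨ solve 1 (λ s → con 2 :* s :* (con 2 :* s) := con 4 :* (s :* s)) refl (∑ lines mult) ⟩
          4 * (∑ lines mult * ∑ lines mult)             ≤⟨ ℕₚ.*-monoʳ-≤ 4 (ℕₚ.≤-trans energy≥ (ℕₚ.*-mono-≤ energy≤2M p²+p≤)) ⟩
          4 * (2 * M * (2 * p ^ 2))                     ≡⟨ solve 2 (λ m q → con 4 :* (con 2 :* m :* (con 2 :* q)) := con 16 :* (m :* q)) refl M (p ^ 2) ⟩
          16 * (M * p ^ 2) ∎
          where
          p²+p≤ : p * p + p ≤ 2 * p ^ 2
          p²+p≤ = ℕₚ.≤-trans (ℕₚ.+-monoʳ-≤ (p * p) (ℕₚ.m≤m*n p p {{ℕ.>-nonZero p>0}})) (ℕₚ.≤-reflexive (trans (cong (p * p +_) (sym (ℕₚ.+-identityʳ (p * p)))) (cong (2 *_) (sym (square p)))))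
          N²≤ : N * N ≤ 2 * ∑ lines mult
          N²≤ = halve {N * N} {N} {∑ lines mult} (ℕₚ.≤-trans ∑-mult≥ (ℕₚ.≤-reflexive (ℕₚ.+-comm (∑ lines mult) N))) (ℕₚ.*-monoˡ-≤ N 2≤N)

        deviation-dominates : ∀ X → 8 ^ 8 * 2 ^ 4 ≤ X → N ^ 3 ≤ deviation → p ^ 15 ≤ N ^ 14 → t ^ 15 ≤ X * (M ^ 4 * N ^ 25)
        deviation-dominates X X≥ big p≤ = weaken (8 ^ 8 * 2 ^ 4) X _ X≥ $ case-deviation 8 2 t energy M N p (ℕₚ.*-cancelˡ-≤ (p * p) {{ℕ.>-nonZero (ℕₚ.*-mono-< p>0 p>0)}} (begin
          p * p * t ^ 2                                 ≡⟨ trans (cong (_* t ^ 2) (sym (square p))) (sym (^-distrib-* 2 p t)) ⟩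
          (p * t) ^ 2                                   ≤⟨ ℕₚ.^-monoˡ-≤ 2 (ℕₚ.≤-trans triangles≤deviation (ℕₚ.+-monoˡ-≤ deviation (ℕₚ.≤-trans (ℕₚ.≤-reflexive (solve 1 (λ N → N :* N :* N := N :* (N :* (N :* con 1))) refl N)) big))) ⟩
          (deviation + deviation) ^ 2                   ≡⟨ trans (square (deviation + deviation)) (solve 1 (λ d → (d :+ d) :* (d :+ d) := con 4 :* (d :* d)) refl deviation) ⟩
          4 * (deviation * deviation)                   ≤⟨ ℕₚ.*-monoʳ-≤ 4 deviation² ⟩
          4 * (energy * (2 * (p * p * p * N)))          ≡⟨ solve 3 (λ e p N → con 4 :* (e :* (con 2 :* (p :* p :* p :* N))) := p :* p :* (con 8 :* (e :* (p :* N)))) refl energy p N ⟩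
          p * p * (8 * (energy * (p * N))) ∎)) energy≤2M (ℕₚ.≤-trans energy≤cube (ℕₚ.≤-reflexive (solve 1 (λ N → N :* (N :* N) := N :* (N :* (N :* con 1))) refl N))) p≤

        mean-dominates : ∀ C₀ X → 2 ^ 15 * (16 ^ 4 * C₀) ≤ X → deviation ≤ N ^ 3 → N ^ 5 ≤ C₀ * p ^ 8 → t ^ 15 ≤ X * (M ^ 4 * N ^ 25)
        mean-dominates C₀ X X≥ small h = weaken (2 ^ 15 * (16 ^ 4 * C₀)) X _ X≥ $ case-mean 2 16 C₀ t M N p p>0 (begin
          p * t                     ≤⟨ triangles≤deviation ⟩
          N * N * N + deviation     ≤⟨ ℕₚ.+-monoʳ-≤ (N * N * N) small ⟩
          N * N * N + N ^ 3         ≡⟨ solve 1 (λ N → N :* N :* N :+ N :* (N :* (N :* con 1)) := con 2 :* (N :* (N :* (N :* con 1)))) refl N ⟩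
          2 * N ^ 3 ∎) N⁴≤ h

    dichotomy : ∀ C₀ s X → (256 ^ 7) ^ 4 ≤ s → 86 ^ 7 * 128 ^ 3 ≤ s → s * 8 ^ 4 ≤ X → 8 ^ 8 * 2 ^ 4 ≤ X → 2 ^ 15 * (16 ^ 4 * C₀) ≤ X →
      N ^ 5 ≤ C₀ * p ^ 8 → isosceles ≤ 3 * N ^ 2 ⊎ isosceles ^ 15 ≤ 2 ^ 15 * X * (M ^ 4 * N ^ 25)
    dichotomy C₀ s X s₁ s₂ X₁ X₂ X₃ h = by-size (t ℕ.≤? 2 * (N * N))
      where
      bound : 2 * (N * N) < t → Dec (N ^ 14 < p ^ 15) → N ^ 3 ≤ deviation ⊎ deviation ≤ N ^ 3 → t ^ 15 ≤ X * (M ^ 4 * N ^ 25)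
      bound many (yes small) _         = small-regime many s X X₁ (small-sets E uE s s₁ s₂ (ℕₚ.<-trans (s≤s z≤n) (2≤N many)) small)
      bound many (no large) (inj₁ big) = deviation-dominates many X X₂ big (ℕₚ.≮⇒≥ large)
      bound many (no large) (inj₂ sm)  = mean-dominates many C₀ X X₃ sm h
      by-size : Dec (t ≤ 2 * (N * N)) → isosceles ≤ 3 * N ^ 2 ⊎ isosceles ^ 15 ≤ 2 ^ 15 * X * (M ^ 4 * N ^ 25)
      by-size (yes few) = inj₁ (ℕₚ.≤-trans isosceles≤ (ℕₚ.≤-trans (ℕₚ.+-monoʳ-≤ (N * N) few) (ℕₚ.≤-reflexive (cong (3 *_) (sym (square N))))))
      by-size (no many) = inj₂ (raise 2 isosceles t X (M ^ 4 * N ^ 25)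
        (ℕₚ.≤-trans isosceles≤ (ℕₚ.≤-trans (ℕₚ.+-monoˡ-≤ t N²≤t) (ℕₚ.≤-reflexive (cong (t +_) (sym (ℕₚ.+-identityʳ t))))))
        (bound (ℕₚ.≰⇒> many) (N ^ 14 ℕ.<? p ^ 15) (ℕₚ.≤-total (N ^ 3) deviation)))
        where
        N²≤t : N * N ≤ t
        N²≤t = ℕₚ.≤-trans (ℕₚ.m≤m+n (N * N) _) (ℕₚ.<⇒≤ (ℕₚ.≰⇒> many))

-- The field of residues modulo p

module FpField (p : ℕ) .{{_ : NonZero p}} (prime : Prime p) (p≡3 : p % 4 ≡ 3) where
  open Counting
  open ℤ-Solver using (con) renaming (solve to solveℤ; _:=_ to _≐_; _:+_ to _∔_; _:*_ to _⊡_; :-_ to ⊟_)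

  F : Set
  F = Fin p

  val : F → ℤ
  val x = ℤ.+ Fin.toℕ x

  infix 4 _≋_
  -- Congruence modulo p with an explicit quotient, so that compatibility with the operations
  -- becomes a polynomial identity over ℤ.
  record _≋_ (a b : ℤ) : Set where
    constructor _,_
    field
      multiple : ℤ
      equation : a ≡ b ℤ.+ multiple ℤ.* ℤ.+ p

  private
    residues-equal : ∀ {r s} → r < p → s < p → ℤ.+ r ≋ ℤ.+ s → r ≡ s
    residues-equal {r} {s} r< s< (k , h) = ℤₚ.+-injective (ℤₚ.i-j≡0⇒i≡j (ℤ.+ r) (ℤ.+ s) (ℤₚ.∣i∣≡0⇒i≡0 (zero-multiple ℤ.∣ k ∣ size (trans (cong ℤ.∣_∣ difference) (ℤₚ.abs-* k (ℤ.+ p))))))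
      where
      difference : ℤ.+ r ℤ.- ℤ.+ s ≡ k ℤ.* ℤ.+ p
      difference = trans (cong (ℤ._- ℤ.+ s) h) (trans (cong (ℤ._- ℤ.+ s) (ℤₚ.+-comm (ℤ.+ s) (k ℤ.* ℤ.+ p))) (trans (ℤₚ.+-assoc (k ℤ.* ℤ.+ p) (ℤ.+ s) _) (trans (cong (ℤ._+_ (k ℤ.* ℤ.+ p)) (ℤₚ.+-inverseʳ (ℤ.+ s))) (ℤₚ.+-identityʳ _))))
      size : ℤ.∣ ℤ.+ r ℤ.- ℤ.+ s ∣ < p
      size = ℕₚ.≤-<-trans (ℕₚ.≤-reflexive (cong ℤ.∣_∣ (ℤₚ.m-n≡m⊖n r s))) (ℕₚ.≤-<-trans (ℤₚ.∣m⊝n∣≤m⊔n r s) (ℕₚ.⊔-lub r< s<))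
      zero-multiple : ∀ {d} m → d < p → d ≡ m * p → d ≡ 0
      zero-multiple zero    _  q = q
      zero-multiple (suc m) lt q = contradiction lt (ℕₚ.≤⇒≯ (ℕₚ.≤-trans (ℕₚ.m≤m+n p (m * p)) (ℕₚ.≤-reflexive (sym q))))

    ≋-trans : ∀ {a b c} → a ≋ b → b ≋ c → a ≋ c
    ≋-trans {c = c} (k , refl) (l , refl) = l ℤ.+ k , solveℤ 4 (λ c k l q → c ∔ l ⊡ q ∔ k ⊡ q ≐ c ∔ (l ∔ k) ⊡ q) refl c k l (ℤ.+ p)

    ≋-sym : ∀ {a b} → a ≋ b → b ≋ a
    ≋-sym {a} {b} (k , refl) = ℤ.- k , solveℤ 3 (λ b k q → b ≐ b ∔ k ⊡ q ∔ (⊟ k) ⊡ q) refl b k (ℤ.+ p)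

    ≋-+ : ∀ {a b c d} → a ≋ b → c ≋ d → a ℤ.+ c ≋ b ℤ.+ d
    ≋-+ {b = b} {d = d} (k , refl) (l , refl) = k ℤ.+ l , solveℤ 5 (λ b d k l q → b ∔ k ⊡ q ∔ (d ∔ l ⊡ q) ≐ b ∔ d ∔ (k ∔ l) ⊡ q) refl b d k l (ℤ.+ p)

    ≋-* : ∀ {a b c d} → a ≋ b → c ≋ d → a ℤ.* c ≋ b ℤ.* d
    ≋-* {b = b} {d = d} (k , refl) (l , refl) = b ℤ.* l ℤ.+ k ℤ.* d ℤ.+ k ℤ.* l ℤ.* ℤ.+ p ,
      solveℤ 5 (λ b d k l q → (b ∔ k ⊡ q) ⊡ (d ∔ l ⊡ q) ≐ b ⊡ d ∔ (b ⊡ l ∔ k ⊡ d ∔ k ⊡ l ⊡ q) ⊡ q) refl b d k l (ℤ.+ p)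

    ≋-neg : ∀ {a b} → a ≋ b → ℤ.- a ≋ ℤ.- b
    ≋-neg {b = b} (k , refl) = ℤ.- k , solveℤ 3 (λ b k q → ⊟ (b ∔ k ⊡ q) ≐ (⊟ b) ∔ (⊟ k) ⊡ q) refl b k (ℤ.+ p)

  infixl 6 _⊕_
  infixl 7 _⊗_
  infix  8 ⊝_

  abstract
    fromℤ : ℤ → F
    fromℤ z = Fin.fromℕ< (n%ℕd<d z p)

    toℕ-fromℤ : ∀ z → Fin.toℕ (fromℤ z) ≡ z %ℕ p
    toℕ-fromℤ z = Finₚ.toℕ-fromℕ< (n%ℕd<d z p)

    val-fromℤ : ∀ z → val (fromℤ z) ≋ z
    val-fromℤ z = ≋-sym (z /ℕ p , trans (a≡a%ℕn+[a/ℕn]*n z p) (cong (λ r → ℤ.+ r ℤ.+ (z /ℕ p) ℤ.* ℤ.+ p) (sym (toℕ-fromℤ z))))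

    ≋⇒≡ : ∀ {x y} → val x ≋ val y → x ≡ y
    ≋⇒≡ {x} {y} h = Finₚ.toℕ-injective (residues-equal (Finₚ.toℕ<n x) (Finₚ.toℕ<n y) h)

    fromℤ-cong : ∀ {a b} → a ≋ b → fromℤ a ≡ fromℤ b
    fromℤ-cong {a} {b} h = ≋⇒≡ (≋-trans (val-fromℤ a) (≋-trans h (≋-sym (val-fromℤ b))))

    fromℤ-val : ∀ x → fromℤ (val x) ≡ x
    fromℤ-val x = ≋⇒≡ (val-fromℤ (val x))

    _⊕_ _⊗_ : F → F → F
    x ⊕ y = fromℤ (val x ℤ.+ val y)
    x ⊗ y = fromℤ (val x ℤ.* val y)

    ⊝_ : F → F
    ⊝ x = fromℤ (ℤ.- val x)

    fromℤ-+ : ∀ x y → fromℤ (x ℤ.+ y) ≡ fromℤ x ⊕ fromℤ y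
    fromℤ-+ x y = sym (fromℤ-cong (≋-+ (val-fromℤ x) (val-fromℤ y)))

    fromℤ-* : ∀ x y → fromℤ (x ℤ.* y) ≡ fromℤ x ⊗ fromℤ y
    fromℤ-* x y = sym (fromℤ-cong (≋-* (val-fromℤ x) (val-fromℤ y)))

    fromℤ-neg : ∀ x → fromℤ (ℤ.- x) ≡ ⊝ fromℤ x
    fromℤ-neg x = sym (fromℤ-cong (≋-neg (val-fromℤ x)))

  𝟘 𝟙 : F
  𝟘 = fromℤ ℤ.0ℤ
  𝟙 = fromℤ ℤ.1ℤ

  private
    -- As `fromℤ` is onto, the ring laws are inherited from ℤ.
    on₁ : (P : F → Set) → (∀ a → P (fromℤ a)) → ∀ x → P x
    on₁ P h x = subst P (fromℤ-val x) (h (val x))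

    on₂ : (P : F → F → Set) → (∀ a b → P (fromℤ a) (fromℤ b)) → ∀ x y → P x y
    on₂ P h x y = on₁ (λ x → P x y) (λ a → on₁ (P (fromℤ a)) (h a) y) x

    on₃ : (P : F → F → F → Set) → (∀ a b c → P (fromℤ a) (fromℤ b) (fromℤ c)) → ∀ x y z → P x y z
    on₃ P h x y z = on₂ (λ x y → P x y z) (λ a b → on₁ (P (fromℤ a) (fromℤ b)) (h a b) z) x y

    ⊕-assoc : ∀ x y z → x ⊕ y ⊕ z ≡ x ⊕ (y ⊕ z)
    ⊕-assoc = on₃ _ λ a b c → begin
      fromℤ a ⊕ fromℤ b ⊕ fromℤ c        ≡⟨ trans (cong (_⊕ fromℤ c) (sym (fromℤ-+ a b))) (sym (fromℤ-+ _ c)) ⟩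
      fromℤ (a ℤ.+ b ℤ.+ c)              ≡⟨ cong fromℤ (ℤₚ.+-assoc a b c) ⟩
      fromℤ (a ℤ.+ (b ℤ.+ c))            ≡⟨ trans (fromℤ-+ a _) (cong (fromℤ a ⊕_) (fromℤ-+ b c)) ⟩
      fromℤ a ⊕ (fromℤ b ⊕ fromℤ c) ∎
      where open ≡-Reasoning

    ⊗-assoc : ∀ x y z → x ⊗ y ⊗ z ≡ x ⊗ (y ⊗ z)
    ⊗-assoc = on₃ _ λ a b c → begin
      fromℤ a ⊗ fromℤ b ⊗ fromℤ c        ≡⟨ trans (cong (_⊗ fromℤ c) (sym (fromℤ-* a b))) (sym (fromℤ-* _ c)) ⟩
      fromℤ (a ℤ.* b ℤ.* c)              ≡⟨ cong fromℤ (ℤₚ.*-assoc a b c) ⟩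
      fromℤ (a ℤ.* (b ℤ.* c))            ≡⟨ trans (fromℤ-* a _) (cong (fromℤ a ⊗_) (fromℤ-* b c)) ⟩
      fromℤ a ⊗ (fromℤ b ⊗ fromℤ c) ∎
      where open ≡-Reasoning

    ⊗-distribˡ : ∀ x y z → x ⊗ (y ⊕ z) ≡ x ⊗ y ⊕ x ⊗ z
    ⊗-distribˡ = on₃ _ λ a b c → begin
      fromℤ a ⊗ (fromℤ b ⊕ fromℤ c)              ≡⟨ trans (cong (fromℤ a ⊗_) (sym (fromℤ-+ b c))) (sym (fromℤ-* a _)) ⟩
      fromℤ (a ℤ.* (b ℤ.+ c))                    ≡⟨ cong fromℤ (ℤₚ.*-distribˡ-+ a b c) ⟩
      fromℤ (a ℤ.* b ℤ.+ a ℤ.* c)                ≡⟨ trans (fromℤ-+ _ _) (cong₂ _⊕_ (fromℤ-* a b) (fromℤ-* a c)) ⟩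
      fromℤ a ⊗ fromℤ b ⊕ fromℤ a ⊗ fromℤ c ∎
      where open ≡-Reasoning

    ⊕-comm : ∀ x y → x ⊕ y ≡ y ⊕ x
    ⊕-comm = on₂ _ (λ a b → trans (sym (fromℤ-+ a b)) (trans (cong fromℤ (ℤₚ.+-comm a b)) (fromℤ-+ b a)))

    ⊗-comm : ∀ x y → x ⊗ y ≡ y ⊗ x
    ⊗-comm = on₂ _ (λ a b → trans (sym (fromℤ-* a b)) (trans (cong fromℤ (ℤₚ.*-comm a b)) (fromℤ-* b a)))

    ⊕-identityˡ : ∀ x → 𝟘 ⊕ x ≡ x
    ⊕-identityˡ = on₁ _ (λ a → trans (sym (fromℤ-+ ℤ.0ℤ a)) (cong fromℤ (ℤₚ.+-identityˡ a)))

    ⊗-identityˡ : ∀ x → 𝟙 ⊗ x ≡ x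
    ⊗-identityˡ = on₁ _ (λ a → trans (sym (fromℤ-* ℤ.1ℤ a)) (cong fromℤ (ℤₚ.*-identityˡ a)))

    ⊝-inverseˡ : ∀ x → ⊝ x ⊕ x ≡ 𝟘
    ⊝-inverseˡ = on₁ _ (λ a → trans (cong (_⊕ fromℤ a) (sym (fromℤ-neg a))) (trans (sym (fromℤ-+ _ a)) (cong fromℤ (ℤₚ.+-inverseˡ a))))

  isCommutativeRing : IsCommutativeRing _≡_ _⊕_ _⊗_ ⊝_ 𝟘 𝟙
  isCommutativeRing = record
    { isRing = record
      { +-isAbelianGroup = record
        { isGroup = record
          { isMonoid = record
            { isSemigroup = record { isMagma = record { isEquivalence = isEquivalence ; ∙-cong = cong₂ _⊕_ } ; assoc = ⊕-assoc }
            ; identity = ⊕-identityˡ , λ x → trans (⊕-comm x 𝟘) (⊕-identityˡ x)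
            }
          ; inverse = ⊝-inverseˡ , λ x → trans (⊕-comm x (⊝ x)) (⊝-inverseˡ x)
          ; ⁻¹-cong = cong ⊝_
          }
        ; comm = ⊕-comm
        }
      ; *-cong = cong₂ _⊗_
      ; *-assoc = ⊗-assoc
      ; *-identity = ⊗-identityˡ , λ x → trans (⊗-comm x 𝟙) (⊗-identityˡ x)
      ; distrib = ⊗-distribˡ , λ x y z → trans (⊗-comm (y ⊕ z) x) (trans (⊗-distribˡ x y z) (cong₂ _⊕_ (⊗-comm x y) (⊗-comm x z)))
      }
    ; *-comm = ⊗-comm
    }

  private
    ringF : CommutativeRing _ _
    ringF = record { isCommutativeRing = isCommutativeRing }

    p>0 : 0 < p
    p>0 = ℕ.>-nonZero⁻¹ p

  toℕ-𝟘 : Fin.toℕ 𝟘 ≡ 0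
  toℕ-𝟘 = trans (toℕ-fromℤ ℤ.0ℤ) (m<n⇒m%n≡m p>0)

  2<p : 2 < p
  2<p = ℕₚ.≤-trans (ℕₚ.≤-reflexive (sym p≡3)) (m%n≤m p 4)

  char : ∀ k → 0 < k → k < p → fromℤ (ℤ.+ k) ≢ 𝟘
  char k k>0 k<p q = ℕₚ.<⇒≢ k>0 (sym (trans (sym (trans (toℕ-fromℤ (ℤ.+ k)) (m<n⇒m%n≡m k<p))) (trans (cong Fin.toℕ q) toℕ-𝟘)))

  private
    bézout : ∀ x → x ≢ 𝟘 → Bézout.Identity 1 p (Fin.toℕ x)
    bézout x x≢ = coprime-Bézout (prime⇒coprime prime {{ℕ.≢-nonZero (λ q → x≢ (Finₚ.toℕ-injective (trans q (sym toℕ-𝟘))))}} (Finₚ.toℕ<n x))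

    inverse-of : ∀ x → Bézout.Identity 1 p (Fin.toℕ x) → ∃[ y ] x ⊗ y ≡ 𝟙
    inverse-of x (Bézout.+- u v eq) = fromℤ (ℤ.- (ℤ.+ v)) , trans (cong (_⊗ fromℤ (ℤ.- (ℤ.+ v))) (sym (fromℤ-val x))) (trans (sym (fromℤ-* (val x) (ℤ.- (ℤ.+ v))))
      (fromℤ-cong (ℤ.- (ℤ.+ u) , trans (solveℤ 2 (λ x v → x ⊡ (⊟ v) ≐ con ℤ.1ℤ ∔ (⊟ (con ℤ.1ℤ ∔ v ⊡ x))) refl (val x) (ℤ.+ v))
        (cong (ℤ._+_ ℤ.1ℤ) (trans (cong ℤ.-_ (trans (cong (ℤ._+_ ℤ.1ℤ) (sym (ℤₚ.pos-* v (Fin.toℕ x)))) (trans (cong ℤ.+_ eq) (ℤₚ.pos-* u p)))) (ℤₚ.neg-distribˡ-* (ℤ.+ u) (ℤ.+ p)))))))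
    inverse-of x (Bézout.-+ u v eq) = fromℤ (ℤ.+ v) , trans (cong (_⊗ fromℤ (ℤ.+ v)) (sym (fromℤ-val x))) (trans (sym (fromℤ-* (val x) (ℤ.+ v)))
      (fromℤ-cong (ℤ.+ u , trans (ℤₚ.*-comm (val x) (ℤ.+ v)) (trans (sym (ℤₚ.pos-* v (Fin.toℕ x))) (trans (cong ℤ.+_ (sym eq)) (cong (ℤ._+_ ℤ.1ℤ) (ℤₚ.pos-* u p)))))))

    inverse-if : ∀ x → Dec (x ≡ 𝟘) → F
    inverse-if x (yes _) = 𝟘
    inverse-if x (no x≢) = proj₁ (inverse-of x (bézout x x≢))

    inverse-if-correct : ∀ x (d : Dec (x ≡ 𝟘)) → x ≢ 𝟘 → x ⊗ inverse-if x d ≡ 𝟙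
    inverse-if-correct x (yes q) x≢ = contradiction q x≢
    inverse-if-correct x (no x≢) _  = proj₂ (inverse-of x (bézout x x≢))

  inv : F → F
  inv x = inverse-if x (x Finₚ.≟ 𝟘)

  inverse : ∀ x → x ≢ 𝟘 → x ⊗ inv x ≡ 𝟙
  inverse x = inverse-if-correct x (x Finₚ.≟ 𝟘)

  elems : List F
  elems = List.allFin p

  elems-length : length elems ≡ p
  elems-length = Listₚ.length-tabulate {n = p} id

  private
    open Algebra.Solver.Ring.NaturalCoefficients.Default (CommutativeRing.commutativeSemiring ringF)
      using () renaming (solve to solveF; _:=_ to _≔_; _:+_ to _:⊕_; _:*_ to _:⊗_)

    ⊗-zeroʳ : ∀ x → x ⊗ 𝟘 ≡ 𝟘
    ⊗-zeroʳ = CommutativeRing.zeroʳ ringF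

    ⊗-cancelˡ : ∀ x {y z} → x ≢ 𝟘 → x ⊗ y ≡ x ⊗ z → y ≡ z
    ⊗-cancelˡ x {y} {z} x≢ h = trans (strip y) (trans (cong (inv x ⊗_) h) (sym (strip z)))
      where
      strip : ∀ y → y ≡ inv x ⊗ (x ⊗ y)
      strip y = trans (sym (⊗-identityˡ y)) (trans (cong (_⊗ y) (trans (sym (inverse x x≢)) (⊗-comm x (inv x)))) (⊗-assoc (inv x) x y))

    ⊗≢𝟘 : ∀ x {y} → x ≢ 𝟘 → y ≢ 𝟘 → x ⊗ y ≢ 𝟘
    ⊗≢𝟘 x x≢ y≢ h = y≢ (⊗-cancelˡ x x≢ (trans h (sym (⊗-zeroʳ x))))

    𝟙≢𝟘 : 𝟙 ≢ 𝟘
    𝟙≢𝟘 = char 1 (s≤s z≤n) (ℕₚ.<-trans (s≤s (s≤s z≤n)) 2<p)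

    ∏ : List F → F
    ∏ = List.foldr _⊗_ 𝟙

    ∏-↭ : ∀ {xs ys} → xs ↭ ys → ∏ xs ≡ ∏ ys
    ∏-↭ ↭.refl = refl
    ∏-↭ (↭.prep x h) = cong (x ⊗_) (∏-↭ h)
    ∏-↭ (↭.swap {xs} {ys} x y h) = trans (cong (λ z → x ⊗ (y ⊗ z)) (∏-↭ h)) (solveF 3 (λ x y z → x :⊗ (y :⊗ z) ≔ y :⊗ (x :⊗ z)) refl x y (∏ ys))
    ∏-↭ (↭.trans h h′) = trans (∏-↭ h) (∏-↭ h′)

    ∏≢𝟘 : ∀ {xs} → All (_≢ 𝟘) xs → ∏ xs ≢ 𝟘
    ∏≢𝟘 []                = 𝟙≢𝟘
    ∏≢𝟘 {x ∷ xs} (h ∷ hs) = ⊗≢𝟘 x h (∏≢𝟘 hs)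

    infixr 9 _^ᶠ_
    _^ᶠ_ : F → ℕ → F
    x ^ᶠ zero  = 𝟙
    x ^ᶠ suc n = x ⊗ x ^ᶠ n

    ∏-scale : ∀ i xs → ∏ (map (i ⊗_) xs) ≡ i ^ᶠ length xs ⊗ ∏ xs
    ∏-scale i []       = sym (⊗-identityˡ 𝟙)
    ∏-scale i (x ∷ xs) = trans (cong (i ⊗ x ⊗_) (∏-scale i xs)) (solveF 4 (λ i x p q → i :⊗ x :⊗ (p :⊗ q) ≔ i :⊗ p :⊗ (x :⊗ q)) refl i x (i ^ᶠ length xs) (∏ xs))

    nonzero? : Decidable (_≢ 𝟘)
    nonzero? x = ¬? (x Finₚ.≟ 𝟘)

    units : List F
    units = filter nonzero? elems

    units-length : suc (length units) ≡ p
    units-length = begin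
      suc (length units)                                          ≡⟨ cong₂ _+_ (sym (∑-pick-1 Finₚ._≟_ (Uniqueₚ.allFin⁺ p) (∈ₚ.∈-allFin 𝟘))) (length-filter-∑ nonzero? elems) ⟩
      ∑ elems (λ x → ⟦ 𝟘 Finₚ.≟ x ⟧) + ∑ elems (λ x → ⟦ nonzero? x ⟧)   ≡⟨ ∑-+ elems _ _ ⟨
      ∑ elems (λ x → ⟦ 𝟘 Finₚ.≟ x ⟧ + ⟦ nonzero? x ⟧)              ≡⟨ ∑-cong elems (λ {x} _ → trans (cong (_+ ⟦ nonzero? x ⟧) (⟦⟧-cong (𝟘 Finₚ.≟ x) (x Finₚ.≟ 𝟘) sym sym)) (complement (x Finₚ.≟ 𝟘))) ⟩
      ∑ elems (λ _ → 1)                                           ≡⟨ trans (sym (length-∑ elems)) elems-length ⟩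
      p ∎
      where
      open ≡-Reasoning
      complement : ∀ {P : Set} (d : Dec P) → ⟦ d ⟧ + ⟦ ¬? d ⟧ ≡ 1
      complement (yes _) = refl
      complement (no _)  = refl

    -- Multiplication by i permutes the units.
    fermat : ∀ i → i ≢ 𝟘 → i ^ᶠ length units ≡ 𝟙
    fermat i i≢ = ⊗-cancelˡ (∏ units) (∏≢𝟘 (Allₚ.all-filter nonzero? elems)) (begin
      ∏ units ⊗ i ^ᶠ length units       ≡⟨ ⊗-comm _ _ ⟩
      i ^ᶠ length units ⊗ ∏ units       ≡⟨ ∏-scale i units ⟨
      ∏ (map (i ⊗_) units)              ≡⟨ ∏-↭ (∼bag⇒↭ (unique∧set⇒bag (Uniqueₚ.map⁺ (⊗-cancelˡ i i≢) unique) unique (mk⇔ into onto))) ⟩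
      ∏ units                           ≡⟨ trans (⊗-comm _ _) (⊗-identityˡ _) ⟨
      ∏ units ⊗ 𝟙 ∎)
      where
      open ≡-Reasoning
      unique : Unique units
      unique = Uniqueₚ.filter⁺ nonzero? (Uniqueₚ.allFin⁺ p)
      unit : ∀ {x} → x ≢ 𝟘 → x ∈ units
      unit {x} x≢ = ∈ₚ.∈-filter⁺ nonzero? (∈ₚ.∈-allFin x) x≢
      inv≢𝟘 : inv i ≢ 𝟘
      inv≢𝟘 q = 𝟙≢𝟘 (trans (sym (inverse i i≢)) (trans (cong (i ⊗_) q) (⊗-zeroʳ i)))
      into : ∀ {x} → x ∈ map (i ⊗_) units → x ∈ units
      into x∈ with ∈ₚ.∈-map⁻ (i ⊗_) x∈
      ... | y , y∈ , refl = unit (⊗≢𝟘 i i≢ (proj₂ (∈ₚ.∈-filter⁻ nonzero? {xs = elems} y∈)))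
      onto : ∀ {x} → x ∈ units → x ∈ map (i ⊗_) units
      onto {x} x∈ = subst (_∈ map (i ⊗_) units) (trans (sym (⊗-assoc i (inv i) x)) (trans (cong (_⊗ x) (inverse i i≢)) (⊗-identityˡ x)))
        (∈ₚ.∈-map⁺ (i ⊗_) (unit (⊗≢𝟘 (inv i) inv≢𝟘 (proj₂ (∈ₚ.∈-filter⁻ nonzero? {xs = elems} x∈)))))

    units-mod-4 : length units ≡ p / 4 * 4 + 2
    units-mod-4 = ℕₚ.suc-injective (trans units-length (trans (m≡m%n+[m/n]*n p 4) (trans (cong (_+ p / 4 * 4) p≡3) (cong suc (ℕₚ.+-comm 2 (p / 4 * 4))))))

    power-of-root : ∀ i → i ⊗ i ⊕ 𝟙 ≡ 𝟘 → ∀ k → i ^ᶠ (k * 4 + 2) ⊕ 𝟙 ≡ 𝟘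
    power-of-root i h zero    = trans (cong (λ z → i ⊗ z ⊕ 𝟙) (trans (⊗-comm i 𝟙) (⊗-identityˡ i))) h
    power-of-root i h (suc k) = trans (cong (_⊕ 𝟙) (fourth _)) (power-of-root i h k)
      where
      i²≡ : i ⊗ i ≡ ⊝ 𝟙
      i²≡ = trans (sym (trans (⊕-assoc (i ⊗ i) 𝟙 (⊝ 𝟙)) (trans (cong (i ⊗ i ⊕_) (trans (⊕-comm 𝟙 (⊝ 𝟙)) (⊝-inverseˡ 𝟙))) (trans (⊕-comm _ 𝟘) (⊕-identityˡ _)))))
        (trans (cong (_⊕ ⊝ 𝟙) h) (⊕-identityˡ _))
      i⁴≡ : i ⊗ i ⊗ (i ⊗ i) ≡ 𝟙
      i⁴≡ = trans (cong₂ _⊗_ i²≡ i²≡) (trans (cong₂ _⊗_ (sym (fromℤ-neg ℤ.1ℤ)) (sym (fromℤ-neg ℤ.1ℤ))) (sym (fromℤ-* (ℤ.- ℤ.1ℤ) (ℤ.- ℤ.1ℤ))))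
      fourth : ∀ z → i ⊗ (i ⊗ (i ⊗ (i ⊗ z))) ≡ z
      fourth z = trans (solveF 2 (λ i z → i :⊗ (i :⊗ (i :⊗ (i :⊗ z))) ≔ i :⊗ i :⊗ (i :⊗ i) :⊗ z) refl i z) (trans (cong (_⊗ z) i⁴≡) (⊗-identityˡ z))

    -- By Fermat i^(p-1) = 1, but p - 1 = 4k + 2 and i² = -1 would give i^(p-1) = -1.
    no-root : ∀ i → i ⊗ i ⊕ 𝟙 ≢ 𝟘
    no-root i h = char 2 (s≤s z≤n) 2<p (trans (fromℤ-+ ℤ.1ℤ ℤ.1ℤ) (trans (cong (_⊕ 𝟙) (sym (fermat i i≢))) (trans (cong (λ n → i ^ᶠ n ⊕ 𝟙) units-mod-4) (power-of-root i h (p / 4)))))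
      where
      i≢ : i ≢ 𝟘
      i≢ refl = 𝟙≢𝟘 (trans (sym (trans (cong (_⊕ 𝟙) (⊗-zeroʳ 𝟘)) (⊕-identityˡ 𝟙))) h)

  anisotropic : ∀ x y → x ⊗ x ⊕ y ⊗ y ≡ 𝟘 → x ≡ 𝟘
  anisotropic x y h = by-cases (x Finₚ.≟ 𝟘)
    where
    by-cases : Dec (x ≡ 𝟘) → x ≡ 𝟘
    by-cases (yes x≡) = x≡
    by-cases (no x≢)  = ⊥-elim (no-root (y ⊗ inv x) (begin
      y ⊗ inv x ⊗ (y ⊗ inv x) ⊕ 𝟙                             ≡⟨ cong (y ⊗ inv x ⊗ (y ⊗ inv x) ⊕_) (trans (cong₂ _⊗_ (inverse x x≢) (inverse x x≢)) (⊗-identityˡ 𝟙)) ⟨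
      y ⊗ inv x ⊗ (y ⊗ inv x) ⊕ x ⊗ inv x ⊗ (x ⊗ inv x)       ≡⟨ solveF 3 (λ x y i → y :⊗ i :⊗ (y :⊗ i) :⊕ x :⊗ i :⊗ (x :⊗ i) ≔ i :⊗ i :⊗ (x :⊗ x :⊕ y :⊗ y)) refl x y (inv x) ⟩
      inv x ⊗ inv x ⊗ (x ⊗ x ⊕ y ⊗ y)                         ≡⟨ trans (cong (inv x ⊗ inv x ⊗_) h) (⊗-zeroʳ (inv x ⊗ inv x)) ⟩
      𝟘 ∎))
      where open ≡-Reasoning

  field𝔽ₚ : Field
  field𝔽ₚ = record
    { F = F ; _⊕_ = _⊕_ ; _⊗_ = _⊗_ ; ⊝_ = ⊝_ ; 𝟘 = 𝟘 ; 𝟙 = 𝟙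
    ; isCommutativeRing = isCommutativeRing
    ; fromℤ = fromℤ ; fromℤ-+ = fromℤ-+ ; fromℤ-* = fromℤ-* ; fromℤ-neg = fromℤ-neg ; fromℤ-0 = refl ; fromℤ-1 = refl
    ; _≟_ = Finₚ._≟_
    ; inv = inv ; inverse = inverse
    ; p = p
    ; elems = elems ; elems-unique = Uniqueₚ.allFin⁺ p ; elems-complete = ∈ₚ.∈-allFin ; elems-length = elems-length
    ; char = char ; 2<p = 2<p ; anisotropic = anisotropic
    }

-- From points with natural coordinates to the plane over the field

module Translation (p : ℕ) .{{_ : NonZero p}} (prime : Prime p) (p≡3 : p % 4 ≡ 3) where
  open Counting
  open import Data.Bool using (T)
  open FpField p prime p≡3 using (field𝔽ₚ; fromℤ; toℕ-fromℤ)
  open FieldTheory field𝔽ₚ hiding (p; fromℤ)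
  open Plane field𝔽ₚ
  open Rectangles field𝔽ₚ

  residue : ℕ → F
  residue a = fromℤ (ℤ.+ a)

  toℕ-residue : ∀ a → Fin.toℕ (residue a) ≡ a % p
  toℕ-residue a = toℕ-fromℤ (ℤ.+ a)

  residue-cong : ∀ {a b} → a % p ≡ b % p → residue a ≡ residue b
  residue-cong {a} {b} h = Finₚ.toℕ-injective (trans (toℕ-residue a) (trans h (sym (toℕ-residue b))))

  residue-injective : ∀ {a b} → residue a ≡ residue b → a % p ≡ b % p
  residue-injective {a} {b} h = trans (sym (toℕ-residue a)) (trans (cong Fin.toℕ h) (toℕ-residue b))

  residue-% : ∀ a → residue (a % p) ≡ residue a
  residue-% a = residue-cong (m%n%n≡m%n a p)

  residue-+ : ∀ a b → residue (a + b) ≡ residue a ⊕ residue b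
  residue-+ a b = fromℤ-+ (ℤ.+ a) (ℤ.+ b)

  residue-* : ∀ a b → residue (a * b) ≡ residue a ⊗ residue b
  residue-* a b = trans (cong fromℤ (ℤₚ.pos-* a b)) (fromℤ-* (ℤ.+ a) (ℤ.+ b))

  residue≡𝟘 : ∀ {a} → a % p ≡ 0 → residue a ≡ 𝟘
  residue≡𝟘 {a} h = residue-cong {a} {0} (trans h (sym (m<n⇒m%n≡m (ℕ.>-nonZero⁻¹ p))))

  residue≡𝟘⁻¹ : ∀ {a} → residue a ≡ 𝟘 → a % p ≡ 0
  residue≡𝟘⁻¹ {a} h = trans (residue-injective {a} {0} h) (m<n⇒m%n≡m (ℕ.>-nonZero⁻¹ p))

  residue-subₚ : ∀ a b → residue (subₚ p a b) ≡ residue a ⊖ residue b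
  residue-subₚ a b = begin
    residue (subₚ p a b)                            ≡⟨ trans (residue-% (a + (p ∸ b % p))) (residue-+ a (p ∸ b % p)) ⟩
    residue a ⊕ residue (p ∸ b % p)                 ≡⟨ solve 3 (λ a c b → a :+ c := (a :- b) :+ (c :+ b)) refl (residue a) (residue (p ∸ b % p)) (residue b) ⟩
    residue a ⊖ residue b ⊕ (residue (p ∸ b % p) ⊕ residue b)   ≡⟨ cong (residue a ⊖ residue b ⊕_) zero-sum ⟩
    residue a ⊖ residue b ⊕ 𝟘                       ≡⟨ ⊕-identityʳ _ ⟩
    residue a ⊖ residue b ∎
    where
    open ≡-Reasoning
    zero-sum : residue (p ∸ b % p) ⊕ residue b ≡ 𝟘
    zero-sum = trans (cong (residue (p ∸ b % p) ⊕_) (sym (residue-% b))) (trans (sym (residue-+ (p ∸ b % p) (b % p)))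
      (trans (cong residue (ℕₚ.m∸n+n≡m (ℕₚ.<⇒≤ (m%n<n b p)))) (residue≡𝟘 (n%n≡0 p))))

  point : Point → Pt
  point (x , y) = residue x , residue y

  private
    residue-form : ∀ a b c d e f g h → residue (subₚ p a b * subₚ p c d + subₚ p e f * subₚ p g h) ≡
      (residue a ⊖ residue b) ⊗ (residue c ⊖ residue d) ⊕ (residue e ⊖ residue f) ⊗ (residue g ⊖ residue h)
    residue-form a b c d e f g h = trans (residue-+ (subₚ p a b * subₚ p c d) _) (cong₂ _⊕_
      (trans (residue-* (subₚ p a b) _) (cong₂ _⊗_ (residue-subₚ a b) (residue-subₚ c d)))
      (trans (residue-* (subₚ p e f) _) (cong₂ _⊗_ (residue-subₚ e f) (residue-subₚ g h))))

  toℕ-dist² : ∀ x y → Fin.toℕ (dist² (point x) (point y)) ≡ dist p x y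
  toℕ-dist² (x₁ , x₂) (y₁ , y₂) = trans (cong Fin.toℕ (sym (residue-form x₁ y₁ x₁ y₁ x₂ y₂ x₂ y₂))) (toℕ-residue (subₚ p x₁ y₁ * subₚ p x₁ y₁ + subₚ p x₂ y₂ * subₚ p x₂ y₂))

  dist²-cong : ∀ x y z w → dist p x y ≡ dist p z w → dist² (point x) (point y) ≡ dist² (point z) (point w)
  dist²-cong x y z w h = Finₚ.toℕ-injective (trans (toℕ-dist² x y) (trans h (sym (toℕ-dist² z w))))

  dist²≡𝟘⇒dist≡0 : ∀ x y → dist² (point x) (point y) ≡ 𝟘 → dist p x y ≡ 0
  dist²≡𝟘⇒dist≡0 x y h = trans (sym (toℕ-dist² x y)) (trans (cong Fin.toℕ h) (trans (toℕ-residue 0) (m<n⇒m%n≡m (ℕ.>-nonZero⁻¹ p))))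

  T-corner : ∀ a b c → Corner (point a) (point b) (point c) → T (corner p a b c)
  T-corner (a₁ , a₂) (b₁ , b₂) (c₁ , c₂) h = ℕₚ.≡⇒≡ᵇ _ 0 (residue≡𝟘⁻¹ (trans (residue-form b₁ a₁ c₁ a₁ b₂ a₂ c₂ a₂) h))

  private
    T-∧⁺ : ∀ {x y} → T x → T y → T (x ∧ y)
    T-∧⁺ s t = Equivalence.from T-∧ (s , t)

    T-∧⁻ : ∀ {x y} → T (x ∧ y) → T x × T y
    T-∧⁻ = Equivalence.to T-∧

    T-not⁺ : ∀ {x} → ¬ T x → T (not x)
    T-not⁺ {true}  h = h _
    T-not⁺ {false} _ = _

    T-not⁻ : ∀ {x} → T (not x) → ¬ T x
    T-not⁻ {false} _ ()

    length-filterᵇ-∑ : ∀ {A : Set} (f : A → Bool) xs → length (filterᵇ f xs) ≡ ∑ xs (λ x → ⟦ T? (f x) ⟧)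
    length-filterᵇ-∑ f xs = length-filter-∑ (T? ∘ f) xs

    tabulate-toℕ : ∀ {A : Set} n (f : ℕ → A) → List.tabulate {n = n} (f ∘ Fin.toℕ) ≡ List.applyUpTo f n
    tabulate-toℕ zero    f = refl
    tabulate-toℕ (suc n) f = cong (f 0 ∷_) (tabulate-toℕ n (f ∘ suc))

  module _ (E : List Point) where
    private
      E′ : List Pt
      E′ = map point E

    ∑-points³ : (f : Pt → Pt → Pt → ℕ) → (∑[ a ∈ E′ ] ∑[ b ∈ E′ ] ∑[ c ∈ E′ ] f a b c) ≡ (∑[ a ∈ E ] ∑[ b ∈ E ] ∑[ c ∈ E ] f (point a) (point b) (point c))
    ∑-points³ f = trans (∑-map point E _) (∑-cong E (λ {a} _ → trans (∑-map point E _) (∑-cong E (λ {b} _ → ∑-map point E _))))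

    -- By the identity |u|² |v|² = (u ∙ v)² + (u ⨯ v)² and anisotropy.
    collinear-vectors : ∀ {u v} → u ≢ (𝟘 , 𝟘) → v ≢ (𝟘 , 𝟘) → u ⨯ v ≡ 𝟘 → u ∙ v ≢ 𝟘
    collinear-vectors {u@(u₁ , u₂)} {v@(v₁ , v₂)} u≢ v≢ h h′ = ⊗≢𝟘 (u≢ ∘ nrm≡𝟘 u) (v≢ ∘ nrm≡𝟘 v) (trans
      (solve 4 (λ a b c d → (a :* a :+ b :* b) :* (c :* c :+ d :* d) := (a :* c :+ b :* d) :* (a :* c :+ b :* d) :+ (a :* d :- b :* c) :* (a :* d :- b :* c)) refl u₁ u₂ v₁ v₂)
      (trans (cong₂ (λ s t → s ⊗ s ⊕ t ⊗ t) h′ h) (trans (cong₂ _⊕_ (⊗-zeroˡ 𝟘) (⊗-zeroˡ 𝟘)) (⊕-identityˡ 𝟘))))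

    onLine⇒ : ∀ α β γ x → T (onLine p α β γ x) → (residue α , residue β) ∙ point x ≡ residue γ
    onLine⇒ α β γ (x₁ , x₂) h = trans (sym (trans (residue-+ (α * x₁) _) (cong₂ _⊕_ (residue-* α x₁) (residue-* β x₂))))
      (trans (sym (residue-% (α * x₁ + β * x₂))) (cong residue (ℕₚ.≡ᵇ⇒≡ _ γ h)))

    -- A line through a, b and d would make b - a and d - a both parallel and orthogonal.
    not-on-a-line : ∀ a b c d → Rectangle (point a) (point b) (point c) (point d) → ¬ T (allOnALine p (a ∷ b ∷ c ∷ d ∷ []))
    not-on-a-line a b c d ((corner-a , _) , a≢b , a≢d) on = found (find (Anyₚ.any⁻ _ (upTo p) on))
      where
      on-line : ∀ α β γ → α < p → β < p → T (not ((α ≡ᵇ 0) ∧ (β ≡ᵇ 0)) ∧ all (onLine p α β γ) (a ∷ b ∷ c ∷ d ∷ [])) → ⊥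
      on-line α β γ α< β< h = conclude (Allₚ.all⁺ (onLine p α β γ) (a ∷ b ∷ c ∷ d ∷ []) (proj₂ split))
        where
        split : T (not ((α ≡ᵇ 0) ∧ (β ≡ᵇ 0))) × T (all (onLine p α β γ) (a ∷ b ∷ c ∷ d ∷ []))
        split = T-∧⁻ h
        n : Pt
        n = residue α , residue β
        n≢ : n ≢ (𝟘 , 𝟘)
        n≢ q = T-not⁻ (proj₁ split) (T-∧⁺ (vanish α α< (cong proj₁ q)) (vanish β β< (cong proj₂ q)))
          where
          vanish : ∀ x → x < p → residue x ≡ 𝟘 → T (x ≡ᵇ 0)
          vanish x x< q = ℕₚ.≡⇒≡ᵇ x 0 (trans (sym (m<n⇒m%n≡m x<)) (residue≡𝟘⁻¹ q))
        orthogonal : ∀ x → T (onLine p α β γ a) → T (onLine p α β γ x) → n ∙ (point x -ᴾ point a) ≡ 𝟘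
        orthogonal (x₁ , x₂) ha hx = trans (solve 6 (λ α β x₁ x₂ a₁ a₂ → α :* (x₁ :- a₁) :+ β :* (x₂ :- a₂) := (α :* x₁ :+ β :* x₂) :- (α :* a₁ :+ β :* a₂)) refl
            (residue α) (residue β) (residue x₁) (residue x₂) (residue (proj₁ a)) (residue (proj₂ a)))
          (≡⇒⊖≡𝟘 (trans (onLine⇒ α β γ (x₁ , x₂) hx) (sym (onLine⇒ α β γ a ha))))
        conclude : All (T ∘ onLine p α β γ) (a ∷ b ∷ c ∷ d ∷ []) → ⊥
        conclude (ha ∷ hb ∷ _ ∷ hd ∷ []) = collinear-vectors (λ q → a≢b (sym (-ᴾ≡𝟘 q))) (λ q → a≢d (sym (-ᴾ≡𝟘 q)))
          (orthogonal⇒parallel n (point b -ᴾ point a) (point d -ᴾ point a) n≢ (orthogonal b ha hb) (orthogonal d ha hd)) corner-a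
      found : ∃[ α ] α ∈ upTo p × T (any (λ β → any (λ γ → not ((α ≡ᵇ 0) ∧ (β ≡ᵇ 0)) ∧ all (onLine p α β γ) (a ∷ b ∷ c ∷ d ∷ [])) (upTo p)) (upTo p)) → ⊥
      found (α , α∈ , h₁) =
        let (β , β∈ , h₂) = find (Anyₚ.any⁻ _ (upTo p) h₁)
            (γ , _ , h₃)  = find (Anyₚ.any⁻ _ (upTo p) h₂)
        in on-line α β γ (∈ₚ.∈-upTo⁻ α∈) (∈ₚ.∈-upTo⁻ β∈) h₃

    module _ (uE′ : Unique E′) where
      open Distances E′ uE′

      -- This comparison and the next two follow the use of the counts: triangles are bounded above
      -- through `isosceles`, whereas `distances` and `rectangles#` stand on the larger sides of the
      -- bounds.
      isoTriangles≤ : isoTriangles p E ≤ isosceles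
      isoTriangles≤ = ℕₚ.≤-trans (ℕₚ.≤-reflexive (trans (length-filterᵇ-∑ _ (cartesianProduct E (cartesianProduct E E)))
          (trans (∑-cartesianProduct E _ _) (∑-cong E (λ _ → ∑-cartesianProduct E E _)))))
        (ℕₚ.≤-trans (∑-mono E (λ {a} _ → ∑-mono E (λ {b} _ → ∑-mono E (λ {c} _ →
            ⟦⟧-mono (T? _) ((dist² (point a) (point c) ≟ dist² (point b) (point c)) ×-dec ¬? (dist² (point b) (point c) ≟ 𝟘)) (triangle a b c)))))
          (ℕₚ.≤-reflexive (sym (∑-points³ (λ a b c → ⟦ (dist² a c ≟ dist² b c) ×-dec ¬? (dist² b c ≟ 𝟘) ⟧)))))
        where
        triangle : ∀ a b c → T ((dist p a c ≡ᵇ dist p b c) ∧ not (dist p b c ≡ᵇ 0)) → dist² (point a) (point c) ≡ dist² (point b) (point c) × dist² (point b) (point c) ≢ 𝟘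
        triangle a b c h = let (same , nonzero) = T-∧⁻ h in
          dist²-cong a c b c (ℕₚ.≡ᵇ⇒≡ _ _ same) , λ q → T-not⁻ nonzero (ℕₚ.≡⇒≡ᵇ _ 0 (dist²≡𝟘⇒dist≡0 b c q))

      distances≤ : distances ≤ distanceCount p E
      distances≤ = ℕₚ.≤-trans (∑-mono elems (λ {δ} _ → ⟦⟧-mono (occurs? δ) (T? (any (λ xy → dist p (proj₁ xy) (proj₂ xy) ≡ᵇ Fin.toℕ δ) (cartesianProduct E E))) (occurring δ)))
        (ℕₚ.≤-reflexive (sym (trans (length-filterᵇ-∑ _ (upTo p)) (trans (cong (λ ds → ∑ ds indicator) (sym residues)) (∑-map Fin.toℕ elems indicator)))))
        where
        indicator : ℕ → ℕ
        indicator δ = ⟦ T? (any (λ xy → dist p (proj₁ xy) (proj₂ xy) ≡ᵇ δ) (cartesianProduct E E)) ⟧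
        residues : map Fin.toℕ elems ≡ upTo p
        residues = trans (Listₚ.map-tabulate id Fin.toℕ) (tabulate-toℕ p id)
        occurring : ∀ δ → Any (λ ab → dist² (proj₁ ab) (proj₂ ab) ≡ δ) (cartesianProduct E′ E′) → T (any (λ xy → dist p (proj₁ xy) (proj₂ xy) ≡ᵇ Fin.toℕ δ) (cartesianProduct E E))
        occurring δ h with find h
        ... | (u , v) , uv∈ , q with ∈ₚ.∈-cartesianProduct⁻ E′ E′ uv∈
        ...   | u∈ , v∈ with ∈ₚ.∈-map⁻ point u∈ | ∈ₚ.∈-map⁻ point v∈
        ...     | x , x∈ , refl | y , y∈ , refl = Anyₚ.any⁺ _ (lose (∈ₚ.∈-cartesianProduct⁺ x∈ y∈) (ℕₚ.≡⇒≡ᵇ _ _ (trans (sym (toℕ-dist² x y)) (cong Fin.toℕ q))))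

      rectangles≥ : rectangles# ≤ rectangles p E
      rectangles≥ = ℕₚ.≤-trans (ℕₚ.≤-reflexive (trans (∑-points³ (λ a b c → ∑[ d ∈ E′ ] ⟦ rectangle? a b c d ⟧))
          (∑-cong E (λ _ → ∑-cong E (λ _ → ∑-cong E (λ _ → ∑-map point E _))))))
        (ℕₚ.≤-trans (∑-mono E (λ {a} _ → ∑-mono E (λ {b} _ → ∑-mono E (λ {c} _ → ∑-mono E (λ {d} _ →
            ⟦⟧-mono (rectangle? (point a) (point b) (point c) (point d)) (T? (isRectangle p a b c d ∧ not (allOnALine p (a ∷ b ∷ c ∷ d ∷ [])))) (rectangle a b c d))))))
          (ℕₚ.≤-reflexive (sym (trans (length-filterᵇ-∑ _ (cartesianProduct E (cartesianProduct E (cartesianProduct E E))))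
            (trans (∑-cartesianProduct E _ _) (∑-cong E (λ _ → trans (∑-cartesianProduct E _ _) (∑-cong E (λ _ → ∑-cartesianProduct E E _)))))))))
        where
        rectangle : ∀ a b c d → Rectangle (point a) (point b) (point c) (point d) → T (isRectangle p a b c d ∧ not (allOnALine p (a ∷ b ∷ c ∷ d ∷ [])))
        rectangle a b c d r@((ra , rb , rc , rd) , _) =
          T-∧⁺ (T-∧⁺ (T-corner a b d ra) (T-∧⁺ (T-corner b a c rb) (T-∧⁺ (T-corner c b d rc) (T-corner d a c rd)))) (T-not⁺ (not-on-a-line a b c d r))

  points-unique : ∀ {E} → IsSubsetFp2 p E → Unique (map point E)
  points-unique (uE , bounded) = AllPairsₚ.map⁺ (go uE bounded)
    where
    small-injective : ∀ {a b} → a < p → b < p → residue a ≡ residue b → a ≡ b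
    small-injective a< b< q = trans (sym (m<n⇒m%n≡m a<)) (trans (residue-injective q) (m<n⇒m%n≡m b<))
    apart : ∀ {x} → proj₁ x < p × proj₂ x < p → ∀ {ys} → All (x ≢_) ys → All (λ y → proj₁ y < p × proj₂ y < p) ys → All (λ y → point x ≢ point y) ys
    apart bx []       []       = []
    apart bx (h ∷ hs) (b ∷ bs) = (λ q → h (cong₂ _,_ (small-injective (proj₁ bx) (proj₁ b) (cong proj₁ q)) (small-injective (proj₂ bx) (proj₂ b) (cong proj₂ q)))) ∷ apart bx hs bs
    go : ∀ {E} → Unique E → All (λ x → proj₁ x < p × proj₂ x < p) E → AllPairs (λ x y → point x ≢ point y) E
    go []       []       = []
    go (h ∷ hs) (b ∷ bs) = apart b h bs ∷ go hs bs

-- From triangles to distances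

module Conclusion where
  open Powers
  open +-*-Solver using (solve; _:=_; _:+_; _:*_; con)

  private
    -- Whichever of r and n² is larger dominates m = d (r + n²).
    expand : ∀ c t m d r n → m ≤ d * (r + n * n) → t ^ 15 ≤ c * (m ^ 4 * n ^ 25) →
      t ^ 15 ≤ c * 16 * (d ^ 4 * n ^ 33) ⊎ t ^ 15 ≤ c * 16 * (n ^ 25 * d ^ 4 * r ^ 4)
    expand c t m d r n hm ht = by-size (ℕₚ.≤-total r (n * n))
      where
      open ℕₚ.≤-Reasoning
      doubled : ∀ x → r + n * n ≤ 2 * x → t ^ 15 ≤ c * (2 ^ 4 * (d ^ 4 * x ^ 4) * n ^ 25)
      doubled x h = begin
        t ^ 15                                   ≤⟨ ht ⟩
        c * (m ^ 4 * n ^ 25)                     ≤⟨ ℕₚ.*-monoʳ-≤ c (ℕₚ.*-monoˡ-≤ (n ^ 25) (ℕₚ.^-monoˡ-≤ 4 (ℕₚ.≤-trans hm (ℕₚ.*-monoʳ-≤ d h)))) ⟩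
        c * ((d * (2 * x)) ^ 4 * n ^ 25)         ≡⟨ cong (λ z → c * (z ^ 4 * n ^ 25)) (solve 2 (λ d x → d :* (con 2 :* x) := con 2 :* (d :* x)) refl d x) ⟩
        c * ((2 * (d * x)) ^ 4 * n ^ 25)         ≡⟨ cong (λ z → c * (z * n ^ 25)) (trans (^-distrib-* 4 2 (d * x)) (cong (2 ^ 4 *_) (^-distrib-* 4 d x))) ⟩
        c * (2 ^ 4 * (d ^ 4 * x ^ 4) * n ^ 25) ∎
      by-size : r ≤ n * n ⊎ n * n ≤ r → _
      by-size (inj₁ h) = inj₁ (begin
        t ^ 15                                   ≤⟨ doubled (n * n) (ℕₚ.≤-trans (ℕₚ.+-monoˡ-≤ (n * n) h) (ℕₚ.≤-reflexive (cong (n * n +_) (sym (ℕₚ.+-identityʳ (n * n)))))) ⟩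
        c * (16 * (d ^ 4 * (n * n) ^ 4) * n ^ 25) ≡⟨ solve 4 (λ c d a b → c :* (con 16 :* (d :* a) :* b) := c :* con 16 :* (d :* (a :* b))) refl c (d ^ 4) ((n * n) ^ 4) (n ^ 25) ⟩
        c * 16 * (d ^ 4 * ((n * n) ^ 4 * n ^ 25)) ≡⟨ cong (λ z → c * 16 * (d ^ 4 * z)) (trans (cong (_* n ^ 25) (trans (cong (λ z → (n * z) ^ 4) (sym (ℕₚ.*-identityʳ n))) (ℕₚ.^-*-assoc n 2 4))) (sym (ℕₚ.^-distribˡ-+-* n 8 25))) ⟩
        c * 16 * (d ^ 4 * n ^ 33) ∎)
      by-size (inj₂ h) = inj₂ (begin
        t ^ 15                                   ≤⟨ doubled r (ℕₚ.≤-trans (ℕₚ.+-monoʳ-≤ r h) (ℕₚ.≤-reflexive (cong (r +_) (sym (ℕₚ.+-identityʳ r))))) ⟩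
        c * (16 * (d ^ 4 * r ^ 4) * n ^ 25)      ≡⟨ solve 4 (λ c d r b → c :* (con 16 :* (d :* r) :* b) := c :* con 16 :* (b :* d :* r)) refl c (d ^ 4) (r ^ 4) (n ^ 25) ⟩
        c * 16 * (n ^ 25 * d ^ 4 * r ^ 4) ∎)

    -- Pinned distances give N³ ≲ D T, and the fifteenth power meets the bound for T¹⁵. With w =
    -- D⁴N³³ or w = N²⁵D⁴□⁴, cancelling the powers of N leaves N¹² ≲ D¹⁹ or N²⁰ ≲ D¹⁹□⁴.
    invert : ∀ e k d t n w → n ^ 3 ≤ k * (d * t) → t ^ 15 ≤ e * w → n ^ 45 ≤ k ^ 15 * e * (d ^ 15 * w)
    invert e k d t n w h₁ h₂ = begin
      n ^ 45                              ≡⟨ ℕₚ.^-*-assoc n 3 15 ⟨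
      (n ^ 3) ^ 15                        ≤⟨ ℕₚ.^-monoˡ-≤ 15 h₁ ⟩
      (k * (d * t)) ^ 15                  ≡⟨ trans (^-distrib-* 15 k _) (cong (k ^ 15 *_) (^-distrib-* 15 d t)) ⟩
      k ^ 15 * (d ^ 15 * t ^ 15)          ≤⟨ ℕₚ.*-monoʳ-≤ (k ^ 15) (ℕₚ.*-monoʳ-≤ (d ^ 15) h₂) ⟩
      k ^ 15 * (d ^ 15 * (e * w))         ≡⟨ solve 4 (λ k d e w → k :* (d :* (e :* w)) := k :* e :* (d :* w)) refl (k ^ 15) (d ^ 15) e w ⟩
      k ^ 15 * e * (d ^ 15 * w) ∎
      where open ℕₚ.≤-Reasoning

    -- Quadratically many triangles give N ≲ D, and D ≥ 1 turns D¹² into D¹⁹.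
    few-triangles : ∀ e k d t n → 0 < n → 0 < d → n ^ 3 ≤ k * (d * t) → t ≤ e * n ^ 2 → n ^ 12 ≤ (k * e) ^ 12 * d ^ 19
    few-triangles e k d t n n>0 d>0 h₁ h₂ = begin
      n ^ 12                     ≤⟨ ℕₚ.^-monoˡ-≤ 12 n≤ ⟩
      (k * e * d) ^ 12           ≡⟨ ^-distrib-* 12 (k * e) d ⟩
      (k * e) ^ 12 * d ^ 12      ≤⟨ ℕₚ.*-monoʳ-≤ ((k * e) ^ 12) (ℕₚ.^-monoʳ-≤ d {{ℕ.>-nonZero d>0}} (ℕₚ.m≤m+n 12 7)) ⟩
      (k * e) ^ 12 * d ^ 19 ∎
      where
      open ℕₚ.≤-Reasoning
      n≤ : n ≤ k * e * d
      n≤ = ℕₚ.*-cancelʳ-≤ n (k * e * d) (n ^ 2) {{ℕ.>-nonZero (^-pos 2 n>0)}} (begin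
        n * n ^ 2                ≤⟨ h₁ ⟩
        k * (d * t)              ≤⟨ ℕₚ.*-monoʳ-≤ k (ℕₚ.*-monoʳ-≤ d h₂) ⟩
        k * (d * (e * n ^ 2))    ≡⟨ solve 4 (λ k d e n → k :* (d :* (e :* n)) := k :* e :* d :* n) refl k d e (n ^ 2) ⟩
        k * e * d * n ^ 2 ∎)

    few-rectangles : ∀ e k d t n → 0 < n → n ^ 3 ≤ k * (d * t) → t ^ 15 ≤ e * (d ^ 4 * n ^ 33) → n ^ 12 ≤ k ^ 15 * e * d ^ 19
    few-rectangles e k d t n n>0 h₁ h₂ = ℕₚ.*-cancelʳ-≤ (n ^ 12) (k ^ 15 * e * d ^ 19) (n ^ 33) {{ℕ.>-nonZero (^-pos 33 n>0)}} (begin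
      n ^ 12 * n ^ 33                          ≡⟨ ℕₚ.^-distribˡ-+-* n 12 33 ⟨
      n ^ 45                                   ≤⟨ invert e k d t n (d ^ 4 * n ^ 33) h₁ h₂ ⟩
      k ^ 15 * e * (d ^ 15 * (d ^ 4 * n ^ 33)) ≡⟨ cong (k ^ 15 * e *_) (trans (sym (ℕₚ.*-assoc (d ^ 15) (d ^ 4) (n ^ 33))) (cong (_* n ^ 33) (sym (ℕₚ.^-distribˡ-+-* d 15 4)))) ⟩
      k ^ 15 * e * (d ^ 19 * n ^ 33)           ≡⟨ ℕₚ.*-assoc (k ^ 15 * e) (d ^ 19) (n ^ 33) ⟨
      k ^ 15 * e * d ^ 19 * n ^ 33 ∎)
      where open ℕₚ.≤-Reasoning

    many-rectangles : ∀ e k d t n r → 0 < n → n ^ 3 ≤ k * (d * t) → t ^ 15 ≤ e * (n ^ 25 * d ^ 4 * r ^ 4) → n ^ 20 ≤ k ^ 15 * e * (d ^ 19 * r ^ 4)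
    many-rectangles e k d t n r n>0 h₁ h₂ = ℕₚ.*-cancelʳ-≤ (n ^ 20) (k ^ 15 * e * (d ^ 19 * r ^ 4)) (n ^ 25) {{ℕ.>-nonZero (^-pos 25 n>0)}} (begin
      n ^ 20 * n ^ 25                                  ≡⟨ ℕₚ.^-distribˡ-+-* n 20 25 ⟨
      n ^ 45                                           ≤⟨ invert e k d t n (n ^ 25 * d ^ 4 * r ^ 4) h₁ h₂ ⟩
      k ^ 15 * e * (d ^ 15 * (n ^ 25 * d ^ 4 * r ^ 4)) ≡⟨ solve 5 (λ k d n d′ r → k :* (d :* (n :* d′ :* r)) := k :* ((d :* d′) :* r) :* n) refl (k ^ 15 * e) (d ^ 15) (n ^ 25) (d ^ 4) (r ^ 4) ⟩
      k ^ 15 * e * (d ^ 15 * d ^ 4 * r ^ 4) * n ^ 25   ≡⟨ cong (λ z → k ^ 15 * e * (z * r ^ 4) * n ^ 25) (sym (ℕₚ.^-distribˡ-+-* d 15 4)) ⟩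
      k ^ 15 * e * (d ^ 19 * r ^ 4) * n ^ 25 ∎)
      where open ℕₚ.≤-Reasoning

    halves : ∀ n → 2 ≤ n → n ^ 3 ≤ 4 * (n * ((n ∸ 1) * (n ∸ 1)))
    halves 1 (s≤s ())
    halves (suc (suc n)) _ = begin
      suc (suc n) ^ 3                          ≡⟨ cong (λ z → suc (suc n) * (suc (suc n) * z)) (ℕₚ.*-identityʳ (suc (suc n))) ⟩
      suc (suc n) * (suc (suc n) * suc (suc n)) ≤⟨ ℕₚ.*-monoʳ-≤ (suc (suc n)) (ℕₚ.*-mono-≤ double double) ⟩
      suc (suc n) * (2 * suc n * (2 * suc n))  ≡⟨ solve 2 (λ a b → a :* (con 2 :* b :* (con 2 :* b)) := con 4 :* (a :* (b :* b))) refl (suc (suc n)) (suc n) ⟩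
      4 * (suc (suc n) * (suc n * suc n)) ∎
      where
      open ℕₚ.≤-Reasoning
      double : suc (suc n) ≤ 2 * suc n
      double = ℕₚ.≤-trans (s≤s (ℕₚ.m≤n+m (suc n) n)) (ℕₚ.≤-reflexive (cong (λ z → suc (n + suc z)) (sym (ℕₚ.+-identityʳ n))))

    log-positive : ∀ n → 2 ≤ n → 1 ≤ ⌊log₂ n ⌋
    log-positive n h = ℕₚ.≤-trans (ℕₚ.≤-reflexive (sym (⌊log₂[2^n]⌋≡n 1))) (⌊log₂⌋-mono-≤ h)

    weaken : ∀ {x a} y n → a ≤ y → x ≤ a * n → x ≤ y * n
    weaken y n h h′ = ℕₚ.≤-trans h′ (ℕₚ.*-monoˡ-≤ n h)

  module _ (c C : ℕ) (3≤C : 3 ≤ C) (c≤C : c * 16 ≤ C) (12≤C : (4 * 3) ^ 12 ≤ C) (c′≤C : 4 ^ 15 * (c * 16) ≤ C) where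

    triangle-bound : ∀ n d r t m → (n ≤ 1 → t ≡ 0) → m ≤ d * (r + n * n) → t ≤ 3 * n ^ 2 ⊎ t ^ 15 ≤ c * (m ^ 4 * n ^ 25) →
      t ≤ C * (n ^ 2 * ⌊log₂ n ⌋) ⊎ (t ^ 15 ≤ C * (d ^ 4 * n ^ 33) ⊎ t ^ 15 ≤ C * (n ^ 25 * d ^ 4 * r ^ 4))
    triangle-bound n d r t m ht hm (inj₂ h) = inj₂ ([ inj₁ ∘ weaken C (d ^ 4 * n ^ 33) c≤C , inj₂ ∘ weaken C (n ^ 25 * d ^ 4 * r ^ 4) c≤C ]′ (expand c t m d r n hm h))
    -- The logarithm is zero for n ≤ 1, so these cases rest on t being zero.
    triangle-bound 0 d r t m ht hm (inj₁ h) = inj₁ (ℕₚ.≤-trans (ℕₚ.≤-reflexive (ht z≤n)) z≤n)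
    triangle-bound 1 d r t m ht hm (inj₁ h) = inj₁ (ℕₚ.≤-trans (ℕₚ.≤-reflexive (ht (s≤s z≤n))) z≤n)
    triangle-bound n@(suc (suc _)) d r t m ht hm (inj₁ h) = inj₁ (ℕₚ.≤-trans (weaken C (n ^ 2) 3≤C h)
      (ℕₚ.*-monoʳ-≤ C (ℕₚ.≤-trans (ℕₚ.≤-reflexive (sym (ℕₚ.*-identityʳ (n ^ 2)))) (ℕₚ.*-monoʳ-≤ (n ^ 2) (log-positive n (s≤s (s≤s z≤n)))))))

    distance-bound : ∀ n d r t m → (0 < n → 0 < d) → n * ((n ∸ 1) * (n ∸ 1)) ≤ d * t → m ≤ d * (r + n * n) → t ≤ 3 * n ^ 2 ⊎ t ^ 15 ≤ c * (m ^ 4 * n ^ 25) →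
      n ^ 12 ≤ C * d ^ 19 ⊎ n ^ 20 ≤ C * (d ^ 19 * r ^ 4)
    distance-bound 0 d r t m hd hn hm _ = inj₁ z≤n
    distance-bound 1 d r t m hd hn hm _ = inj₁ (ℕₚ.*-mono-≤ (ℕₚ.≤-trans (s≤s z≤n) 3≤C) (^-pos 19 (hd (s≤s z≤n))))
    distance-bound n@(suc (suc _)) d r t m hd hn hm = [ inj₁ ∘ weaken C (d ^ 19) 12≤C ∘ few-triangles 3 4 d t n n>0 (hd n>0) cube≤ , by-terms ∘ expand c t m d r n hm ]′
      where
      n>0 : 0 < n
      n>0 = s≤s z≤n
      cube≤ : n ^ 3 ≤ 4 * (d * t)
      cube≤ = ℕₚ.≤-trans (halves n (s≤s (s≤s z≤n))) (ℕₚ.*-monoʳ-≤ 4 hn)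
      by-terms : t ^ 15 ≤ c * 16 * (d ^ 4 * n ^ 33) ⊎ t ^ 15 ≤ c * 16 * (n ^ 25 * d ^ 4 * r ^ 4) → n ^ 12 ≤ C * d ^ 19 ⊎ n ^ 20 ≤ C * (d ^ 19 * r ^ 4)
      by-terms (inj₁ h) = inj₁ (weaken C (d ^ 19) c′≤C (few-rectangles (c * 16) 4 d t n n>0 cube≤ h))
      by-terms (inj₂ h) = inj₂ (weaken C (d ^ 19 * r ^ 4) c′≤C (many-rectangles (c * 16) 4 d t n r n>0 cube≤ h))

-- The theorem with its constants

open FieldDef
open Conclusion
open Counting

module _ (p : ℕ) .{{_ : NonZero p}} (prime : Prime p) (p≡3 : p % 4 ≡ 3) (E : List Point) (E⊆ : IsSubsetFp2 p E) where
  open FpField p prime p≡3 using (field𝔽ₚ)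
  open Translation p prime p≡3
  open Plane field𝔽ₚ using (dist²; dist²-self; dist²≡𝟘)
  open FieldTheory field𝔽ₚ using (_≟_; 𝟘; elems)

  private
    E′ : List (Plane.Pt field𝔽ₚ)
    E′ = map point E
    uE′ : Unique E′
    uE′ = points-unique E⊆

  open Rectangles.Distances field𝔽ₚ E′ uE′ using (distances; rectangles#; isosceles; isosceles≥; isosceles-trivial; distances>0)

  same-length : length E′ ≡ length E
  same-length = Listₚ.length-map point E

  M : ℕ
  M = distances * (rectangles# + length E′ * length E′)

  M≤ : M ≤ distanceCount p E * (rectangles p E + length E′ * length E′)
  M≤ = ℕₚ.*-mono-≤ (distances≤ E uE′) (ℕₚ.+-monoˡ-≤ (length E′ * length E′) (rectangles≥ E uE′))

  -- The constants stay variables subject to inequalities, so the huge numerals need no evaluation: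
  -- s serves the small sets, X the bound for T¹⁵, and C all final estimates.
  theorem-with-constants : ∀ C₀ s X C → (256 ^ 7) ^ 4 ≤ s → 86 ^ 7 * 128 ^ 3 ≤ s → s * 8 ^ 4 ≤ X → 8 ^ 8 * 2 ^ 4 ≤ X → 2 ^ 15 * (16 ^ 4 * C₀) ≤ X →
    3 ≤ C → 2 ^ 15 * X * 16 ≤ C → (4 * 3) ^ 12 ≤ C → 4 ^ 15 * (2 ^ 15 * X * 16) ≤ C → length E ^ 5 ≤ C₀ * p ^ 8 →
    (isoTriangles p E ≤ C * (length E ^ 2 * ⌊log₂ length E ⌋)
       ⊎ (isoTriangles p E ^ 15 ≤ C * (distanceCount p E ^ 4 * length E ^ 33)
       ⊎ isoTriangles p E ^ 15 ≤ C * (length E ^ 25 * distanceCount p E ^ 4 * rectangles p E ^ 4)))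
    × (length E ^ 12 ≤ C * distanceCount p E ^ 19
       ⊎ length E ^ 20 ≤ C * (distanceCount p E ^ 19 * rectangles p E ^ 4))
  theorem-with-constants C₀ s X C s₁ s₂ X₁ X₂ X₃ C₁ C₂ C₃ C₄ h =
    subst (λ n → (isoTriangles p E ≤ C * (n ^ 2 * ⌊log₂ n ⌋)
       ⊎ (isoTriangles p E ^ 15 ≤ C * (distanceCount p E ^ 4 * n ^ 33)
       ⊎ isoTriangles p E ^ 15 ≤ C * (n ^ 25 * distanceCount p E ^ 4 * rectangles p E ^ 4)))
      × (n ^ 12 ≤ C * distanceCount p E ^ 19 ⊎ n ^ 20 ≤ C * (distanceCount p E ^ 19 * rectangles p E ^ 4))) same-length
      ( triangle-bound (2 ^ 15 * X) C C₁ C₂ C₃ C₄ (length E′) (distanceCount p E) (rectangles p E) (isoTriangles p E) M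
          (λ small → ℕₚ.n≤0⇒n≡0 (ℕₚ.≤-trans (isoTriangles≤ E uE′) (ℕₚ.≤-reflexive (isosceles-trivial small)))) M≤
          ([ inj₁ ∘ ℕₚ.≤-trans (isoTriangles≤ E uE′) , inj₂ ∘ ℕₚ.≤-trans (ℕₚ.^-monoˡ-≤ 15 (isoTriangles≤ E uE′)) ]′ bound)
      , distance-bound (2 ^ 15 * X) C C₁ C₂ C₃ C₄ (length E′) (distanceCount p E) (rectangles p E) isosceles M
          (λ pos → ℕₚ.≤-trans (distances>0 pos) (distances≤ E uE′))
          (ℕₚ.≤-trans isosceles≥ (ℕₚ.*-monoˡ-≤ isosceles (distances≤ E uE′))) M≤ bound )
    where
    bound : isosceles ≤ 3 * length E′ ^ 2 ⊎ isosceles ^ 15 ≤ 2 ^ 15 * X * (M ^ 4 * length E′ ^ 25)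
    bound = Dichotomy.dichotomy field𝔽ₚ E′ uE′ C₀ s X s₁ s₂ X₁ X₂ X₃ (subst (λ n → n ^ 5 ≤ C₀ * p ^ 8) (sym same-length) h)

abstract
  -- Opaque, so that the numerals are never unfolded.
  constants : ∀ a b u v w k l m n → ∃[ s ] ∃[ X ] ∃[ C ] (a ≤ s × b ≤ s × s * u ≤ X × v ≤ X × w ≤ X × 3 ≤ C × k * X * l ≤ C × m ≤ C × n * (k * X * l) ≤ C)
  constants a b u v w k l m n = a + b , X , 3 + (c + (m + n * c)) ,
    ℕₚ.m≤m+n a b , ℕₚ.m≤n+m b a , ℕₚ.m≤m+n _ _ , ℕₚ.≤-trans (ℕₚ.m≤m+n v w) (ℕₚ.m≤n+m (v + w) ((a + b) * u)) , ℕₚ.≤-trans (ℕₚ.m≤n+m w v) (ℕₚ.m≤n+m (v + w) ((a + b) * u)) ,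
    ℕₚ.m≤m+n 3 _ , ℕₚ.≤-trans (ℕₚ.m≤m+n c _) (ℕₚ.m≤n+m _ 3) , ℕₚ.≤-trans (ℕₚ.m≤m+n m (n * c)) (ℕₚ.≤-trans (ℕₚ.m≤n+m _ c) (ℕₚ.m≤n+m _ 3)) , ℕₚ.≤-trans (ℕₚ.m≤n+m (n * c) m) (ℕₚ.≤-trans (ℕₚ.m≤n+m _ c) (ℕₚ.m≤n+m _ 3))
    where
    X c : ℕ
    X = (a + b) * u + (v + w)
    c = k * X * l

theorem1p1 : (C₀ : ℕ) → ∃ λ (C : ℕ) →
    (p : ℕ) .{{_ : NonZero p}} → Prime p → p % 4 ≡ 3 →
    (E : List Point) → IsSubsetFp2 p E →
    length E ^ 5 ≤ C₀ * p ^ 8 →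
    ( (isoTriangles p E ≤ C * (length E ^ 2 * ⌊log₂ length E ⌋)
    ⊎ (isoTriangles p E ^ 15 ≤ C * (distanceCount p E ^ 4 * length E ^ 33)
    ⊎ isoTriangles p E ^ 15
    ≤ C * (length E ^ 25 * distanceCount p E ^ 4 * rectangles p E ^ 4)))
    × (length E ^ 12 ≤ C * distanceCount p E ^ 19
    ⊎ length E ^ 20 ≤ C * (distanceCount p E ^ 19 * rectangles p E ^ 4)))
theorem1p1 C₀ = let (s , X , C , s₁ , s₂ , X₁ , X₂ , X₃ , C₁ , C₂ , C₃ , C₄) = constants ((256 ^ 7) ^ 4) (86 ^ 7 * 128 ^ 3) (8 ^ 4) (8 ^ 8 * 2 ^ 4) (2 ^ 15 * (16 ^ 4 * C₀)) (2 ^ 15) 16 ((4 * 3) ^ 12) (4 ^ 15) in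
  C , λ p prime p≡3 E E⊆ → theorem-with-constants p prime p≡3 E E⊆ C₀ s X C s₁ s₂ X₁ X₂ X₃ C₁ C₂ C₃ C₄
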